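{- For every index $\boldsymbol{k}$, we have $$\zeta^{\star,\ast}_{\widehat{\mathcal{S}}}(\boldsymbol{k})\equiv\zeta^{\star,\mathrm{sh}}_{\widehat{\mathcal{S}}}(\boldsymbol{k})\equiv\zeta^{\star,KY}_{\widehat{\mathcal{S}}}(\boldsymbol{k})$$ in $(\mathcal{Z}/\zeta(2)\mathcal{Z})[[t]]$.
   Context: An index is a tuple $\boldsymbol{k}=(k_1,\dots,k_r)$ of positive integers ($r\ge 0$; $r=0$ gives the empty index $\varnothing$). It is admissible if it is empty or $k_r\ge 2$. For admissible $\boldsymbol{k}$, $\zeta(k_1,\dots,k_r)=\sum_{1\le n_1<\cdots<n_r}\frac{1}{n_1^{k_1}\cdots n_r^{k_r}}$, $\zeta(\varnothing)=1$. $\mathcal{Z}\subset\mathbb{R}$ is the $\mathbb{Q}$-linear span of $1$ and all multiple zeta values; it is a $\mathbb{Q}$-algebra. Let $\mathfrak{H}=\mathbb{Q}\langle x,y\rangle$, $\mathfrak{H}^1=\mathbb{Q}+y\mathfrak{H}\supset\mathfrak{H}^0=\mathbb{Q}+y\mathfrak{H}x$, $z_k=yx^{k-1}$, $z_{\boldsymbol{k}}=z_{k_1}\cdots z_{k_r}$. Let $Z:\mathfrak{H}^0\to\mathbb{R}$ be the $\mathbb{Q}$-linear map with $Z(z_{\boldsymbol{k}})=\zeta(\boldsymbol{k})$ for admissible $\boldsymbol{k}$. The harmonic product $\ast$ on $\mathfrak{H}^1$ is the $\mathbb{Q}$-bilinear product with $w\ast1=1\ast w=w$ and $w_1z_k\ast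 w_2z_l=(w_1\ast w_2z_l)z_k+(w_1z_k\ast w_2)z_l+(w_1\ast w_2)z_{k+l}$. The shuffle product $\mathrm{sh}$ on $\mathfrak{H}$ is the $\mathbb{Q}$-bilinear product with $w\,\mathrm{sh}\,1=1\,\mathrm{sh}\,w=w$ and $w_1u_1\,\mathrm{sh}\,w_2u_2=(w_1\,\mathrm{sh}\,w_2u_2)u_1+(w_1u_1\,\mathrm{sh}\,w_2)u_2$ for $u_1,u_2\in\{x,y\}$. For $\bullet\in\{\ast,\mathrm{sh}\}$, $Z$ is a homomorphism for $\bullet$ on $\mathfrak{H}^0$, $(\mathfrak{H}^1,\bullet)\cong(\mathfrak{H}^0,\bullet)[y]$, and $Z^{\bullet}:(\mathfrak{H}^1,\bullet)\to\mathbb{R}[T]$, $w\mapsto Z^\bullet(w;T)$, is the unique $\mathbb{Q}$-algebra homomorphism extending $Z$ with $Z^{\bullet}(y;T)=T$; its image lies in $\mathcal{Z}[T]$. Put $\zeta^{\bullet}(\boldsymbol{k})=Z^{\bullet}(z_{\boldsymbol{k}};0)$ and $$\zeta^{\star,\bullet}(k_1,\dots,k_r)=\sum_{\square=\text{`,' or `+'}}\zeta^{\bullet}(k_1\square\cdots\square k_r)\qquad(\bullet\in\{\ast,\mathrm{sh}\}),$$ the sum being over all $2^{r-1}$ ways to replace each $\square$ by a comma or a plus sign (and $\zeta^{\star,\bullet}(\varnothing)=1$). Kaneko–Yamamoto regularization: a 2-poset is a finite poset $X$ with a label map $\delta_X:X\to\{x,y\}$. Put $W(X)=\sum_f \delta_X(f^{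 -1}(1))\cdots\delta_X(f^{ -1}(\#X))\in\mathfrak{H}$, summed over all bijections $f:X\to\{1,\dots,\#X\}$ such that $p<q$ implies $f(p)<f(q)$ ($W(\varnothing)=1$). For $\boldsymbol{k}=(k_1,\dots,k_r)$, let $X^\star(\boldsymbol{k})$ be the 2-poset with elements $p_{i,m}$ ($1\le i\le r$, $1\le m\le k_i$), with order generated by $p_{i,1}<p_{i,2}<\cdots<p_{i,k_i}$ for each $i$ and $p_{i,1}<p_{i+1,k_{i+1}}$ for $1\le i\le r-1$, and with $p_{i,1}$ labelled $y$ and $p_{i,m}$ ($m\ge2$) labelled $x$. Put $w^\star(\boldsymbol{k})=W(X^\star(\boldsymbol{k}))\in\mathfrak{H}^1$ and $\zeta^{\star,KY}(\boldsymbol{k})=Z^{\mathrm{sh}}(w^\star(\boldsymbol{k});0)\in\mathcal{Z}$. For $\bullet\in\{\ast,\mathrm{sh},KY\}$ the $t$-adic symmetric multiple zeta-star values are the elements of $\mathcal{Z}[[t]]$ $$\zeta_{\widehat{\mathcal{S}}}^{\star,\bullet}(k_1,\dots,k_r)=\sum_{i=0}^{r}(-1)^{k_{i+1}+\cdots+k_r}\zeta^{\star,\bullet}(k_1,\ldots,k_i)\sum_{l_{i+1},\ldots,l_r\ge0}\ \prod_{j=i+1}^r\binom{k_j+l_j-1}{l_j}\,\zeta^{\star,\bullet}(k_r+l_r,\ldots,k_{i+1}+l_{i+1})\,t^{l_{i+1}+\cdots+l_r}.$$ -}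

module Defs where

open import Algebra.Bundles.Raw using (RawRing)
open import Algebra.Morphism.Structures using (module RingMorphisms)
open import Data.Fin.Base as Fin using (Fin; zero; suc; toℕ)
open import Data.Fin.Permutation as Perm using (Permutation; insert)
import Data.Fin.Properties as Fin
open import Data.Integer.Base as ℤ using (+_)
import Data.Integer.Properties as ℤ
open import Data.List.Base using
  ( List; []; _∷_; _∷ʳ_; _++_; map; reverse; concatMap; mapMaybe; replicate; foldr; filter; tabulate; lookup
  ; length; zipWith; take; drop; upTo; allFin)
import Data.List.Properties as List
open import Data.List.Relation.Unary.All as All using (All; []; _∷_)
import Data.List.Relation.Unary.All.Properties as All
open import Data.Maybe.Base as Maybe using (Maybe; just; nothing)
open import Data.Nat.Base as ℕ using (ℕ; zero; suc)
open import Data.Nat.Combinatorics using (_C_)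
open import Data.Nat.ListAction using (sum; product)
import Data.Nat.Properties as ℕ
open import Data.Product using (Σ; ∃; ∃-syntax; Σ-syntax; _×_; _,_; proj₁; proj₂)
open import Data.Rational.Base using
  ( ℚ; mkℚ; 0ℚ; 1ℚ; ½; _+_; _*_; _-_; -_; ∣_∣; _/_; _≤_; _<_; 1/_; *<*; toℚᵘ; positive; nonNegative)
import Data.Rational.Properties as ℚ
open import Data.Rational.Solver using (module +-*-Solver)
open import Data.Rational.Unnormalised.Base as ℚᵘ using (mkℚᵘ)
import Data.Rational.Unnormalised.Properties as ℚᵘ
open import Data.Sum.Base using (_⊎_; inj₁; inj₂)
open import Data.Sum.Function.Propositional using (_⊎-↔_)
open import Function.Base using (_∘_)
open import Function.Bundles using (_↔_; mk↔ₛ′; Inverse)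
open import Function.Construct.Composition using (_↔-∘_)
open import Function.Construct.Identity using (↔-id)
open import Function.Construct.Symmetry using (↔-sym)
open import Level using (0ℓ)
import Relation.Binary.Construct.Closure.Transitive as Closure
open import Relation.Binary.Construct.Closure.Transitive using (TransClosure; [_]; _∷_)
open import Relation.Binary.Definitions using (Decidable; DecidableEquality)
open import Relation.Binary.PropositionalEquality using
  (_≡_; refl; sym; trans; cong; cong₂; subst; subst₂; resp₂; isEquivalence; module ≡-Reasoning)
open import Relation.Binary.Structures using (IsStrictPartialOrder)
open import Relation.Nullary using (Dec; yes; no; contradiction)
open import Relation.Nullary.Decidable using (map′; _×-dec_; _⊎-dec_; _→-dec_)
import Relation.Unary as U

module ℚ-Lemmas where
  open +-*-Solver

  frac : (n : ℕ) → toℚᵘ (+ 1 / suc n) ℚᵘ.≃ mkℚᵘ (+ 1) n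
  frac n = ℚ.toℚᵘ-fromℚᵘ (mkℚᵘ (+ 1) n)

  u : ℕ → ℚ
  u n = + 1 / suc n

  u≥0 : ∀ n → 0ℚ ≤ u n
  u≥0 n = ℚ.nonNegative⁻¹ (u n) {{ℚ.normalize-nonNeg 1 (suc n)}}

  /-mono : ∀ {a b} .{{_ : ℕ.NonZero a}} .{{_ : ℕ.NonZero b}} → b ℕ.≤ a → (+ 1 / a) ≤ (+ 1 / b)
  /-mono {suc a} {suc b} b≤a = ℚ.toℚᵘ-cancel-≤ (begin
    toℚᵘ (+ 1 / suc a)  ≃⟨ frac a ⟩
    mkℚᵘ (+ 1) a        ≤⟨ ℚᵘ.*≤* (subst₂ ℤ._≤_ (sym (ℤ.*-identityˡ _)) (sym (ℤ.*-identityˡ _)) (ℤ.+≤+ b≤a)) ⟩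
    mkℚᵘ (+ 1) b        ≃⟨ ℚᵘ.≃-sym (frac b) ⟩
    toℚᵘ (+ 1 / suc b)  ∎)
    where open ℚᵘ.≤-Reasoning

  int : ℕ → ℚ
  int zero    = 0ℚ
  int (suc n) = 1ℚ + int n

  int≡ : ∀ n → toℚᵘ (int n) ℚᵘ.≃ mkℚᵘ (+ n) 0
  int≡ zero    = ℚᵘ.≃-refl
  int≡ (suc n) = ℚᵘ.≃-trans (ℚ.toℚᵘ-homo-+ 1ℚ (int n))
    (ℚᵘ.≃-trans (ℚᵘ.+-congʳ (mkℚᵘ (+ 1) 0) (int≡ n))
      (ℚᵘ.*≡* (cong (λ z → z ℤ.* (+ 1)) (cong (λ z → + 1 ℤ.+ z) (ℤ.*-identityʳ (+ n))))))

  int*u : ∀ n → int (suc n) * u n ≡ 1ℚ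
  int*u n = ℚ.toℚᵘ-injective (ℚᵘ.≃-trans (ℚ.toℚᵘ-homo-* (int (suc n)) (u n))
    (ℚᵘ.≃-trans (ℚᵘ.*-cong (int≡ (suc n)) (frac n))
      (ℚᵘ.*≡* (trans (ℤ.*-identityʳ _) (trans (ℤ.*-identityʳ (+ suc n))
         (sym (trans (ℤ.*-identityˡ _) (cong +_ (ℕ.+-identityʳ (suc n))))))))))

  arch : ∀ ε → 0ℚ < ε → ∃[ N ] ∀ n → N ℕ.≤ n → u n < ε
  arch (mkℚ (ℤ.+ zero) d _) (*<* (ℤ.+<+ ()))
  arch (mkℚ ℤ.-[1+ _ ] d _) (*<* ())
  arch ε@(mkℚ (ℤ.+ suc a) d _) _ = suc d , λ n d<n → ℚ.toℚᵘ-cancel-< (ℚᵘ.<-respˡ-≃ (ℚᵘ.≃-sym (frac n))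
    (ℚᵘ.*<* (ℤ.+<+ (ℕ.<-≤-trans (subst (ℕ._< suc n) (sym (ℕ.+-identityʳ (suc d))) (ℕ.s≤s d<n)) (ℕ.m≤m+n (suc n) (a ℕ.* suc n))))))

  *-mono-≤0 : ∀ {p q r s} → 0ℚ ≤ p → 0ℚ ≤ s → p ≤ q → r ≤ s → p * r ≤ q * s
  *-mono-≤0 {p} {q} {r} {s} 0≤p 0≤s p≤q r≤s = ℚ.≤-trans
    (ℚ.*-monoˡ-≤-nonNeg p {{nonNegative 0≤p}} r≤s) (ℚ.*-monoʳ-≤-nonNeg s {{nonNegative 0≤s}} p≤q)

  *-nn : ∀ {p q} → 0ℚ ≤ p → 0ℚ ≤ q → 0ℚ ≤ p * q
  *-nn {p} {q} 0≤p 0≤q = subst (_≤ p * q) (ℚ.*-zeroʳ p) (ℚ.*-monoˡ-≤-nonNeg p {{nonNegative 0≤p}} 0≤q)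

  +-nn : ∀ {p q} → 0ℚ ≤ p → 0ℚ ≤ q → 0ℚ ≤ p + q
  +-nn = ℚ.+-mono-≤

  *-pos : ∀ {p q} → 0ℚ < p → 0ℚ < q → 0ℚ < p * q
  *-pos {p} {q} 0<p 0<q = ℚ.positive⁻¹ (p * q) {{ℚ.pos*pos⇒pos p {{positive 0<p}} q {{positive 0<q}}}}

  ½-pos : ∀ {ε} → 0ℚ < ε → 0ℚ < ½ * ε
  ½-pos = *-pos (ℚ.positive⁻¹ ½)

  ½+½ : ∀ ε → ½ * ε + ½ * ε ≡ ε
  ½+½ = solve 1 (λ e → con ½ :* e :+ con ½ :* e := e) refl

  ≤-from-diff : ∀ {p q} → 0ℚ ≤ q - p → p ≤ q
  ≤-from-diff {p} {q} h = subst₂ _≤_ (ℚ.+-identityˡ p) (solve 2 (λ p q → (q :- p) :+ p := q) refl p q) (ℚ.+-monoˡ-≤ p h)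

  sq-cancel : ∀ {p q} → 0ℚ < q → p * p < q * q → p < q
  sq-cancel {p} {q} 0<q h with p ℚ.<? q
  ... | yes p<q = p<q
  ... | no p≮q = contradiction (ℚ.<-≤-trans h (*-mono-≤0 (ℚ.<⇒≤ 0<q) (ℚ.≤-trans (ℚ.<⇒≤ 0<q) q≤p) q≤p q≤p)) (ℚ.<-irrefl refl)
    where q≤p = ℚ.≮⇒≥ p≮q

  arch* : ∀ c ε → 0ℚ < c → 0ℚ < ε → ∃[ N ] ∀ n → N ℕ.≤ n → c * u n < ε
  arch* c ε 0<c 0<ε = proj₁ a , λ n N≤n →
      subst (c * u n <_) (trans (sym (ℚ.*-assoc c (1/ c) ε)) (trans (cong (_* ε) (ℚ.*-inverseʳ c)) (ℚ.*-identityˡ ε)))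
        (ℚ.*-monoʳ-<-pos c (proj₂ a n N≤n))
    where
    instance
      c⁺ = positive 0<c
      c≢0 = ℚ.pos⇒nonZero c
    a = arch (1/ c * ε) (*-pos (ℚ.positive⁻¹ (1/ c) {{ℚ.1/pos⇒pos c}}) 0<ε)

open +-*-Solver
open ℚ-Lemmas

-- A real number is a Cauchy sequence of rationals; two of them are equal when their difference is null.
Cauchy : (ℕ → ℚ) → Set
Cauchy s = ∀ ε → 0ℚ < ε → ∃[ N ] ∀ m n → N ℕ.≤ m → N ℕ.≤ n → ∣ s m - s n ∣ < ε

record ℝ : Set where
  constructor real
  field
    seq    : ℕ → ℚ
    cauchy : Cauchy seq

open ℝ public

infix 4 _≈ℝ_
_≈ℝ_ : ℝ → ℝ → Set
a ≈ℝ b = ∀ ε → 0ℚ < ε → ∃[ N ] ∀ n → N ℕ.≤ n → ∣ seq a n - seq b n ∣ < ε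

abstract
  const-cauchy : ∀ q → Cauchy (λ _ → q)
  const-cauchy q ε 0<ε = 0 , λ _ _ _ _ → subst (λ z → ∣ z ∣ < ε) (sym (ℚ.+-inverseʳ q)) 0<ε

fromℚ : ℚ → ℝ
fromℚ q = real (λ _ → q) (const-cauchy q)

0ℝ 1ℝ : ℝ
0ℝ = fromℚ 0ℚ
1ℝ = fromℚ 1ℚ

infixl 6 _+ℝ_ _-ℝ_
infixl 7 _*ℝ_
infix  8 -ℝ_

abstract
  +-cauchy : ∀ a b → Cauchy (λ n → seq a n + seq b n)
  +-cauchy a b = λ ε 0<ε →
    let Na , ca = cauchy a (½ * ε) (½-pos 0<ε)
        Nb , cb = cauchy b (½ * ε) (½-pos 0<ε)
    in Na ℕ.⊔ Nb , λ m n N≤m N≤n → subst₂ _<_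
        (cong ∣_∣ refl) (½+½ ε)
        (subst (λ z → ∣ z ∣ < ½ * ε + ½ * ε)
          (solve 4 (λ a b c d → (a :- b) :+ (c :- d) := (a :+ c) :- (b :+ d)) refl
            (seq a m) (seq a n) (seq b m) (seq b n))
          (ℚ.≤-<-trans (ℚ.∣p+q∣≤∣p∣+∣q∣ (seq a m - seq a n) (seq b m - seq b n))
            (ℚ.+-mono-< (ca m n (ℕ.m⊔n≤o⇒m≤o Na Nb N≤m) (ℕ.m⊔n≤o⇒m≤o Na Nb N≤n))
                        (cb m n (ℕ.m⊔n≤o⇒n≤o Na Nb N≤m) (ℕ.m⊔n≤o⇒n≤o Na Nb N≤n)))))

_+ℝ_ : ℝ → ℝ → ℝ
a +ℝ b = real (λ n → seq a n + seq b n) (+-cauchy a b)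

abstract
  neg-cauchy : ∀ a → Cauchy (λ n → - seq a n)
  neg-cauchy a = λ ε 0<ε →
    let N , c = cauchy a ε 0<ε
    in N , λ m n N≤m N≤n → subst (_< ε)
        (trans (sym (ℚ.∣-p∣≡∣p∣ (seq a m - seq a n)))
          (cong ∣_∣ (solve 2 (λ a b → :- (a :- b) := :- a :- (:- b)) refl (seq a m) (seq a n))))
        (c m n N≤m N≤n)

-ℝ_ : ℝ → ℝ
-ℝ a = real (λ n → - seq a n) (neg-cauchy a)

_-ℝ_ : ℝ → ℝ → ℝ
a -ℝ b = a +ℝ (-ℝ b)

module ℝ-Lemmas where

  bounded : (a : ℝ) → ∃[ N ] ∃[ B ] (0ℚ < B × ∀ n → N ℕ.≤ n → ∣ seq a n ∣ < B)
  bounded a with cauchy a 1ℚ (ℚ.positive⁻¹ 1ℚ)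
  ... | N , c = N , 1ℚ + ∣ seq a N ∣
      , ℚ.+-mono-<-≤ (ℚ.positive⁻¹ 1ℚ) (ℚ.0≤∣p∣ (seq a N))
      , λ n N≤n → subst (λ z → ∣ z ∣ < 1ℚ + ∣ seq a N ∣)
          (solve 2 (λ p q → (p :- q) :+ q := p) refl (seq a n) (seq a N))
          (ℚ.≤-<-trans (ℚ.∣p+q∣≤∣p∣+∣q∣ (seq a n - seq a N) (seq a N))
            (ℚ.+-monoˡ-< ∣ seq a N ∣ (c n N N≤n ℕ.≤-refl)))

  part : ∀ ε B → 0ℚ < ε → 0ℚ < B → ∃[ δ ] (0ℚ < δ × B * δ ≡ ½ * ε)
  part ε B 0<ε 0<B = 1/ B * (½ * ε) , *-pos (ℚ.positive⁻¹ (1/ B) {{ℚ.1/pos⇒pos B}}) (½-pos 0<ε)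
    , trans (sym (ℚ.*-assoc B (1/ B) _)) (trans (cong (_* (½ * ε)) (ℚ.*-inverseʳ B)) (ℚ.*-identityˡ _))
    where
    instance
      B⁺ = positive 0<B
      B≢0 = ℚ.pos⇒nonZero B

  ∣*∣-< : ∀ {p q B δ} → ∣ p ∣ < B → 0ℚ < B → ∣ q ∣ < δ → ∣ p * q ∣ < B * δ
  ∣*∣-< {p} {q} {B} {δ} p<B 0<B q<δ = subst (_< B * δ) (sym (ℚ.∣p*q∣≡∣p∣*∣q∣ p q))
    (ℚ.≤-<-trans (ℚ.*-monoʳ-≤-nonNeg ∣ q ∣ {{ℚ.∣-∣-nonNeg q}} (ℚ.<⇒≤ p<B))
                 (ℚ.*-monoʳ-<-pos B {{positive 0<B}} q<δ))

open ℝ-Lemmas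

abstract
  *-cauchy : ∀ a b → Cauchy (λ n → seq a n * seq b n)
  *-cauchy a b = λ ε 0<ε →
    let Ma , A , 0<A , ba = bounded a
        Mb , B , 0<B , bb = bounded b
        δa , 0<δa , ea = part ε B 0<ε 0<B
        δb , 0<δb , eb = part ε A 0<ε 0<A
        Na , ca = cauchy a δa 0<δa
        Nb , cb = cauchy b δb 0<δb
        M = Ma ℕ.⊔ Mb
        N = Na ℕ.⊔ Nb
    in M ℕ.⊔ N , λ m n h h′ →
        let hm = ℕ.m⊔n≤o⇒m≤o M N h
            hn = ℕ.m⊔n≤o⇒n≤o M N h
            hm′ = ℕ.m⊔n≤o⇒m≤o M N h′
            hn′ = ℕ.m⊔n≤o⇒n≤o M N h′
        in subst₂ _<_
          (cong ∣_∣ (solve 4 (λ a b c d → (a :* (c :- d)) :+ (d :* (a :- b)) := a :* c :- b :* d) refl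
              (seq a m) (seq a n) (seq b m) (seq b n)))
          (trans (cong₂ _+_ eb ea) (½+½ ε))
          (ℚ.≤-<-trans (ℚ.∣p+q∣≤∣p∣+∣q∣ (seq a m * (seq b m - seq b n)) (seq b n * (seq a m - seq a n)))
            (ℚ.+-mono-<
              (∣*∣-< (ba m (ℕ.m⊔n≤o⇒m≤o Ma Mb hm)) 0<A
                (cb m n (ℕ.m⊔n≤o⇒n≤o Na Nb hn) (ℕ.m⊔n≤o⇒n≤o Na Nb hn′)))
              (∣*∣-< (bb n (ℕ.m⊔n≤o⇒n≤o Ma Mb hm′)) 0<B
                (ca m n (ℕ.m⊔n≤o⇒m≤o Na Nb hn) (ℕ.m⊔n≤o⇒m≤o Na Nb hn′)))))

_*ℝ_ : ℝ → ℝ → ℝ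
a *ℝ b = real (λ n → seq a n * seq b n) (*-cauchy a b)

record ℕ⁺ : Set where
  constructor 1+_
  field
    pred⁺ : ℕ

open ℕ⁺ public

⌊_⌋ : ℕ⁺ → ℕ
⌊ 1+ n ⌋ = suc n

Index : Set
Index = List ℕ⁺

-- 1 / (N + 1)^k
invPow : ℕ → ℕ⁺ → ℚ
invPow N k = _/_ (+ 1) (suc N ℕ.^ ⌊ k ⌋) {{ℕ.m^n≢0 (suc N) ⌊ k ⌋}}

-- harm (k_r ∷ … ∷ k_1) N = Σ_{1 ≤ n_1 < … < n_r ≤ N} 1 / (n_1^{k_1} ⋯ n_r^{k_r});
-- the successor clause splits off the terms with n_r = N + 1.
harm : Index → ℕ → ℚ
harm []       N       = 1ℚ
harm (k ∷ ks) zero    = 0ℚ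
harm (k ∷ ks) (suc N) = harm (k ∷ ks) N + harm ks N * invPow N k

data Admissible : Index → Set where
  empty : Admissible []
  snoc  : ∀ ks {k} → 2 ℕ.≤ ⌊ k ⌋ → Admissible (ks ∷ʳ k)

-- harm ks N ≤ 2^r P_N with P_N = ∏_{n ≤ N} (1 + 1/(2n)), P_N² ≤ 2N + 1, and ∑_{n > N} P_{n-1} / n² telescopes
-- to at most 2 P_N / N.
module ζ-Convergence where

  P : ℕ → ℚ
  P zero    = 1ℚ
  P (suc N) = P N * (1ℚ + ½ * u N)

  K : Index → ℚ
  K []       = 1ℚ
  K (_ ∷ ks) = K ks + K ks

  0≤½ : 0ℚ ≤ ½
  0≤½ = ℚ.nonNegative⁻¹ ½

  P≥1 : ∀ N → 1ℚ ≤ P N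
  P≥1 zero    = ℚ.≤-refl
  P≥1 (suc N) = *-mono-≤0 {1ℚ} {P N} {1ℚ} {1ℚ + ½ * u N} (ℚ.nonNegative⁻¹ 1ℚ) (+-nn (ℚ.nonNegative⁻¹ 1ℚ) 0≤½u) (P≥1 N)
      (subst (_≤ 1ℚ + ½ * u N) (ℚ.+-identityʳ 1ℚ) (ℚ.+-monoʳ-≤ 1ℚ 0≤½u))
    where 0≤½u = *-nn 0≤½ (u≥0 N)

  P≥0 : ∀ N → 0ℚ ≤ P N
  P≥0 N = ℚ.≤-trans (ℚ.nonNegative⁻¹ 1ℚ) (P≥1 N)

  K>0 : ∀ ks → 0ℚ < K ks
  K>0 []       = ℚ.positive⁻¹ 1ℚ
  K>0 (_ ∷ ks) = ℚ.+-mono-< (K>0 ks) (K>0 ks)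

  K≥0 : ∀ ks → 0ℚ ≤ K ks
  K≥0 ks = ℚ.<⇒≤ (K>0 ks)

  invPow≥0 : ∀ N k → 0ℚ ≤ invPow N k
  invPow≥0 N k = ℚ.nonNegative⁻¹ (invPow N k) {{ℚ.normalize-nonNeg 1 (suc N ℕ.^ ⌊ k ⌋) {{ℕ.m^n≢0 (suc N) ⌊ k ⌋}}}}

  invPow≤u : ∀ N k → invPow N k ≤ u N
  invPow≤u N (1+ k) = /-mono {suc N ℕ.^ suc k} {suc N} {{ℕ.m^n≢0 (suc N) (suc k)}}
    (subst (ℕ._≤ suc N ℕ.^ suc k) (ℕ.*-identityʳ (suc N)) (ℕ.^-monoʳ-≤ (suc N) {1} {suc k} (ℕ.s≤s ℕ.z≤n)))

  u² : ∀ N → _/_ (+ 1) (suc N ℕ.* suc N) ≡ u N * u N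
  u² N = ℚ.toℚᵘ-injective (ℚᵘ.≃-trans (ℚ.toℚᵘ-fromℚᵘ (mkℚᵘ (+ 1) (N ℕ.+ N ℕ.* suc N)))
    (ℚᵘ.≃-sym (ℚᵘ.≃-trans (ℚ.toℚᵘ-homo-* (u N) (u N)) (ℚᵘ.*-cong (frac N) (frac N)))))

  invPow≤u² : ∀ N k → 2 ℕ.≤ ⌊ k ⌋ → invPow N k ≤ u N * u N
  invPow≤u² N k 2≤k = subst (invPow N k ≤_) (u² N) (/-mono {suc N ℕ.^ ⌊ k ⌋} {suc N ℕ.* suc N} {{ℕ.m^n≢0 (suc N) ⌊ k ⌋}}
    (subst (ℕ._≤ suc N ℕ.^ ⌊ k ⌋) (cong (suc N ℕ.*_) (ℕ.*-identityʳ (suc N))) (ℕ.^-monoʳ-≤ (suc N) 2≤k)))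

  harm≥0 : ∀ ks N → 0ℚ ≤ harm ks N
  harm≥0 []       N       = ℚ.nonNegative⁻¹ 1ℚ
  harm≥0 (k ∷ ks) zero    = ℚ.≤-refl
  harm≥0 (k ∷ ks) (suc N) = +-nn (harm≥0 (k ∷ ks) N) (*-nn (harm≥0 ks N) (invPow≥0 N k))

  harm≤ : ∀ ks N → harm ks N ≤ K ks * P N
  harm≤ []       N       = subst (1ℚ ≤_) (sym (ℚ.*-identityˡ (P N))) (P≥1 N)
  harm≤ (k ∷ ks) zero    = *-nn (K≥0 (k ∷ ks)) (ℚ.nonNegative⁻¹ 1ℚ)
  harm≤ (k ∷ ks) (suc N) = ℚ.≤-trans
    (ℚ.+-mono-≤ (harm≤ (k ∷ ks) N)
      (*-mono-≤0 (harm≥0 ks N) (u≥0 N) (harm≤ ks N) (invPow≤u N k)))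
    (ℚ.≤-reflexive (solve 3 (λ c p u → ((c :+ c) :* p :+ c :* p :* u) := (c :+ c) :* (p :* (con 1ℚ :+ con ½ :* u))) refl (K ks) (P N) (u N)))

  u-diff : ∀ M → u M - u (suc M) ≡ u M * u (suc M)
  u-diff M = begin
    a - b                        ≡⟨ cong₂ _-_ (sym (ℚ.*-identityʳ a)) (sym (ℚ.*-identityʳ b)) ⟩
    a * 1ℚ - b * 1ℚ              ≡⟨ cong₂ (λ p q → a * p - b * q) (sym (int*u (suc M))) (sym (int*u M)) ⟩
    a * ((1ℚ + i) * b) - b * (i * a)  ≡⟨ solve 3 (λ a b i → a :* ((con 1ℚ :+ i) :* b) :- b :* (i :* a) := a :* b) refl a b i ⟩
    a * b                        ∎
    where
    open ≡-Reasoning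
    a = u M
    b = u (suc M)
    i = int (suc M)

  u-anti : ∀ M → u (suc M) ≤ u M
  u-anti M = /-mono {suc (suc M)} {suc M} (ℕ.n≤1+n (suc M))

  D : Index → ℕ → ℚ
  D ks M = K ks * P (suc M) * u M + K ks * P (suc M) * u M

  step : ∀ k ks M → 2 ℕ.≤ ⌊ k ⌋ →
         harm (k ∷ ks) (suc (suc M)) + D ks (suc M) ≤ harm (k ∷ ks) (suc M) + D ks M
  step k ks M 2≤k = ≤-from-diff (subst (0ℚ ≤_) eq (+-nn (*-nn (*-nn (K≥0 ks) (P≥0 (suc M))) rest≥0) slack≥0))
    where
    a = u M
    b = u (suc M)
    c = K ks
    p = P (suc M)
    h = harm (k ∷ ks) (suc M)
    g = harm ks (suc M) * invPow (suc M) k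
    slack = c * p * (b * b) - g
    slack≥0 : 0ℚ ≤ slack
    slack≥0 = subst (_≤ slack) (ℚ.+-inverseʳ g) (ℚ.+-monoˡ-≤ (- g)
      (*-mono-≤0 (harm≥0 ks (suc M)) (*-nn (u≥0 (suc M)) (u≥0 (suc M))) (harm≤ ks (suc M)) (invPow≤u² (suc M) k 2≤k)))
    rest = ((a * b) + (a * b)) - (b * b + b * b)
    rest≥0 : 0ℚ ≤ rest
    rest≥0 = subst (_≤ rest) (ℚ.+-inverseʳ (b * b + b * b)) (ℚ.+-monoˡ-≤ (- (b * b + b * b)) (ℚ.+-mono-≤ bb bb))
      where bb = ℚ.*-monoʳ-≤-nonNeg b {{nonNegative (u≥0 (suc M))}} (u-anti M)
    eq : c * p * rest + slack ≡ (h + D ks M) - (h + g + D ks (suc M))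
    eq = trans (cong (λ z → c * p * ((z + z) - (b * b + b * b)) + slack) (sym (u-diff M)))
      (trans (cong₂ _+_ (lem₁ (c * p) a b (b * b)) refl)
      (trans (lem₂ h g (c * p * a) (c * p * b) (c * p * (b * b)))
        (cong (λ z → (h + D ks M) - (h + g + z)) (lem₃ c p b))))
      where
      lem₁ : ∀ z a b q → z * (((a - b) + (a - b)) - (q + q)) ≡ ((z * a - z * b) + (z * a - z * b)) - (z * q + z * q)
      lem₁ = solve 4 (λ z a b q → z :* (((a :- b) :+ (a :- b)) :- (q :+ q)) := ((z :* a :- z :* b) :+ (z :* a :- z :* b)) :- (z :* q :+ z :* q)) refl
      lem₂ : ∀ h g x y q → ((x - y) + (x - y)) - (q + q) + (q - g) ≡ (h + (x + x)) - (h + g + (y + y + q))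
      lem₂ = solve 5 (λ h g x y q → ((x :- y) :+ (x :- y)) :- (q :+ q) :+ (q :- g) := (h :+ (x :+ x)) :- (h :+ g :+ (y :+ y :+ q))) refl
      lem₃ : ∀ c p b → c * p * b + c * p * b + c * p * (b * b) ≡ c * (p * (1ℚ + ½ * b)) * b + c * (p * (1ℚ + ½ * b)) * b
      lem₃ = solve 3 (λ c p b → c :* p :* b :+ c :* p :* b :+ c :* p :* (b :* b) := c :* (p :* (con 1ℚ :+ con ½ :* b)) :* b :+ c :* (p :* (con 1ℚ :+ con ½ :* b)) :* b) refl

  D≥0 : ∀ ks M → 0ℚ ≤ D ks M
  D≥0 ks M = +-nn h h
    where h = *-nn (*-nn (K≥0 ks) (P≥0 (suc M))) (u≥0 M)

  tele : ∀ k ks M d → 2 ℕ.≤ ⌊ k ⌋ →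
         harm (k ∷ ks) (suc (d ℕ.+ M)) + D ks (d ℕ.+ M) ≤ harm (k ∷ ks) (suc M) + D ks M
  tele k ks M zero    2≤k = ℚ.≤-refl
  tele k ks M (suc d) 2≤k = ℚ.≤-trans (step k ks (d ℕ.+ M) 2≤k) (tele k ks M d 2≤k)

  incr : ∀ k ks M d → harm (k ∷ ks) (suc M) ≤ harm (k ∷ ks) (suc (d ℕ.+ M))
  incr k ks M zero    = ℚ.≤-refl
  incr k ks M (suc d) = ℚ.≤-trans (incr k ks M d)
    (subst (_≤ harm (k ∷ ks) (suc (suc (d ℕ.+ M)))) (ℚ.+-identityʳ _)
      (ℚ.+-monoʳ-≤ (harm (k ∷ ks) (suc (d ℕ.+ M))) (*-nn (harm≥0 ks (suc (d ℕ.+ M))) (invPow≥0 (suc (d ℕ.+ M)) k))))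

  P² : ∀ N → P N * P N ≤ int N + int N + 1ℚ
  P² zero    = ℚ.≤-refl
  P² (suc N) = ℚ.≤-trans
    (ℚ.≤-reflexive (solve 2 (λ p q → (p :* q) :* (p :* q) := (p :* p) :* (q :* q)) refl (P N) (1ℚ + ½ * u N)))
    (ℚ.≤-trans
      (ℚ.*-monoʳ-≤-nonNeg (q * q) {{nonNegative (*-nn q≥0 q≥0)}} (P² N))
      (≤-from-diff (subst (0ℚ ≤_) eq (+-nn (*-nn 0≤½ (u≥0 N)) (*-nn (*-nn 0≤½ 0≤½) (*-nn (u≥0 N) (u≥0 N)))))))
    where
    v = u N
    j = int N
    q = 1ℚ + ½ * v
    q≥0 : 0ℚ ≤ q
    q≥0 = +-nn (ℚ.nonNegative⁻¹ 1ℚ) (*-nn 0≤½ (u≥0 N))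
    e = (1ℚ + j) * v
    lem : ∀ e v j → e ≡ (1ℚ + j) * v → e ≡ 1ℚ →
          ½ * v + ½ * ½ * (v * v) ≡ ((1ℚ + j) + (1ℚ + j) + 1ℚ) - (j + j + 1ℚ) * ((1ℚ + ½ * v) * (1ℚ + ½ * v))
    lem e v j h h1 = sym (trans
      (solve 2 (λ v j →
         ((con 1ℚ :+ j) :+ (con 1ℚ :+ j) :+ con 1ℚ) :- (j :+ j :+ con 1ℚ) :* ((con 1ℚ :+ con ½ :* v) :* (con 1ℚ :+ con ½ :* v))
         := con 1ℚ :+ con 1ℚ :+ v :+ con ½ :* con ½ :* (v :* v)
            :- (((con 1ℚ :+ j) :* v) :+ ((con 1ℚ :+ j) :* v) :+ con ½ :* (((con 1ℚ :+ j) :* v) :* v))) refl v j)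
      (trans (cong (λ z → 1ℚ + 1ℚ + v + ½ * ½ * (v * v) - (z + z + ½ * (z * v))) (trans (sym h) h1))
        (solve 1 (λ v → con 1ℚ :+ con 1ℚ :+ v :+ con ½ :* con ½ :* (v :* v) :- (con 1ℚ :+ con 1ℚ :+ con ½ :* (con 1ℚ :* v))
           := con ½ :* v :+ con ½ :* con ½ :* (v :* v)) refl v)))
    eq = lem e v j refl (int*u N)

  3ℚ : ℚ
  3ℚ = 1ℚ + 1ℚ + 1ℚ

  int≥0 : ∀ n → 0ℚ ≤ int n
  int≥0 zero    = ℚ.≤-refl
  int≥0 (suc n) = +-nn (ℚ.nonNegative⁻¹ 1ℚ) (int≥0 n)

  D² : ∀ ks M → D ks M * D ks M ≤ ((K ks + K ks) * (K ks + K ks) * 3ℚ) * u M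
  D² ks M = ℚ.≤-trans
    (ℚ.≤-reflexive (solve 3 (λ c p a → (c :* p :* a :+ c :* p :* a) :* (c :* p :* a :+ c :* p :* a)
        := (((c :+ c) :* (c :+ c)) :* (a :* a)) :* (p :* p)) refl c p a))
    (ℚ.≤-trans
      (ℚ.*-monoˡ-≤-nonNeg ((cc * cc) * (a * a)) {{nonNegative (*-nn cc²≥0 (*-nn (u≥0 M) (u≥0 M)))}}
        (ℚ.≤-trans (P² (suc M)) bound))
      (ℚ.≤-reflexive (trans
        (solve 3 (λ k a n → (k :* (a :* a)) :* (con 3ℚ :* n) := k :* con 3ℚ :* a :* (n :* a)) refl (cc * cc) a n)
        (trans (cong (cc * cc * 3ℚ * a *_) (int*u M)) (ℚ.*-identityʳ _)))))
    where
    c = K ks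
    cc = c + c
    p = P (suc M)
    a = u M
    n = int (suc M)
    cc²≥0 : 0ℚ ≤ cc * cc
    cc²≥0 = *-nn (+-nn (K≥0 ks) (K≥0 ks)) (+-nn (K≥0 ks) (K≥0 ks))
    bound : n + n + 1ℚ ≤ 3ℚ * n
    bound = ≤-from-diff (subst (0ℚ ≤_)
      (solve 1 (λ j → j := con 3ℚ :* (con 1ℚ :+ j) :- ((con 1ℚ :+ j) :+ (con 1ℚ :+ j) :+ con 1ℚ)) refl (int M)) (int≥0 M))

  gap : ∀ k ks M d → 2 ℕ.≤ ⌊ k ⌋ → ∣ harm (k ∷ ks) (suc (d ℕ.+ M)) - harm (k ∷ ks) (suc M) ∣ ≤ D ks M
  gap k ks M d 2≤k = subst (_≤ D ks M) (sym (ℚ.0≤p⇒∣p∣≡p 0≤)) (≤-from-diff (subst (0ℚ ≤_) eq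
      (+-nn (D≥0 ks (d ℕ.+ M)) diff)))
    where
    y = harm (k ∷ ks) (suc (d ℕ.+ M))
    x = harm (k ∷ ks) (suc M)
    0≤ : 0ℚ ≤ y - x
    0≤ = subst (_≤ y - x) (ℚ.+-inverseʳ x) (ℚ.+-monoˡ-≤ (- x) (incr k ks M d))
    Y = y + D ks (d ℕ.+ M)
    diff : 0ℚ ≤ (x + D ks M) - Y
    diff = subst (_≤ (x + D ks M) - Y) (ℚ.+-inverseʳ Y) (ℚ.+-monoˡ-≤ (- Y) (tele k ks M d 2≤k))
    eq = solve 4 (λ x y e f → f :+ ((x :+ e) :- (y :+ f)) := e :- (y :- x)) refl x y (D ks M) (D ks (d ℕ.+ M))

  ∣-∣-swap : ∀ p q → ∣ p - q ∣ ≡ ∣ q - p ∣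
  ∣-∣-swap p q = trans (sym (ℚ.∣-p∣≡∣p∣ (p - q))) (cong ∣_∣ (solve 2 (λ p q → :- (p :- q) := q :- p) refl p q))

  sq-small : ∀ (f : ℕ → ℚ) K → 0ℚ < K → (∀ M → f M * f M ≤ K * u M) →
             ∀ ε → 0ℚ < ε → ∃[ N ] ∀ M → N ℕ.≤ M → f M < ε
  sq-small f K 0<c²t f² ε 0<ε = proj₁ a , λ M N≤M → sq-cancel {f M} {ε} 0<ε (ℚ.≤-<-trans (f² M) (proj₂ a M N≤M))
    where a = arch* K (ε * ε) 0<c²t (*-pos {ε} {ε} 0<ε 0<ε)

  D→0 : ∀ ks ε → 0ℚ < ε → ∃[ N ] ∀ M → N ℕ.≤ M → D ks M < ε
  D→0 ks = sq-small (D ks) ((K ks + K ks) * (K ks + K ks) * 3ℚ) (0<c²t (K ks + K ks) 3ℚ 2K>0 (ℚ.positive⁻¹ 3ℚ)) (D² ks)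
    where
    2K>0 : 0ℚ < K ks + K ks
    2K>0 = ℚ.+-mono-< (K>0 ks) (K>0 ks)
    0<c²t : ∀ c t → 0ℚ < c → 0ℚ < t → 0ℚ < c * c * t
    0<c²t c t 0<c 0<t = *-pos {c * c} {t} (*-pos {c} {c} 0<c 0<c) 0<t

  gap⇒cauchy : ∀ (s g : ℕ → ℚ) → (∀ M d → ∣ s (suc (d ℕ.+ M)) - s (suc M) ∣ ≤ g M) →
               (∀ ε → 0ℚ < ε → ∃[ N ] ∀ M → N ℕ.≤ M → g M < ε) → Cauchy s
  gap⇒cauchy s g s-gap g→0 ε 0<ε = suc N , go
    where
    N = proj₁ (g→0 ε 0<ε)
    near : ∀ m n → suc N ℕ.≤ suc m → m ℕ.≤ n → ∣ s (suc n) - s (suc m) ∣ < ε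
    near m n (ℕ.s≤s N≤m) m≤n = subst (λ z → ∣ s (suc z) - s (suc m) ∣ < ε) (ℕ.m∸n+n≡m m≤n)
      (ℚ.≤-<-trans (s-gap m (n ℕ.∸ m)) (proj₂ (g→0 ε 0<ε) m N≤m))
    go : ∀ m n → suc N ℕ.≤ m → suc N ℕ.≤ n → ∣ s m - s n ∣ < ε
    go (suc m) (suc n) hm hn with ℕ.≤-total m n
    ... | inj₁ m≤n = subst (_< ε) (∣-∣-swap (s (suc n)) (s (suc m))) (near m n hm m≤n)
    ... | inj₂ n≤m = near n m hn n≤m

  harm-cauchy : ∀ k ks → 2 ℕ.≤ ⌊ k ⌋ → Cauchy (harm (k ∷ ks))
  harm-cauchy k ks 2≤k = gap⇒cauchy (harm (k ∷ ks)) (D ks) (λ M d → gap k ks M d 2≤k) (D→0 ks)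

  abstract
    ζ-cauchy : ∀ {k} → Admissible k → Cauchy (harm (reverse k))
    ζ-cauchy empty = cauchy 1ℝ
    ζ-cauchy (snoc ks {k} 2≤k) = subst (λ r → Cauchy (harm r)) (sym (List.reverse-++ ks (k ∷ []))) (harm-cauchy k (reverse ks) 2≤k)

ζ : (k : Index) → Admissible k → ℝ
ζ k adm = real (harm (reverse k)) (ζ-Convergence.ζ-cauchy adm)

-- Elements of the free ℚ-module on B, as formal sums; equality compares coefficients.
Lin : Set → Set
Lin B = List (ℚ × B)

module Free {B : Set} (_≟_ : DecidableEquality B) where

  coeff : Lin B → B → ℚ
  coeff []            b = 0ℚ
  coeff ((q , c) ∷ p) b with c ≟ b
  ... | yes _ = q + coeff p b
  ... | no  _ = coeff p b

  infix 4 _≈_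
  _≈_ : Lin B → Lin B → Set
  p ≈ p′ = ∀ b → coeff p b ≡ coeff p′ b

⟨_⟩ : {B : Set} → B → Lin B
⟨ b ⟩ = (1ℚ , b) ∷ []

infixr 7 _·_
_·_ : {B : Set} → ℚ → Lin B → Lin B
q · p = map (λ (r , b) → q * r , b) p

bilinear : {A B C : Set} → (A → B → List C) → Lin A → Lin B → Lin C
bilinear f p p′ = concatMap (λ (q , a) → concatMap (λ (r , b) → map (q * r ,_) (f a b)) p′) p

data Letter : Set where
  𝕩 𝕪 : Letter

Word : Set
Word = List Letter

infix 4 _≟⁺_
_≟⁺_ : DecidableEquality ℕ⁺
(1+ m) ≟⁺ (1+ n) = map′ (cong 1+_) (cong pred⁺) (m ℕ.≟ n)

infixl 6 _⊕_ _⊞_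
_⊕_ : ℕ⁺ → ℕ⁺ → ℕ⁺
(1+ m) ⊕ (1+ n) = 1+ (m ℕ.+ suc n)

_⊞_ : ℕ⁺ → ℕ → ℕ⁺
(1+ m) ⊞ l = 1+ (m ℕ.+ l)

𝔥 : Set
𝔥 = Lin Word

-- 𝔥¹ = ℚ + y𝔥 is the free algebra on z_1, z_2, …; the basis word z_{k_1} ⋯ z_{k_r} is represented by k.
𝔥¹ : Set
𝔥¹ = Lin Index

-- 𝔥⁰ = ℚ + y𝔥x has the basis of all z_k with k admissible.
𝔥⁰ : Set
𝔥⁰ = Lin (Σ Index Admissible)

open Free (List.≡-dec _≟⁺_) public using () renaming (coeff to coeff¹; _≈_ to _≈¹_)

𝔥⁰⇒𝔥¹ : 𝔥⁰ → 𝔥¹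
𝔥⁰⇒𝔥¹ = map λ (q , k , _) → q , k

z : ℕ⁺ → Word
z k = 𝕪 ∷ replicate (pred⁺ k) 𝕩

zs : Index → Word
zs = concatMap z

ι : 𝔥¹ → 𝔥
ι = map λ (q , k) → q , zs k

parse : ℕ → Word → Index
parse n []      = (1+ n) ∷ []
parse n (𝕩 ∷ w) = parse (suc n) w
parse n (𝕪 ∷ w) = (1+ n) ∷ parse 0 w

unzs : Word → Maybe Index
unzs []      = just []
unzs (𝕩 ∷ w) = nothing
unzs (𝕪 ∷ w) = just (parse 0 w)

-- Left inverse of ι (see π-ι). Words not in 𝔥¹ are dropped, but π is only ever applied to elements of 𝔥¹:
-- see ι-sh¹ and ι-w⋆.
π : 𝔥 → 𝔥¹
π = mapMaybe λ (q , w) → Maybe.map (q ,_) (unzs w)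

-- Both products are defined by recursion on the last letters, hence on reversed words;
-- see ∗-snoc and sh-snoc.
_∗ʳ_ : Index → Index → List Index
[]      ∗ʳ v       = v ∷ []
(k ∷ u) ∗ʳ []      = (k ∷ u) ∷ []
(k ∷ u) ∗ʳ (l ∷ v) = map (k ∷_) (u ∗ʳ (l ∷ v)) ++ map (l ∷_) ((k ∷ u) ∗ʳ v) ++ map ((k ⊕ l) ∷_) (u ∗ʳ v)

_∗ʷ_ : Index → Index → List Index
u ∗ʷ v = map reverse (reverse u ∗ʳ reverse v)

_shʳ_ : Word → Word → List Word
[]      shʳ v       = v ∷ []
(a ∷ u) shʳ []      = (a ∷ u) ∷ []
(a ∷ u) shʳ (b ∷ v) = map (a ∷_) (u shʳ (b ∷ v)) ++ map (b ∷_) ((a ∷ u) shʳ v)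

_shʷ_ : Word → Word → List Word
u shʷ v = map reverse (reverse u shʳ reverse v)

infixl 7 _∗_ _sh_ _sh¹_
_∗_ : 𝔥¹ → 𝔥¹ → 𝔥¹
_∗_ = bilinear _∗ʷ_

_sh_ : 𝔥 → 𝔥 → 𝔥
_sh_ = bilinear _shʷ_

_sh¹_ : 𝔥¹ → 𝔥¹ → 𝔥¹
u sh¹ v = π (ι u sh ι v)

rev-snoc : {A : Set} (us : List A) (a : A) → reverse (us ∷ʳ a) ≡ a ∷ reverse us
rev-snoc us a = List.reverse-++ us (a ∷ [])

map-rev-∷ : {A : Set} (a : A) (ws : List (List A)) →
            map reverse (map (a ∷_) ws) ≡ map (_∷ʳ a) (map reverse ws)
map-rev-∷ a ws = trans (sym (List.map-∘ ws)) (trans (List.map-cong (List.unfold-reverse a) ws) (List.map-∘ ws))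

∗-snoc : ∀ u k v l → (u ∷ʳ k) ∗ʷ (v ∷ʳ l) ≡
         map (_∷ʳ k) (u ∗ʷ (v ∷ʳ l)) ++ map (_∷ʳ l) ((u ∷ʳ k) ∗ʷ v) ++ map (_∷ʳ (k ⊕ l)) (u ∗ʷ v)
∗-snoc u k v l rewrite rev-snoc u k | rev-snoc v l
  | List.map-++ reverse (map (k ∷_) (reverse u ∗ʳ (l ∷ reverse v)))
      (map (l ∷_) ((k ∷ reverse u) ∗ʳ reverse v) ++ map ((k ⊕ l) ∷_) (reverse u ∗ʳ reverse v))
  | List.map-++ reverse (map (l ∷_) ((k ∷ reverse u) ∗ʳ reverse v)) (map ((k ⊕ l) ∷_) (reverse u ∗ʳ reverse v))
  | map-rev-∷ k (reverse u ∗ʳ (l ∷ reverse v))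
  | map-rev-∷ l ((k ∷ reverse u) ∗ʳ reverse v)
  | map-rev-∷ (k ⊕ l) (reverse u ∗ʳ reverse v) = refl

sh-snoc : ∀ u a v b → (u ∷ʳ a) shʷ (v ∷ʳ b) ≡ map (_∷ʳ a) (u shʷ (v ∷ʳ b)) ++ map (_∷ʳ b) ((u ∷ʳ a) shʷ v)
sh-snoc u a v b rewrite rev-snoc u a | rev-snoc v b
  | List.map-++ reverse (map (a ∷_) (reverse u shʳ (b ∷ reverse v))) (map (b ∷_) ((a ∷ reverse u) shʳ reverse v))
  | map-rev-∷ a (reverse u shʳ (b ∷ reverse v))
  | map-rev-∷ b ((a ∷ reverse u) shʳ reverse v) = refl

data InH¹ : Word → Set where
  one : InH¹ []
  y∷_ : ∀ w → InH¹ (𝕪 ∷ w)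

replicate-shift : ∀ n (w : Word) → replicate n 𝕩 ++ 𝕩 ∷ w ≡ 𝕩 ∷ replicate n 𝕩 ++ w
replicate-shift zero    w = refl
replicate-shift (suc n) w = cong (𝕩 ∷_) (replicate-shift n w)

zs-parse : ∀ n w → zs (parse n w) ≡ 𝕪 ∷ replicate n 𝕩 ++ w
zs-parse n []      = refl
zs-parse n (𝕩 ∷ w) = trans (zs-parse (suc n) w) (cong (𝕪 ∷_) (sym (replicate-shift n w)))
zs-parse n (𝕪 ∷ w) = cong (λ v → 𝕪 ∷ replicate n 𝕩 ++ v) (zs-parse 0 w)

ι-π : ∀ {p} → All (λ (_ , w) → InH¹ w) p → ι (π p) ≡ p
ι-π []                        = refl
ι-π {(q , .[]) ∷ _} (one ∷ h)    = cong ((q , []) ∷_) (ι-π h)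
ι-π {(q , 𝕪 ∷ w) ∷ _} ((y∷ _) ∷ h) = cong₂ _∷_ (cong (q ,_) (zs-parse 0 w)) (ι-π h)

parse-zs : ∀ n m l → parse n (replicate m 𝕩 ++ zs l) ≡ (1+ (m ℕ.+ n)) ∷ l
parse-zs n zero    []      = refl
parse-zs n zero    (k ∷ l) =
  cong ((1+ n) ∷_) (trans (parse-zs 0 (pred⁺ k) l) (cong (λ m → (1+ m) ∷ l) (ℕ.+-identityʳ (pred⁺ k))))
parse-zs n (suc m) l       = trans (parse-zs (suc n) m l) (cong (λ m → (1+ m) ∷ l) (ℕ.+-suc m n))

unzs-zs : ∀ k → unzs (zs k) ≡ just k
unzs-zs []      = refl
unzs-zs (k ∷ l) = cong just (trans (parse-zs 0 (pred⁺ k) l) (cong (λ m → (1+ m) ∷ l) (ℕ.+-identityʳ (pred⁺ k))))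

π-ι : ∀ p → π (ι p) ≡ p
π-ι []            = refl
π-ι ((q , k) ∷ p) rewrite unzs-zs k = cong ((q , k) ∷_) (π-ι p)

InH¹-zs : ∀ k → InH¹ (zs k)
InH¹-zs []      = one
InH¹-zs (k ∷ l) = y∷ (replicate (pred⁺ k) 𝕩 ++ zs l)

data EndsY : Word → Set where
  here  : EndsY (𝕪 ∷ [])
  there : ∀ {a w} → EndsY w → EndsY (a ∷ w)

endsY-sh : ∀ {u v} → EndsY u → EndsY v → All EndsY (u shʳ v)
endsY-sh here here           = there here ∷ there here ∷ []
endsY-sh here (there ev)     = there (there ev) ∷ All.map⁺ (All.map there (endsY-sh here ev))
endsY-sh (there eu) here     = All.++⁺ (All.map⁺ (All.map there (endsY-sh eu here))) (there (there eu) ∷ [])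
endsY-sh (there eu) (there ev) =
  All.++⁺ (All.map⁺ (All.map there (endsY-sh eu (there ev)))) (All.map⁺ (All.map there (endsY-sh (there eu) ev)))

endsY-snoc : ∀ w → EndsY (w ∷ʳ 𝕪)
endsY-snoc []      = here
endsY-snoc (a ∷ w) = there (endsY-snoc w)

unsnocY : ∀ {w} → EndsY w → ∃[ v ] w ≡ v ∷ʳ 𝕪
unsnocY here              = [] , refl
unsnocY (there {a = a} e) = a ∷ proj₁ (unsnocY e) , cong (a ∷_) (proj₂ (unsnocY e))

rev-endsY : ∀ {w} → EndsY w → InH¹ (reverse w)
rev-endsY e with unsnocY e
... | v , refl = subst InH¹ (sym (rev-snoc v 𝕪)) (y∷ reverse v)

shʳ-[] : ∀ u → u shʳ [] ≡ u ∷ []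
shʳ-[] []      = refl
shʳ-[] (_ ∷ _) = refl

InH¹-sh : ∀ {u v} → InH¹ u → InH¹ v → All InH¹ (u shʷ v)
InH¹-sh {v = v} one hv = subst InH¹ (sym (List.reverse-involutive v)) hv ∷ []
InH¹-sh {u} (y∷ w) one rewrite shʳ-[] (reverse u) | List.reverse-involutive u = (y∷ w) ∷ []
InH¹-sh (y∷ u) (y∷ v) rewrite List.unfold-reverse 𝕪 u | List.unfold-reverse 𝕪 v =
  All.map⁺ (All.map rev-endsY (endsY-sh (endsY-snoc (reverse u)) (endsY-snoc (reverse v))))

ι-sh¹ : ∀ u v → ι (u sh¹ v) ≡ ι u sh ι v
ι-sh¹ u v = ι-π (All.concat⁺ (All.map⁺ (All.map⁺ (All.universal (λ (_ , k) →
    All.concat⁺ (All.map⁺ (All.map⁺ (All.universal (λ (_ , l) →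
      All.map⁺ (InH¹-sh (InH¹-zs k) (InH¹-zs l))) v)))) u))))

𝔥¹-rawRing : (𝔥¹ → 𝔥¹ → 𝔥¹) → RawRing 0ℓ 0ℓ
𝔥¹-rawRing _•_ = record
  { Carrier = 𝔥¹
  ; _≈_     = _≈¹_
  ; _+_     = _++_
  ; _*_     = _•_
  ; -_      = (- 1ℚ) ·_
  ; 0#      = []
  ; 1#      = ⟨ [] ⟩
  }

-- c_0 ∷ c_1 ∷ … is c_0 + c_1 T + …; trailing zeros are immaterial for _≈ᵀ_.
ℝ[T] : Set
ℝ[T] = List ℝ

coeffᵀ : ℝ[T] → ℕ → ℝ
coeffᵀ []      n       = 0ℝ
coeffᵀ (c ∷ p) zero    = c
coeffᵀ (c ∷ p) (suc n) = coeffᵀ p n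

infix 4 _≈ᵀ_
_≈ᵀ_ : ℝ[T] → ℝ[T] → Set
p ≈ᵀ q = ∀ n → coeffᵀ p n ≈ℝ coeffᵀ q n

infixl 6 _+ᵀ_
infixl 7 _*ᵀ_
infixr 7 _·ᵀ_
_+ᵀ_ : ℝ[T] → ℝ[T] → ℝ[T]
[]      +ᵀ q       = q
(c ∷ p) +ᵀ []      = c ∷ p
(c ∷ p) +ᵀ (d ∷ q) = c +ℝ d ∷ p +ᵀ q

_·ᵀ_ : ℝ → ℝ[T] → ℝ[T]
c ·ᵀ p = map (c *ℝ_) p

_*ᵀ_ : ℝ[T] → ℝ[T] → ℝ[T]
[]      *ᵀ q = []
(c ∷ p) *ᵀ q = c ·ᵀ q +ᵀ (0ℝ ∷ p *ᵀ q)

const : ℝ → ℝ[T]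
const c = c ∷ []

T : ℝ[T]
T = 0ℝ ∷ 1ℝ ∷ []

ℝ[T]-rawRing : RawRing 0ℓ 0ℓ
ℝ[T]-rawRing = record
  { Carrier = ℝ[T]
  ; _≈_     = _≈ᵀ_
  ; _+_     = _+ᵀ_
  ; _*_     = _*ᵀ_
  ; -_      = map (λ c → -ℝ c)
  ; 0#      = []
  ; 1#      = const 1ℝ
  }

∑ : List ℝ → ℝ
∑ = foldr _+ℝ_ 0ℝ

Z : 𝔥⁰ → ℝ
Z w = ∑ (map (λ (q , k , adm) → fromℚ q *ℝ ζ k adm) w)

-- Z• is the ℚ-algebra homomorphism (𝔥¹ , •) → ℝ[T] extending Z with y ↦ T (there is exactly one).
record IsRegularization (_•_ : 𝔥¹ → 𝔥¹ → 𝔥¹) (Z• : 𝔥¹ → ℝ[T]) : Set where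
  field
    isRingHomomorphism : RingMorphisms.IsRingHomomorphism (𝔥¹-rawRing _•_) ℝ[T]-rawRing Z•
    ·-homo             : ∀ q w → Z• (q · w) ≈ᵀ fromℚ q ·ᵀ Z• w
    extends            : ∀ w → Z• (𝔥⁰⇒𝔥¹ w) ≈ᵀ const (Z w)
    y↦T                : Z• ⟨ (1+ 0) ∷ [] ⟩ ≈ᵀ T

-- squares k lists all k_1 □ ⋯ □ k_r with each □ a comma or a plus.
squaresFrom : ℕ⁺ → Index → List Index
squaresFrom k []       = (k ∷ []) ∷ []
squaresFrom k (l ∷ ks) = map (k ∷_) (squaresFrom l ks) ++ squaresFrom (k ⊕ l) ks

squares : Index → List Index
squares []       = [] ∷ []
squares (k ∷ ks) = squaresFrom k ks

regζ : (𝔥¹ → ℝ[T]) → Index → ℝ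
regζ Z• k = coeffᵀ (Z• ⟨ k ⟩) 0

ζ⋆ : (𝔥¹ → ℝ[T]) → Index → ℝ
ζ⋆ Z• k = ∑ (map (regζ Z•) (squares k))

-- Only the strict order ≺ of the poset is recorded.
record 2-Poset : Set₁ where
  field
    Elem                 : Set
    size                 : ℕ
    enum                 : Elem ↔ Fin size
    _≺_                  : Elem → Elem → Set
    isStrictPartialOrder : IsStrictPartialOrder _≡_ _≺_
    _≺?_                 : Decidable _≺_
    δ                    : Elem → Letter

-- every permutation of Fin n, exactly once: f ↦ (f 0 , the induced permutation of the rest)
permutations : ∀ n → List (Permutation n n)
permutations zero    = Perm.id ∷ []
permutations (suc n) = concatMap (λ j → map (insert zero j) (permutations n)) (allFin (suc n))

module _ (𝒳 : 2-Poset) where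
  open 2-Poset 𝒳

  Monotone : Elem ↔ Fin size → Set
  Monotone f = ∀ p q → p ≺ q → Inverse.to f p Fin.< Inverse.to f q

  ∀? : {P : Elem → Set} → U.Decidable P → Dec (∀ p → P p)
  ∀? {P} P? = map′ (λ h p → subst P (Inverse.strictlyInverseʳ enum p) (h (Inverse.to enum p))) (λ h i → h (Inverse.from enum i))
    (Fin.all? (P? ∘ Inverse.from enum))

  monotone? : U.Decidable Monotone
  monotone? f = ∀? λ p → ∀? λ q → (p ≺? q) →-dec (Inverse.to f p Fin.<? Inverse.to f q)

  linearExtensions : List (Elem ↔ Fin size)
  linearExtensions = filter monotone? (map (_↔-∘ enum) (permutations size))

  W : 𝔥
  W = map (λ f → 1ℚ , tabulate (δ ∘ Inverse.from f)) linearExtensions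

module X⋆-Order (k : Index) where

  Elem : Set
  Elem = Σ[ i ∈ Fin (length k) ] Fin ⌊ lookup k i ⌋

  -- (i , m) is p_{i+1,m+1}; in particular (i , zero) is p_{i+1,1} and (i , fromℕ _) is p_{i+1,k_{i+1}}.
  infix 4 _⋖_
  data _⋖_ : Elem → Elem → Set where
    chain : ∀ {i} {m m′ : Fin ⌊ lookup k i ⌋} → toℕ m′ ≡ suc (toℕ m) → (i , m) ⋖ (i , m′)
    link  : ∀ {i j} → toℕ j ≡ suc (toℕ i) → (i , zero) ⋖ (j , Fin.fromℕ (pred⁺ (lookup k j)))

  infix 4 _≺_
  _≺_ : Elem → Elem → Set
  _≺_ = TransClosure _⋖_

  label : Elem → Letter
  label (i , zero)  = 𝕪
  label (i , suc m) = 𝕩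

  rank : Elem → ℕ
  rank (i , zero)  = toℕ i
  rank (i , suc m) = length k ℕ.+ toℕ m

  rank-⋖ : ∀ {p q} → p ⋖ q → rank p ℕ.< rank q
  rank-⋖ (chain {i} {zero} {suc m′} e)   = ℕ.<-≤-trans (Fin.toℕ<n i) (ℕ.m≤m+n (length k) (toℕ m′))
  rank-⋖ (chain {i} {suc m} {suc m′} e)  = ℕ.+-monoʳ-< (length k) (ℕ.≤-reflexive (sym (ℕ.suc-injective e)))
  rank-⋖ (link {i} {j} e) = above (Fin.fromℕ (pred⁺ (lookup k j)))
    where
    above : ∀ m → toℕ i ℕ.< rank (j , m)
    above zero    = ℕ.≤-reflexive (sym e)
    above (suc m) = ℕ.<-≤-trans (Fin.toℕ<n i) (ℕ.m≤m+n (length k) (toℕ m))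

  rank-≺ : ∀ {p q} → p ≺ q → rank p ℕ.< rank q
  rank-≺ [ r ]   = rank-⋖ r
  rank-≺ (r ∷ s) = ℕ.<-trans (rank-⋖ r) (rank-≺ s)

  _⋖?_ : Decidable _⋖_
  (i , m) ⋖? (j , n) = map′ to from (chain? ⊎-dec link?)
    where
    Chain = ∃[ e ] toℕ n ≡ suc (toℕ (subst (λ i → Fin ⌊ lookup k i ⌋) {i} {j} e m))
    Link  = toℕ j ≡ suc (toℕ i) × m ≡ zero × n ≡ Fin.fromℕ (pred⁺ (lookup k j))
    chain? : Dec Chain
    chain? with i Fin.≟ j
    ... | no i≢j   = no (i≢j ∘ proj₁)
    ... | yes refl = map′ (refl ,_) (λ where (refl , h) → h) (toℕ n ℕ.≟ suc (toℕ m))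
    link? : Dec Link
    link? = (toℕ j ℕ.≟ suc (toℕ i)) ×-dec (m Fin.≟ zero) ×-dec (n Fin.≟ Fin.fromℕ (pred⁺ (lookup k j)))
    to : Chain ⊎ Link → (i , m) ⋖ (j , n)
    to (inj₁ (refl , e))        = chain e
    to (inj₂ (e , refl , refl)) = link e
    from : (i , m) ⋖ (j , n) → Chain ⊎ Link
    from (chain e) = inj₁ (refl , e)
    from (link e)  = inj₂ (e , refl , refl)

  ∃? : {P : Elem → Set} → U.Decidable P → Dec (∃ P)
  ∃? P? = map′ (λ (i , m , h) → (i , m) , h) (λ ((i , m) , h) → i , m , h)
    (Fin.any? λ i → Fin.any? λ m → P? (i , m))

  ≺?-below : ∀ n p q → rank q ℕ.< n → Dec (p ≺ q)
  ≺?-below (suc n) p q (ℕ.s≤s q≤n) = map′ to from ((p ⋖? q) ⊎-dec ∃? through?)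
    where
    through? : U.Decidable λ s → (s ⋖ q) × (p ≺ s)
    through? s with s ⋖? q
    ... | no  s⋖̸q = no (s⋖̸q ∘ proj₁)
    ... | yes s⋖q = map′ (s⋖q ,_) proj₂ (≺?-below n p s (ℕ.<-≤-trans (rank-⋖ s⋖q) q≤n))
    to : (p ⋖ q) ⊎ (∃ λ s → (s ⋖ q) × (p ≺ s)) → p ≺ q
    to (inj₁ r)           = [ r ]
    to (inj₂ (s , r , h)) = h Closure.∷ʳ r
    from : ∀ {p} → p ≺ q → (p ⋖ q) ⊎ (∃ λ s → (s ⋖ q) × (p ≺ s))
    from [ r ]   = inj₁ r
    from (r ∷ h) with from h
    ... | inj₁ r′            = inj₂ (_ , r′ , [ r ])
    ... | inj₂ (s , r′ , h′) = inj₂ (s , r′ , r ∷ h′)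

  _≺?_ : Decidable _≺_
  p ≺? q = ≺?-below (suc (rank q)) p q ℕ.≤-refl

  ≺-isStrictPartialOrder : IsStrictPartialOrder _≡_ _≺_
  ≺-isStrictPartialOrder = record
    { isEquivalence = isEquivalence
    ; irrefl        = λ { {p} refl h → ℕ.<-irrefl refl (rank-≺ h) }
    ; trans         = Closure.transitive _⋖_
    ; <-resp-≈      = resp₂ _≺_
    }

X⋆-size : Index → ℕ
X⋆-size k = sum (map ⌊_⌋ k)

X⋆-enum : ∀ k → X⋆-Order.Elem k ↔ Fin (X⋆-size k)
X⋆-enum []      = mk↔ₛ′ (λ { (() , _) }) (λ ()) (λ ()) (λ { (() , _) })
X⋆-enum (k ∷ l) = (↔-sym Fin.+↔⊎ ↔-∘ (↔-id _ ⊎-↔ X⋆-enum l)) ↔-∘ split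
  where
  split : X⋆-Order.Elem (k ∷ l) ↔ (Fin ⌊ k ⌋ ⊎ X⋆-Order.Elem l)
  split = mk↔ₛ′ (λ { (zero , m) → inj₁ m ; (suc i , m) → inj₂ (i , m) })
                (λ { (inj₁ m) → zero , m ; (inj₂ (i , m)) → suc i , m })
                (λ { (inj₁ m) → refl ; (inj₂ (i , m)) → refl })
                (λ { (zero , m) → refl ; (suc i , m) → refl })

X⋆ : Index → 2-Poset
X⋆ k = record
  { Elem                 = Elem
  ; size                 = X⋆-size k
  ; enum                 = X⋆-enum k
  ; _≺_                  = _≺_
  ; isStrictPartialOrder = ≺-isStrictPartialOrder
  ; _≺?_                 = _≺?_
  ; δ                    = label
  }
  where open X⋆-Order k

w⋆ : Index → 𝔥¹
w⋆ k = π (W (X⋆ k))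

X⋆-first : ∀ k {n} (f : X⋆-Order.Elem k ↔ Fin n) →
           (∀ p q → X⋆-Order._≺_ k p q → Inverse.to f p Fin.< Inverse.to f q) →
           InH¹ (tabulate (X⋆-Order.label k ∘ Inverse.from f))
X⋆-first k {zero}  f mono = one
X⋆-first k {suc n} f mono with Inverse.from f zero in eq
... | i , zero  = y∷ _
... | i , suc m = contradiction
        (subst (Inverse.to f (i , Fin.inject₁ m) Fin.<_) (Inverse.inverseˡ f (sym eq))
          (mono (i , Fin.inject₁ m) (i , suc m) [ X⋆-Order.chain (cong suc (sym (Fin.toℕ-inject₁ m))) ]))
        λ ()

ι-w⋆ : ∀ k → ι (w⋆ k) ≡ W (X⋆ k)
ι-w⋆ k = ι-π (All.map⁺ (All.map (λ {f} → X⋆-first k f)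
  (All.all-filter (monotone? (X⋆ k)) (map (_↔-∘ X⋆-enum k) (permutations (X⋆-size k))))))

ζ⋆-KY : (𝔥¹ → ℝ[T]) → Index → ℝ
ζ⋆-KY Zsh k = coeffᵀ (Zsh (w⋆ k)) 0

ℝ⟦t⟧ : Set
ℝ⟦t⟧ = ℕ → ℝ

sgn : ℕ → ℝ
sgn zero    = 1ℝ
sgn (suc n) = -ℝ sgn n

-- all (l_1 , … , l_m) ∈ ℕ^m with l_1 + ⋯ + l_m = n
weakCompositions : (m n : ℕ) → List (List ℕ)
weakCompositions zero    zero    = [] ∷ []
weakCompositions zero    (suc n) = []
weakCompositions (suc m) n       = concatMap (λ l → map (l ∷_) (weakCompositions m (n ℕ.∸ l))) (upTo (suc n))

-- ∏_j binom(k_j + l_j - 1 , l_j)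
binom : Index → List ℕ → ℝ
binom k l = fromℚ (+ product (zipWith (λ kⱼ lⱼ → (pred⁺ kⱼ ℕ.+ lⱼ) C lⱼ) k l) / 1)

-- the t^n-coefficient of the i-th summand
ζŜ-term : (Index → ℝ) → Index → ℕ → ℕ → ℝ
ζŜ-term ζ⋆• k n i =
  sgn (sum (map ⌊_⌋ (drop i k))) *ℝ ζ⋆• (take i k) *ℝ
  ∑ (map (λ l → binom (drop i k) l *ℝ ζ⋆• (reverse (zipWith _⊞_ (drop i k) l)))
         (weakCompositions (length (drop i k)) n))

ζŜ : (Index → ℝ) → Index → ℝ⟦t⟧
ζŜ ζ⋆• k n = ∑ (map (ζŜ-term ζ⋆• k n) (upTo (suc (length k))))

infix 4 _∈𝒵
_∈𝒵 : ℝ → Set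
a ∈𝒵 = ∃[ w ] a ≈ℝ Z w

ζ2 : ℝ
ζ2 = ζ ((1+ 1) ∷ []) (snoc [] ℕ.≤-refl)

infix 4 _≡[ζ2𝒵]_ _≡[ζ2𝒵]⟦t⟧_

-- equality in 𝒵 / ζ(2)𝒵
_≡[ζ2𝒵]_ : ℝ → ℝ → Set
a ≡[ζ2𝒵] b = a ∈𝒵 × b ∈𝒵 × ∃[ c ] (c ∈𝒵 × a -ℝ b ≈ℝ ζ2 *ℝ c)

_≡[ζ2𝒵]⟦t⟧_ : ℝ⟦t⟧ → ℝ⟦t⟧ → Set
f ≡[ζ2𝒵]⟦t⟧ g = ∀ n → f n ≡[ζ2𝒵] g n

{-# OPTIONS --safe #-}

-- Indices and words are read from the end: the head of a list is k_r, or the last letter. Let D f (k) = f (k′) if k is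
-- k′ followed by a 1, and 0 otherwise, and let a power series a(u) act on functions of indices by a ▷ f = a(D) f. With
-- E(u) = ∑ ζ∗({1}^m) u^m and A = 1/E,
--
--   ζ^sh = A ▷ ζ∗,   ζ⋆^sh = A ▷ ζ⋆∗,   ζ⋆^KY = E(-u) ▷ ζ⋆∗.
--
-- ζŜ is a convolution of ζ⋆ with a signed sum over the ζ⋆(k_r + l_r, …); D is self-adjoint for it, so that replacing ζ⋆
-- by a ▷ ζ⋆ inserts the factor a(u) a(-u). Since E(u) E(-u) = ∑ (-1)^m ζ({2}^m) u^{2m}, and since Euler's recursion puts
-- ζ(2m), hence ζ({2}^m), into ζ(2)𝒵, this factor is 1 modulo ζ(2)𝒵.
--
-- Both sides of ζ^sh = A ▷ ζ∗ are limits of A_N ▷ η_N, formed with the sums η_N truncated at N. As D is a derivation for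
-- ∗, A_N ▷ η_N is a combination of truncated sums of admissible indices, with coefficients independent of N; this gives
-- A ▷ ζ∗. For ζ^sh it suffices to show A_N ▷ η_N → 0 on x v sh y^m with m > 0. Coefficients c_n of polylogarithms turn
-- shuffles into Cauchy products, so the value there is ± ∑_n c_n(x v) h_m(1/(N-n+1), …, 1/N) with h_m complete
-- homogeneous, and this is at most η_N(v) h_m(1, …, 1/N) / N by convexity in n.
--
-- Finally ∑_i (-1)^{r-i} S(k_1, …, k_i) • (k_r, …, k_{i+1}) = 0 for r > 0, both when S is the sum over squares and • is ∗
-- and when S is w⋆ and • is sh; each relation determines S, and comparing the two gives the formula for ζ⋆^KY.

module Submission where

open import Algebra.Bundles using (CommutativeRing)
open import Algebra.Morphism.Structures using (module RingMorphisms)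
import Algebra.Solver.Ring
open import Algebra.Solver.Ring.AlmostCommutativeRing using (fromCommutativeRing; _-Raw-AlmostCommutative⟶_; Induced-equivalence)
open import Algebra.Structures using (IsCommutativeRing)
open import Data.Bool.Base using (Bool; true; false; _∧_; not; if_then_else_)
import Data.Bool.Properties as Bool
open import Data.Empty using (⊥-elim)
open import Data.Fin.Base as Fin using (Fin; zero; suc; toℕ; punchIn)
open import Data.Fin.Permutation as Perm using (Permutation; insert)
import Data.Fin.Properties as Fin
open import Data.Integer.Base as ℤ using ()
open import Data.List.Base using
  ( List; []; _∷_; _++_; _∷ʳ_; map; concatMap; reverse; replicate; length; filter; tabulate; allFin; upTo; applyUpTo
  ; take; drop; zipWith)
import Data.List.Properties as List
open import Data.List.Membership.Propositional using (_∈_; _∉_)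
open import Data.List.Membership.Propositional.Properties using (∈-++⁺ˡ; ∈-++⁺ʳ; ∈-++⁻)
open import Data.List.Relation.Binary.Permutation.Propositional as ↭ using (_↭_; prep; ↭-refl; ↭-sym; ↭-trans)
open import Data.List.Relation.Binary.Permutation.Propositional.Properties using (∈-resp-↭; All-resp-↭; ++⁺ˡ; ++-comm)
open import Data.List.Relation.Ternary.Interleaving.Propositional using (Interleaving; []; consˡ; consʳ; toPermutation)
open import Data.List.Relation.Unary.All as All using (All; []; _∷_)
import Data.List.Relation.Unary.All.Properties as All
open import Data.List.Relation.Unary.Any using (here; there)
open import Data.Maybe.Base using (just; nothing; maybe′)
open import Data.Nat.Base as ℕ using (ℕ; zero; suc)
open import Data.Nat.Combinatorics using (_C_)
open import Data.Nat.Induction using (<-wellFounded)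
open import Data.Nat.ListAction using (sum; product)
import Data.Nat.Properties as ℕ
open import Data.Product using (∃-syntax; _×_; _,_; proj₁; proj₂)
import Data.Product.Properties as Product
open import Data.Rational.Base as ℚ using (ℚ; 0ℚ; 1ℚ; ½)
import Data.Rational.Properties as ℚ
open import Data.Rational.Solver using (module +-*-Solver)
import Data.Rational.Unnormalised.Base as ℚᵘ
import Data.Rational.Unnormalised.Properties as ℚᵘ
open import Data.Sum.Base as Sum using (_⊎_; inj₁; inj₂)
open import Function.Base using (_∘_; id)
open import Function.Bundles using (_↔_; Inverse)
open import Function.Construct.Composition using (_↔-∘_)
open import Induction.WellFounded using (Acc; acc)
open import Level using (0ℓ)
open import Relation.Binary.Construct.Closure.Transitive using ([_]; _∷_)
open import Relation.Binary.Definitions using (DecidableEquality; WeaklyDecidable)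
import Relation.Binary.PropositionalEquality as ≡
open import Relation.Binary.PropositionalEquality using (_≡_; _≢_)
import Relation.Binary.Reasoning.Setoid
open import Relation.Nullary using (Dec; yes; no; does; contradiction)
import Relation.Unary as U
open import Defs

-- Real numbers

-- The homomorphism laws alone do not relate Z∗ to Zsh; both give ζ at admissible indices, but the
-- comparison has to pass through divergent truncated sums. There E_N(u) = ∏ (1 + u/n) over n ≤ N,
-- hence A_N(u) = ∏ 1/(1 + u/n): the divergence is removed exactly at every N, without expansions in
-- log N or a Γ-function. Only products with powers of y have to be followed to the limit, since the
-- vanishing at y^m, the values at admissible words and the relations for y^m sh x v determine ζ^sh.
--
-- The minus sign in a(u) a(-u) arises because deleting a 1 changes the sign (-1)^(k_{i+1} + ⋯ +
-- k_r). On both sides of a cut the deleted ones are adjacent to it, which is why D can pass from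
-- one factor of the convolution to the other.
--
-- That ζ(2m) lies in ζ(2)𝒵 follows from the two products in depth two, without π. Newton's
-- identities then lead from power sums to ζ∗({1}^m) and ζ({2}^m), dividing only by positive
-- integers.

module _ where
  open import Data.Rational.Base using (_+_; _*_; _-_; -_; ∣_∣; _≤_; _<_; _/_; nonNegative)
  open ≡ using (refl; sym; trans; cong; cong₂; subst; subst₂; module ≡-Reasoning)
  open ℚ-Lemmas
  open ℝ-Lemmas
  open +-*-Solver

  Null : (ℕ → ℚ) → Set
  Null s = ∀ ε → 0ℚ < ε → ∃[ N ] ∀ n → N ℕ.≤ n → ∣ s n ∣ < ε

  abstract
    null-≤ : ∀ {s t} → (∀ n → ∣ s n ∣ ≤ ∣ t n ∣) → Null t → Null s
    null-≤ s≤t t→0 ε 0<ε = proj₁ (t→0 ε 0<ε) , λ n N≤n → ℚ.≤-<-trans (s≤t n) (proj₂ (t→0 ε 0<ε) n N≤n)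

    null-≡ : ∀ {s t} → (∀ n → s n ≡ t n) → Null t → Null s
    null-≡ s≡t = null-≤ (λ n → ℚ.≤-reflexive (cong ∣_∣ (s≡t n)))

    null-0 : Null (λ _ → 0ℚ)
    null-0 ε 0<ε = 0 , λ _ _ → 0<ε

    null-+ : ∀ {s t} → Null s → Null t → Null (λ n → s n + t n)
    null-+ {s} {t} s→0 t→0 ε 0<ε =
      let M , s< = s→0 (½ * ε) (½-pos 0<ε)
          N , t< = t→0 (½ * ε) (½-pos 0<ε)
      in M ℕ.⊔ N , λ n h → subst (∣ s n + t n ∣ <_) (½+½ ε)
           (ℚ.≤-<-trans (ℚ.∣p+q∣≤∣p∣+∣q∣ (s n) (t n))
             (ℚ.+-mono-< (s< n (ℕ.m⊔n≤o⇒m≤o M N h)) (t< n (ℕ.m⊔n≤o⇒n≤o M N h))))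

    null-neg : ∀ {s} → Null s → Null (λ n → - s n)
    null-neg {s} = null-≤ (λ n → ℚ.≤-reflexive (ℚ.∣-p∣≡∣p∣ (s n)))

    null-*-bounded : ∀ {s} (a : ℝ) → Null s → Null (λ n → seq a n * s n)
    null-*-bounded {s} a s→0 ε 0<ε =
      let M , B , 0<B , a< = bounded a
          δ , 0<δ , Bδ = part ε B 0<ε 0<B
          N , s< = s→0 δ 0<δ
      in M ℕ.⊔ N , λ n h → ℚ.<-trans
           (subst (∣ seq a n * s n ∣ <_) Bδ
             (∣*∣-< (a< n (ℕ.m⊔n≤o⇒m≤o M N h)) 0<B (s< n (ℕ.m⊔n≤o⇒n≤o M N h))))
           (subst₂ _<_ (ℚ.+-identityʳ (½ * ε)) (½+½ ε) (ℚ.+-monoʳ-< (½ * ε) (½-pos 0<ε)))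

    null-* : ∀ {s t} → Null s → Null t → Null (λ n → s n * t n)
    null-* {s} {t} s→0 t→0 ε 0<ε =
      let M , s< = s→0 1ℚ (ℚ.positive⁻¹ 1ℚ)
          N , t< = t→0 ε 0<ε
      in M ℕ.⊔ N , λ n h → subst (∣ s n * t n ∣ <_) (ℚ.*-identityˡ ε)
           (∣*∣-< (s< n (ℕ.m⊔n≤o⇒m≤o M N h)) (ℚ.positive⁻¹ 1ℚ) (t< n (ℕ.m⊔n≤o⇒n≤o M N h)))

  infix 4 _~_
  _~_ : (ℕ → ℚ) → (ℕ → ℚ) → Set
  s ~ t = Null (λ n → s n - t n)

  abstract
    ~-≡ : ∀ {s t} → (∀ n → s n ≡ t n) → s ~ t
    ~-≡ {s} {t} e = null-≡ (λ n → trans (cong (_- t n) (e n)) (ℚ.+-inverseʳ (t n))) null-0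

    ~-refl : ∀ {s} → s ~ s
    ~-refl {s} = ~-≡ {s} {s} (λ _ → refl)

    ~-sym : ∀ {s t} → s ~ t → t ~ s
    ~-sym {s} {t} h = null-≡ (λ n → solve 2 (λ p q → q :- p := :- (p :- q)) refl (s n) (t n)) (null-neg {λ n → s n - t n} h)

    ~-trans : ∀ {s t u} → s ~ t → t ~ u → s ~ u
    ~-trans {s} {t} {u} h k =
      null-≡ (λ n → solve 3 (λ p q r → p :- r := (p :- q) :+ (q :- r)) refl (s n) (t n) (u n))
        (null-+ {λ n → s n - t n} {λ n → t n - u n} h k)

    ~-+ : ∀ {s t s′ t′} → s ~ s′ → t ~ t′ → (λ n → s n + t n) ~ (λ n → s′ n + t′ n)
    ~-+ {s} {t} {s′} {t′} h k =
      null-≡ (λ n → solve 4 (λ p q p′ q′ → (p :+ q) :- (p′ :+ q′) := (p :- p′) :+ (q :- q′)) refl (s n) (t n) (s′ n) (t′ n))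
        (null-+ {λ n → s n - s′ n} {λ n → t n - t′ n} h k)

    ~-neg : ∀ {s s′} → s ~ s′ → (λ n → - s n) ~ (λ n → - s′ n)
    ~-neg {s} {s′} h = null-≡ (λ n → solve 2 (λ p q → :- p :- (:- q) := :- (p :- q)) refl (s n) (s′ n))
      (null-neg {λ n → s n - s′ n} h)

    -- Only the limits `a` and `b` have to be bounded: the products are expanded around them, and
    -- what remains is a product of two null sequences.
    ~-* : ∀ {s t} (a b : ℝ) → s ~ seq a → t ~ seq b → (λ n → s n * t n) ~ (λ n → seq a n * seq b n)
    ~-* {s} {t} a b h k =
      null-≡ (λ n → solve 4 (λ p q p′ q′ → p :* q :- p′ :* q′ := (p :- p′) :* (q :- q′) :+ (q′ :* (p :- p′) :+ p′ :* (q :- q′)))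
          refl (s n) (t n) (seq a n) (seq b n))
        (null-+ {λ n → (s n - seq a n) * (t n - seq b n)} {λ n → seq b n * (s n - seq a n) + seq a n * (t n - seq b n)}
          (null-* {λ n → s n - seq a n} {λ n → t n - seq b n} h k)
          (null-+ {λ n → seq b n * (s n - seq a n)} {λ n → seq a n * (t n - seq b n)}
            (null-*-bounded {λ n → s n - seq a n} b h) (null-*-bounded {λ n → t n - seq b n} a k)))

  -- Wrapping the equality keeps the two reals inferable.
  infix 4 _≋_
  record _≋_ (a b : ℝ) : Set where
    constructor mk≋
    field un≋ : a ≈ℝ b
  open _≋_ public

  infix 4 _⟶_
  -- A real number is its Cauchy sequence, so converging to `a` means being equivalent to the
  -- sequence of `a`; limits then respect the ring operations by the congruence laws of `_~_`.
  record _⟶_ (s : ℕ → ℚ) (a : ℝ) : Set where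
    constructor mk⟶
    field un⟶ : s ~ seq a
  open _⟶_ public

  -- Opaque copies of the operations: unification must not unfold them to operations on sequences.
  infixl 6 _⊹_
  infixl 7 _∙_
  infix  8 ⊖_
  abstract
    _⊹_ _∙_ : ℝ → ℝ → ℝ
    _⊹_ = _+ℝ_
    _∙_ = _*ℝ_

    ⊖_ : ℝ → ℝ
    ⊖_ = -ℝ_

    ⊹-def : ∀ a b → a ⊹ b ≡ a +ℝ b
    ⊹-def a b = refl

    ∙-def : ∀ a b → a ∙ b ≡ a *ℝ b
    ∙-def a b = refl

    ⊖-def : ∀ a → ⊖ a ≡ -ℝ a
    ⊖-def a = refl

  abstract
    ≋-pt : ∀ {a b} → (∀ n → seq a n ≡ seq b n) → a ≋ b
    ≋-pt {a} {b} e = mk≋ (~-≡ {seq a} {seq b} e)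

    ⟶-self : ∀ a → seq a ⟶ a
    ⟶-self a = mk⟶ (~-refl {seq a})

    ⟶-unique : ∀ {s a b} → s ⟶ a → s ⟶ b → a ≋ b
    ⟶-unique {s} {a} {b} (mk⟶ h) (mk⟶ k) = mk≋ (~-trans {seq a} {s} {seq b} (~-sym {s} {seq a} h) k)

    ⟶-≡ : ∀ {s t a} → (∀ n → s n ≡ t n) → t ⟶ a → s ⟶ a
    ⟶-≡ {s} {t} {a} e (mk⟶ h) = mk⟶ (~-trans {s} {t} {seq a} (~-≡ {s} {t} e) h)

    ⟶-≋ : ∀ {s a b} → a ≋ b → s ⟶ a → s ⟶ b
    ⟶-≋ {s} {a} {b} (mk≋ e) (mk⟶ h) = mk⟶ (~-trans {s} {seq a} {seq b} h e)

    ⟶-const : ∀ q → (λ _ → q) ⟶ fromℚ q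
    ⟶-const q = mk⟶ (~-refl {λ _ → q})

    ⟶-+ : ∀ {s t a b} → s ⟶ a → t ⟶ b → (λ n → s n + t n) ⟶ a ⊹ b
    ⟶-+ {s} {t} {a} {b} (mk⟶ h) (mk⟶ k) = mk⟶ (~-+ {s} {t} {seq a} {seq b} h k)

    ⟶-neg : ∀ {s a} → s ⟶ a → (λ n → - s n) ⟶ ⊖ a
    ⟶-neg {s} {a} (mk⟶ h) = mk⟶ (~-neg {s} {seq a} h)

    ⟶-* : ∀ {s t a b} → s ⟶ a → t ⟶ b → (λ n → s n * t n) ⟶ a ∙ b
    ⟶-* {s} {t} {a} {b} (mk⟶ h) (mk⟶ k) = mk⟶ (~-* {s} {t} a b h k)

    null⇒⟶0 : ∀ {s} → Null s → s ⟶ 0ℝ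
    null⇒⟶0 {s} h = mk⟶ (null-≡ (λ n → ℚ.+-identityʳ (s n)) h)

    ≋-refl : ∀ {a} → a ≋ a
    ≋-refl {a} = mk≋ (~-refl {seq a})

    ≋-sym : ∀ {a b} → a ≋ b → b ≋ a
    ≋-sym {a} {b} (mk≋ h) = mk≋ (~-sym {seq a} {seq b} h)

    ≋-trans : ∀ {a b c} → a ≋ b → b ≋ c → a ≋ c
    ≋-trans {a} {b} {c} (mk≋ h) (mk≋ k) = mk≋ (~-trans {seq a} {seq b} {seq c} h k)

    ⊹-cong : ∀ {a b c d} → a ≋ b → c ≋ d → a ⊹ c ≋ b ⊹ d
    ⊹-cong {a} {b} {c} {d} (mk≋ h) (mk≋ k) = mk≋ (~-+ {seq a} {seq c} {seq b} {seq d} h k)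

    ∙-cong : ∀ {a b c d} → a ≋ b → c ≋ d → a ∙ c ≋ b ∙ d
    ∙-cong {a} {b} {c} {d} (mk≋ h) (mk≋ k) = mk≋ (~-* {seq a} {seq c} b d h k)

    ⊖-cong : ∀ {a b} → a ≋ b → ⊖ a ≋ ⊖ b
    ⊖-cong {a} {b} (mk≋ h) = mk≋ (~-neg {seq a} {seq b} h)

  abstract
    ring-isCommutativeRing : IsCommutativeRing _≋_ _⊹_ _∙_ ⊖_ 0ℝ 1ℝ
    ring-isCommutativeRing = record
      { isRing = record
        { +-isAbelianGroup = record
          { isGroup = record
            { isMonoid = record
              { isSemigroup = record
                { isMagma = record
                  { isEquivalence = record { refl = ≋-refl ; sym = ≋-sym ; trans = ≋-trans }
                  ; ∙-cong = ⊹-cong }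
                ; assoc = λ a b c → ≋-pt (λ n → ℚ.+-assoc (seq a n) (seq b n) (seq c n)) }
              ; identity = (λ a → ≋-pt (λ n → ℚ.+-identityˡ (seq a n))) , (λ a → ≋-pt (λ n → ℚ.+-identityʳ (seq a n))) }
            ; inverse = (λ a → ≋-pt (λ n → ℚ.+-inverseˡ (seq a n))) , (λ a → ≋-pt (λ n → ℚ.+-inverseʳ (seq a n)))
            ; ⁻¹-cong = ⊖-cong }
          ; comm = λ a b → ≋-pt (λ n → ℚ.+-comm (seq a n) (seq b n)) }
        ; *-cong = ∙-cong
        ; *-assoc = λ a b c → ≋-pt (λ n → ℚ.*-assoc (seq a n) (seq b n) (seq c n))
        ; *-identity = (λ a → ≋-pt (λ n → ℚ.*-identityˡ (seq a n))) , (λ a → ≋-pt (λ n → ℚ.*-identityʳ (seq a n)))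
        ; distrib = (λ a b c → ≋-pt (λ n → ℚ.*-distribˡ-+ (seq a n) (seq b n) (seq c n)))
                  , (λ a b c → ≋-pt (λ n → ℚ.*-distribʳ-+ (seq a n) (seq b n) (seq c n))) }
      ; *-comm = λ a b → ≋-pt (λ n → ℚ.*-comm (seq a n) (seq b n)) }

    fromℚ-+ : ∀ p q → fromℚ (p + q) ≋ fromℚ p ⊹ fromℚ q
    fromℚ-+ p q = ≋-pt (λ _ → refl)

    fromℚ-* : ∀ p q → fromℚ (p * q) ≋ fromℚ p ∙ fromℚ q
    fromℚ-* p q = ≋-pt (λ _ → refl)

    fromℚ-neg : ∀ p → fromℚ (- p) ≋ ⊖ fromℚ p
    fromℚ-neg p = ≋-pt (λ _ → refl)

  ℝ-commutativeRing : CommutativeRing 0ℓ 0ℓ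
  ℝ-commutativeRing = record { isCommutativeRing = ring-isCommutativeRing }

  φℝ : CommutativeRing.rawRing ℚ.+-*-commutativeRing -Raw-AlmostCommutative⟶ fromCommutativeRing ℝ-commutativeRing
  φℝ = record
    { ⟦_⟧ = fromℚ ; +-homo = fromℚ-+ ; *-homo = fromℚ-* ; -‿homo = fromℚ-neg ; 0-homo = ≋-refl ; 1-homo = ≋-refl }

-- Sums, power series and the deletion of leading ones over a commutative ring

pattern 1⁺     = 1+ zero
pattern 2+⁺_ m = 1+ suc m

⊕-comm : ∀ k l → k ⊕ l ≡ l ⊕ k
⊕-comm (1+ m) (1+ n) = ≡.cong 1+_ (≡.trans (ℕ.+-suc m n) (≡.trans (≡.cong suc (ℕ.+-comm m n)) (≡.sym (ℕ.+-suc n m))))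

⊕-assoc : ∀ k l m → (k ⊕ l) ⊕ m ≡ k ⊕ (l ⊕ m)
⊕-assoc (1+ k) (1+ l) (1+ m) = ≡.cong 1+_ (ℕ.+-assoc k (suc l) (suc m))

mergeHead : ℕ⁺ → Index → Index
mergeHead k []      = []
mergeHead k (h ∷ t) = h ⊕ k ∷ t

module _ where
  open ≡ using (cong; cong₂; trans; sym)

  squaresFrom-⊕ : ∀ b a p → squaresFrom (b ⊕ a) p ≡ map (mergeHead b) (squaresFrom a p)
  squaresFrom-⊕ b a []      = cong (λ x → (x ∷ []) ∷ []) (⊕-comm b a)
  squaresFrom-⊕ b a (l ∷ p) = trans
    (cong₂ _++_
      (trans (List.map-cong (λ w → cong (_∷ w) (⊕-comm b a)) (squaresFrom l p)) (List.map-∘ (squaresFrom l p)))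
      (trans (cong (λ x → squaresFrom x p) (⊕-assoc b a l)) (squaresFrom-⊕ b (a ⊕ l) p)))
    (sym (List.map-++ (mergeHead b) (map (a ∷_) (squaresFrom l p)) (squaresFrom (a ⊕ l) p)))

-- The ring is a parameter because the same algebra is needed twice: over ℚ for the truncated sums
-- and over ℝ for their limits.
module Over (R : CommutativeRing 0ℓ 0ℓ)
            (φ : CommutativeRing.rawRing ℚ.+-*-commutativeRing -Raw-AlmostCommutative⟶ fromCommutativeRing R) where

  open CommutativeRing R public hiding (zero)
  open _-Raw-AlmostCommutative⟶_ φ public renaming (⟦_⟧ to φ₀)

  coeff≟ : WeaklyDecidable (Induced-equivalence φ)
  coeff≟ p q with p ℚ.≟ q
  ... | yes ≡.refl = just refl
  ... | no _       = nothing

  module Solver = Algebra.Solver.Ring (CommutativeRing.rawRing ℚ.+-*-commutativeRing) (fromCommutativeRing R) φ coeff≟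
  open Solver public using (solve; _:+_; _:*_; _:-_; :-_; _:=_; con)
  module ≈-Reasoning = Relation.Binary.Reasoning.Setoid setoid
  open ≈-Reasoning

  ≡⇒≈ : ∀ {x y} → x ≡ y → x ≈ y
  ≡⇒≈ ≡.refl = refl

  private
    variable
      A B : Set

  ⅀ : List A → (A → Carrier) → Carrier
  ⅀ []      f = 0#
  ⅀ (x ∷ l) f = f x + ⅀ l f

  ⅀-cong : ∀ (l : List A) {f g : A → Carrier} → (∀ x → f x ≈ g x) → ⅀ l f ≈ ⅀ l g
  ⅀-cong []      e = refl
  ⅀-cong (x ∷ l) e = +-cong (e x) (⅀-cong l e)

  ⅀-++ : ∀ (l m : List A) f → ⅀ (l ++ m) f ≈ ⅀ l f + ⅀ m f
  ⅀-++ []      m f = sym (+-identityˡ _)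
  ⅀-++ (x ∷ l) m f = trans (+-congˡ (⅀-++ l m f)) (sym (+-assoc _ _ _))

  ⅀-map : ∀ (g : A → B) (l : List A) f → ⅀ (map g l) f ≈ ⅀ l (f ∘ g)
  ⅀-map g []      f = refl
  ⅀-map g (x ∷ l) f = +-congˡ (⅀-map g l f)

  ⅀-concatMap : ∀ (g : A → List B) (l : List A) f → ⅀ (concatMap g l) f ≈ ⅀ l (λ x → ⅀ (g x) f)
  ⅀-concatMap g []      f = refl
  ⅀-concatMap g (x ∷ l) f = trans (⅀-++ (g x) (concatMap g l) f) (+-congˡ (⅀-concatMap g l f))

  ⅀-0 : ∀ (l : List A) {f} → (∀ x → f x ≈ 0#) → ⅀ l f ≈ 0#
  ⅀-0 []      e = refl
  ⅀-0 (x ∷ l) e = trans (+-cong (e x) (⅀-0 l e)) (+-identityˡ _)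

  interchange : ∀ a b c d → (a + b) + (c + d) ≈ (a + c) + (b + d)
  interchange = solve 4 (λ a b c d → (a :+ b) :+ (c :+ d) := (a :+ c) :+ (b :+ d)) refl

  ⅀-+ : ∀ (l : List A) f g → ⅀ l (λ x → f x + g x) ≈ ⅀ l f + ⅀ l g
  ⅀-+ []      f g = sym (+-identityˡ _)
  ⅀-+ (x ∷ l) f g = trans (+-congˡ (⅀-+ l f g)) (interchange _ _ _ _)

  ⅀-*ˡ : ∀ (l : List A) c f → ⅀ l (λ x → c * f x) ≈ c * ⅀ l f
  ⅀-*ˡ []      c f = sym (zeroʳ c)
  ⅀-*ˡ (x ∷ l) c f = trans (+-congˡ (⅀-*ˡ l c f)) (sym (distribˡ _ _ _))

  ⅀-*ʳ : ∀ (l : List A) c f → ⅀ l (λ x → f x * c) ≈ ⅀ l f * c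
  ⅀-*ʳ []      c f = sym (zeroˡ c)
  ⅀-*ʳ (x ∷ l) c f = trans (+-congˡ (⅀-*ʳ l c f)) (sym (distribʳ _ _ _))

  ⅀-swap : ∀ (l : List A) (m : List B) (f : A → B → Carrier) → ⅀ l (λ x → ⅀ m (f x)) ≈ ⅀ m (λ y → ⅀ l (λ x → f x y))
  ⅀-swap []      m f = sym (⅀-0 m (λ _ → refl))
  ⅀-swap (x ∷ l) m f = trans (+-congˡ (⅀-swap l m f)) (sym (⅀-+ m _ _))

  sg : ℕ → Carrier
  sg zero    = 1#
  sg (suc n) = - sg n

  sg² : ∀ n → sg n * sg n ≈ 1#
  sg² zero    = *-identityˡ 1#
  sg² (suc n) = trans (solve 1 (λ a → (:- a) :* (:- a) := a :* a) refl (sg n)) (sg² n)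

  Series : Set
  Series = ℕ → Carrier

  δ₀ : Series
  δ₀ zero    = 1#
  δ₀ (suc _) = 0#

  shift : Series → Series
  shift a n = a (suc n)

  X· : Series → Series
  X· a zero    = 0#
  X· a (suc n) = a n

  -- The substitution of -u for u.
  tw : Series → Series
  tw a n = sg n * a n

  infixl 7 _⊛_
  _⊛_ : Series → Series → Series
  (a ⊛ b) zero    = a 0 * b 0
  (a ⊛ b) (suc n) = a 0 * b (suc n) + (shift a ⊛ b) n

  ⊛-cong : ∀ {a a′ b b′} → (∀ n → a n ≈ a′ n) → (∀ n → b n ≈ b′ n) → ∀ n → (a ⊛ b) n ≈ (a′ ⊛ b′) n
  ⊛-cong e h zero    = *-cong (e 0) (h 0)
  ⊛-cong e h (suc n) = +-cong (*-cong (e 0) (h (suc n))) (⊛-cong (e ∘ suc) h n)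

  ⊛-+ʳ : ∀ a b c n → (a ⊛ (λ m → b m + c m)) n ≈ (a ⊛ b) n + (a ⊛ c) n
  ⊛-+ʳ a b c zero    = distribˡ _ _ _
  ⊛-+ʳ a b c (suc n) = trans (+-cong (distribˡ _ _ _) (⊛-+ʳ (shift a) b c n)) (interchange _ _ _ _)

  ⊛-+ˡ : ∀ a b c n → ((λ m → a m + b m) ⊛ c) n ≈ (a ⊛ c) n + (b ⊛ c) n
  ⊛-+ˡ a b c zero    = distribʳ _ _ _
  ⊛-+ˡ a b c (suc n) = trans (+-cong (distribʳ _ _ _) (⊛-+ˡ (shift a) (shift b) c n)) (interchange _ _ _ _)

  ⊛-*ʳ : ∀ x a b n → (a ⊛ (λ m → x * b m)) n ≈ x * (a ⊛ b) n
  ⊛-*ʳ x a b zero    = solve 3 (λ x a b → a :* (x :* b) := x :* (a :* b)) refl x (a 0) (b 0)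
  ⊛-*ʳ x a b (suc n) = trans (+-congˡ (⊛-*ʳ x (shift a) b n))
    (solve 4 (λ x a b c → a :* (x :* b) :+ x :* c := x :* (a :* b :+ c)) refl x (a 0) (b (suc n)) _)

  ⊛-*ˡ : ∀ x a b n → ((λ m → x * a m) ⊛ b) n ≈ x * (a ⊛ b) n
  ⊛-*ˡ x a b zero    = *-assoc _ _ _
  ⊛-*ˡ x a b (suc n) = trans (+-cong (*-assoc _ _ _) (⊛-*ˡ x (shift a) b n)) (sym (distribˡ _ _ _))

  ⊛-0ʳ : ∀ a n → (a ⊛ (λ _ → 0#)) n ≈ 0#
  ⊛-0ʳ a zero    = zeroʳ _
  ⊛-0ʳ a (suc n) = trans (+-cong (zeroʳ _) (⊛-0ʳ (shift a) n)) (+-identityˡ _)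

  ⊛-sucʳ : ∀ a b n → (a ⊛ b) (suc n) ≈ a (suc n) * b 0 + (a ⊛ shift b) n
  ⊛-sucʳ a b zero    = +-comm _ _
  ⊛-sucʳ a b (suc n) = trans (+-congˡ (⊛-sucʳ (shift a) b n))
    (solve 3 (λ x y z → x :+ (y :+ z) := y :+ (x :+ z)) refl _ _ _)

  ⊛-comm : ∀ a b n → (a ⊛ b) n ≈ (b ⊛ a) n
  ⊛-comm a b zero    = *-comm _ _
  ⊛-comm a b (suc n) = trans (+-cong (*-comm _ _) (⊛-comm (shift a) b n)) (sym (⊛-sucʳ b a n))

  ⊛-assoc : ∀ a b c n → ((a ⊛ b) ⊛ c) n ≈ (a ⊛ (b ⊛ c)) n
  ⊛-assoc a b c zero    = *-assoc _ _ _
  ⊛-assoc a b c (suc n) = begin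
    a 0 * b 0 * c (suc n) + ((λ m → a 0 * b (suc m) + (shift a ⊛ b) m) ⊛ c) n
      ≈⟨ +-congˡ (⊛-+ˡ (λ m → a 0 * b (suc m)) (shift a ⊛ b) c n) ⟩
    a 0 * b 0 * c (suc n) + (((λ m → a 0 * b (suc m)) ⊛ c) n + ((shift a ⊛ b) ⊛ c) n)
      ≈⟨ +-congˡ (+-cong (⊛-*ˡ (a 0) (shift b) c n) (⊛-assoc (shift a) b c n)) ⟩
    a 0 * b 0 * c (suc n) + (a 0 * (shift b ⊛ c) n + (shift a ⊛ (b ⊛ c)) n)
      ≈⟨ solve 5 (λ a b c s t → a :* b :* c :+ (a :* s :+ t) := a :* (b :* c :+ s) :+ t) refl (a 0) (b 0) (c (suc n)) _ _ ⟩
    a 0 * (b 0 * c (suc n) + (shift b ⊛ c) n) + (shift a ⊛ (b ⊛ c)) n ∎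

  ⊛-identityʳ : ∀ a n → (a ⊛ δ₀) n ≈ a n
  ⊛-identityʳ a zero    = *-identityʳ _
  ⊛-identityʳ a (suc n) = trans (+-cong (zeroʳ _) (⊛-identityʳ (shift a) n)) (+-identityˡ _)

  ⊛-identityˡ : ∀ a n → (δ₀ ⊛ a) n ≈ a n
  ⊛-identityˡ a n = trans (⊛-comm δ₀ a n) (⊛-identityʳ a n)

  ⊛-X : ∀ a b n → (a ⊛ X· b) n ≈ X· (a ⊛ b) n
  ⊛-X a b zero    = zeroʳ _
  ⊛-X a b (suc n) = trans (⊛-sucʳ a (X· b) n) (trans (+-congʳ (zeroʳ _)) (+-identityˡ _))

  ⊛-negˡ : ∀ a b n → ((λ m → - a m) ⊛ b) n ≈ - (a ⊛ b) n
  ⊛-negˡ a b zero    = solve 2 (λ a b → (:- a) :* b := :- (a :* b)) refl _ _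
  ⊛-negˡ a b (suc n) = trans (+-congˡ (⊛-negˡ (shift a) b n))
    (solve 3 (λ a b c → (:- a) :* b :+ :- c := :- (a :* b :+ c)) refl _ _ _)

  tw-⊛ : ∀ a b n → tw (a ⊛ b) n ≈ (tw a ⊛ tw b) n
  tw-⊛ a b zero    = trans (*-identityˡ _) (*-cong (sym (*-identityˡ _)) (sym (*-identityˡ _)))
  tw-⊛ a b (suc n) = begin
    - sg n * (a 0 * b (suc n) + (shift a ⊛ b) n)
      ≈⟨ solve 4 (λ s a b r → (:- s) :* (a :* b :+ r) := a :* ((:- s) :* b) :+ :- (s :* r)) refl (sg n) (a 0) (b (suc n)) _ ⟩
    a 0 * (- sg n * b (suc n)) + - (sg n * (shift a ⊛ b) n)
      ≈⟨ +-cong (*-congʳ (sym (*-identityˡ _))) (-‿cong (tw-⊛ (shift a) b n)) ⟩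
    tw a 0 * tw b (suc n) + - (tw (shift a) ⊛ tw b) n
      ≈⟨ +-congˡ (sym (⊛-negˡ (tw (shift a)) (tw b) n)) ⟩
    tw a 0 * tw b (suc n) + ((λ m → - tw (shift a) m) ⊛ tw b) n
      ≈⟨ +-congˡ (⊛-cong (λ m → solve 2 (λ s x → :- (s :* x) := (:- s) :* x) refl (sg m) (a (suc m))) (λ _ → refl) n) ⟩
    tw a 0 * tw b (suc n) + (shift (tw a) ⊛ tw b) n ∎

  tw-tw : ∀ a n → tw (tw a) n ≈ a n
  tw-tw a n = trans (sym (*-assoc _ _ _)) (trans (*-congʳ (sg² n)) (*-identityˡ _))

  tw-δ₀ : ∀ n → tw δ₀ n ≈ δ₀ n
  tw-δ₀ zero    = *-identityˡ _
  tw-δ₀ (suc n) = zeroʳ _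

sgℚ : ℕ → ℚ
sgℚ zero    = 1ℚ
sgℚ (suc n) = ℚ.- sgℚ n

ones : ℕ → Index
ones n = replicate n 1⁺

-- reg i k = ∑_j (-1)^{i+j} S(1^{i+j}) ∗ D^j k, where D removes a leading 1 and S is the sum over squares.
regTerm : ℕ → Index → Lin Index
regTerm i k = map (sgℚ i ,_) (concatMap (_∗ʳ k) (squares (ones i)))

reg : ℕ → Index → Lin Index
reg i []                = regTerm i []
reg i k@(1⁺ ∷ k′)       = regTerm i k ++ reg (suc i) k′
reg i k@((2+⁺ _) ∷ _)   = regTerm i k

module Stuffle (R : CommutativeRing 0ℓ 0ℓ)
               (φ : CommutativeRing.rawRing ℚ.+-*-commutativeRing -Raw-AlmostCommutative⟶ fromCommutativeRing R) where
  open Over R φ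
  open ≈-Reasoning

  D : (Index → Carrier) → Index → Carrier
  D f []              = 0#
  D f (1⁺ ∷ p)        = f p
  D f ((2+⁺ _) ∷ p)   = 0#

  infixr 6 _▷_
  -- The sum ∑ a_n D^n f. It is finite at every index, as D^n f vanishes where fewer than n ones
  -- lead.
  _▷_ : Series → (Index → Carrier) → Index → Carrier
  (a ▷ f) []              = a 0 * f []
  (a ▷ f) (1⁺ ∷ p)        = a 0 * f (1⁺ ∷ p) + (shift a ▷ f) p
  (a ▷ f) ((2+⁺ m) ∷ p)   = a 0 * f ((2+⁺ m) ∷ p)

  ▷-D : ∀ a f p → (a ▷ f) p ≈ a 0 * f p + D (shift a ▷ f) p
  ▷-D a f []            = sym (+-identityʳ _)
  ▷-D a f (1⁺ ∷ p)      = refl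
  ▷-D a f ((2+⁺ _) ∷ p) = sym (+-identityʳ _)

  ▷-cong : ∀ {a b f g} → (∀ n → a n ≈ b n) → (∀ p → f p ≈ g p) → ∀ p → (a ▷ f) p ≈ (b ▷ g) p
  ▷-cong e h []            = *-cong (e 0) (h _)
  ▷-cong e h (1⁺ ∷ p)      = +-cong (*-cong (e 0) (h _)) (▷-cong (e ∘ suc) h p)
  ▷-cong e h ((2+⁺ _) ∷ p) = *-cong (e 0) (h _)

  ▷-+ : ∀ a b f p → ((λ n → a n + b n) ▷ f) p ≈ (a ▷ f) p + (b ▷ f) p
  ▷-+ a b f []            = distribʳ _ _ _
  ▷-+ a b f (1⁺ ∷ p)      = trans (+-cong (distribʳ _ _ _) (▷-+ (shift a) (shift b) f p)) (interchange _ _ _ _)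
  ▷-+ a b f ((2+⁺ _) ∷ p) = distribʳ _ _ _

  ▷-* : ∀ x a f p → ((λ n → x * a n) ▷ f) p ≈ x * (a ▷ f) p
  ▷-* x a f []            = *-assoc _ _ _
  ▷-* x a f (1⁺ ∷ p)      = trans (+-cong (*-assoc _ _ _) (▷-* x (shift a) f p)) (sym (distribˡ _ _ _))
  ▷-* x a f ((2+⁺ _) ∷ p) = *-assoc _ _ _

  ▷-0 : ∀ {a} f → (∀ n → a n ≈ 0#) → ∀ p → (a ▷ f) p ≈ 0#
  ▷-0 f e []            = trans (*-congʳ (e 0)) (zeroˡ _)
  ▷-0 f e (1⁺ ∷ p)      = trans (+-cong (trans (*-congʳ (e 0)) (zeroˡ _)) (▷-0 f (e ∘ suc) p)) (+-identityˡ _)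
  ▷-0 f e ((2+⁺ _) ∷ p) = trans (*-congʳ (e 0)) (zeroˡ _)

  ▷-δ₀ : ∀ f p → (δ₀ ▷ f) p ≈ f p
  ▷-δ₀ f []            = *-identityˡ _
  ▷-δ₀ f (1⁺ ∷ p)      = trans (+-cong (*-identityˡ _) (▷-0 f (λ _ → refl) p)) (+-identityʳ _)
  ▷-δ₀ f ((2+⁺ _) ∷ p) = *-identityˡ _

  ▷-▷ : ∀ a b f p → (a ▷ (b ▷ f)) p ≈ ((a ⊛ b) ▷ f) p
  ▷-▷ a b f []            = sym (*-assoc _ _ _)
  ▷-▷ a b f (1⁺ ∷ p)      = begin
    a 0 * (b 0 * f (1⁺ ∷ p) + (shift b ▷ f) p) + (shift a ▷ (b ▷ f)) p
      ≈⟨ solve 5 (λ a b c d e → a :* (b :* c :+ d) :+ e := a :* b :* c :+ (a :* d :+ e)) refl (a 0) (b 0) (f (1⁺ ∷ p)) _ _ ⟩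
    a 0 * b 0 * f (1⁺ ∷ p) + (a 0 * (shift b ▷ f) p + (shift a ▷ (b ▷ f)) p)
      ≈⟨ +-congˡ (+-cong (sym (▷-* (a 0) (shift b) f p)) (▷-▷ (shift a) b f p)) ⟩
    a 0 * b 0 * f (1⁺ ∷ p) + (((λ n → a 0 * b (suc n)) ▷ f) p + ((shift a ⊛ b) ▷ f) p)
      ≈⟨ +-congˡ (sym (▷-+ _ _ f p)) ⟩
    a 0 * b 0 * f (1⁺ ∷ p) + (shift (a ⊛ b) ▷ f) p ∎
  ▷-▷ a b f ((2+⁺ _) ∷ p) = sym (*-assoc _ _ _)

  -- The convolution ∑_{k = k′k″} F(k′) G(k″), along a list whose first part is already reversed into p.
  pair : (Index → Carrier) → (Index → Carrier) → Index → Index → Carrier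
  pair F G p []      = F p * G []
  pair F G p (k ∷ q) = F p * G (k ∷ q) + pair F G (k ∷ p) q

  pair-cong : ∀ {F F′ G G′} → (∀ p → F p ≈ F′ p) → (∀ p → G p ≈ G′ p) → ∀ p q → pair F G p q ≈ pair F′ G′ p q
  pair-cong e h p []      = *-cong (e p) (h [])
  pair-cong e h p (k ∷ q) = +-cong (*-cong (e p) (h (k ∷ q))) (pair-cong e h (k ∷ p) q)

  pair-+ʳ : ∀ F G H p q → pair F (λ r → G r + H r) p q ≈ pair F G p q + pair F H p q
  pair-+ʳ F G H p []      = distribˡ _ _ _
  pair-+ʳ F G H p (k ∷ q) = trans (+-cong (distribˡ _ _ _) (pair-+ʳ F G H (k ∷ p) q)) (interchange _ _ _ _)

  private
    -- Both convolutions run over the deletions of a block of n adjacent ones from the whole index,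
    -- with weight a_n: `a ▷ F` puts the cut at the end of the block, `a ▷ G` at its beginning. If
    -- the cuts start at the boundary between p and q, the sums differ by the blocks which begin
    -- inside p and end at the boundary or beyond it; `cross` collects these.
    cross : Series → (Index → Carrier) → (Index → Carrier) → Index → Index → Carrier
    cross a F G []            q = 0#
    cross a F G (1⁺ ∷ p)      q = F p * (shift a ▷ G) q + cross (shift a) F G p q
    cross a F G ((2+⁺ _) ∷ p) q = 0#

    -- This separates the blocks which end at the boundary from those which also take the first 1 of
    -- the right part.
    cross-1 : ∀ a F G p q → cross a F G p (1⁺ ∷ q) ≈ D (shift a ▷ F) p * G (1⁺ ∷ q) + cross (shift a) F G p q
    cross-1 a F G []            q = sym (trans (+-identityʳ _) (zeroˡ _))
    cross-1 a F G (1⁺ ∷ p)      q = begin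
      F p * (a 1 * G (1⁺ ∷ q) + (shift (shift a) ▷ G) q) + cross (shift a) F G p (1⁺ ∷ q)
        ≈⟨ +-congˡ (cross-1 (shift a) F G p q) ⟩
      F p * (a 1 * G (1⁺ ∷ q) + (shift (shift a) ▷ G) q) + (D (shift (shift a) ▷ F) p * G (1⁺ ∷ q) + cross (shift (shift a)) F G p q)
        ≈⟨ solve 6 (λ f a g s d c → f :* (a :* g :+ s) :+ (d :* g :+ c) := (a :* f :+ d) :* g :+ (f :* s :+ c)) refl _ _ _ _ _ _ ⟩
      (a 1 * F p + D (shift (shift a) ▷ F) p) * G (1⁺ ∷ q) + (F p * (shift (shift a) ▷ G) q + cross (shift (shift a)) F G p q)
        ≈⟨ +-congʳ (*-congʳ (sym (▷-D (shift a) F p))) ⟩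
      (shift a ▷ F) p * G (1⁺ ∷ q) + (F p * (shift (shift a) ▷ G) q + cross (shift (shift a)) F G p q) ∎
    cross-1 a F G ((2+⁺ _) ∷ p) q = sym (trans (+-identityʳ _) (zeroˡ _))

    cross-2+ : ∀ a F G p m q → cross a F G p ((2+⁺ m) ∷ q) ≈ D (shift a ▷ F) p * G ((2+⁺ m) ∷ q)
    cross-2+ a F G []            m q = sym (zeroˡ _)
    cross-2+ a F G (1⁺ ∷ p)      m q = begin
      F p * (a 1 * G ((2+⁺ m) ∷ q)) + cross (shift a) F G p ((2+⁺ m) ∷ q)
        ≈⟨ +-congˡ (cross-2+ (shift a) F G p m q) ⟩
      F p * (a 1 * G ((2+⁺ m) ∷ q)) + D (shift (shift a) ▷ F) p * G ((2+⁺ m) ∷ q)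
        ≈⟨ solve 4 (λ f a g d → f :* (a :* g) :+ d :* g := (a :* f :+ d) :* g) refl _ _ _ _ ⟩
      (a 1 * F p + D (shift (shift a) ▷ F) p) * G ((2+⁺ m) ∷ q)
        ≈⟨ *-congʳ (sym (▷-D (shift a) F p)) ⟩
      (shift a ▷ F) p * G ((2+⁺ m) ∷ q) ∎
    cross-2+ a F G ((2+⁺ _) ∷ p) m q = sym (zeroˡ _)

    cross-[] : ∀ a F G p → cross a F G p [] ≈ D (shift a ▷ F) p * G []
    cross-[] a F G []            = sym (zeroˡ _)
    cross-[] a F G (1⁺ ∷ p)      = begin
      F p * (a 1 * G []) + cross (shift a) F G p []
        ≈⟨ +-congˡ (cross-[] (shift a) F G p) ⟩
      F p * (a 1 * G []) + D (shift (shift a) ▷ F) p * G []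
        ≈⟨ solve 4 (λ f a g d → f :* (a :* g) :+ d :* g := (a :* f :+ d) :* g) refl _ _ _ _ ⟩
      (a 1 * F p + D (shift (shift a) ▷ F) p) * G []
        ≈⟨ *-congʳ (sym (▷-D (shift a) F p)) ⟩
      (shift a ▷ F) p * G [] ∎
    cross-[] a F G ((2+⁺ _) ∷ p) = sym (zeroˡ _)

    pair-▷-cross : ∀ a F G p q → pair (a ▷ F) G p q ≈ pair F (a ▷ G) p q + cross a F G p q
    pair-▷-cross a F G p [] = begin
      (a ▷ F) p * G []                               ≈⟨ *-congʳ (▷-D a F p) ⟩
      (a 0 * F p + D (shift a ▷ F) p) * G []         ≈⟨ solve 4 (λ a f d g → (a :* f :+ d) :* g := f :* (a :* g) :+ d :* g) refl _ _ _ _ ⟩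
      F p * (a 0 * G []) + D (shift a ▷ F) p * G []  ≈⟨ +-congˡ (sym (cross-[] a F G p)) ⟩
      F p * (a 0 * G []) + cross a F G p []          ∎
    pair-▷-cross a F G p (1⁺ ∷ q) = begin
      (a ▷ F) p * g + pair (a ▷ F) G (1⁺ ∷ p) q
        ≈⟨ +-cong (*-congʳ (▷-D a F p)) (pair-▷-cross a F G (1⁺ ∷ p) q) ⟩
      (a 0 * F p + D (shift a ▷ F) p) * g + (pair F (a ▷ G) (1⁺ ∷ p) q + (F p * (shift a ▷ G) q + cross (shift a) F G p q))
        ≈⟨ solve 7 (λ a f d g r s c → (a :* f :+ d) :* g :+ (r :+ (f :* s :+ c)) := (f :* (a :* g :+ s) :+ r) :+ (d :* g :+ c)) refl _ _ _ _ _ _ _ ⟩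
      (F p * (a 0 * g + (shift a ▷ G) q) + pair F (a ▷ G) (1⁺ ∷ p) q) + (D (shift a ▷ F) p * g + cross (shift a) F G p q)
        ≈⟨ +-congˡ (sym (cross-1 a F G p q)) ⟩
      (F p * (a 0 * g + (shift a ▷ G) q) + pair F (a ▷ G) (1⁺ ∷ p) q) + cross a F G p (1⁺ ∷ q) ∎
      where g = G (1⁺ ∷ q)
    pair-▷-cross a F G p ((2+⁺ m) ∷ q) = begin
      (a ▷ F) p * g + pair (a ▷ F) G ((2+⁺ m) ∷ p) q
        ≈⟨ +-cong (*-congʳ (▷-D a F p)) (pair-▷-cross a F G ((2+⁺ m) ∷ p) q) ⟩
      (a 0 * F p + D (shift a ▷ F) p) * g + (pair F (a ▷ G) ((2+⁺ m) ∷ p) q + 0#)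
        ≈⟨ +-congˡ (+-identityʳ _) ⟩
      (a 0 * F p + D (shift a ▷ F) p) * g + pair F (a ▷ G) ((2+⁺ m) ∷ p) q
        ≈⟨ solve 5 (λ a f d g r → (a :* f :+ d) :* g :+ r := (f :* (a :* g) :+ r) :+ d :* g) refl _ _ _ _ _ ⟩
      (F p * (a 0 * g) + pair F (a ▷ G) ((2+⁺ m) ∷ p) q) + D (shift a ▷ F) p * g
        ≈⟨ +-congˡ (sym (cross-2+ a F G p m q)) ⟩
      (F p * (a 0 * g) + pair F (a ▷ G) ((2+⁺ m) ∷ p) q) + cross a F G p ((2+⁺ m) ∷ q) ∎
      where g = G ((2+⁺ m) ∷ q)

  -- For an empty left part no block can begin before the boundary.
  pair-▷ : ∀ a F G q → pair (a ▷ F) G [] q ≈ pair F (a ▷ G) [] q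
  pair-▷ a F G q = trans (pair-▷-cross a F G [] q) (+-identityʳ _)

  star : (Index → Carrier) → Index → Carrier
  star f p = ⅀ (squares p) f

  squaresFrom-D : ∀ f m p → ⅀ (squaresFrom (2+⁺ m) p) (D f) ≈ 0#
  squaresFrom-D f m []            = +-identityʳ _
  squaresFrom-D f m (k@(1+ n) ∷ p) = trans (⅀-++ (map ((2+⁺ m) ∷_) (squaresFrom k p)) _ (D f))
    (trans (+-cong (trans (⅀-map ((2+⁺ m) ∷_) (squaresFrom k p) (D f)) (⅀-0 (squaresFrom k p) (λ _ → refl)))
                   (squaresFrom-D f (m ℕ.+ suc n) p))
      (+-identityʳ _))

  -- A square of p begins with 1 only if p does and the first □ is a comma; a plus makes the first
  -- entry at least 2.
  star-D : ∀ f p → star (D f) p ≈ D (star f) p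
  star-D f []                  = +-identityʳ _
  star-D f (1⁺ ∷ [])           = refl
  star-D f (1⁺ ∷ k@(1+ n) ∷ p) = trans (⅀-++ (map (1⁺ ∷_) (squaresFrom k p)) _ (D f))
    (trans (+-cong (⅀-map (1⁺ ∷_) (squaresFrom k p) (D f)) (squaresFrom-D f n p)) (+-identityʳ _))
  star-D f ((2+⁺ m) ∷ p)       = squaresFrom-D f m p

  star-▷ : ∀ a f p → star (a ▷ f) p ≈ (a ▷ star f) p
  star-▷ a f p = begin
    star (a ▷ f) p                                   ≈⟨ ⅀-cong (squares p) (▷-D a f) ⟩
    star (λ w → a 0 * f w + D (shift a ▷ f) w) p     ≈⟨ ⅀-+ (squares p) _ _ ⟩
    star (λ w → a 0 * f w) p + star (D (shift a ▷ f)) p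
      ≈⟨ +-cong (⅀-*ˡ (squares p) (a 0) f) (trans (star-D (shift a ▷ f) p) (below p)) ⟩
    a 0 * star f p + D (shift a ▷ star f) p          ≈⟨ sym (▷-D a (star f) p) ⟩
    (a ▷ star f) p ∎
    where
    below : ∀ p → D (star (shift a ▷ f)) p ≈ D (shift a ▷ star f) p
    below []            = refl
    below (1⁺ ∷ p)      = star-▷ (shift a) f p
    below ((2+⁺ _) ∷ p) = refl

  -- D is a derivation because a term of u ∗ v begins with 1 only if this is the first entry of u or
  -- of v: merged entries are at least 2.
  ∗-D : ∀ f u v → ⅀ (u ∗ʳ v) (D f) ≈ D (λ u′ → ⅀ (u′ ∗ʳ v) f) u + D (λ v′ → ⅀ (u ∗ʳ v′) f) v
  ∗-D f []              []              = refl
  ∗-D f []              (1⁺ ∷ v)        = sym (+-identityˡ _)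
  ∗-D f []              ((2+⁺ _) ∷ v)   = refl
  ∗-D f (1⁺ ∷ u)        []              = +-congʳ (trans (sym (+-identityʳ _)) (≡⇒≈ (≡.cong (λ l → ⅀ l f) (≡.sym (lem u)))))
    where
    lem : ∀ u → u ∗ʳ [] ≡ u ∷ []
    lem []      = ≡.refl
    lem (_ ∷ _) = ≡.refl
  ∗-D f ((2+⁺ _) ∷ u)   []              = refl
  ∗-D f (k@(1+ m) ∷ u)  (l@(1+ n) ∷ v)  = begin
    ⅀ (map (k ∷_) U ++ map (l ∷_) V ++ map ((k ⊕ l) ∷_) UV) (D f)
      ≈⟨ trans (⅀-++ (map (k ∷_) U) _ (D f)) (+-congˡ (⅀-++ (map (l ∷_) V) _ (D f))) ⟩
    ⅀ (map (k ∷_) U) (D f) + (⅀ (map (l ∷_) V) (D f) + ⅀ (map ((k ⊕ l) ∷_) UV) (D f))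
      ≈⟨ +-cong (⅀-map (k ∷_) U (D f)) (+-cong (⅀-map (l ∷_) V (D f)) (trans (⅀-map ((k ⊕ l) ∷_) UV (D f)) (⅀-0 UV merged))) ⟩
    ⅀ U (D f ∘ (k ∷_)) + (⅀ V (D f ∘ (l ∷_)) + 0#)
      ≈⟨ +-cong (first k) (trans (+-identityʳ _) (second l)) ⟩
    D (λ u′ → ⅀ (u′ ∗ʳ (l ∷ v)) f) (k ∷ u) + D (λ v′ → ⅀ ((k ∷ u) ∗ʳ v′) f) (l ∷ v) ∎
    where
    U = u ∗ʳ (l ∷ v)
    V = (k ∷ u) ∗ʳ v
    UV = u ∗ʳ v
    merged : ∀ w → D f ((k ⊕ l) ∷ w) ≈ 0#
    merged w rewrite ℕ.+-suc m n = refl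
    first : ∀ k′ → ⅀ U (D f ∘ (k′ ∷_)) ≈ D (λ u′ → ⅀ (u′ ∗ʳ (l ∷ v)) f) (k′ ∷ u)
    first 1⁺      = refl
    first (2+⁺ _) = ⅀-0 U (λ _ → refl)
    second : ∀ l′ → ⅀ V (D f ∘ (l′ ∷_)) ≈ D (λ v′ → ⅀ ((k ∷ u) ∗ʳ v′) f) (l′ ∷ v)
    second 1⁺      = refl
    second (2+⁺ _) = ⅀-0 V (λ _ → refl)

  eval : (Index → Carrier) → Lin Index → Carrier
  eval f l = ⅀ l λ (q , w) → φ₀ q * f w

  φ-sg : ∀ n → φ₀ (sgℚ n) ≈ sg n
  φ-sg zero    = 1-homo
  φ-sg (suc n) = trans (-‿homo (sgℚ n)) (-‿cong (φ-sg n))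

  private
    B : (Index → Carrier) → ℕ → Index → Carrier
    B f i k = star (λ h → ⅀ (h ∗ʳ k) f) (ones i)

    eval-regTerm : ∀ f i k → eval f (regTerm i k) ≈ sg i * B f i k
    eval-regTerm f i k = trans (⅀-map (sgℚ i ,_) (concatMap (_∗ʳ k) (squares (ones i))) _)
      (trans (⅀-*ˡ (concatMap (_∗ʳ k) (squares (ones i))) (φ₀ (sgℚ i)) f)
        (*-cong (φ-sg i) (⅀-concatMap (_∗ʳ k) (squares (ones i)) f)))

    before : (Index → Carrier) → ℕ → Index → Carrier
    before f zero    k = 0#
    before f (suc i) k = B f i k

    B-D : ∀ f i k → B (D f) i k ≈ before f i k + D (B f i) k
    B-D f i k = trans (⅀-cong (squares (ones i)) (λ h → ∗-D f h k))
      (trans (⅀-+ (squares (ones i)) _ _)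
        (+-cong (trans (star-D (λ h → ⅀ (h ∗ʳ k) f) (ones i)) (fst i)) (snd k)))
      where
      fst : ∀ i → D (star (λ h → ⅀ (h ∗ʳ k) f)) (ones i) ≈ before f i k
      fst zero    = refl
      fst (suc i) = refl
      snd : ∀ k → star (λ h → D (λ v → ⅀ (h ∗ʳ v) f) k) (ones i) ≈ D (B f i) k
      snd []            = ⅀-0 (squares (ones i)) (λ _ → refl)
      snd (1⁺ ∷ k)      = refl
      snd ((2+⁺ _) ∷ k) = ⅀-0 (squares (ones i)) (λ _ → refl)

    -- Removing a leading 1 is a derivation for ∗ and turns S(1^i) into S(1^{i-1}). For k = 1 k′ it
    -- maps S(1^i) ∗ k to S(1^{i-1}) ∗ k + S(1^i) ∗ k′, and under alternating signs the second part
    -- cancels against the next term of `reg`.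
    reg-D-from : ∀ f i k → eval (D f) (reg i k) ≈ sg i * before f i k
    reg-D-from f i []            = trans (eval-regTerm (D f) i []) (*-congˡ (trans (B-D f i []) (+-identityʳ _)))
    reg-D-from f i (1⁺ ∷ k)      = begin
      eval (D f) (regTerm i (1⁺ ∷ k) ++ reg (suc i) k)
        ≈⟨ ⅀-++ (regTerm i (1⁺ ∷ k)) (reg (suc i) k) _ ⟩
      eval (D f) (regTerm i (1⁺ ∷ k)) + eval (D f) (reg (suc i) k)
        ≈⟨ +-cong (trans (eval-regTerm (D f) i (1⁺ ∷ k)) (*-congˡ (B-D f i (1⁺ ∷ k)))) (reg-D-from f (suc i) k) ⟩
      sg i * (before f i (1⁺ ∷ k) + B f i k) + - sg i * B f i k
        ≈⟨ solve 3 (λ s b c → s :* (b :+ c) :+ (:- s) :* c := s :* b) refl (sg i) (before f i (1⁺ ∷ k)) (B f i k) ⟩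
      sg i * before f i (1⁺ ∷ k) ∎
    reg-D-from f i ((2+⁺ m) ∷ k) = trans (eval-regTerm (D f) i ((2+⁺ m) ∷ k)) (*-congˡ (trans (B-D f i ((2+⁺ m) ∷ k)) (+-identityʳ _)))

  reg-D : ∀ f k → eval (D f) (reg 0 k) ≈ 0#
  reg-D f k = trans (reg-D-from f 0 k) (zeroʳ _)

  admPart : (Index → Carrier) → Index → Carrier
  admPart f []            = f []
  admPart f (1⁺ ∷ p)      = 0#
  admPart f ((2+⁺ m) ∷ p) = f ((2+⁺ m) ∷ p)

  eval-cong : ∀ {f g} → (∀ p → f p ≈ g p) → ∀ l → eval f l ≈ eval g l
  eval-cong e l = ⅀-cong l (λ (q , w) → *-congˡ (e w))

  -- reg 0 k is killed by D, hence it is a combination of admissible words.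
  reg-admPart : ∀ f k → eval f (reg 0 k) ≈ eval (admPart f) (reg 0 k)
  reg-admPart f k = begin
    eval f (reg 0 k)                                                    ≈⟨ eval-cong split (reg 0 k) ⟩
    eval (λ p → admPart f p + D (λ w → f (1⁺ ∷ w)) p) (reg 0 k)         ≈⟨ ⅀-cong (reg 0 k) (λ _ → distribˡ _ _ _) ⟩
    ⅀ (reg 0 k) (λ (q , w) → φ₀ q * admPart f w + φ₀ q * D (λ w → f (1⁺ ∷ w)) w)  ≈⟨ ⅀-+ (reg 0 k) _ _ ⟩
    eval (admPart f) (reg 0 k) + eval (D (λ w → f (1⁺ ∷ w))) (reg 0 k)  ≈⟨ +-congˡ (reg-D _ k) ⟩
    eval (admPart f) (reg 0 k) + 0#                                     ≈⟨ +-identityʳ _ ⟩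
    eval (admPart f) (reg 0 k) ∎
    where
    split : ∀ p → f p ≈ admPart f p + D (λ w → f (1⁺ ∷ w)) p
    split []            = sym (+-identityʳ _)
    split (1⁺ ∷ p)      = sym (+-identityˡ _)
    split ((2+⁺ _) ∷ p) = sym (+-identityʳ _)

  ∷-nonempty : ∀ {f g : Index → Carrier} a p → (∀ h t → f (h ∷ t) ≈ g (h ∷ t)) → ⅀ (squaresFrom a p) f ≈ ⅀ (squaresFrom a p) g
  ∷-nonempty a []      e = +-congʳ (e a [])
  ∷-nonempty a (l ∷ p) e = trans (⅀-++ (map (a ∷_) (squaresFrom l p)) _ _)
    (trans (+-cong (trans (⅀-map (a ∷_) (squaresFrom l p) _)
                     (trans (⅀-cong (squaresFrom l p) (e a)) (sym (⅀-map (a ∷_) (squaresFrom l p) _))))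
                   (∷-nonempty (a ⊕ l) p e))
      (sym (⅀-++ (map (a ∷_) (squaresFrom l p)) _ _)))

  private
    -- The part of (h ∷ t) ∗ q in which h comes first and unmerged.
    headY : (Index → Carrier) → Index → Index → Carrier
    headY f q []      = 0#
    headY f q (h ∷ t) = ⅀ (t ∗ʳ q) (λ w → f (h ∷ w))

    S∗ : (Index → Carrier) → Index → Index → Carrier
    S∗ f p q = star (λ s → ⅀ (s ∗ʳ q) f) p

    Y : (Index → Carrier) → ℕ⁺ → Index → Index → Carrier
    Y f b p q = ⅀ (squaresFrom b p) (headY f q)

    -- The squares of (b, a, p) arise from those of (a, p) by putting b in front or by adding it to
    -- the head. Hence the terms which begin with b or with h ⊕ b are those of `Y f b (a ∷ p) q`.
    -- Every product thus splits into a part shared with the preceding cut and a part shared with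
    -- the following one, and `altS` telescopes.
    S∗-Y : ∀ f a p b q → S∗ f (a ∷ p) (b ∷ q) ≈ Y f a p (b ∷ q) + Y f b (a ∷ p) q
    S∗-Y f a p b q = begin
      ⅀ S (λ s → ⅀ (s ∗ʳ (b ∷ q)) f)
        ≈⟨ ∷-nonempty a p step ⟩
      ⅀ S (λ s → headY f (b ∷ q) s + (⅀ (s ∗ʳ q) (λ w → f (b ∷ w)) + headY f q (mergeHead b s)))
        ≈⟨ trans (⅀-+ S _ _) (+-congˡ (⅀-+ S _ _)) ⟩
      Y f a p (b ∷ q) + (⅀ S (λ s → ⅀ (s ∗ʳ q) (λ w → f (b ∷ w))) + ⅀ S (headY f q ∘ mergeHead b))
        ≈⟨ +-congˡ (+-cong (sym (⅀-map (b ∷_) S (headY f q))) (sym (trans (≡⇒≈ (≡.cong (λ l → ⅀ l (headY f q)) (squaresFrom-⊕ b a p))) (⅀-map (mergeHead b) S (headY f q))))) ⟩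
      Y f a p (b ∷ q) + (⅀ (map (b ∷_) S) (headY f q) + ⅀ (squaresFrom (b ⊕ a) p) (headY f q))
        ≈⟨ +-congˡ (sym (⅀-++ (map (b ∷_) S) _ _)) ⟩
      Y f a p (b ∷ q) + Y f b (a ∷ p) q ∎
      where
      S = squaresFrom a p
      step : ∀ h t → ⅀ ((h ∷ t) ∗ʳ (b ∷ q)) f ≈
             headY f (b ∷ q) (h ∷ t) + (⅀ ((h ∷ t) ∗ʳ q) (λ w → f (b ∷ w)) + headY f q (mergeHead b (h ∷ t)))
      step h t = trans (⅀-++ (map (h ∷_) (t ∗ʳ (b ∷ q))) _ f)
        (+-cong (⅀-map (h ∷_) (t ∗ʳ (b ∷ q)) f)
          (trans (⅀-++ (map (b ∷_) ((h ∷ t) ∗ʳ q)) _ f)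
            (+-cong (⅀-map (b ∷_) ((h ∷ t) ∗ʳ q) f) (⅀-map ((h ⊕ b) ∷_) (t ∗ʳ q) f))))

    S∗-[] : ∀ f a p → S∗ f (a ∷ p) [] ≈ Y f a p []
    S∗-[] f a p = ∷-nonempty a p step
      where
      step : ∀ h t → ⅀ ((h ∷ t) ∗ʳ []) f ≈ headY f [] (h ∷ t)
      step h []      = refl
      step h (_ ∷ _) = refl

    altS : (Index → Carrier) → Index → Index → Carrier
    altS f p []      = S∗ f p []
    altS f p (k ∷ q) = sg (length (k ∷ q)) * S∗ f p (k ∷ q) + altS f (k ∷ p) q

    altS-Y : ∀ f a p q → altS f (a ∷ p) q ≈ sg (length q) * Y f a p q
    altS-Y f a p []      = trans (S∗-[] f a p) (sym (*-identityˡ _))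
    altS-Y f a p (b ∷ q) = trans (+-cong (*-congˡ (S∗-Y f a p b q)) (altS-Y f b (a ∷ p) q))
      (solve 3 (λ s x y → (:- s) :* (x :+ y) :+ s :* y := (:- s) :* x) refl _ _ _)

    altS-0 : ∀ f b q → altS f [] (b ∷ q) ≈ 0#
    altS-0 f b q = begin
      - sg (length q) * S∗ f [] (b ∷ q) + altS f (b ∷ []) q  ≈⟨ +-cong (*-congˡ (trans (+-identityʳ _) (+-identityʳ _))) (altS-Y f b [] q) ⟩
      - sg (length q) * f (b ∷ q) + sg (length q) * (headY f q (b ∷ []) + 0#)
        ≈⟨ +-congˡ (*-congˡ (trans (+-identityʳ _) (+-identityʳ _))) ⟩
      - sg (length q) * f (b ∷ q) + sg (length q) * f (b ∷ q)  ≈⟨ sym (distribʳ _ _ _) ⟩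
      (- sg (length q) + sg (length q)) * f (b ∷ q)            ≈⟨ trans (*-congʳ (-‿inverseˡ _)) (zeroˡ _) ⟩
      0# ∎

  module Character (χ : Index → Carrier) (χ-[] : χ [] ≈ 1#) (χ-∗ : ∀ u v → χ u * χ v ≈ ⅀ (u ∗ʳ v) χ) where

    χ± : Index → Carrier
    χ± q = sg (length q) * χ q

    star-* : ∀ p q → star χ p * χ q ≈ star (λ s → ⅀ (s ∗ʳ q) χ) p
    star-* p q = trans (sym (⅀-*ʳ (squares p) (χ q) χ)) (⅀-cong (squares p) (λ s → χ-∗ s q))

    private
      pair-altS : ∀ p q → pair (star χ) χ± p q ≈ altS χ p q
      pair-altS p []      = trans (*-congˡ (*-identityˡ _)) (star-* p [])
      pair-altS p (k ∷ q) = +-cong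
        (trans (solve 3 (λ s x y → x :* (s :* y) := s :* (x :* y)) refl (sg (length (k ∷ q))) (star χ p) (χ (k ∷ q))) (*-congˡ (star-* p (k ∷ q))))
        (pair-altS (k ∷ p) q)

    -- The antipode relation of the quasi-shuffle Hopf algebra: up to the sign given by the length,
    -- S of the reversed index is the antipode.
    antipode : ∀ k q → pair (star χ) χ± [] (k ∷ q) ≈ 0#
    antipode k q = trans (pair-altS [] (k ∷ q)) (altS-0 χ k q)

    antipode-[] : pair (star χ) χ± [] [] ≈ 1#
    antipode-[] = trans (*-cong (trans (+-identityʳ _) χ-[]) (trans (*-identityˡ _) χ-[])) (*-identityˡ _)

    E A : Series
    E m = χ (ones m)
    A m = sg m * star χ (ones m)

    private
      pair-⊛ : ∀ i m → pair (star χ) χ± (ones i) (ones m) ≈ ((λ j → star χ (ones (i ℕ.+ j))) ⊛ tw E) m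
      pair-⊛ i zero rewrite ℕ.+-identityʳ i = refl
      pair-⊛ i (suc m) = +-cong
        (*-cong (≡⇒≈ (≡.cong (λ n → star χ (ones n)) (≡.sym (ℕ.+-identityʳ i)))) (*-congʳ (≡⇒≈ (≡.cong sg (length-ones (suc m))))))
        (trans (pair-⊛ (suc i) m) (⊛-cong (λ j → ≡⇒≈ (≡.cong (λ n → star χ (ones n)) (≡.sym (ℕ.+-suc i j)))) (λ _ → refl) m))
        where
        length-ones : ∀ m → length (ones m) ≡ m
        length-ones zero    = ≡.refl
        length-ones (suc m) = ≡.cong suc (length-ones m)

    -- The antipode relation at 1^n says that ∑ S(1^m) u^m is inverse to E(-u); here u is replaced
    -- by -u.
    A⊛E : ∀ n → (A ⊛ E) n ≈ δ₀ n
    A⊛E n = begin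
      (A ⊛ E) n                             ≈⟨ ⊛-cong (λ _ → refl) (λ m → sym (tw-tw E m)) n ⟩
      (tw (star χ ∘ ones) ⊛ tw (tw E)) n    ≈⟨ sym (tw-⊛ (star χ ∘ ones) (tw E) n) ⟩
      tw ((star χ ∘ ones) ⊛ tw E) n         ≈⟨ *-congˡ (trans (sym (pair-⊛ 0 n)) (pair-δ n)) ⟩
      tw δ₀ n                               ≈⟨ tw-δ₀ n ⟩
      δ₀ n                                  ∎
      where
      pair-δ : ∀ n → pair (star χ) χ± [] (ones n) ≈ δ₀ n
      pair-δ zero    = antipode-[]
      pair-δ (suc n) = antipode 1⁺ (ones n)

    private
      eval-reg-from : ∀ i k → eval χ (reg i k) ≈ ((λ j → A (i ℕ.+ j)) ▷ χ) k
      B-χ : ∀ i k → eval χ (regTerm i k) ≈ A i * χ k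
      B-χ i k = trans (eval-regTerm χ i k) (trans (*-congˡ (sym (star-* (ones i) k))) (sym (*-assoc _ _ _)))
      A-+0 : ∀ i k → A i * χ k ≈ A (i ℕ.+ 0) * χ k
      A-+0 i k = *-congʳ (≡⇒≈ (≡.cong A (≡.sym (ℕ.+-identityʳ i))))
      eval-reg-from i []            = trans (B-χ i []) (A-+0 i [])
      eval-reg-from i (1⁺ ∷ k)      = trans (⅀-++ (regTerm i (1⁺ ∷ k)) _ _)
        (+-cong (trans (B-χ i (1⁺ ∷ k)) (A-+0 i (1⁺ ∷ k)))
          (trans (eval-reg-from (suc i) k) (▷-cong (λ j → ≡⇒≈ (≡.cong A (≡.sym (ℕ.+-suc i j)))) (λ _ → refl) k)))
      eval-reg-from i ((2+⁺ m) ∷ k) = trans (B-χ i ((2+⁺ m) ∷ k)) (A-+0 i ((2+⁺ m) ∷ k))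

    -- The combination `reg 0 k` does not depend on χ, so that one and the same serves all η_N and
    -- the regularized values.
    A▷χ : ∀ k → (A ▷ χ) k ≈ eval (admPart χ) (reg 0 k)
    A▷χ k = trans (sym (eval-reg-from 0 k)) (reg-admPart χ k)

-- Polylogarithms

zsʳ : Index → Word
zsʳ []            = []
zsʳ ((1+ m) ∷ l)  = replicate m 𝕩 ++ 𝕪 ∷ zsʳ l

-- The reversed words of 𝔥¹. Their polylogarithms are power series, whereas x alone would require a
-- logarithm; `θc` fails for it at n = 0.
data H : Word → Set where
  nil  : H []
  ends : ∀ {w} → EndsY w → H w

H-tail : ∀ {a w} → H (a ∷ w) → H w
H-tail (ends here)      = nil
H-tail (ends (there e)) = ends e

reverse-z : ∀ m → reverse (z (1+ m)) ≡ replicate m 𝕩 ++ 𝕪 ∷ []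
reverse-z m = ≡.trans (List.unfold-reverse 𝕪 (replicate m 𝕩)) (≡.cong (_++ 𝕪 ∷ []) (rev m))
  where
  append : ∀ m → replicate m 𝕩 ++ 𝕩 ∷ [] ≡ 𝕩 ∷ replicate m 𝕩
  append zero    = ≡.refl
  append (suc m) = ≡.cong (𝕩 ∷_) (append m)
  rev : ∀ m → reverse (replicate m 𝕩) ≡ replicate m 𝕩
  rev zero    = ≡.refl
  rev (suc m) = ≡.trans (List.unfold-reverse 𝕩 (replicate m 𝕩)) (≡.trans (≡.cong (_++ 𝕩 ∷ []) (rev m)) (append m))

reverse-zs : ∀ l → reverse (zs (reverse l)) ≡ zsʳ l
reverse-zs []           = ≡.refl
reverse-zs (k@(1+ m) ∷ l) = begin
  reverse (zs (reverse (k ∷ l)))             ≡⟨ ≡.cong (reverse ∘ zs) (List.unfold-reverse k l) ⟩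
  reverse (zs (reverse l ++ k ∷ []))         ≡⟨ ≡.cong reverse (≡.trans (List.concatMap-++ z (reverse l) (k ∷ [])) (≡.cong (zs (reverse l) ++_) (List.++-identityʳ (z k)))) ⟩
  reverse (zs (reverse l) ++ z k)       ≡⟨ List.reverse-++ (zs (reverse l)) (z k) ⟩
  reverse (z k) ++ reverse (zs (reverse l)) ≡⟨ ≡.cong₂ _++_ (reverse-z m) (reverse-zs l) ⟩
  (replicate m 𝕩 ++ 𝕪 ∷ []) ++ zsʳ l         ≡⟨ List.++-assoc (replicate m 𝕩) (𝕪 ∷ []) (zsʳ l) ⟩
  zsʳ (k ∷ l) ∎
  where open ≡.≡-Reasoning

zsʳ-ones : ∀ n → zsʳ (ones n) ≡ replicate n 𝕪
zsʳ-ones zero    = ≡.refl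
zsʳ-ones (suc n) = ≡.cong (𝕪 ∷_) (zsʳ-ones n)

zsʳ-endsY : ∀ k l → EndsY (zsʳ (k ∷ l))
zsʳ-endsY (1+ suc m) l       = there (zsʳ-endsY (1+ m) l)
zsʳ-endsY 1⁺         []      = here
zsʳ-endsY 1⁺         (k ∷ l) = there (zsʳ-endsY k l)

zsʳ-shape : ∀ l → (∃[ n ] zsʳ l ≡ replicate n 𝕪) ⊎ (∃[ n ] ∃[ v ] EndsY v × zsʳ l ≡ replicate n 𝕪 ++ 𝕩 ∷ v)
zsʳ-shape []             = inj₁ (0 , ≡.refl)
zsʳ-shape ((2+⁺ m) ∷ l)  = inj₂ (0 , zsʳ ((1+ m) ∷ l) , zsʳ-endsY (1+ m) l , ≡.refl)
zsʳ-shape (1⁺ ∷ l) with zsʳ-shape l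
... | inj₁ (n , e)         = inj₁ (suc n , ≡.cong (𝕪 ∷_) e)
... | inj₂ (n , v , h , e) = inj₂ (suc n , v , h , ≡.cong (𝕪 ∷_) e)

endsY-ones : ∀ n → EndsY (replicate (suc n) 𝕪)
endsY-ones zero    = here
endsY-ones (suc n) = there (endsY-ones n)

admissible-reverse : ∀ m l → Admissible (reverse ((2+⁺ m) ∷ l))
admissible-reverse m l = ≡.subst Admissible (≡.sym (List.unfold-reverse (2+⁺ m) l)) (snoc (reverse l) (ℕ.s≤s (ℕ.s≤s ℕ.z≤n)))

module Polylog (R : CommutativeRing 0ℓ 0ℓ)
               (φ : CommutativeRing.rawRing ℚ.+-*-commutativeRing -Raw-AlmostCommutative⟶ fromCommutativeRing R)
               (int u : ℕ → CommutativeRing.Carrier R)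
               (int-0 : CommutativeRing._≈_ R (int 0) (CommutativeRing.0# R))
               (int-suc : ∀ n → CommutativeRing._≈_ R (int (suc n)) (CommutativeRing._+_ R (CommutativeRing.1# R) (int n)))
               (int*u : ∀ n → CommutativeRing._≈_ R (CommutativeRing._*_ R (int (suc n)) (u n)) (CommutativeRing.1# R))
               where
  open Over R φ
  open ≈-Reasoning

  pre : Series → Series
  pre f zero    = f 0
  pre f (suc n) = pre f n + f (suc n)

  -- The coefficients of the polylogarithm of a reversed word.
  c : Word → Series
  c []      zero    = 1#
  c []      (suc n) = 0#
  c (_ ∷ _) zero    = 0#
  c (𝕩 ∷ w) (suc n) = u n * c w (suc n)
  c (𝕪 ∷ w) (suc n) = u n * pre (c w) n

  K1 : Series
  K1 _ = 1#

  pre-⊛ : ∀ f n → (K1 ⊛ f) n ≈ pre f n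
  pre-⊛ f zero    = *-identityˡ _
  pre-⊛ f (suc n) = trans (+-cong (*-identityˡ _) (pre-⊛ f n)) (+-comm _ _)

  θ : Series → Series
  θ f n = int n * f n

  θ-⊛ : ∀ f g n → θ (f ⊛ g) n ≈ (θ f ⊛ g) n + (f ⊛ θ g) n
  θ-⊛ f g zero = begin
    int 0 * (f 0 * g 0)                        ≈⟨ trans (*-congʳ int-0) (zeroˡ _) ⟩
    0#                                         ≈⟨ sym (trans (+-cong (trans (*-congʳ int0*) (zeroˡ _)) (trans (*-congˡ int0*) (zeroʳ _))) (+-identityˡ _)) ⟩
    int 0 * f 0 * g 0 + f 0 * (int 0 * g 0) ∎
    where
    int0* : ∀ {x} → int 0 * x ≈ 0#
    int0* = trans (*-congʳ int-0) (zeroˡ _)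
  θ-⊛ f g (suc n) = begin
    i′ * (f 0 * g (suc n) + (shift f ⊛ g) n)
      ≈⟨ trans (distribˡ _ _ _) (+-congˡ (trans (*-congʳ (int-suc n)) (trans (distribʳ _ _ _) (trans (+-congʳ (*-identityˡ _)) (+-comm _ _))))) ⟩
    i′ * (f 0 * g (suc n)) + (θ (shift f ⊛ g) n + (shift f ⊛ g) n)
      ≈⟨ +-congˡ (+-congʳ (θ-⊛ (shift f) g n)) ⟩
    i′ * (f 0 * g (suc n)) + ((θ (shift f) ⊛ g) n + (shift f ⊛ θ g) n + (shift f ⊛ g) n)
      ≈⟨ solve 6 (λ i x y a b c → i :* (x :* y) :+ (a :+ b :+ c) := (a :+ c) :+ (x :* (i :* y) :+ b)) refl i′ (f 0) (g (suc n)) _ _ _ ⟩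
    ((θ (shift f) ⊛ g) n + (shift f ⊛ g) n) + (f ⊛ θ g) (suc n)
      ≈⟨ +-congʳ (sym (⊛-+ˡ (θ (shift f)) (shift f) g n)) ⟩
    ((λ m → θ (shift f) m + shift f m) ⊛ g) n + (f ⊛ θ g) (suc n)
      ≈⟨ +-congʳ (⊛-cong (λ m → trans (+-comm _ _) (trans (+-congʳ (sym (*-identityˡ _))) (trans (sym (distribʳ _ _ _)) (*-congʳ (sym (int-suc m)))))) (λ _ → refl) n) ⟩
    (shift (θ f) ⊛ g) n + (f ⊛ θ g) (suc n)
      ≈⟨ +-congʳ (sym (trans (+-congʳ (trans (*-congʳ (trans (*-congʳ int-0) (zeroˡ _))) (zeroˡ _))) (+-identityˡ _))) ⟩
    (θ f ⊛ g) (suc n) + (f ⊛ θ g) (suc n) ∎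
    where i′ = int (suc n)

  -- The differential forms dz/z and dz/(1-z): z d/dz maps Li of x w to Li of w, and Li of y w to
  -- z/(1-z) times Li of w.
  peel : Letter → Series → Series
  peel 𝕩 f n       = f n
  peel 𝕪 f zero    = 0#
  peel 𝕪 f (suc n) = pre f n

  private
    J : Letter → Series
    J 𝕩 = δ₀
    J 𝕪 = X· K1

  peel-⊛ : ∀ a f n → peel a f n ≈ (J a ⊛ f) n
  peel-⊛ 𝕩 f n       = sym (⊛-identityˡ f n)
  peel-⊛ 𝕪 f zero    = sym (zeroˡ _)
  peel-⊛ 𝕪 f (suc n) = sym (trans (+-cong (zeroˡ _) (pre-⊛ f n)) (+-identityˡ _))

  peel-cong : ∀ a {f g} → (∀ n → f n ≈ g n) → ∀ n → peel a f n ≈ peel a g n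
  peel-cong a {f} {g} e n = trans (peel-⊛ a f n) (trans (⊛-cong (λ _ → refl) e n) (sym (peel-⊛ a g n)))

  ⊛-⅀ : ∀ {A : Set} (a : Series) (l : List A) (f : A → Series) n → (a ⊛ (λ m → ⅀ l (λ x → f x m))) n ≈ ⅀ l (λ x → (a ⊛ f x) n)
  ⊛-⅀ a []      f n = ⊛-0ʳ a n
  ⊛-⅀ a (x ∷ l) f n = trans (⊛-+ʳ a (f x) _ n) (+-congˡ (⊛-⅀ a l f n))

  peel-⅀ : ∀ a {A : Set} (l : List A) (f : A → Series) n → peel a (λ m → ⅀ l (λ x → f x m)) n ≈ ⅀ l (λ x → peel a (f x) n)
  peel-⅀ a l f n = trans (peel-⊛ a _ n) (trans (⊛-⅀ (J a) l f n) (⅀-cong l (λ x → sym (peel-⊛ a (f x) n))))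

  peel-⊛ˡ : ∀ a f g n → (peel a f ⊛ g) n ≈ peel a (f ⊛ g) n
  peel-⊛ˡ a f g n = trans (⊛-cong (peel-⊛ a f) (λ _ → refl) n) (trans (⊛-assoc (J a) f g n) (sym (peel-⊛ a (f ⊛ g) n)))

  peel-⊛ʳ : ∀ a f g n → (f ⊛ peel a g) n ≈ peel a (f ⊛ g) n
  peel-⊛ʳ a f g n = trans (⊛-comm f (peel a g) n) (trans (peel-⊛ˡ a g f n) (peel-cong a (⊛-comm g f) n))

  private
    unit : ∀ n x → int (suc n) * (u n * x) ≈ x
    unit n x = trans (sym (*-assoc _ _ _)) (trans (*-congʳ (int*u n)) (*-identityˡ x))

  θc-suc : ∀ a w n → θ (c (a ∷ w)) (suc n) ≈ peel a (c w) (suc n)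
  θc-suc 𝕩 w n = unit n _
  θc-suc 𝕪 w n = unit n _

  θc : ∀ {a w} → H (a ∷ w) → ∀ n → θ (c (a ∷ w)) n ≈ peel a (c w) n
  θc {a} {w} h (suc n) = θc-suc a w n
  θc {𝕪} h zero = zeroʳ _
  θc {𝕩} {_ ∷ _} h zero = zeroʳ _
  θc {𝕩} {[]} (ends (there ())) zero

  int-cancel : ∀ n {x y} → int (suc n) * x ≈ int (suc n) * y → x ≈ y
  int-cancel n {x} {y} e = trans (sym (lem x)) (trans (*-congˡ e) (lem y))
    where
    lem : ∀ x → u n * (int (suc n) * x) ≈ x
    lem x = trans (solve 3 (λ a b c → a :* (b :* c) := b :* (a :* c)) refl (u n) (int (suc n)) x) (unit n x)

  c-[] : ∀ n → c [] n ≈ δ₀ n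
  c-[] zero    = refl
  c-[] (suc n) = refl

  -- θ = z d/dz is a derivation, and it strips the outermost letter of a polylogarithm.
  c-sh : ∀ {u v} → H u → H v → ∀ n → (c u ⊛ c v) n ≈ ⅀ (u shʳ v) (λ w → c w n)
  c-sh {[]} {v} _ _ n = trans (⊛-cong {b = c v} c-[] (λ _ → refl) n) (trans (⊛-identityˡ (c v) n) (sym (+-identityʳ _)))
  c-sh {a ∷ u} {[]} _ _ n = trans (⊛-cong {c (a ∷ u)} (λ _ → refl) c-[] n) (trans (⊛-identityʳ (c (a ∷ u)) n) (sym (+-identityʳ _)))
  c-sh {a ∷ u} {b ∷ v} hu hv zero = trans (zeroˡ _) (sym (trans (⅀-++ (map (a ∷_) (u shʳ (b ∷ v))) _ _)
    (trans (+-cong (trans (⅀-map (a ∷_) (u shʳ (b ∷ v)) _) (⅀-0 (u shʳ (b ∷ v)) (λ _ → refl)))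
      (trans (⅀-map (b ∷_) ((a ∷ u) shʳ v) _) (⅀-0 ((a ∷ u) shʳ v) (λ _ → refl)))) (+-identityˡ _))))
  c-sh {a ∷ u} {b ∷ v} hu hv (suc n) = int-cancel n (begin
    θ (c (a ∷ u) ⊛ c (b ∷ v)) (suc n)
      ≈⟨ θ-⊛ (c (a ∷ u)) (c (b ∷ v)) (suc n) ⟩
    (θ (c (a ∷ u)) ⊛ c (b ∷ v)) (suc n) + (c (a ∷ u) ⊛ θ (c (b ∷ v))) (suc n)
      ≈⟨ +-cong (⊛-cong {b = c (b ∷ v)} (θc hu) (λ _ → refl) (suc n)) (⊛-cong {c (a ∷ u)} (λ _ → refl) (θc hv) (suc n)) ⟩
    (peel a (c u) ⊛ c (b ∷ v)) (suc n) + (c (a ∷ u) ⊛ peel b (c v)) (suc n)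
      ≈⟨ +-cong (peel-⊛ˡ a (c u) (c (b ∷ v)) (suc n)) (peel-⊛ʳ b (c (a ∷ u)) (c v) (suc n)) ⟩
    peel a (c u ⊛ c (b ∷ v)) (suc n) + peel b (c (a ∷ u) ⊛ c v) (suc n)
      ≈⟨ +-cong (peel-cong a (c-sh (H-tail hu) hv) (suc n)) (peel-cong b (c-sh hu (H-tail hv)) (suc n)) ⟩
    peel a (λ m → ⅀ U (λ w → c w m)) (suc n) + peel b (λ m → ⅀ V (λ w → c w m)) (suc n)
      ≈⟨ +-cong (unpeel a U) (unpeel b V) ⟩
    int (suc n) * ⅀ (map (a ∷_) U) (λ w → c w (suc n)) + int (suc n) * ⅀ (map (b ∷_) V) (λ w → c w (suc n))
      ≈⟨ sym (distribˡ (int (suc n)) _ _) ⟩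
    int (suc n) * (⅀ (map (a ∷_) U) (λ w → c w (suc n)) + ⅀ (map (b ∷_) V) (λ w → c w (suc n)))
      ≈⟨ *-congˡ (sym (⅀-++ (map (a ∷_) U) _ _)) ⟩
    int (suc n) * ⅀ ((a ∷ u) shʳ (b ∷ v)) (λ w → c w (suc n)) ∎)
    where
    U = u shʳ (b ∷ v)
    V = (a ∷ u) shʳ v
    unpeel : ∀ a U → peel a (λ m → ⅀ U (λ w → c w m)) (suc n) ≈ int (suc n) * ⅀ (map (a ∷_) U) (λ w → c w (suc n))
    unpeel a U = trans (peel-⅀ a U c (suc n)) (trans (⅀-cong U (λ w → sym (θc-suc a w n)))
      (trans (⅀-*ˡ U (int (suc n)) _) (*-congˡ (sym (⅀-map (a ∷_) U _)))))

  -- The partial sum up to N is the N-th coefficient after multiplication by 1/(1-z), and this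
  -- factor can be absorbed by one of the two polylogarithms.
  pre-sh : ∀ {u v} → H u → H v → ∀ N → ⅀ (u shʳ v) (λ w → pre (c w) N) ≈ (c v ⊛ pre (c u)) N
  pre-sh {u} {v} hu hv N = begin
    ⅀ (u shʳ v) (λ w → pre (c w) N)             ≈⟨ ⅀-cong (u shʳ v) (λ w → sym (pre-⊛ (c w) N)) ⟩
    ⅀ (u shʳ v) (λ w → (K1 ⊛ c w) N)            ≈⟨ sym (⊛-⅀ K1 (u shʳ v) c N) ⟩
    (K1 ⊛ (λ n → ⅀ (u shʳ v) (λ w → c w n))) N  ≈⟨ ⊛-cong (λ _ → refl) (λ n → sym (c-sh hu hv n)) N ⟩
    (K1 ⊛ (c u ⊛ c v)) N                        ≈⟨ sym (⊛-assoc K1 (c u) (c v) N) ⟩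
    ((K1 ⊛ c u) ⊛ c v) N                        ≈⟨ ⊛-comm (K1 ⊛ c u) (c v) N ⟩
    (c v ⊛ (K1 ⊛ c u)) N                        ≈⟨ ⊛-cong (λ _ → refl) (pre-⊛ (c u)) N ⟩
    (c v ⊛ pre (c u)) N ∎

module Words (R : CommutativeRing 0ℓ 0ℓ)
             (φ : CommutativeRing.rawRing ℚ.+-*-commutativeRing -Raw-AlmostCommutative⟶ fromCommutativeRing R) where
  open Over R φ
  open Stuffle R φ using (_▷_)
  open ≈-Reasoning

  infixr 6 _▷ʷ_
  _▷ʷ_ : Series → (Word → Carrier) → Word → Carrier
  (a ▷ʷ f) []      = a 0 * f []
  (a ▷ʷ f) (𝕪 ∷ w) = a 0 * f (𝕪 ∷ w) + (shift a ▷ʷ f) w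
  (a ▷ʷ f) (𝕩 ∷ w) = a 0 * f (𝕩 ∷ w)

  ▷ʷ-zsʳ : ∀ a f l → (a ▷ʷ f) (zsʳ l) ≈ (a ▷ (λ k → f (zsʳ k))) l
  ▷ʷ-zsʳ a f []            = refl
  ▷ʷ-zsʳ a f (1⁺ ∷ l)      = +-congˡ (▷ʷ-zsʳ (shift a) f l)
  ▷ʷ-zsʳ a f ((2+⁺ m) ∷ l) = refl

  sh-cons : ∀ a u b v f → ⅀ ((a ∷ u) shʳ (b ∷ v)) f ≈ ⅀ (u shʳ (b ∷ v)) (λ w → f (a ∷ w)) + ⅀ ((a ∷ u) shʳ v) (λ w → f (b ∷ w))
  sh-cons a u b v f = trans (⅀-++ (map (a ∷_) (u shʳ (b ∷ v))) _ f)
    (+-cong (⅀-map (a ∷_) (u shʳ (b ∷ v)) f) (⅀-map (b ∷_) ((a ∷ u) shʳ v) f))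

  -- A leading y of y^m sh x v can only come from y^m, and its removal leaves y^{m-1} sh x v. So
  -- a(D) acts as a Cauchy product in m.
  sh-▷ʷ : ∀ a f v m → ⅀ (replicate m 𝕪 shʳ (𝕩 ∷ v)) (a ▷ʷ f) ≈ (a ⊛ (λ n → ⅀ (replicate n 𝕪 shʳ (𝕩 ∷ v)) f)) m
  sh-▷ʷ a f v zero    = trans (+-identityʳ _) (*-congˡ (sym (+-identityʳ _)))
  sh-▷ʷ a f v (suc m) = begin
    ⅀ (replicate (suc m) 𝕪 shʳ (𝕩 ∷ v)) (a ▷ʷ f)
      ≈⟨ sh-cons 𝕪 (replicate m 𝕪) 𝕩 v (a ▷ʷ f) ⟩
    ⅀ U (λ w → a 0 * f (𝕪 ∷ w) + (shift a ▷ʷ f) w) + ⅀ V (λ w → a 0 * f (𝕩 ∷ w))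
      ≈⟨ +-cong (trans (⅀-+ U _ _) (+-cong (⅀-*ˡ U (a 0) _) (sh-▷ʷ (shift a) f v m))) (⅀-*ˡ V (a 0) _) ⟩
    (a 0 * ⅀ U (λ w → f (𝕪 ∷ w)) + (shift a ⊛ (λ n → ⅀ (replicate n 𝕪 shʳ (𝕩 ∷ v)) f)) m) + a 0 * ⅀ V (λ w → f (𝕩 ∷ w))
      ≈⟨ solve 4 (λ a x y z → (a :* x :+ y) :+ a :* z := a :* (x :+ z) :+ y) refl _ _ _ _ ⟩
    a 0 * (⅀ U (λ w → f (𝕪 ∷ w)) + ⅀ V (λ w → f (𝕩 ∷ w))) + (shift a ⊛ (λ n → ⅀ (replicate n 𝕪 shʳ (𝕩 ∷ v)) f)) m
      ≈⟨ +-congʳ (*-congˡ (sym (sh-cons 𝕪 (replicate m 𝕪) 𝕩 v f))) ⟩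
    (a ⊛ (λ n → ⅀ (replicate n 𝕪 shʳ (𝕩 ∷ v)) f)) (suc m) ∎
    where
    U = replicate m 𝕪 shʳ (𝕩 ∷ v)
    V = replicate (suc m) 𝕪 shʳ v

-- Finite harmonic sums

module _ where
  open import Data.Rational.Base using (_+_; _*_; _-_; -_; ∣_∣; _≤_; _<_; _/_; nonNegative)
  open ≡ using (refl; sym; trans; cong; cong₂; subst; subst₂; module ≡-Reasoning)
  open ℚ-Lemmas
  open ζ-Convergence
  open +-*-Solver

  φℚ : CommutativeRing.rawRing ℚ.+-*-commutativeRing -Raw-AlmostCommutative⟶ fromCommutativeRing ℚ.+-*-commutativeRing
  φℚ = record
    { ⟦_⟧ = id ; +-homo = λ _ _ → refl ; *-homo = λ _ _ → refl ; -‿homo = λ _ → refl ; 0-homo = refl ; 1-homo = refl }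

  module Q = Over ℚ.+-*-commutativeRing φℚ
  module QS = Stuffle ℚ.+-*-commutativeRing φℚ
  open Q using (⅀; _⊛_; shift; sg)

  recip-* : ∀ a b .{{_ : ℕ.NonZero a}} .{{_ : ℕ.NonZero b}} .{{_ : ℕ.NonZero (a ℕ.* b)}} → ℤ.+ 1 / (a ℕ.* b) ≡ (ℤ.+ 1 / a) * (ℤ.+ 1 / b)
  recip-* (suc a) (suc b) = ℚ.toℚᵘ-injective (ℚᵘ.≃-trans (frac (b ℕ.+ a ℕ.* suc b))
    (ℚᵘ.≃-sym (ℚᵘ.≃-trans (ℚ.toℚᵘ-homo-* (u a) (u b)) (ℚᵘ.*-cong (frac a) (frac b)))))

  invPow-cong : ∀ a b .{{_ : ℕ.NonZero a}} .{{_ : ℕ.NonZero b}} → a ≡ b → (ℤ.+ 1 / a) ≡ (ℤ.+ 1 / b)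
  invPow-cong a .a refl = refl

  invPow-⊕ : ∀ N k l → invPow N (k ⊕ l) ≡ invPow N k * invPow N l
  invPow-⊕ N (1+ m) (1+ n) = trans
    (invPow-cong (suc N ℕ.^ (suc m ℕ.+ suc n)) (suc N ℕ.^ suc m ℕ.* suc N ℕ.^ suc n)
      {{ℕ.m^n≢0 (suc N) (suc m ℕ.+ suc n)}} {{nz}} (ℕ.^-distribˡ-+-* (suc N) (suc m) (suc n)))
    (recip-* (suc N ℕ.^ suc m) (suc N ℕ.^ suc n) {{ℕ.m^n≢0 (suc N) (suc m)}} {{ℕ.m^n≢0 (suc N) (suc n)}} {{nz}})
    where
    nz : ℕ.NonZero (suc N ℕ.^ suc m ℕ.* suc N ℕ.^ suc n)
    nz = ℕ.m*n≢0 _ _ {{ℕ.m^n≢0 (suc N) (suc m)}} {{ℕ.m^n≢0 (suc N) (suc n)}}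

  invPow-1 : ∀ N → invPow N 1⁺ ≡ u N
  invPow-1 N = invPow-cong (suc N ℕ.^ 1) (suc N) {{ℕ.m^n≢0 (suc N) 1}} (ℕ.*-identityʳ (suc N))

  η : ℕ → Index → ℚ
  η N l = harm l N

  ⅀-map-0 : ∀ k UV → ⅀ (map (k ∷_) UV) (η 0) ≡ 0ℚ
  ⅀-map-0 k UV = trans (Q.⅀-map (k ∷_) UV (η 0)) (Q.⅀-0 UV (λ _ → refl))

  ⅀-map-suc : ∀ N k UV → ⅀ (map (k ∷_) UV) (η (suc N)) ≡ ⅀ (map (k ∷_) UV) (η N) + ⅀ UV (η N) * invPow N k
  ⅀-map-suc N k UV = trans (Q.⅀-map (k ∷_) UV (η (suc N)))
    (trans (Q.⅀-+ UV _ _) (cong₂ _+_ (sym (Q.⅀-map (k ∷_) UV (η N))) (Q.⅀-*ʳ UV (invPow N k) (η N))))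

  -- Both sides are compared by their increments in N. The merged entries come from the product of
  -- the two new summands, where the largest variable is N + 1 in both factors.
  η-∗ : ∀ N u v → η N u * η N v ≡ ⅀ (u ∗ʳ v) (η N)
  η-∗ N []      v       = trans (ℚ.*-identityˡ (η N v)) (sym (ℚ.+-identityʳ (η N v)))
  η-∗ N (k ∷ u) []      = trans (ℚ.*-identityʳ (η N (k ∷ u))) (sym (ℚ.+-identityʳ (η N (k ∷ u))))
  η-∗ zero (k ∷ u) (l ∷ v) = sym (trans (Q.⅀-++ (map (k ∷_) (u ∗ʳ (l ∷ v))) _ (η 0))
    (cong₂ _+_ (⅀-map-0 k (u ∗ʳ (l ∷ v))) (trans (Q.⅀-++ (map (l ∷_) ((k ∷ u) ∗ʳ v)) _ (η 0))
      (cong₂ _+_ (⅀-map-0 l ((k ∷ u) ∗ʳ v)) (⅀-map-0 (k ⊕ l) (u ∗ʳ v))))))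
  η-∗ (suc N) (k ∷ u) (l ∷ v) = begin
    (a + b * p) * (c + d * q)
      ≡⟨ solve 6 (λ a b c d p q → (a :+ b :* p) :* (c :+ d :* q) := a :* c :+ ((b :* c) :* p :+ ((a :* d) :* q :+ (b :* d) :* (p :* q)))) refl a b c d p q ⟩
    a * c + ((b * c) * p + ((a * d) * q + (b * d) * (p * q)))
      ≡⟨ cong₂ _+_ (trans (η-∗ N (k ∷ u) (l ∷ v)) (split3 (η N)))
          (cong₂ _+_ (cong (_* p) (η-∗ N u (l ∷ v)))
            (cong₂ _+_ (cong (_* q) (η-∗ N (k ∷ u) v)) (cong₂ _*_ (η-∗ N u v) (sym (invPow-⊕ N k l))))) ⟩
    (⅀ (map (k ∷_) U) (η N) + (⅀ (map (l ∷_) V) (η N) + ⅀ (map ((k ⊕ l) ∷_) UV) (η N)))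
      + (⅀ U (η N) * p + (⅀ V (η N) * q + ⅀ UV (η N) * invPow N (k ⊕ l)))
      ≡⟨ solve 6 (λ x y z x′ y′ z′ → (x :+ (y :+ z)) :+ (x′ :+ (y′ :+ z′)) := (x :+ x′) :+ ((y :+ y′) :+ (z :+ z′))) refl
           (⅀ (map (k ∷_) U) (η N)) (⅀ (map (l ∷_) V) (η N)) (⅀ (map ((k ⊕ l) ∷_) UV) (η N)) (⅀ U (η N) * p) (⅀ V (η N) * q) (⅀ UV (η N) * invPow N (k ⊕ l)) ⟩
    (⅀ (map (k ∷_) U) (η N) + ⅀ U (η N) * p) + ((⅀ (map (l ∷_) V) (η N) + ⅀ V (η N) * q) + (⅀ (map ((k ⊕ l) ∷_) UV) (η N) + ⅀ UV (η N) * invPow N (k ⊕ l)))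
      ≡⟨ sym (cong₂ _+_ (⅀-map-suc N k U) (cong₂ _+_ (⅀-map-suc N l V) (⅀-map-suc N (k ⊕ l) UV))) ⟩
    ⅀ (map (k ∷_) U) (η (suc N)) + (⅀ (map (l ∷_) V) (η (suc N)) + ⅀ (map ((k ⊕ l) ∷_) UV) (η (suc N)))
      ≡⟨ sym (split3 (η (suc N))) ⟩
    ⅀ ((k ∷ u) ∗ʳ (l ∷ v)) (η (suc N)) ∎
    where
    open ≡-Reasoning
    a = η N (k ∷ u)
    b = η N u
    c = η N (l ∷ v)
    d = η N v
    p = invPow N k
    q = invPow N l
    U = u ∗ʳ (l ∷ v)
    V = (k ∷ u) ∗ʳ v
    UV = u ∗ʳ v
    split3 : ∀ f → ⅀ ((k ∷ u) ∗ʳ (l ∷ v)) f ≡ ⅀ (map (k ∷_) U) f + (⅀ (map (l ∷_) V) f + ⅀ (map ((k ⊕ l) ∷_) UV) f)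
    split3 f = trans (Q.⅀-++ (map (k ∷_) U) _ f) (cong (⅀ (map (k ∷_) U) f +_) (Q.⅀-++ (map (l ∷_) V) (map ((k ⊕ l) ∷_) UV) f))

  module Cη (N : ℕ) = QS.Character (η N) refl (η-∗ N)

  module PL = Polylog ℚ.+-*-commutativeRing φℚ int u refl (λ _ → refl) int*u
  open PL using (pre; c)

  c-zero : ∀ m w → c (replicate m 𝕩 ++ 𝕪 ∷ w) 0 ≡ 0ℚ
  c-zero zero    w = refl
  c-zero (suc m) w = refl

  c-suc : ∀ m w N → c (replicate m 𝕩 ++ 𝕪 ∷ w) (suc N) ≡ pre (c w) N * invPow N (1+ m)
  c-suc zero    w N = trans (ℚ.*-comm (u N) (pre (c w) N)) (cong (pre (c w) N *_) (sym (invPow-1 N)))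
  c-suc (suc m) w N = begin
    u N * c (replicate m 𝕩 ++ 𝕪 ∷ w) (suc N)     ≡⟨ cong (u N *_) (c-suc m w N) ⟩
    u N * (pre (c w) N * invPow N (1+ m))         ≡⟨ solve 3 (λ a b c → a :* (b :* c) := b :* (a :* c)) refl (u N) (pre (c w) N) (invPow N (1+ m)) ⟩
    pre (c w) N * (u N * invPow N (1+ m))         ≡⟨ cong (λ z → pre (c w) N * (z * invPow N (1+ m))) (sym (invPow-1 N)) ⟩
    pre (c w) N * (invPow N 1⁺ * invPow N (1+ m)) ≡⟨ cong (pre (c w) N *_) (sym (invPow-⊕ N 1⁺ (1+ m))) ⟩
    pre (c w) N * invPow N (1+ suc m) ∎
    where open ≡-Reasoning

  pre-c : ∀ l N → pre (c (zsʳ l)) N ≡ η N l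
  pre-c []           zero    = refl
  pre-c []           (suc N) = trans (ℚ.+-identityʳ (pre (c []) N)) (pre-c [] N)
  pre-c ((1+ m) ∷ l) zero    = c-zero m (zsʳ l)
  pre-c ((1+ m) ∷ l) (suc N) = cong₂ _+_ (pre-c ((1+ m) ∷ l) N)
    (trans (c-suc m (zsʳ l) N) (cong (_* invPow N (1+ m)) (pre-c l N)))

  c≥0 : ∀ w n → 0ℚ ≤ c w n
  pre≥0 : ∀ w n → 0ℚ ≤ pre (c w) n
  c≥0 []      zero    = ℚ.nonNegative⁻¹ 1ℚ
  c≥0 []      (suc n) = ℚ.≤-refl
  c≥0 (_ ∷ _) zero    = ℚ.≤-refl
  c≥0 (𝕩 ∷ w) (suc n) = *-nn (u≥0 n) (c≥0 w (suc n))
  c≥0 (𝕪 ∷ w) (suc n) = *-nn (u≥0 n) (pre≥0 w n)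
  pre≥0 w zero    = c≥0 w 0
  pre≥0 w (suc n) = +-nn (pre≥0 w n) (c≥0 w (suc n))

  -- The complete homogeneous symmetric polynomials.
  hsym : ℕ → List ℚ → ℚ
  hsym zero    ts       = 1ℚ
  hsym (suc m) []       = 0ℚ
  hsym (suc m) (t ∷ ts) = hsym (suc m) ts + t * hsym m (t ∷ ts)

  -- The reciprocals of M + 1, ..., M + i, because `u M` is 1/(M + 1).
  win : ℕ → ℕ → List ℚ
  win M zero    = []
  win M (suc i) = u M ∷ win (suc M) i

  h≥0 : ∀ m M i → 0ℚ ≤ hsym m (win M i)
  h≥0 zero    M i       = ℚ.nonNegative⁻¹ 1ℚ
  h≥0 (suc m) M zero    = ℚ.≤-refl
  h≥0 (suc m) M (suc i) = +-nn (h≥0 (suc m) (suc M) i) (*-nn (u≥0 M) (h≥0 m M (suc i)))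

  -- The elementary symmetric polynomials of 1, 1/2, ..., 1/M.
  eη : ℕ → ℕ → ℚ
  eη M m = η M (ones m)

  eη-suc : ∀ M m → eη (suc M) m ≡ eη M m + u M * Q.X· (eη M) m
  eη-suc M zero    = sym (trans (cong (1ℚ +_) (ℚ.*-zeroʳ (u M))) (ℚ.+-identityʳ 1ℚ))
  eη-suc M (suc m) = cong (eη M (suc m) +_) (trans (cong (eη M m *_) (invPow-1 M)) (ℚ.*-comm (eη M m) (u M)))

  module _ (N : ℕ) where
    open Cη N using (A; A⊛E)

    Aeη-suc : ∀ M m → (A ⊛ eη (suc M)) m ≡ (A ⊛ eη M) m + u M * Q.X· (A ⊛ eη M) m
    Aeη-suc M m = trans (Q.⊛-cong {A} (λ _ → refl) (eη-suc M) m)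
      (trans (Q.⊛-+ʳ A (eη M) (λ n → u M * Q.X· (eη M) n) m)
        (cong ((A ⊛ eη M) m +_) (trans (Q.⊛-*ʳ (u M) A (Q.X· (eη M)) m) (cong (u M *_) (Q.⊛-X A (eη M) m)))))

    -- A_N(u) E_M(u) is the product of 1/(1 + u/n) over M < n ≤ N, which generates the complete
    -- homogeneous polynomials of these 1/n with alternating signs.
    A⊛E-window : ∀ i M m → i ℕ.+ M ≡ N → (A ⊛ eη M) m ≡ sg m * hsym m (win M i)
    A⊛E-window zero    .N zero    refl = trans (A⊛E zero) (sym (ℚ.*-identityˡ 1ℚ))
    A⊛E-window zero    .N (suc m) refl = trans (A⊛E (suc m)) (sym (ℚ.*-zeroʳ (sg (suc m))))
    A⊛E-window (suc i) M zero    e = trans (sym (trans (Aeη-suc M zero) (trans (cong ((A ⊛ eη M) 0 +_) (ℚ.*-zeroʳ (u M))) (ℚ.+-identityʳ _))))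
      (A⊛E-window i (suc M) zero (trans (ℕ.+-suc i M) e))
    A⊛E-window (suc i) M (suc m) e = begin
      (A ⊛ eη M) (suc m)
        ≡⟨ solve 2 (λ x y → x := (x :+ y) :- y) refl ((A ⊛ eη M) (suc m)) (u M * (A ⊛ eη M) m) ⟩
      ((A ⊛ eη M) (suc m) + u M * (A ⊛ eη M) m) - u M * (A ⊛ eη M) m
        ≡⟨ cong₂ (λ x y → x - u M * y) (trans (sym (Aeη-suc M (suc m))) (A⊛E-window i (suc M) (suc m) (trans (ℕ.+-suc i M) e))) (A⊛E-window (suc i) M m e) ⟩
      - sg m * hsym (suc m) (win (suc M) i) - u M * (sg m * hsym m (win M (suc i)))
        ≡⟨ solve 4 (λ s a u b → (:- s) :* a :- u :* (s :* b) := (:- s) :* (a :+ u :* b)) refl (sg m) (hsym (suc m) (win (suc M) i)) (u M) (hsym m (win M (suc i))) ⟩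
      - sg m * hsym (suc m) (win M (suc i)) ∎
      where open ≡-Reasoning

  ∣sg*∣ : ∀ m x → ∣ sg m * x ∣ ≡ ∣ x ∣
  ∣sg*∣ zero    x = cong ∣_∣ (ℚ.*-identityˡ x)
  ∣sg*∣ (suc m) x = trans (cong ∣_∣ (sym (ℚ.neg-distribˡ-* (sg m) x))) (trans (ℚ.∣-p∣≡∣p∣ (sg m * x)) (∣sg*∣ m x))

  -- The growth of `hsym (suc m)` when 1/(M + 1) is put in front of the window. That these
  -- increments increase as M decreases is the convexity used below.
  incr-h : ℕ → ℕ → ℕ → ℚ
  incr-h m M i = u M * hsym m (win M (suc i))

  h-mono : ∀ m M i → hsym m (win (suc M) i) ≤ hsym m (win M (suc i))
  h-mono zero    M i = ℚ.≤-refl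
  h-mono (suc m) M i = subst (_≤ hsym (suc m) (win M (suc i))) (ℚ.+-identityʳ (hsym (suc m) (win (suc M) i)))
    (ℚ.+-monoʳ-≤ (hsym (suc m) (win (suc M) i)) (*-nn (u≥0 M) (h≥0 m M (suc i))))

  incr-mono : ∀ m M i → incr-h m (suc M) i ≤ incr-h m M (suc i)
  incr-mono m M i = *-mono-≤0 {u (suc M)} {u M} (u≥0 (suc M)) (h≥0 m M (suc (suc i))) (u-anti M) (h-mono m M (suc i))

  incr-mono* : ∀ m M i j → incr-h m (j ℕ.+ M) i ≤ incr-h m M (j ℕ.+ i)
  incr-mono* m M i zero    = ℚ.≤-refl
  incr-mono* m M i (suc j) = ℚ.≤-trans
    (subst (λ z → incr-h m z i ≤ incr-h m (suc M) (j ℕ.+ i)) (ℕ.+-suc j M) (incr-mono* m (suc M) i j))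
    (incr-mono m M (j ℕ.+ i))

  int-≥0 : ∀ n → 0ℚ ≤ int n
  int-≥0 zero    = ℚ.≤-refl
  int-≥0 (suc n) = +-nn (ℚ.nonNegative⁻¹ 1ℚ) (int-≥0 n)

  -- The left side is a sum of i increments, and each of them is at most the next one,
  -- `incr-h m M i`.
  h≤int*incr : ∀ m M i → hsym (suc m) (win (suc M) i) ≤ int i * incr-h m M i
  h≤int*incr m M zero    = ℚ.≤-reflexive (sym (ℚ.*-zeroˡ (incr-h m M 0)))
  h≤int*incr m M (suc i) = ℚ.≤-trans (ℚ.+-monoˡ-≤ d (h≤int*incr m (suc M) i))
    (ℚ.≤-trans (ℚ.≤-reflexive (solve 2 (λ i d → i :* d :+ d := (con 1ℚ :+ i) :* d) refl (int i) d))
      (ℚ.*-monoˡ-≤-nonNeg (int (suc i)) {{nonNegative (int-≥0 (suc i))}} (incr-mono m M i)))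
    where d = incr-h m (suc M) i

  -- i ↦ hsym (suc m) (win (N - i) i) is convex and vanishes at 0.
  h-convex : ∀ m M i j → hsym (suc m) (win (j ℕ.+ M) i) * int (j ℕ.+ i) ≤ int i * hsym (suc m) (win M (j ℕ.+ i))
  h-convex m M i zero    = ℚ.≤-reflexive (ℚ.*-comm (hsym (suc m) (win M i)) (int i))
  h-convex m M i (suc j) = ℚ.≤-trans
    (ℚ.≤-reflexive (solve 2 (λ f n → f :* (con 1ℚ :+ n) := f :* n :+ f) refl f (int (j ℕ.+ i))))
    (ℚ.≤-trans (ℚ.+-mono-≤
        (subst (λ z → hsym (suc m) (win z i) * int (j ℕ.+ i) ≤ int i * hsym (suc m) (win (suc M) (j ℕ.+ i))) (ℕ.+-suc j M) (h-convex m (suc M) i j))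
        (ℚ.≤-trans (h≤int*incr m (j ℕ.+ M) i) (ℚ.*-monoˡ-≤-nonNeg (int i) {{nonNegative (int-≥0 i)}} (incr-mono* m M i j))))
      (ℚ.≤-reflexive (sym (ℚ.*-distribˡ-+ (int i) (hsym (suc m) (win (suc M) (j ℕ.+ i))) (incr-h m M (j ℕ.+ i))))))
    where f = hsym (suc m) (win (suc (j ℕ.+ M)) i)

  fsum : (ℕ → ℚ) → ℕ → ℚ
  fsum f zero    = f 0
  fsum f (suc n) = f 0 + fsum (shift f) n

  fsum-cong : ∀ {f g} → (∀ n → f n ≡ g n) → ∀ n → fsum f n ≡ fsum g n
  fsum-cong e zero    = e 0
  fsum-cong e (suc n) = cong₂ _+_ (e 0) (fsum-cong (e ∘ suc) n)

  fsum-*ʳ : ∀ f b n → fsum (λ i → f i * b) n ≡ fsum f n * b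
  fsum-*ʳ f b zero    = refl
  fsum-*ʳ f b (suc n) = trans (cong (f 0 * b +_) (fsum-*ʳ (shift f) b n)) (sym (ℚ.*-distribʳ-+ b (f 0) (fsum (shift f) n)))

  fsum-⊛ : ∀ f n → (f ⊛ PL.K1) n ≡ fsum f n
  fsum-⊛ f zero    = ℚ.*-identityʳ (f 0)
  fsum-⊛ f (suc n) = cong₂ _+_ (ℚ.*-identityʳ (f 0)) (fsum-⊛ (shift f) n)

  fsum-pre : ∀ f n → fsum f n ≡ pre f n
  fsum-pre f n = trans (sym (fsum-⊛ f n)) (trans (Q.⊛-comm f PL.K1 n) (PL.pre-⊛ f n))

  ⊛-bound : ∀ f g w N → (∀ i → 0ℚ ≤ f i) → (∀ i j → i ℕ.+ j ≡ N → ∣ g j ∣ ≤ w i) → ∣ (f ⊛ g) N ∣ ≤ fsum (λ i → f i * w i) N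
  ⊛-bound f g w zero    f≥0 b = term f g w 0 0 f≥0 (b 0 0 refl)
    where
    term : ∀ (f g w : ℕ → ℚ) i j → (∀ i → 0ℚ ≤ f i) → ∣ g j ∣ ≤ w i → ∣ f i * g j ∣ ≤ f i * w i
    term f g w i j f≥0 b = subst (_≤ f i * w i) (sym (trans (ℚ.∣p*q∣≡∣p∣*∣q∣ (f i) (g j)) (cong (_* ∣ g j ∣) (ℚ.0≤p⇒∣p∣≡p (f≥0 i)))))
      (ℚ.*-monoˡ-≤-nonNeg (f i) {{nonNegative (f≥0 i)}} b)
  ⊛-bound f g w (suc N) f≥0 b = ℚ.≤-trans (ℚ.∣p+q∣≤∣p∣+∣q∣ (f 0 * g (suc N)) ((shift f ⊛ g) N))
    (ℚ.+-mono-≤ first (⊛-bound (shift f) g (w ∘ suc) N (f≥0 ∘ suc) (λ i j e → b (suc i) j (cong suc e))))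
    where
    first : ∣ f 0 * g (suc N) ∣ ≤ f 0 * w 0
    first = subst (_≤ f 0 * w 0) (sym (trans (ℚ.∣p*q∣≡∣p∣*∣q∣ (f 0) (g (suc N))) (cong (_* ∣ g (suc N) ∣) (ℚ.0≤p⇒∣p∣≡p (f≥0 0)))))
      (ℚ.*-monoˡ-≤-nonNeg (f 0) {{nonNegative (f≥0 0)}} (b 0 (suc N) refl))

  -- The value of A_N ▷ η_N at y^{m+1} sh x v, with the convolution in u moved inside that of the
  -- polylogarithms.
  defect : Word → ℕ → ℕ → ℚ
  defect v m N = (c (𝕩 ∷ v) ⊛ (λ M → (Cη.A N ⊛ eη M) (suc m))) N

  -- With N = n + 1, convexity bounds the window polynomial for i entries by i/N times that for all
  -- N entries. The factor i is absorbed by i c_i(x v) = c_i(v), so that the sum over i becomes the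
  -- truncated sum at v.
  defect≤ : ∀ {v} → EndsY v → ∀ m n → ∣ defect v m (suc n) ∣ ≤ pre (c v) (suc n) * (u n * hsym (suc m) (win 0 (suc n)))
  defect≤ {v} e m n = ℚ.≤-trans
    (⊛-bound (c (𝕩 ∷ v)) _ (λ i → int i * b) (suc n) (c≥0 (𝕩 ∷ v)) bound)
    (ℚ.≤-reflexive (trans (fsum-cong (λ i → trans (solve 3 (λ c i b → c :* (i :* b) := (i :* c) :* b) refl (c (𝕩 ∷ v) i) (int i) b) (cong (_* b) (PL.θc (ends (there e)) i))) (suc n))
      (trans (fsum-*ʳ (c v) b (suc n)) (cong (_* b) (fsum-pre (c v) (suc n))))))
    where
    b = u n * hsym (suc m) (win 0 (suc n))
    bound : ∀ i j → i ℕ.+ j ≡ suc n → ∣ (Cη.A (suc n) ⊛ eη j) (suc m) ∣ ≤ int i * b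
    bound i j e = subst (_≤ int i * b)
      (sym (trans (cong ∣_∣ (A⊛E-window (suc n) i j (suc m) e)) (trans (∣sg*∣ (suc m) hj) (ℚ.0≤p⇒∣p∣≡p (h≥0 (suc m) j i)))))
      (subst₂ _≤_ (trans (cong (u n *_) (cong₂ (λ a b → hsym (suc m) (win a i) * int b) (ℕ.+-identityʳ j) (trans (ℕ.+-comm j i) e)))
                    (trans (solve 3 (λ u hsym i → u :* (hsym :* i) := hsym :* (i :* u)) refl (u n) hj (int (suc n))) (trans (cong (hj *_) (int*u n)) (ℚ.*-identityʳ hj))))
                  (trans (cong (λ k → u n * (int i * hsym (suc m) (win 0 k))) (trans (ℕ.+-comm j i) e))
                    (solve 3 (λ u i hsym → u :* (i :* hsym) := i :* (u :* hsym)) refl (u n) (int i) (hsym (suc m) (win 0 (suc n)))))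
        (ℚ.*-monoˡ-≤-nonNeg (u n) {{nonNegative (u≥0 n)}} (h-convex m 0 i j)))
      where hj = hsym (suc m) (win j i)

  -- A product of two sums bounded by P = O(√N) is not o(N); so hsym is bounded by Q = ∏ (1 + 1/(8n)) with Q² ≤ P.
  ⅛ 9ℚ : ℚ
  ⅛  = ℤ.+ 1 / 8
  9ℚ = ℤ.+ 9 / 1

  prodℚ : ℚ → List ℚ → ℚ
  prodℚ x []       = 1ℚ
  prodℚ x (t ∷ ts) = prodℚ x ts * (1ℚ + x * t)

  9^ : ℕ → ℚ
  9^ zero    = 1ℚ
  9^ (suc m) = 9ℚ * 9^ m

  9^≥0 : ∀ m → 0ℚ ≤ 9^ m
  9^≥0 zero    = ℚ.nonNegative⁻¹ 1ℚ
  9^≥0 (suc m) = *-nn (ℚ.nonNegative⁻¹ 9ℚ) (9^≥0 m)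

  u≤1 : ∀ n → u n ≤ 1ℚ
  u≤1 n = /-mono {suc n} {1} (ℕ.s≤s ℕ.z≤n)

  prodℚ≥1 : ∀ {x} → 0ℚ ≤ x → ∀ M i → 1ℚ ≤ prodℚ x (win M i)
  prodℚ≥1 0≤x M zero    = ℚ.≤-refl
  prodℚ≥1 {x} 0≤x M (suc i) = *-mono-≤0 {1ℚ} {prodℚ x (win (suc M) i)} {1ℚ} {1ℚ + x * u M} (ℚ.nonNegative⁻¹ 1ℚ) (+-nn (ℚ.nonNegative⁻¹ 1ℚ) (*-nn 0≤x (u≥0 M)))
    (prodℚ≥1 0≤x (suc M) i) (subst (_≤ 1ℚ + x * u M) (ℚ.+-identityʳ 1ℚ) (ℚ.+-monoʳ-≤ 1ℚ (*-nn 0≤x (u≥0 M))))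

  0≤⅛ : 0ℚ ≤ ⅛
  0≤⅛ = ℚ.nonNegative⁻¹ ⅛

  Qw : ℕ → ℕ → ℚ
  Qw M i = prodℚ ⅛ (win M i)

  Qw≥0 : ∀ M i → 0ℚ ≤ Qw M i
  Qw≥0 M i = ℚ.≤-trans (ℚ.nonNegative⁻¹ 1ℚ) (prodℚ≥1 0≤⅛ M i)

  -- The induction needs C/8 ≥ 1 + t/8 for t ≤ 1, hence the factor C = 9 for each degree.
  h≤ : ∀ m M i → hsym m (win M i) ≤ 9^ m * Qw M i
  h≤ zero    M i       = subst (1ℚ ≤_) (sym (ℚ.*-identityˡ (Qw M i))) (prodℚ≥1 0≤⅛ M i)
  h≤ (suc m) M zero    = *-nn (9^≥0 (suc m)) (Qw≥0 M 0)
  h≤ (suc m) M (suc i) = ℚ.≤-trans (ℚ.+-mono-≤ (h≤ (suc m) (suc M) i) (ℚ.*-monoˡ-≤-nonNeg (u M) {{nonNegative (u≥0 M)}} (h≤ m M (suc i))))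
    (≤-from-diff (subst (0ℚ ≤_)
      (solve 3 (λ k q t → con ⅛ :* ((k :* q) :* t) :* (con 1ℚ :- t) := con 9ℚ :* k :* (q :* (con 1ℚ :+ con ⅛ :* t)) :- (con 9ℚ :* k :* q :+ t :* (k :* (q :* (con 1ℚ :+ con ⅛ :* t)))))
        refl (9^ m) (Qw (suc M) i) (u M))
      (*-nn (*-nn 0≤⅛ (*-nn (*-nn (9^≥0 m) (Qw≥0 (suc M) i)) (u≥0 M)))
        (subst (_≤ 1ℚ - u M) (ℚ.+-inverseʳ (u M)) (ℚ.+-monoˡ-≤ (- u M) (u≤1 M))))))

  win-snoc : ∀ M i → win M (suc i) ≡ win M i ++ u (M ℕ.+ i) ∷ []
  win-snoc M zero    = cong (λ z → u z ∷ []) (sym (ℕ.+-identityʳ M))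
  win-snoc M (suc i) = cong (u M ∷_) (trans (win-snoc (suc M) i) (cong (λ z → win (suc M) i ++ u z ∷ []) (sym (ℕ.+-suc M i))))

  prodℚ-snoc : ∀ x ts t → prodℚ x (ts ++ t ∷ []) ≡ prodℚ x ts * (1ℚ + x * t)
  prodℚ-snoc x []       t = refl
  prodℚ-snoc x (s ∷ ts) t = trans (cong (_* (1ℚ + x * s)) (prodℚ-snoc x ts t))
    (solve 3 (λ a b c → a :* b :* c := a :* c :* b) refl (prodℚ x ts) (1ℚ + x * t) (1ℚ + x * s))

  prodℚ-P : ∀ N → prodℚ ½ (win 0 N) ≡ P N
  prodℚ-P zero    = refl
  prodℚ-P (suc N) = trans (cong (prodℚ ½) (win-snoc 0 N)) (trans (prodℚ-snoc ½ (win 0 N) (u N)) (cong (_* (1ℚ + ½ * u N)) (prodℚ-P N)))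

  Q²≤ : ∀ M i → Qw M i * Qw M i ≤ prodℚ ½ (win M i)
  Q²≤ M zero    = ℚ.≤-refl
  Q²≤ M (suc i) = ℚ.≤-trans (ℚ.≤-reflexive (solve 2 (λ q s → (q :* s) :* (q :* s) := (q :* q) :* (s :* s)) refl (Qw (suc M) i) (1ℚ + ⅛ * t)))
    (*-mono-≤0 {Qw (suc M) i * Qw (suc M) i} {prodℚ ½ (win (suc M) i)} {(1ℚ + ⅛ * t) * (1ℚ + ⅛ * t)} {1ℚ + ½ * t}
      (*-nn (Qw≥0 (suc M) i) (Qw≥0 (suc M) i)) (+-nn (ℚ.nonNegative⁻¹ 1ℚ) (*-nn 0≤½ (u≥0 M))) (Q²≤ (suc M) i)
      (≤-from-diff (subst (0ℚ ≤_)
        (solve 1 (λ t → con ¼ :* t :- con (⅛ * ⅛) :* (t :* t) := (con 1ℚ :+ con ½ :* t) :- (con 1ℚ :+ con ⅛ :* t) :* (con 1ℚ :+ con ⅛ :* t)) refl t)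
        (subst (0ℚ ≤_) (solve 1 (λ t → con (⅛ * ⅛) :* t :* (con 1ℚ :- t) :+ con (¼ - ⅛ * ⅛) :* t := con ¼ :* t :- con (⅛ * ⅛) :* (t :* t)) refl t)
          (+-nn (*-nn (*-nn (ℚ.nonNegative⁻¹ (⅛ * ⅛)) (u≥0 M)) (subst (_≤ 1ℚ - t) (ℚ.+-inverseʳ t) (ℚ.+-monoˡ-≤ (- t) (u≤1 M))))
            (*-nn (ℚ.nonNegative⁻¹ (¼ - ⅛ * ⅛)) (u≥0 M)))))))
    where
    t = u M
    ¼ = ℤ.+ 1 / 4

  growth : ℕ → ℚ
  growth n = P (suc n) * Qw 0 (suc n) * u n

  growth≥0 : ∀ n → 0ℚ ≤ growth n
  growth≥0 n = *-nn (*-nn (P≥0 (suc n)) (Qw≥0 0 (suc n))) (u≥0 n)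

  P²≤3 : ∀ n → P (suc n) * P (suc n) ≤ 3ℚ * int (suc n)
  P²≤3 n = ℚ.≤-trans (P² (suc n)) (≤-from-diff (subst (0ℚ ≤_)
    (solve 1 (λ j → j := con 3ℚ :* (con 1ℚ :+ j) :- ((con 1ℚ :+ j) :+ (con 1ℚ :+ j) :+ con 1ℚ)) refl (int n)) (int≥0 n)))

  growth²≤ : ∀ n → growth n * growth n ≤ 3ℚ * (P (suc n) * u n)
  growth²≤ n = ℚ.≤-trans
    (ℚ.≤-reflexive (solve 3 (λ p q t → (p :* q :* t) :* (p :* q :* t) := (q :* q) :* ((p :* p) :* (t :* t))) refl p q t))
    (ℚ.≤-trans (*-mono-≤0 {q * q} {p} {(p * p) * (t * t)} {(3ℚ * i) * (t * t)} (*-nn q≥0 q≥0) (*-nn 3i≥0 t²≥0) Q²≤P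
        (ℚ.*-monoʳ-≤-nonNeg (t * t) {{nonNegative t²≥0}} (P²≤3 n)))
      (ℚ.≤-reflexive (trans (solve 4 (λ p k t i → p :* ((k :* i) :* (t :* t)) := k :* (p :* t) :* (i :* t)) refl p 3ℚ t i)
        (trans (cong (3ℚ * (p * t) *_) (int*u n)) (ℚ.*-identityʳ (3ℚ * (p * t)))))))
    where
    p = P (suc n)
    q = Qw 0 (suc n)
    t = u n
    i = int (suc n)
    q≥0 = Qw≥0 0 (suc n)
    t²≥0 = *-nn (u≥0 n) (u≥0 n)
    3i≥0 = *-nn (ℚ.nonNegative⁻¹ 3ℚ) (int-≥0 (suc n))
    Q²≤P : q * q ≤ p
    Q²≤P = subst (q * q ≤_) (prodℚ-P (suc n)) (Q²≤ 0 (suc n))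

  27ℚ : ℚ
  27ℚ = 3ℚ * 3ℚ * 3ℚ

  -- With N = n + 1, the bounds Q² ≤ P and P² ≤ 3N give (P Q / N)⁴ ≤ P⁶ / N⁴ ≤ 27 / N. Taking the
  -- fourth power avoids roots.
  growth⁴≤ : ∀ n → (growth n * growth n) * (growth n * growth n) ≤ 27ℚ * u n
  growth⁴≤ n = ℚ.≤-trans (*-mono-≤0 {x} {y} {x} {y} x≥0 y≥0 (growth²≤ n) (growth²≤ n))
    (ℚ.≤-trans (ℚ.≤-reflexive (solve 3 (λ k p t → (k :* (p :* t)) :* (k :* (p :* t)) := (k :* k :* (t :* t)) :* (p :* p)) refl 3ℚ p t))
    (ℚ.≤-trans (ℚ.*-monoˡ-≤-nonNeg (3ℚ * 3ℚ * (t * t)) {{nonNegative (*-nn (ℚ.nonNegative⁻¹ (3ℚ * 3ℚ)) (*-nn (u≥0 n) (u≥0 n)))}} (P²≤3 n))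
      (ℚ.≤-reflexive (trans (solve 3 (λ k t i → (k :* k :* (t :* t)) :* (k :* i) := (k :* k :* k :* t) :* (i :* t)) refl 3ℚ t i)
        (trans (cong (27ℚ * t *_) (int*u n)) (ℚ.*-identityʳ (27ℚ * t)))))))
    where
    p = P (suc n)
    t = u n
    i = int (suc n)
    x = growth n * growth n
    y = 3ℚ * (p * t)
    x≥0 = *-nn (growth≥0 n) (growth≥0 n)
    y≥0 = *-nn (ℚ.nonNegative⁻¹ 3ℚ) (*-nn (P≥0 (suc n)) (u≥0 n))

  null-⁴ : ∀ (f : ℕ → ℚ) B → 0ℚ < B → (∀ n → 0ℚ ≤ f n) → (∀ n → (f n * f n) * (f n * f n) ≤ B * u n) → Null f
  null-⁴ f B 0<C f≥0 f⁴ ε 0<ε = proj₁ s , λ n N≤n → subst (_< ε) (sym (ℚ.0≤p⇒∣p∣≡p (f≥0 n))) (sq-cancel {f n} {ε} 0<ε (proj₂ s n N≤n))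
    where s = sq-small (λ n → f n * f n) B 0<C f⁴ (ε * ε) (*-pos {ε} {ε} 0<ε 0<ε)

  growth-null : Null growth
  growth-null = null-⁴ growth 27ℚ (ℚ.positive⁻¹ 27ℚ) growth≥0 growth⁴≤

  EndsY⇒zsʳ : ∀ {w} → EndsY w → ∃[ k ] ∃[ l ] w ≡ zsʳ (k ∷ l)
  EndsY⇒zsʳ here = 1⁺ , [] , refl
  EndsY⇒zsʳ (there {𝕪} e) with EndsY⇒zsʳ e
  ... | k , l , refl = 1⁺ , k ∷ l , refl
  EndsY⇒zsʳ (there {𝕩} e) with EndsY⇒zsʳ e
  ... | (1+ m) , l , refl = (2+⁺ m) , l , refl

  null-suc : ∀ {s} → Null (s ∘ suc) → Null s
  null-suc h ε 0<ε = suc (proj₁ (h ε 0<ε)) , λ { (suc n) (ℕ.s≤s N≤n) → proj₂ (h ε 0<ε) n N≤n }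

  null-scale : ∀ q {s} → Null s → Null (λ n → q * s n)
  null-scale q = null-*-bounded (fromℚ q)

  defect-null : ∀ {v} → EndsY v → ∀ m → Null (defect v m)
  defect-null {v} e m with EndsY⇒zsʳ e
  ... | k , l , v≡ = null-suc (null-≤ bound (null-scale (K (k ∷ l) * 9^ (suc m)) growth-null))
    where
    κ = K (k ∷ l) * 9^ (suc m)
    κ≥0 : 0ℚ ≤ κ
    κ≥0 = *-nn (K≥0 (k ∷ l)) (9^≥0 (suc m))
    bound : ∀ n → ∣ defect v m (suc n) ∣ ≤ ∣ κ * growth n ∣
    bound n = ℚ.≤-trans (defect≤ e m n) (ℚ.≤-trans
      (*-mono-≤0 {pre (c v) (suc n)} {K (k ∷ l) * P (suc n)} {u n * hsym (suc m) (win 0 (suc n))} {u n * (9^ (suc m) * Qw 0 (suc n))}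
        (pre≥0 v (suc n)) (*-nn (u≥0 n) (*-nn (9^≥0 (suc m)) (Qw≥0 0 (suc n))))
        (subst (_≤ K (k ∷ l) * P (suc n)) (sym (trans (cong (λ w → pre (c w) (suc n)) v≡) (pre-c (k ∷ l) (suc n)))) (harm≤ (k ∷ l) (suc n)))
        (ℚ.*-monoˡ-≤-nonNeg (u n) {{nonNegative (u≥0 n)}} (h≤ (suc m) 0 (suc n))))
      (ℚ.≤-reflexive (trans
        (solve 5 (λ k p t e q → k :* p :* (t :* (e :* q)) := k :* e :* (p :* q :* t)) refl (K (k ∷ l)) (P (suc n)) (u n) (9^ (suc m)) (Qw 0 (suc n)))
        (sym (ℚ.0≤p⇒∣p∣≡p (*-nn κ≥0 (growth≥0 n)))))))

-- Regularized values

open Over ℝ-commutativeRing φℝ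
open Stuffle ℝ-commutativeRing φℝ
open ≈-Reasoning

c₀ : ℝ[T] → ℝ
c₀ p = coeffᵀ p 0

c₀-cong : ∀ p q → p ≈ᵀ q → c₀ p ≈ c₀ q
c₀-cong p q e = mk≋ (e 0)

c₀-+ : ∀ p q → c₀ (p +ᵀ q) ≈ c₀ p + c₀ q
c₀-+ []      q       = sym (+-identityˡ _)
c₀-+ (c ∷ p) []      = sym (+-identityʳ _)
c₀-+ (c ∷ p) (d ∷ q) = ≡⇒≈ (≡.sym (⊹-def c d))

c₀-· : ∀ c p → c₀ (c ·ᵀ p) ≈ c * c₀ p
c₀-· c []      = sym (zeroʳ c)
c₀-· c (d ∷ p) = ≡⇒≈ (≡.sym (∙-def c d))

c₀-* : ∀ p q → c₀ (p *ᵀ q) ≈ c₀ p * c₀ q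
c₀-* []      q = sym (zeroˡ _)
c₀-* (c ∷ p) q = trans (c₀-+ (c ·ᵀ q) (0ℝ ∷ p *ᵀ q)) (trans (+-identityʳ _) (c₀-· c q))

∑≈⅀ : ∀ {A : Set} (f : A → ℝ) l → ∑ (map f l) ≈ ⅀ l f
∑≈⅀ f []      = refl
∑≈⅀ f (x ∷ l) = trans (≡⇒≈ (≡.sym (⊹-def (f x) _))) (+-congˡ (∑≈⅀ f l))

Z≈⅀ : ∀ w → Z w ≈ ⅀ w (λ (q , k , adm) → fromℚ q * ζ k adm)
Z≈⅀ w = trans (∑≈⅀ _ w) (⅀-cong w (λ (q , k , adm) → ≡⇒≈ (≡.sym (∙-def (fromℚ q) (ζ k adm)))))

module Reg {_•_ : 𝔥¹ → 𝔥¹ → 𝔥¹} {Z• : 𝔥¹ → ℝ[T]} (isReg : IsRegularization _•_ Z•) where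
  open IsRegularization isReg
  private module Hom = RingMorphisms.IsRingHomomorphism isRingHomomorphism

  ρ : Index → ℝ
  ρ = regζ Z•

  ρ[_] : 𝔥¹ → ℝ
  ρ[ w ] = ⅀ w (λ (q , k) → fromℚ q * ρ k)

  linear : ∀ w → c₀ (Z• w) ≈ ρ[ w ]
  linear []            = c₀-cong (Z• []) [] Hom.0#-homo
  linear ((q , k) ∷ w) = begin
    c₀ (Z• ((q , k) ∷ w))                       ≈⟨ c₀-cong (Z• ((q , k) ∷ w)) (Z• ((q , k) ∷ []) +ᵀ Z• w) (Hom.+-homo ((q , k) ∷ []) w) ⟩
    c₀ (Z• ((q , k) ∷ []) +ᵀ Z• w)              ≈⟨ c₀-+ (Z• ((q , k) ∷ [])) (Z• w) ⟩
    c₀ (Z• ((q , k) ∷ [])) + c₀ (Z• w)          ≈⟨ +-cong head (linear w) ⟩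
    fromℚ q * ρ k + ρ[ w ] ∎
    where
    head : c₀ (Z• ((q , k) ∷ [])) ≈ fromℚ q * ρ k
    head = trans (≡⇒≈ (≡.cong (λ r → c₀ (Z• ((r , k) ∷ []))) (≡.sym (ℚ.*-identityʳ q))))
      (trans (c₀-cong (Z• (q · ⟨ k ⟩)) (fromℚ q ·ᵀ Z• ⟨ k ⟩) (·-homo q ⟨ k ⟩)) (c₀-· (fromℚ q) (Z• ⟨ k ⟩)))

  mult : ∀ u v → ρ[ u ] * ρ[ v ] ≈ ρ[ u • v ]
  mult u v = begin
    ρ[ u ] * ρ[ v ]            ≈⟨ *-cong (sym (linear u)) (sym (linear v)) ⟩
    c₀ (Z• u) * c₀ (Z• v)      ≈⟨ sym (c₀-* (Z• u) (Z• v)) ⟩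
    c₀ (Z• u *ᵀ Z• v)          ≈⟨ sym (c₀-cong (Z• (u • v)) (Z• u *ᵀ Z• v) (Hom.*-homo u v)) ⟩
    c₀ (Z• (u • v))            ≈⟨ linear (u • v) ⟩
    ρ[ u • v ] ∎

  ρ⟨_⟩ : ∀ k → ρ[ ⟨ k ⟩ ] ≈ ρ k
  ρ⟨ k ⟩ = trans (+-identityʳ _) (*-identityˡ _)

  ρ-[] : ρ [] ≈ 1#
  ρ-[] = c₀-cong (Z• ⟨ [] ⟩) (const 1ℝ) Hom.1#-homo

  ρ-1 : ρ (1⁺ ∷ []) ≈ 0#
  ρ-1 = c₀-cong (Z• ⟨ 1⁺ ∷ [] ⟩) T y↦T

  ρ-adm : ∀ {k} (adm : Admissible k) → ρ k ≈ ζ k adm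
  ρ-adm {k} adm = trans (c₀-cong (Z• ⟨ k ⟩) (const (Z ((1ℚ , k , adm) ∷ []))) (extends ((1ℚ , k , adm) ∷ [])))
    (trans (Z≈⅀ ((1ℚ , k , adm) ∷ [])) (trans (+-identityʳ _) (*-identityˡ _)))

⅀-map-const : ∀ {A : Set} (f : A → ℝ) q l → ⅀ (map (q ,_) l) (λ (r , x) → fromℚ r * f x) ≈ fromℚ q * ⅀ l f
⅀-map-const f q l = trans (⅀-map (q ,_) l _) (⅀-*ˡ l (fromℚ q) f)

⅀-bilinear : ∀ {A B X : Set} (m : A → B → List X) (f : X → ℝ) (p : Lin A) (p′ : Lin B) →
  ⅀ (bilinear m p p′) (λ (r , x) → fromℚ r * f x) ≈ ⅀ p (λ (q , a) → ⅀ p′ (λ (r , b) → fromℚ (q ℚ.* r) * ⅀ (m a b) f))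
⅀-bilinear m f p p′ = trans (⅀-concatMap _ p _) (⅀-cong p (λ (q , a) → trans (⅀-concatMap _ p′ _)
  (⅀-cong p′ (λ (r , b) → ⅀-map-const f (q ℚ.* r) (m a b)))))

module Reg∗ {Z∗ : 𝔥¹ → ℝ[T]} (isReg : IsRegularization _∗_ Z∗) where
  open Reg isReg public

  ρ-∗ : ∀ u v → ρ u * ρ v ≈ ⅀ (u ∗ʷ v) ρ
  ρ-∗ u v = begin
    ρ u * ρ v                        ≈⟨ *-cong (sym ρ⟨ u ⟩) (sym ρ⟨ v ⟩) ⟩
    ρ[ ⟨ u ⟩ ] * ρ[ ⟨ v ⟩ ]          ≈⟨ mult ⟨ u ⟩ ⟨ v ⟩ ⟩
    ρ[ ⟨ u ⟩ ∗ ⟨ v ⟩ ]          ≈⟨ ⅀-bilinear _∗ʷ_ ρ ⟨ u ⟩ ⟨ v ⟩ ⟩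
    fromℚ (1ℚ ℚ.* 1ℚ) * ⅀ (u ∗ʷ v) ρ + 0# + 0#  ≈⟨ trans (+-identityʳ _) (trans (+-identityʳ _) (*-identityˡ _)) ⟩
    ⅀ (u ∗ʷ v) ρ ∎

  α : Index → ℝ
  α l = ρ (reverse l)

  α-∗ : ∀ u v → α u * α v ≈ ⅀ (u ∗ʳ v) α
  α-∗ u v = trans (ρ-∗ (reverse u) (reverse v)) (trans (⅀-map reverse (reverse (reverse u) ∗ʳ reverse (reverse v)) ρ)
    (≡⇒≈ (≡.cong₂ (λ u v → ⅀ (u ∗ʳ v) α) (List.reverse-involutive u) (List.reverse-involutive v))))

module Regsh {Zsh : 𝔥¹ → ℝ[T]} (isReg : IsRegularization _sh¹_ Zsh) where
  open Reg isReg public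

  -- The value on words outside of 𝔥¹ is immaterial.
  ρᵂ : Word → ℝ
  ρᵂ w = maybe′ ρ 0ℝ (unzs w)

  ρᵂ-π : ∀ p → ρ[ π p ] ≈ ⅀ p (λ (q , w) → fromℚ q * ρᵂ w)
  ρᵂ-π []            = refl
  ρᵂ-π ((q , w) ∷ p) with unzs w
  ... | just k  = +-congˡ (ρᵂ-π p)
  ... | nothing = trans (ρᵂ-π p) (sym (trans (+-congʳ (zeroʳ _)) (+-identityˡ _)))

  ρᵂ-zs : ∀ k → ρᵂ (zs k) ≈ ρ k
  ρᵂ-zs k rewrite unzs-zs k = refl

  ρ-sh : ∀ u v → ρ[ u ] * ρ[ v ] ≈ ⅀ (ι u) (λ (q , a) → ⅀ (ι v) (λ (r , b) → fromℚ (q ℚ.* r) * ⅀ (a shʷ b) ρᵂ))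
  ρ-sh u v = trans (mult u v) (trans (ρᵂ-π (ι u sh ι v)) (⅀-bilinear _shʷ_ ρᵂ (ι u) (ι v)))

  β : Index → ℝ
  β l = ρ (reverse l)

  βᵂ : Word → ℝ
  βᵂ w = ρᵂ (reverse w)

open ℚ-Lemmas using (int; u; int*u)
open PL using (pre; c)
open Words ℚ.+-*-commutativeRing φℚ
module Wℝ = Words ℝ-commutativeRing φℝ

⟶-⅀ : ∀ {A : Set} (f : ℕ → A → ℚ) (g : A → ℝ) {l} → All (λ x → (λ N → f N x) ⟶ g x) l → (λ N → Q.⅀ l (f N)) ⟶ ⅀ l g
⟶-⅀ f g []       = ⟶-const 0ℚ
⟶-⅀ f g (h ∷ hs) = ⟶-+ h (⟶-⅀ f g hs)

⟶-sub : ∀ {s t b a c} → s ⟶ a → t ⟶ c → (∀ n → s n ≡ b n ℚ.+ t n) → b ⟶ a - c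
⟶-sub {s} {t} {b} hs ht e = ⟶-≡ (λ n → ≡.sym (≡.trans (≡.cong (ℚ._- t n) (e n))
  (≡.trans (ℚ.+-assoc (b n) (t n) (ℚ.- t n)) (≡.trans (≡.cong (b n ℚ.+_) (ℚ.+-inverseʳ (t n))) (ℚ.+-identityʳ (b n)))))) (⟶-+ hs (⟶-neg ht))

fromℚ-cancel : ∀ n {x} → fromℚ (int (suc n)) * x ≈ 0# → x ≈ 0#
fromℚ-cancel n {x} e = begin
  x                                      ≈⟨ sym (*-identityˡ x) ⟩
  fromℚ 1ℚ * x                           ≈⟨ *-congʳ (trans (≡⇒≈ (≡.cong fromℚ (≡.trans (≡.sym (int*u n)) (ℚ.*-comm (int (suc n)) (u n))))) (fromℚ-* (u n) (int (suc n)))) ⟩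
  fromℚ (u n) * fromℚ (int (suc n)) * x  ≈⟨ *-assoc _ _ _ ⟩
  fromℚ (u n) * (fromℚ (int (suc n)) * x) ≈⟨ trans (*-congˡ e) (zeroʳ _) ⟩
  0# ∎

module _ {_•_ : 𝔥¹ → 𝔥¹ → 𝔥¹} {Z• : 𝔥¹ → ℝ[T]} (isReg : IsRegularization _•_ Z•) where
  open Reg isReg

  η⟶ρ : ∀ m l → (λ N → η N ((2+⁺ m) ∷ l)) ⟶ ρ (reverse ((2+⁺ m) ∷ l))
  η⟶ρ m l = ⟶-≋ (sym (ρ-adm adm)) (⟶-≡ (λ N → ≡.cong (η N) (≡.sym (List.reverse-involutive ((2+⁺ m) ∷ l)))) (⟶-self (ζ _ adm)))
    where adm = admissible-reverse m l

  admPart-⟶ : ∀ k → (λ N → QS.admPart (η N) k) ⟶ admPart (ρ ∘ reverse) k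
  admPart-⟶ []            = ⟶-≋ (sym ρ-[]) (⟶-const 1ℚ)
  admPart-⟶ (1⁺ ∷ k)      = ⟶-const 0ℚ
  admPart-⟶ ((2+⁺ m) ∷ k) = η⟶ρ m k

module Reg∗-Limit {Z∗ : 𝔥¹ → ℝ[T]} (isReg : IsRegularization _∗_ Z∗) where
  open Reg∗ isReg
  open Character α ρ-[] α-∗ public

  A▷η⟶ : ∀ k → (λ N → (Cη.A N QS.▷ η N) k) ⟶ (A ▷ α) k
  A▷η⟶ k = ⟶-≋ (sym (A▷χ k)) (⟶-≡ (λ N → Cη.A▷χ N k) (eval⟶ (reg 0 k)))
    where
    eval⟶ : ∀ l → (λ N → QS.eval (QS.admPart (η N)) l) ⟶ eval (admPart α) l
    eval⟶ []            = ⟶-const 0ℚ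
    eval⟶ ((q , w) ∷ l) = ⟶-+ (⟶-* (⟶-const q) (admPart-⟶ isReg w)) (eval⟶ l)

module Regsh-Limit {Zsh : 𝔥¹ → ℝ[T]} (isReg : IsRegularization _sh¹_ Zsh) where
  open Regsh isReg

  βᵂ-zsʳ : ∀ l → βᵂ (zsʳ l) ≈ β l
  βᵂ-zsʳ l = trans (≡⇒≈ (≡.cong ρᵂ (≡.trans (≡.cong reverse (≡.sym (reverse-zs l))) (List.reverse-involutive (zs (reverse l)))))) (ρᵂ-zs (reverse l))

  β-sh : ∀ u v → β u * β v ≈ ⅀ (zsʳ u shʳ zsʳ v) βᵂ
  β-sh u v = begin
    β u * β v                    ≈⟨ *-cong (sym ρ⟨ reverse u ⟩) (sym ρ⟨ reverse v ⟩) ⟩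
    ρ[ ⟨ reverse u ⟩ ] * ρ[ ⟨ reverse v ⟩ ]  ≈⟨ ρ-sh ⟨ reverse u ⟩ ⟨ reverse v ⟩ ⟩
    fromℚ (1ℚ ℚ.* 1ℚ) * ⅀ (zs (reverse u) shʷ zs (reverse v)) ρᵂ + 0# + 0#  ≈⟨ trans (+-identityʳ _) (trans (+-identityʳ _) (*-identityˡ _)) ⟩
    ⅀ (zs (reverse u) shʷ zs (reverse v)) ρᵂ  ≈⟨ ⅀-map reverse (reverse (zs (reverse u)) shʳ reverse (zs (reverse v))) ρᵂ ⟩
    ⅀ (reverse (zs (reverse u)) shʳ reverse (zs (reverse v))) βᵂ
      ≈⟨ ≡⇒≈ (≡.cong₂ (λ a b → ⅀ (a shʳ b) βᵂ) (reverse-zs u) (reverse-zs v)) ⟩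
    ⅀ (zsʳ u shʳ zsʳ v) βᵂ ∎

  private
    insertY : ∀ n (f : Word → ℝ) → ⅀ ((𝕪 ∷ []) shʳ replicate n 𝕪) f ≈ fromℚ (int (suc n)) * f (replicate (suc n) 𝕪)
    insertY zero    f = trans (+-identityʳ _) (sym (*-identityˡ _))
    insertY (suc n) f = begin
      f (𝕪 ∷ 𝕪 ∷ replicate n 𝕪) + ⅀ (map (𝕪 ∷_) ((𝕪 ∷ []) shʳ replicate n 𝕪)) f
        ≈⟨ +-congˡ (trans (⅀-map (𝕪 ∷_) ((𝕪 ∷ []) shʳ replicate n 𝕪) f) (insertY n (λ w → f (𝕪 ∷ w)))) ⟩
      x + fromℚ (int (suc n)) * x                 ≈⟨ +-congʳ (sym (*-identityˡ _)) ⟩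
      1# * x + fromℚ (int (suc n)) * x            ≈⟨ sym (distribʳ _ _ _) ⟩
      (1# + fromℚ (int (suc n))) * x              ≈⟨ *-congʳ (sym (fromℚ-+ 1ℚ (int (suc n)))) ⟩
      fromℚ (int (suc (suc n))) * x ∎
      where x = f (replicate (suc (suc n)) 𝕪)

  -- Because y sh y^n = (n + 1) y^{n+1} and y is sent to T, evaluated at 0.
  β-ones : ∀ n → β (ones (suc n)) ≈ 0#
  β-ones n = fromℚ-cancel n (begin
    fromℚ (int (suc n)) * β (ones (suc n))
      ≈⟨ *-congˡ (trans (sym (βᵂ-zsʳ (ones (suc n)))) (≡⇒≈ (≡.cong βᵂ (zsʳ-ones (suc n))))) ⟩
    fromℚ (int (suc n)) * βᵂ (replicate (suc n) 𝕪)   ≈⟨ sym (insertY n βᵂ) ⟩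
    ⅀ ((𝕪 ∷ []) shʳ replicate n 𝕪) βᵂ                 ≈⟨ ≡⇒≈ (≡.cong (λ w → ⅀ ((𝕪 ∷ []) shʳ w) βᵂ) (≡.sym (zsʳ-ones n))) ⟩
    ⅀ ((𝕪 ∷ []) shʳ zsʳ (ones n)) βᵂ                  ≈⟨ sym (β-sh (1⁺ ∷ []) (ones n)) ⟩
    β (1⁺ ∷ []) * β (ones n)                          ≈⟨ trans (*-congʳ ρ-1) (zeroˡ _) ⟩
    0# ∎)

  private
    L : ℕ → Word → ℚ
    L N = Cη.A N ▷ʷ (λ w → pre (c w) N)

    Good : Word → Set
    Good w = (λ N → L N w) ⟶ βᵂ w

    good-𝕩 : ∀ {v} → EndsY v → Good (𝕩 ∷ v)
    good-𝕩 e with EndsY⇒zsʳ e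
    ... | (1+ m) , l , ≡.refl = ⟶-≋ (sym (βᵂ-zsʳ ((2+⁺ m) ∷ l)))
      (⟶-≡ (λ N → ≡.trans (ℚ.*-identityˡ (pre (c (zsʳ ((2+⁺ m) ∷ l))) N)) (pre-c ((2+⁺ m) ∷ l) N)) (η⟶ρ isReg m l))

    shift-𝕪 : ∀ i w → replicate i 𝕪 ++ 𝕪 ∷ w ≡ 𝕪 ∷ replicate i 𝕪 ++ w
    shift-𝕪 zero    w = ≡.refl
    shift-𝕪 (suc i) w = ≡.cong (𝕪 ∷_) (shift-𝕪 i w)

    H-ones : ∀ n → H (replicate n 𝕪)
    H-ones zero    = nil
    H-ones (suc n) = ends (endsY-ones n)

    -- Both sides are zero: the left by `defect-null`, the right because β vanishes at powers of y
    -- and is multiplicative.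
    base : ∀ {v} → EndsY v → ∀ n → (λ N → Q.⅀ (replicate (suc n) 𝕪 shʳ (𝕩 ∷ v)) (L N)) ⟶ ⅀ (replicate (suc n) 𝕪 shʳ (𝕩 ∷ v)) βᵂ
    base {v} e n = ⟶-≋ (sym rhs) (⟶-≡ lhs (null⇒⟶0 (defect-null e n)))
      where
      lhs : ∀ N → Q.⅀ (replicate (suc n) 𝕪 shʳ (𝕩 ∷ v)) (L N) ≡ defect v n N
      lhs N = ≡.trans (sh-▷ʷ (Cη.A N) (λ w → pre (c w) N) v (suc n)) (≡.trans
        (Q.⊛-cong {Cη.A N} (λ _ → ≡.refl) (λ m → ≡.trans (PL.pre-sh (H-ones m) (ends (there e)) N) (Q.⊛-cong {c (𝕩 ∷ v)} (λ _ → ≡.refl) (λ M → pre-ones M m) N)) (suc n))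
        (swap (Cη.A N) (c (𝕩 ∷ v)) eη (suc n) N))
        where
        pre-ones : ∀ M m → pre (c (replicate m 𝕪)) M ≡ eη M m
        pre-ones M m = ≡.trans (≡.cong (λ w → pre (c w) M) (≡.sym (zsʳ-ones m))) (pre-c (ones m) M)
        -- One Cauchy product concerns the variable u, the other the variable z of the
        -- polylogarithms, so they can be exchanged.
        swap : ∀ a b (F : ℕ → ℕ → ℚ) m N → (a Q.⊛ (λ m′ → (b Q.⊛ (λ M → F M m′)) N)) m ≡ (b Q.⊛ (λ M → (a Q.⊛ F M) m)) N
        swap a b F m zero    = Q.⊛-*ʳ (b 0) a (F 0) m
        swap a b F m (suc N) = ≡.trans (Q.⊛-+ʳ a (λ m′ → b 0 ℚ.* F (suc N) m′) (λ m′ → (Q.shift b Q.⊛ (λ M → F M m′)) N) m)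
          (≡.cong₂ ℚ._+_ (Q.⊛-*ʳ (b 0) a (F (suc N)) m) (swap a (Q.shift b) F m N))
      rhs : ⅀ (replicate (suc n) 𝕪 shʳ (𝕩 ∷ v)) βᵂ ≈ 0#
      rhs with EndsY⇒zsʳ e
      ... | (1+ m) , l , ≡.refl = trans (≡⇒≈ (≡.cong (λ w → ⅀ (w shʳ zsʳ ((2+⁺ m) ∷ l)) βᵂ) (≡.sym (zsʳ-ones (suc n)))))
        (trans (sym (β-sh (ones (suc n)) ((2+⁺ m) ∷ l))) (trans (*-congʳ (β-ones n)) (zeroˡ _)))

    -- Induction on the number of leading y, by y^{i+1} (y^m sh x v) = y^i (y^{m+1} sh x v) - y^i x
    -- (y^{m+1} sh v). Starting with `base` at i = 0, this moves all n + 1 letters y to the front,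
    -- and the subtracted words have only i ≤ n leading y.
    good : ∀ n → Acc ℕ._<_ n → ∀ {v} → EndsY v → Good (replicate n 𝕪 ++ 𝕩 ∷ v)
    good zero    _         e = good-𝕩 e
    good (suc n) (acc rec) {v} e = ⟶-≋ (+-identityʳ _) (⟶-≡ (λ N → ≡.sym (ℚ.+-identityʳ _)) (insert≤ (suc n) 0 (ℕ.+-identityʳ (suc n))))
      where
      f : ℕ → (ℕ → Word → ℚ)
      f i N w = L N (replicate i 𝕪 ++ w)
      g : ℕ → Word → ℝ
      g i w = βᵂ (replicate i 𝕪 ++ w)
      insert≤ : ∀ i m → i ℕ.+ m ≡ suc n → (λ N → Q.⅀ (replicate m 𝕪 shʳ (𝕩 ∷ v)) (f i N)) ⟶ ⅀ (replicate m 𝕪 shʳ (𝕩 ∷ v)) (g i)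
      insert≤ zero    .(suc n) ≡.refl = base e n
      insert≤ (suc i) m       eq     = ⟶-≋ limit (⟶-sub (insert≤ i (suc m) (≡.trans (ℕ.+-suc i m) eq)) rest split)
        where
        U = replicate m 𝕪 shʳ (𝕩 ∷ v)
        V = replicate (suc m) 𝕪 shʳ v
        rest : (λ N → Q.⅀ V (λ w → f i N (𝕩 ∷ w))) ⟶ ⅀ V (λ w → g i (𝕩 ∷ w))
        rest = ⟶-⅀ _ _ (All.map (λ h → good i (rec (ℕ.≤-trans (ℕ.m≤m+n (suc i) m) (ℕ.≤-reflexive eq))) h) (endsY-sh (endsY-ones m) e))
        split : ∀ N → Q.⅀ (replicate (suc m) 𝕪 shʳ (𝕩 ∷ v)) (f i N) ≡ Q.⅀ U (f (suc i) N) ℚ.+ Q.⅀ V (λ w → f i N (𝕩 ∷ w))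
        split N = ≡.trans (sh-cons 𝕪 (replicate m 𝕪) 𝕩 v (f i N))
          (≡.cong (ℚ._+ Q.⅀ V (λ w → f i N (𝕩 ∷ w))) (Q.⅀-cong U (λ w → ≡.cong (L N) (shift-𝕪 i w))))
        limit : ⅀ (replicate (suc m) 𝕪 shʳ (𝕩 ∷ v)) (g i) - ⅀ V (λ w → g i (𝕩 ∷ w)) ≈ ⅀ U (g (suc i))
        limit = begin
          ⅀ (replicate (suc m) 𝕪 shʳ (𝕩 ∷ v)) (g i) - ⅀ V (λ w → g i (𝕩 ∷ w))
            ≈⟨ +-congʳ (Wℝ.sh-cons 𝕪 (replicate m 𝕪) 𝕩 v (g i)) ⟩
          ⅀ U (λ w → g i (𝕪 ∷ w)) + ⅀ V (λ w → g i (𝕩 ∷ w)) - ⅀ V (λ w → g i (𝕩 ∷ w))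
            ≈⟨ solve 2 (λ a b → a :+ b :- b := a) refl _ _ ⟩
          ⅀ U (λ w → g i (𝕪 ∷ w))
            ≈⟨ ⅀-cong U (λ w → ≡⇒≈ (≡.cong βᵂ (shift-𝕪 i w))) ⟩
          ⅀ U (g (suc i)) ∎

  A▷η⟶β : ∀ l → (λ N → (Cη.A N QS.▷ η N) l) ⟶ β l
  A▷η⟶β l = ⟶-≋ (βᵂ-zsʳ l) (⟶-≡ (λ N → ≡.sym (≡.trans (▷ʷ-zsʳ (Cη.A N) (λ w → pre (c w) N) l) (QS.▷-cong (λ _ → ≡.refl) (λ k → pre-c k N) l))) good-zsʳ)
    where
    L-ones : ∀ n N → L N (replicate n 𝕪) ≡ Q.δ₀ n
    L-ones n N = ≡.trans (go (Cη.A N) n) (Cη.A⊛E N n)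
      where
      pre-ones : ∀ m → pre (c (replicate m 𝕪)) N ≡ eη N m
      pre-ones m = ≡.trans (≡.cong (λ w → pre (c w) N) (≡.sym (zsʳ-ones m))) (pre-c (ones m) N)
      go : ∀ a m → (a ▷ʷ (λ w → pre (c w) N)) (replicate m 𝕪) ≡ (a Q.⊛ eη N) m
      go a zero    = ≡.cong (a 0 ℚ.*_) (pre-ones 0)
      go a (suc m) = ≡.cong₂ ℚ._+_ (≡.cong (a 0 ℚ.*_) (pre-ones (suc m))) (go (Q.shift a) m)
    good-ones : ∀ n → Good (replicate n 𝕪)
    good-ones zero    = ⟶-≋ (sym ρ-[]) (⟶-≡ (L-ones 0) (⟶-const 1ℚ))
    good-ones (suc n) = ⟶-≋ (sym (trans (≡⇒≈ (≡.cong βᵂ (≡.sym (zsʳ-ones (suc n))))) (trans (βᵂ-zsʳ (ones (suc n))) (β-ones n)))) (⟶-≡ (L-ones (suc n)) (⟶-const 0ℚ))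
    good-zsʳ : Good (zsʳ l)
    good-zsʳ with zsʳ-shape l
    ... | inj₁ (n , eq)         = ≡.subst Good (≡.sym eq) (good-ones n)
    ... | inj₂ (n , v , e , eq) = ≡.subst Good (≡.sym eq) (good n (<-wellFounded n) e)

module Comparison {Z∗ Zsh : 𝔥¹ → ℝ[T]} (reg∗ : IsRegularization _∗_ Z∗) (regsh : IsRegularization _sh¹_ Zsh) where
  open Reg∗ reg∗ using (α)
  open Regsh regsh using (β)
  open Reg∗-Limit reg∗ using (A; A▷η⟶)
  open Regsh-Limit regsh using (A▷η⟶β)

  β≈A▷α : ∀ l → β l ≈ (A ▷ α) l
  β≈A▷α l = ⟶-unique (A▷η⟶β l) (A▷η⟶ l)

-- Even zeta values

-- The sum of k i j over i + j = n.
AD : (ℕ → ℕ → ℝ) → ℕ → ℝ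
AD k zero    = k 0 0
AD k (suc n) = k 0 (suc n) + AD (λ i j → k (suc i) j) n

AD-cong : ∀ {k l} n → (∀ i j → i ℕ.+ j ≡ n → k i j ≈ l i j) → AD k n ≈ AD l n
AD-cong zero    e = e 0 0 ≡.refl
AD-cong (suc n) e = +-cong (e 0 (suc n) ≡.refl) (AD-cong n (λ i j h → e (suc i) j (≡.cong suc h)))

AD-+ : ∀ k l n → AD (λ i j → k i j + l i j) n ≈ AD k n + AD l n
AD-+ k l zero    = refl
AD-+ k l (suc n) = trans (+-congˡ (AD-+ _ _ n)) (interchange _ _ _ _)

AD-neg : ∀ k n → AD (λ i j → - k i j) n ≈ - AD k n
AD-neg k zero    = refl
AD-neg k (suc n) = trans (+-congˡ (AD-neg _ n)) (solve 2 (λ a b → :- a :+ :- b := :- (a :+ b)) refl _ _)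

AD-last : ∀ k n → AD k (suc n) ≈ AD (λ i j → k i (suc j)) n + k (suc n) 0
AD-last k zero    = refl
AD-last k (suc n) = trans (+-congˡ (AD-last (λ i j → k (suc i) j) n)) (sym (+-assoc _ _ _))

AD-swap : ∀ k n → AD (λ i j → k j i) n ≈ AD k n
AD-swap k zero    = refl
AD-swap k (suc n) = trans (+-congˡ (AD-swap (λ i j → k i (suc j)) n)) (trans (+-comm _ _) (sym (AD-last k n)))

AD-sg- : ∀ (k : ℕ → ℕ → ℝ) n → AD (λ i j → - sg j * k i j) n ≈ - AD (λ i j → sg j * k i j) n
AD-sg- k n = trans (AD-cong n (λ i j _ → solve 2 (λ s x → (:- s) :* x := :- (s :* x)) refl (sg j) (k i j))) (AD-neg (λ i j → sg j * k i j) n)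

AD-const : ∀ x n → AD (λ _ _ → x) n ≈ fromℚ (int (suc n)) * x
AD-const x zero    = sym (*-identityˡ x)
AD-const x (suc n) = trans (+-cong (sym (*-identityˡ x)) (AD-const x n)) (trans (sym (distribʳ x _ _)) (*-congʳ (sym (fromℚ-+ 1ℚ (int (suc n))))))

AD-⊛ : ∀ a b n → (a ⊛ b) n ≈ AD (λ i j → a i * b j) n
AD-⊛ a b zero    = refl
AD-⊛ a b (suc n) = +-congˡ (AD-⊛ (shift a) b n)

AD-closed : ∀ {P : ℝ → Set} → (∀ {a b} → P a → P b → P (a + b)) → ∀ {k} n → (∀ i j → i ℕ.+ j ≡ n → P (k i j)) → P (AD k n)
AD-closed {P} c zero    h = h 0 0 ≡.refl
AD-closed {P} c (suc n) h = c (h 0 (suc n) ≡.refl) (AD-closed {P} c n (λ i j e → h (suc i) j (≡.cong suc e)))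

⅀-closed : ∀ {P : ℝ → Set} → P 0# → (∀ {a b} → P a → P b → P (a + b)) → ∀ {A : Set} {f : A → ℝ} {l} → All (λ x → P (f x)) l → P (⅀ l f)
⅀-closed {P} z c []       = z
⅀-closed {P} z c (h ∷ hs) = c h (⅀-closed {P} z c hs)

data Admʳ : Index → Set where
  []ᵃ  : Admʳ []
  _∷ᵃ_ : ∀ m l → Admʳ ((2+⁺ m) ∷ l)

reverse-Admʳ : ∀ {k} → Admissible k → Admʳ (reverse k)
reverse-Admʳ empty                    = []ᵃ
reverse-Admʳ (snoc ks {2+⁺ m} _) = ≡.subst Admʳ (≡.sym (rev-snoc ks (2+⁺ m))) (m ∷ᵃ reverse ks)
reverse-Admʳ (snoc ks {1⁺} (ℕ.s≤s ()))

Admʳ-∗ : ∀ {u v} → Admʳ u → Admʳ v → All Admʳ (u ∗ʳ v)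
Admʳ-∗ []ᵃ        hv         = hv ∷ []
Admʳ-∗ (m ∷ᵃ l)   []ᵃ        = (m ∷ᵃ l) ∷ []
Admʳ-∗ (m ∷ᵃ u)   (n ∷ᵃ v)   = All.++⁺ (All.map⁺ (All.universal (m ∷ᵃ_) (u ∗ʳ ((2+⁺ n) ∷ v))))
  (All.++⁺ (All.map⁺ (All.universal (n ∷ᵃ_) (((2+⁺ m) ∷ u) ∗ʳ v))) (All.map⁺ (All.universal (λ w → (m ℕ.+ suc (suc n)) ∷ᵃ w) (u ∗ʳ v))))

-- The sum over the insertions of x into d^j.
ins : ℕ⁺ → ℕ⁺ → ℕ → (Index → ℝ) → ℝ
ins x d zero    f = f (x ∷ [])
ins x d (suc j) f = f (x ∷ replicate (suc j) d) + ins x d j (λ w → f (d ∷ w))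

private
  -- Insertion into one d fewer, for the terms in which x has merged with a d; for j = 0 there is no
  -- d to merge with.
  ins⁻ : ℕ⁺ → ℕ⁺ → ℕ → (Index → ℝ) → ℝ
  ins⁻ x d zero    f = 0#
  ins⁻ x d (suc j) f = ins x d j f

  ∗-ins⁻ : ∀ x d j f → ⅀ ((x ∷ []) ∗ʳ replicate j d) f ≈ ins x d j f + ins⁻ (x ⊕ d) d j f
  ∗-ins⁻ x d zero    f = refl
  ∗-ins⁻ x d (suc j) f = begin
    f (x ∷ d ∷ D′) + ⅀ (map (d ∷_) ((x ∷ []) ∗ʳ D′) ++ ((x ⊕ d) ∷ D′) ∷ []) f
      ≈⟨ +-congˡ (trans (⅀-++ (map (d ∷_) ((x ∷ []) ∗ʳ D′)) _ f) (+-cong (trans (⅀-map (d ∷_) ((x ∷ []) ∗ʳ D′) f) (∗-ins⁻ x d j _)) (+-identityʳ _))) ⟩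
    f (x ∷ d ∷ D′) + (ins x d j fd + ins⁻ (x ⊕ d) d j fd + f ((x ⊕ d) ∷ D′))
      ≈⟨ solve 4 (λ a b c e → a :+ (b :+ c :+ e) := (a :+ b) :+ (e :+ c)) refl _ _ _ _ ⟩
    ins x d (suc j) f + (f ((x ⊕ d) ∷ D′) + ins⁻ (x ⊕ d) d j fd)
      ≈⟨ +-congˡ (last j) ⟩
    ins x d (suc j) f + ins (x ⊕ d) d j f ∎
    where
    D′ = replicate j d
    fd : Index → ℝ
    fd w = f (d ∷ w)
    last : ∀ j → f ((x ⊕ d) ∷ replicate j d) + ins⁻ (x ⊕ d) d j fd ≈ ins (x ⊕ d) d j f
    last zero    = +-identityʳ _
    last (suc j) = refl

∗-ins : ∀ x d j f → ⅀ ((x ∷ []) ∗ʳ replicate (suc j) d) f ≈ ins x d (suc j) f + ins (x ⊕ d) d j f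
∗-ins x d j f = ∗-ins⁻ x d (suc j) f

ins-same : ∀ d j f → ins d d j f ≈ fromℚ (int (suc j)) * f (replicate (suc j) d)
ins-same d zero    f = sym (*-identityˡ _)
ins-same d (suc j) f = trans (+-cong (sym (*-identityˡ _)) (ins-same d j _))
  (trans (sym (distribʳ _ _ _)) (*-congʳ (sym (fromℚ-+ 1ℚ (int (suc j))))))

-- In ∑_{i+j=n} (-1)^j 1^i ∗ 1^j the terms which start with 1 cancel, and those which start with 2 reproduce the sum.
module Ones where
  k : (Index → ℝ) → ℕ → ℕ → ℝ
  k f i j = ⅀ (ones i ∗ʳ ones j) f

  S : (Index → ℝ) → ℕ → ℝ
  S f = AD (λ i j → sg j * k f i j)

  private
    pA pB pC : (Index → ℝ) → ℕ → ℕ → ℝ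
    pA f zero    j       = 0#
    pA f (suc i) j       = k (λ w → f (1⁺ ∷ w)) i j
    pB f i       zero    = 0#
    pB f i       (suc j) = k (λ w → f (1⁺ ∷ w)) i j
    pC f zero    j       = 0#
    pC f (suc i) zero    = 0#
    pC f (suc i) (suc j) = k (λ w → f ((2+⁺ 0) ∷ w)) i j

    -- The three parts are distinguished by the origin of the first entry: left, right or merged.
    -- The hypothesis excludes i = j = 0, where there is no first entry.
    k-split : ∀ f i j {n} → i ℕ.+ j ≡ suc n → k f i j ≈ pA f i j + (pB f i j + pC f i j)
    k-split f zero    (suc j)       _ = sym (trans (+-identityˡ _) (+-identityʳ _))
    k-split f (suc zero)    zero    _ = sym (trans (+-congˡ (+-identityˡ _)) (+-identityʳ _))
    k-split f (suc (suc i)) zero    _ = sym (trans (+-congˡ (+-identityˡ _)) (+-identityʳ _))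
    k-split f (suc i) (suc j) _ = trans (⅀-++ (map (1⁺ ∷_) (ones i ∗ʳ ones (suc j))) _ f)
      (+-cong (⅀-map (1⁺ ∷_) (ones i ∗ʳ ones (suc j)) f)
        (trans (⅀-++ (map (1⁺ ∷_) (ones (suc i) ∗ʳ ones j)) _ f)
          (+-cong (⅀-map (1⁺ ∷_) (ones (suc i) ∗ʳ ones j) f) (⅀-map ((2+⁺ 0) ∷_) (ones i ∗ʳ ones j) f))))

    f1 f2 : (Index → ℝ) → Index → ℝ
    f1 f w = f (1⁺ ∷ w)
    f2 f w = f ((2+⁺ 0) ∷ w)

    SA : ∀ f n → AD (λ i j → sg j * pA f i j) (suc n) ≈ S (f1 f) n
    SA f n = trans (+-congʳ (zeroʳ _)) (+-identityˡ _)

    SB : ∀ f n → AD (λ i j → sg j * pB f i j) (suc n) ≈ - S (f1 f) n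
    SB f n = trans (AD-last (λ i j → sg j * pB f i j) n) (trans (+-congˡ (zeroʳ _)) (trans (+-identityʳ _) (AD-sg- (k (f1 f)) n)))

    SC : ∀ f n → AD (λ i j → sg j * pC f i j) (suc (suc n)) ≈ - S (f2 f) n
    SC f n = trans (+-congʳ (zeroʳ _)) (trans (+-identityˡ _) (trans (AD-last (λ i j → sg j * pC f (suc i) j) n) (trans (+-congˡ (zeroʳ _)) (trans (+-identityʳ _) (AD-sg- (k (f2 f)) n)))))

    S-split : ∀ f n → S f (suc n) ≈ AD (λ i j → sg j * pC f i j) (suc n)
    S-split f n = begin
      S f (suc n)
        ≈⟨ AD-cong {λ i j → sg j * k f i j} {λ i j → sg j * pA f i j + (sg j * pB f i j + sg j * pC f i j)} (suc n) (λ i j e → trans (*-congˡ (k-split f i j e)) (trans (distribˡ _ _ _) (+-congˡ (distribˡ _ _ _)))) ⟩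
      AD (λ i j → sg j * pA f i j + (sg j * pB f i j + sg j * pC f i j)) (suc n)
        ≈⟨ trans (AD-+ (λ i j → sg j * pA f i j) (λ i j → sg j * pB f i j + sg j * pC f i j) (suc n)) (+-congˡ (AD-+ (λ i j → sg j * pB f i j) (λ i j → sg j * pC f i j) (suc n))) ⟩
      AD (λ i j → sg j * pA f i j) (suc n) + (AD (λ i j → sg j * pB f i j) (suc n) + AD (λ i j → sg j * pC f i j) (suc n))
        ≈⟨ +-cong (SA f n) (+-congʳ (SB f n)) ⟩
      S (f1 f) n + (- S (f1 f) n + AD (λ i j → sg j * pC f i j) (suc n))
        ≈⟨ solve 2 (λ a b → a :+ (:- a :+ b) := b) refl _ _ ⟩
      AD (λ i j → sg j * pC f i j) (suc n) ∎

  S-0 : ∀ f → S f 0 ≈ f []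
  S-0 f = trans (*-identityˡ _) (+-identityʳ _)

  S-1 : ∀ f → S f 1 ≈ 0#
  S-1 f = trans (S-split f 0) (trans (+-cong (zeroʳ _) (zeroʳ _)) (+-identityˡ _))

  S-+2 : ∀ f n → S f (suc (suc n)) ≈ - S (λ w → f ((2+⁺ 0) ∷ w)) n
  S-+2 f n = trans (S-split f (suc n)) (SC f n)

module DepthTwo where
  word : ℕ → Word
  word a = replicate a 𝕩 ++ 𝕪 ∷ []

  k : (Word → ℝ) → ℕ → ℕ → ℝ
  k f a b = ⅀ (word a shʳ word b) f

  private
    fx : (Word → ℝ) → Word → ℝ
    fx f w = f (𝕩 ∷ w)

    pA pB : (Word → ℝ) → ℕ → ℕ → ℝ
    pA f zero    b       = f (𝕪 ∷ word b)
    pA f (suc a) b       = k (fx f) a b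
    pB f a       zero    = f (𝕪 ∷ word a)
    pB f a       (suc b) = k (fx f) a b

    shʳ-[]′ : ∀ w f → ⅀ (w shʳ []) f ≈ f w
    shʳ-[]′ []      f = +-identityʳ _
    shʳ-[]′ (_ ∷ _) f = +-identityʳ _

    k-split : ∀ f a b → k f a b ≈ pA f a b + pB f a b
    k-split f zero    zero    = trans (Wℝ.sh-cons 𝕪 [] 𝕪 [] f) (+-cong (+-identityʳ _) (+-identityʳ _))
    k-split f zero    (suc b) = trans (Wℝ.sh-cons 𝕪 [] 𝕩 (word b) f) (+-congʳ (+-identityʳ _))
    k-split f (suc a) zero    = trans (Wℝ.sh-cons 𝕩 (word a) 𝕪 [] f) (+-congˡ (shʳ-[]′ (word (suc a)) (λ w → f (𝕪 ∷ w))))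
    k-split f (suc a) (suc b) = Wℝ.sh-cons 𝕩 (word a) 𝕩 (word b) f

  -- The terms which start with x cancel.
  alternating : ∀ f N → AD (λ a b → sg b * k f a b) N ≈ (1# + sg N) * f (𝕪 ∷ word N)
  alternating f zero    = trans (*-identityˡ _) (trans (k-split f 0 0)
    (trans (+-cong (sym (*-identityˡ _)) (sym (*-identityˡ _))) (sym (distribʳ _ _ _))))
  alternating f (suc N) = begin
    AD (λ a b → sg b * k f a b) (suc N)
      ≈⟨ AD-cong {λ a b → sg b * k f a b} {λ a b → sg b * pA f a b + sg b * pB f a b} (suc N) (λ a b _ → trans (*-congˡ (k-split f a b)) (distribˡ _ _ _)) ⟩
    AD (λ a b → sg b * pA f a b + sg b * pB f a b) (suc N)
      ≈⟨ AD-+ (λ a b → sg b * pA f a b) (λ a b → sg b * pB f a b) (suc N) ⟩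
    AD (λ a b → sg b * pA f a b) (suc N) + AD (λ a b → sg b * pB f a b) (suc N)
      ≈⟨ +-congˡ (trans (AD-last (λ a b → sg b * pB f a b) N) (+-congʳ (AD-sg- (k (fx f)) N))) ⟩
    (sg (suc N) * y + S) + (- S + 1# * y)
      ≈⟨ solve 4 (λ s y z o → (s :* y :+ z) :+ (:- z :+ o :* y) := (o :+ s) :* y) refl _ _ _ _ ⟩
    (1# + sg (suc N)) * y ∎
    where
    y = f (𝕪 ∷ word (suc N))
    S = AD (λ a b → sg b * k (fx f) a b) N

  -- The single y has N + 2 places in x^N y. The two next to the final y give the same word, whence
  -- the additional summand.
  single : ∀ f N → k f 0 N ≈ AD (λ i j → f (replicate i 𝕩 ++ 𝕪 ∷ word j)) N + f (replicate N 𝕩 ++ 𝕪 ∷ word 0)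
  single f zero    = k-split f 0 0
  single f (suc N) = trans (k-split f 0 (suc N)) (trans (+-congˡ (single (fx f) N)) (sym (+-assoc _ _ _)))

-- Membership in 𝒵 and in the ideal ζ(2)𝒵

record 𝒵 (a : ℝ) : Set where
  constructor in𝒵
  field
    rep : 𝔥⁰
    eq  : a ≈ Z rep

𝒵-≈ : ∀ {a b} → a ≈ b → 𝒵 a → 𝒵 b
𝒵-≈ e (in𝒵 w h) = in𝒵 w (trans (sym e) h)

𝒵-0 : 𝒵 0#
𝒵-0 = in𝒵 [] refl

𝒵-+ : ∀ {a b} → 𝒵 a → 𝒵 b → 𝒵 (a + b)
𝒵-+ (in𝒵 v g) (in𝒵 w h) = in𝒵 (v ++ w) (trans (+-cong (trans g (Z≈⅀ v)) (trans h (Z≈⅀ w))) (trans (sym (⅀-++ v w _)) (sym (Z≈⅀ (v ++ w)))))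

𝒵-ℚ : ∀ q {a} → 𝒵 a → 𝒵 (fromℚ q * a)
𝒵-ℚ q (in𝒵 w h) = in𝒵 (q · w) (begin
  fromℚ q * _                                               ≈⟨ *-congˡ (trans h (Z≈⅀ w)) ⟩
  fromℚ q * ⅀ w (λ (r , k , adm) → fromℚ r * ζ k adm)       ≈⟨ sym (⅀-*ˡ w (fromℚ q) _) ⟩
  ⅀ w (λ (r , k , adm) → fromℚ q * (fromℚ r * ζ k adm))     ≈⟨ ⅀-cong w (λ (r , k , adm) → trans (sym (*-assoc _ _ _)) (*-congʳ (sym (fromℚ-* q r)))) ⟩
  ⅀ w (λ (r , k , adm) → fromℚ (q ℚ.* r) * ζ k adm)         ≈⟨ sym (⅀-map _ w _) ⟩
  ⅀ (q · w) (λ (r , k , adm) → fromℚ r * ζ k adm)           ≈⟨ sym (Z≈⅀ (q · w)) ⟩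
  Z (q · w) ∎)

𝒵-neg : ∀ {a} → 𝒵 a → 𝒵 (- a)
𝒵-neg {a} h = 𝒵-≈ (begin
  fromℚ (ℚ.- 1ℚ) * a  ≈⟨ *-congʳ (fromℚ-neg 1ℚ) ⟩
  - 1# * a            ≈⟨ solve 2 (λ o a → (:- o) :* a := :- (o :* a)) refl _ _ ⟩
  - (1# * a)          ≈⟨ -‿cong (*-identityˡ a) ⟩
  - a ∎) (𝒵-ℚ (ℚ.- 1ℚ) h)

𝒵-ζ : ∀ k adm → 𝒵 (ζ k adm)
𝒵-ζ k adm = in𝒵 ((1ℚ , k , adm) ∷ []) (sym (trans (Z≈⅀ ((1ℚ , k , adm) ∷ [])) (trans (+-identityʳ _) (*-identityˡ _))))

𝒵-1 : 𝒵 1#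
𝒵-1 = 𝒵-≈ (≋-pt (λ _ → ≡.refl)) (𝒵-ζ [] empty)

module Membership {Z∗ : 𝔥¹ → ℝ[T]} (reg∗ : IsRegularization _∗_ Z∗) where
  open Reg∗ reg∗ using (ρ; ρ-adm; ρ-[]; ρ-1; α; α-∗)
  open Reg∗-Limit reg∗

  𝒵-α-adm : ∀ {l} → Admʳ l → 𝒵 (α l)
  𝒵-α-adm []ᵃ      = 𝒵-≈ (sym ρ-[]) 𝒵-1
  𝒵-α-adm (m ∷ᵃ l) = 𝒵-≈ (sym (ρ-adm adm)) (𝒵-ζ _ adm)
    where adm = admissible-reverse m l

  -- Multiplicativity of Z∗ rewrites a product of two zeta values as a stuffle product, and
  -- stuffling admissible indices yields admissible ones only.
  𝒵-* : ∀ {a b} → 𝒵 a → 𝒵 b → 𝒵 (a * b)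
  𝒵-* {a} {b} (in𝒵 v g) (in𝒵 w h) = 𝒵-≈ (begin
    ⅀ v (λ (q , k , adm) → ⅀ w (λ (r , l , adm′) → (fromℚ q * ζ k adm) * (fromℚ r * ζ l adm′)))
      ≈⟨ ⅀-cong v (λ (q , k , adm) → ⅀-*ˡ w (fromℚ q * ζ k adm) _) ⟩
    ⅀ v (λ (q , k , adm) → (fromℚ q * ζ k adm) * ⅀ w (λ (r , l , adm′) → fromℚ r * ζ l adm′))
      ≈⟨ ⅀-*ʳ v _ _ ⟩
    ⅀ v (λ (q , k , adm) → fromℚ q * ζ k adm) * ⅀ w (λ (r , l , adm′) → fromℚ r * ζ l adm′)
      ≈⟨ *-cong (sym (trans g (Z≈⅀ v))) (sym (trans h (Z≈⅀ w))) ⟩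
    a * b ∎)
    (⅀-closed {𝒵} 𝒵-0 𝒵-+ (All.universal (λ (q , k , adm) → ⅀-closed {𝒵} 𝒵-0 𝒵-+ (All.universal (λ (r , l , adm′) → term q k adm r l adm′) w)) v))
    where
    ζ≈α : ∀ k adm → ζ k adm ≈ α (reverse k)
    ζ≈α k adm = trans (sym (ρ-adm adm)) (≡⇒≈ (≡.cong ρ (≡.sym (List.reverse-involutive k))))
    term : ∀ q k adm r l adm′ → 𝒵 ((fromℚ q * ζ k adm) * (fromℚ r * ζ l adm′))
    term q k adm r l adm′ = 𝒵-≈ (begin
      fromℚ q * (fromℚ r * ⅀ (reverse k ∗ʳ reverse l) α)   ≈⟨ *-congˡ (*-congˡ (sym (α-∗ (reverse k) (reverse l)))) ⟩
      fromℚ q * (fromℚ r * (α (reverse k) * α (reverse l))) ≈⟨ *-congˡ (*-congˡ (*-cong (sym (ζ≈α k adm)) (sym (ζ≈α l adm′)))) ⟩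
      fromℚ q * (fromℚ r * (ζ k adm * ζ l adm′))            ≈⟨ solve 4 (λ a b c d → a :* (b :* (c :* d)) := (a :* c) :* (b :* d)) refl _ _ _ _ ⟩
      (fromℚ q * ζ k adm) * (fromℚ r * ζ l adm′) ∎)
      (𝒵-ℚ q (𝒵-ℚ r (⅀-closed {𝒵} 𝒵-0 𝒵-+ (All.map 𝒵-α-adm (Admʳ-∗ (reverse-Admʳ adm) (reverse-Admʳ adm′))))))

  𝒵-sg : ∀ n → 𝒵 (sg n)
  𝒵-sg zero    = 𝒵-1
  𝒵-sg (suc n) = 𝒵-neg (𝒵-sg n)

  𝒵-- : ∀ {a b} → 𝒵 a → 𝒵 b → 𝒵 (a - b)
  𝒵-- g h = 𝒵-+ g (𝒵-neg h)

  𝒵-⊛ : ∀ {a b} n → (∀ m → m ℕ.≤ n → 𝒵 (a m)) → (∀ m → m ℕ.≤ n → 𝒵 (b m)) → 𝒵 ((a ⊛ b) n)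
  𝒵-⊛ zero    g h = 𝒵-* (g 0 ℕ.≤-refl) (h 0 ℕ.≤-refl)
  𝒵-⊛ (suc n) g h = 𝒵-+ (𝒵-* (g 0 ℕ.z≤n) (h (suc n) ℕ.≤-refl)) (𝒵-⊛ n (λ m m≤n → g (suc m) (ℕ.s≤s m≤n)) (λ m m≤n → h m (ℕ.m≤n⇒m≤1+n m≤n)))

  𝒵-▷ : ∀ {a f} → (∀ n → 𝒵 (a n)) → (∀ l → 𝒵 (f l)) → ∀ l → 𝒵 ((a ▷ f) l)
  𝒵-▷ g h []            = 𝒵-* (g 0) (h [])
  𝒵-▷ g h (1⁺ ∷ l)      = 𝒵-+ (𝒵-* (g 0) (h (1⁺ ∷ l))) (𝒵-▷ (g ∘ suc) h l)
  𝒵-▷ g h ((2+⁺ m) ∷ l) = 𝒵-* (g 0) (h ((2+⁺ m) ∷ l))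

  private
    unint : ∀ {P : ℝ → Set} → (∀ {a b} → a ≈ b → P a → P b) → (∀ q {a} → P a → P (fromℚ q * a)) → ∀ n {x} → P (fromℚ (int (suc n)) * x) → P x
    unint P-≈ P-ℚ n {x} h = P-≈ (begin
      fromℚ (u n) * (fromℚ (int (suc n)) * x)  ≈⟨ sym (*-assoc _ _ _) ⟩
      fromℚ (u n) * fromℚ (int (suc n)) * x    ≈⟨ *-congʳ (sym (fromℚ-* (u n) (int (suc n)))) ⟩
      fromℚ (u n ℚ.* int (suc n)) * x          ≈⟨ *-congʳ (≡⇒≈ (≡.cong fromℚ (≡.trans (ℚ.*-comm (u n) (int (suc n))) (int*u n)))) ⟩
      1# * x                                   ≈⟨ *-identityˡ x ⟩
      x ∎) (P-ℚ (u n) h)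

  α-ins : ∀ x d j → ins x d (suc j) α ≈ α (x ∷ []) * α (replicate (suc j) d) - ins (x ⊕ d) d j α
  α-ins x d j = begin
    ins x d (suc j) α                                              ≈⟨ solve 2 (λ a b → a := a :+ b :- b) refl _ _ ⟩
    ins x d (suc j) α + ins (x ⊕ d) d j α - ins (x ⊕ d) d j α      ≈⟨ +-congʳ (sym (∗-ins x d j α)) ⟩
    ⅀ ((x ∷ []) ∗ʳ replicate (suc j) d) α - ins (x ⊕ d) d j α      ≈⟨ +-congʳ (sym (α-∗ (x ∷ []) (replicate (suc j) d))) ⟩
    α (x ∷ []) * α (replicate (suc j) d) - ins (x ⊕ d) d j α ∎

  private
    𝒵-ins : ∀ j → (∀ i → i ℕ.≤ j → 𝒵 (E i)) → ∀ m → 𝒵 (ins (2+⁺ m) 1⁺ j α)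
    𝒵-ins zero    h m = 𝒵-α-adm (m ∷ᵃ [])
    𝒵-ins (suc j) h m = 𝒵-≈ (sym (α-ins (2+⁺ m) 1⁺ j)) (𝒵-- (𝒵-* (𝒵-α-adm (m ∷ᵃ [])) (h (suc j) ℕ.≤-refl))
      (𝒵-ins j (λ i i≤j → h i (ℕ.m≤n⇒m≤1+n i≤j)) (m ℕ.+ 1)))

    -- Newton's identities: (i + 2) E(i + 2) is a combination of products of some ζ(m), m ≥ 2, with
    -- earlier coefficients of E, since the term with ζ∗(1) is 0.
    𝒵-E-below : ∀ n i → i ℕ.≤ n → 𝒵 (E i)
    𝒵-E-below n       zero    _         = 𝒵-≈ (sym ρ-[]) 𝒵-1
    𝒵-E-below (suc n) (suc zero) _ = 𝒵-≈ (sym ρ-1) 𝒵-0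
    𝒵-E-below (suc n) (suc (suc i)) (ℕ.s≤s i<n) = unint 𝒵-≈ 𝒵-ℚ (suc i)
      (𝒵-≈ (trans (sym (α-ins 1⁺ 1⁺ i)) (ins-same 1⁺ (suc i) α))
        (𝒵-- (𝒵-* (𝒵-≈ (sym ρ-1) 𝒵-0) (𝒵-E-below n (suc i) i<n)) (𝒵-ins i (λ j j≤i → 𝒵-E-below n j (ℕ.≤-trans j≤i (ℕ.≤-trans (ℕ.n≤1+n i) i<n))) 0)))

  𝒵-E : ∀ n → 𝒵 (E n)
  𝒵-E n = 𝒵-E-below n n ℕ.≤-refl

  E-0 : E 0 ≈ 1#
  E-0 = ρ-[]

  A-0 : A 0 ≈ 1#
  A-0 = trans (*-identityˡ _) (trans (+-identityʳ _) ρ-[])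

  A-1 : A 1 ≈ 0#
  A-1 = trans (*-congˡ (trans (+-identityʳ _) ρ-1)) (zeroʳ _)

  private
    𝒵-A-below : ∀ n i → i ℕ.≤ n → 𝒵 (A i)
    𝒵-A-below n       zero    _           = 𝒵-≈ (sym A-0) 𝒵-1
    𝒵-A-below (suc n) (suc i) (ℕ.s≤s i≤n) = 𝒵-≈ (begin
      - (shift E ⊛ A) i                              ≈⟨ solve 2 (λ x y → :- y := x :- (x :+ y)) refl (E 0 * A (suc i)) _ ⟩
      E 0 * A (suc i) - (E ⊛ A) (suc i)              ≈⟨ +-cong (trans (*-congʳ E-0) (*-identityˡ _)) (-‿cong (trans (⊛-comm E A (suc i)) (A⊛E (suc i)))) ⟩
      A (suc i) - 0#                                 ≈⟨ minus-0 ⟩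
      A (suc i) ∎)
      (𝒵-neg (𝒵-⊛ i (λ m _ → 𝒵-E (suc m)) (λ m m≤i → 𝒵-A-below n m (ℕ.≤-trans m≤i i≤n))))
      where
      minus-0 : A (suc i) - 0# ≈ A (suc i)
      minus-0 = trans (+-congˡ (trans (sym (+-identityˡ _)) (-‿inverseʳ 0#))) (+-identityʳ _)

  𝒵-A : ∀ n → 𝒵 (A n)
  𝒵-A n = 𝒵-A-below n n ℕ.≤-refl

  𝒵-A▷α : ∀ l → 𝒵 ((A ▷ α) l)
  𝒵-A▷α l = 𝒵-≈ (sym (A▷χ l)) (⅀-closed {𝒵} 𝒵-0 𝒵-+ (All.universal (λ (q , w) → 𝒵-ℚ q (adm w)) (reg 0 l)))
    where
    adm : ∀ w → 𝒵 (admPart α w)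
    adm []            = 𝒵-α-adm []ᵃ
    adm (1⁺ ∷ w)      = 𝒵-0
    adm ((2+⁺ m) ∷ w) = 𝒵-α-adm (m ∷ᵃ w)

  -- E(D) undoes A(D). As A(D) α has values in 𝒵 by `A▷χ` and E has coefficients in 𝒵, all
  -- regularized values lie in 𝒵.
  α≈E▷ : ∀ l → α l ≈ (E ▷ (A ▷ α)) l
  α≈E▷ l = sym (trans (▷-▷ E A α l) (trans (▷-cong (λ n → trans (⊛-comm E A n) (A⊛E n)) (λ _ → refl) l) (▷-δ₀ α l)))

  𝒵-α : ∀ l → 𝒵 (α l)
  𝒵-α l = 𝒵-≈ (sym (α≈E▷ l)) (𝒵-▷ 𝒵-E 𝒵-A▷α l)

  record I (a : ℝ) : Set where
    constructor inI
    field
      {quot} : ℝ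
      mem    : 𝒵 quot
      eq     : a ≈ ζ2 * quot

  I-≈ : ∀ {a b} → a ≈ b → I a → I b
  I-≈ e (inI m h) = inI m (trans (sym e) h)

  I-0 : I 0#
  I-0 = inI 𝒵-0 (sym (zeroʳ _))

  I-+ : ∀ {a b} → I a → I b → I (a + b)
  I-+ (inI m g) (inI n h) = inI (𝒵-+ m n) (trans (+-cong g h) (sym (distribˡ _ _ _)))

  I-*ʳ : ∀ {a b} → I a → 𝒵 b → I (a * b)
  I-*ʳ (inI m g) n = inI (𝒵-* m n) (trans (*-congʳ g) (*-assoc _ _ _))

  I-*ˡ : ∀ {a b} → 𝒵 a → I b → I (a * b)
  I-*ˡ m h = I-≈ (*-comm _ _) (I-*ʳ h m)

  I-ℚ : ∀ q {a} → I a → I (fromℚ q * a)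
  I-ℚ q (inI {c} m h) = inI (𝒵-ℚ q m) (trans (*-congˡ h) (solve 3 (λ a b c → a :* (b :* c) := b :* (a :* c)) refl _ _ _))

  I-neg : ∀ {a} → I a → I (- a)
  I-neg (inI m h) = inI (𝒵-neg m) (trans (-‿cong h) (solve 2 (λ a b → :- (a :* b) := a :* (:- b)) refl _ _))

  I-- : ∀ {a b} → I a → I b → I (a - b)
  I-- g h = I-+ g (I-neg h)

  I-⊛ : ∀ {a b} n → (∀ m → 𝒵 (a m)) → (∀ m → I (b m)) → I ((a ⊛ b) n)
  I-⊛ zero    g h = I-*ˡ (g 0) (h 0)
  I-⊛ (suc n) g h = I-+ (I-*ˡ (g 0) (h (suc n))) (I-⊛ n (g ∘ suc) h)

  I-▷ : ∀ {a f} → (∀ n → I (a n)) → (∀ l → 𝒵 (f l)) → ∀ l → I ((a ▷ f) l)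
  I-▷ g h []            = I-*ʳ (g 0) (h [])
  I-▷ g h (1⁺ ∷ l)      = I-+ (I-*ʳ (g 0) (h (1⁺ ∷ l))) (I-▷ (g ∘ suc) h l)
  I-▷ g h ((2+⁺ m) ∷ l) = I-*ʳ (g 0) (h ((2+⁺ m) ∷ l))

  I-unint : ∀ n {x} → I (fromℚ (int (suc n)) * x) → I x
  I-unint = unint I-≈ I-ℚ

-- Euler's recursion and the series E(u) E(-u) and A(u) A(-u) modulo ζ(2)𝒵

module EvenZeta {Z∗ Zsh : 𝔥¹ → ℝ[T]} (reg∗ : IsRegularization _∗_ Z∗) (regsh : IsRegularization _sh¹_ Zsh) where
  open Reg∗ reg∗ using (ρ; ρ-adm; ρ-[]; ρ-1; α; α-∗)
  open Reg∗-Limit reg∗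
  open Regsh regsh using (β; βᵂ)
  open Regsh-Limit regsh using (βᵂ-zsʳ; β-sh)
  open Comparison reg∗ regsh
  open Membership reg∗
  open DepthTwo using (word)

  private
    g : ℕ → ℝ
    g a = α ((1+ a) ∷ [])

    t τ : ℕ → ℕ → ℝ
    t i j = βᵂ (replicate i 𝕩 ++ 𝕪 ∷ word j)
    τ i j = α ((1+ i) ∷ (1+ j) ∷ [])

    β-g : ∀ a → β ((1+ a) ∷ []) ≈ g a
    β-g zero    = trans (β≈A▷α (1⁺ ∷ [])) (trans (+-cong (*-congˡ ρ-1) (trans (*-congʳ A-1) (zeroˡ _))) (trans (+-identityʳ _) (trans (zeroʳ _) (sym ρ-1))))
    β-g (suc a) = trans (β≈A▷α ((2+⁺ a) ∷ [])) (trans (*-congʳ A-0) (*-identityˡ _))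

    -- As A 1 = 0, the two regularizations can differ in depth two only at (1, 1), which is excluded
    -- by i + j > 0.
    t≈τ : ∀ i j {n} → i ℕ.+ j ≡ suc n → t i j ≈ τ i j
    t≈τ i j e = trans (βᵂ-zsʳ ((1+ i) ∷ (1+ j) ∷ [])) (trans (β≈A▷α ((1+ i) ∷ (1+ j) ∷ [])) (go i j e))
      where
      go : ∀ i j {n} → i ℕ.+ j ≡ suc n → (A ▷ α) ((1+ i) ∷ (1+ j) ∷ []) ≈ τ i j
      go zero    (suc j) _ = trans (+-cong (trans (*-congʳ A-0) (*-identityˡ _)) (trans (*-congʳ A-1) (zeroˡ _))) (+-identityʳ _)
      go (suc i) j       _ = trans (*-congʳ A-0) (*-identityˡ _)

    g*g-sh : ∀ a b → g a * g b ≈ DepthTwo.k βᵂ a b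
    g*g-sh a b = trans (*-cong (sym (β-g a)) (sym (β-g b))) (β-sh ((1+ a) ∷ []) ((1+ b) ∷ []))

    g*g-∗ : ∀ a b → g a * g b ≈ τ a b + (τ b a + g (suc (a ℕ.+ b)))
    g*g-∗ a b = trans (α-∗ ((1+ a) ∷ []) ((1+ b) ∷ [])) (+-congˡ (+-congˡ (trans (+-identityʳ _) (≡⇒≈ (≡.cong (λ n → α ((1+ n) ∷ [])) (ℕ.+-suc a b))))))

    g0* : ∀ x → g 0 * x ≈ 0#
    g0* x = trans (*-congʳ ρ-1) (zeroˡ x)

    module _ (N : ℕ) where
      n : ℕ
      n = suc N
      ζₙ : ℝ
      ζₙ = g (suc n)
      ADτ : ℝ
      ADτ = AD τ n

      -- The regularized sum formula for double zeta values, from y sh x^n y and the vanishing of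
      -- the regularized ζ(1).
      sum-formula : ADτ + τ n 0 ≈ 0#
      sum-formula = begin
        ADτ + τ n 0                          ≈⟨ +-cong (AD-cong n (λ i j e → sym (t≈τ i j e))) (sym (t≈τ n 0 (ℕ.+-identityʳ n))) ⟩
        AD t n + t n 0                       ≈⟨ sym (DepthTwo.single βᵂ n) ⟩
        DepthTwo.k βᵂ 0 n                    ≈⟨ sym (g*g-sh 0 n) ⟩
        g 0 * g n                            ≈⟨ g0* _ ⟩
        0# ∎

      stuffle-0 : τ 0 n + (τ n 0 + ζₙ) ≈ 0#
      stuffle-0 = trans (sym (g*g-∗ 0 n)) (g0* _)

      stuffle-sum : AD (λ a b → g a * g b) n ≈ ADτ + (ADτ + fromℚ (int (suc n)) * ζₙ)
      stuffle-sum = begin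
        AD (λ a b → g a * g b) n                   ≈⟨ AD-cong n (λ a b e → trans (g*g-∗ a b) (+-congˡ (+-congˡ (≡⇒≈ (≡.cong (λ m → g (suc m)) e))))) ⟩
        AD (λ a b → τ a b + (τ b a + ζₙ)) n         ≈⟨ trans (AD-+ τ (λ a b → τ b a + ζₙ) n) (+-congˡ (AD-+ (λ a b → τ b a) (λ _ _ → ζₙ) n)) ⟩
        ADτ + (AD (λ a b → τ b a) n + AD (λ _ _ → ζₙ) n)  ≈⟨ +-congˡ (+-cong (AD-swap τ n) (AD-const ζₙ n)) ⟩
        ADτ + (ADτ + fromℚ (int (suc n)) * ζₙ) ∎

      shuffle-sum : AD (λ a b → sg b * (g a * g b)) n ≈ (1# + sg n) * τ 0 n
      shuffle-sum = begin
        AD (λ a b → sg b * (g a * g b)) n           ≈⟨ AD-cong n (λ a b _ → *-congˡ {sg b} (g*g-sh a b)) ⟩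
        AD (λ a b → sg b * DepthTwo.k βᵂ a b) n     ≈⟨ DepthTwo.alternating βᵂ n ⟩
        (1# + sg n) * t 0 n                         ≈⟨ *-congˡ (t≈τ 0 n ≡.refl) ⟩
        (1# + sg n) * τ 0 n ∎

      -- Euler's (n + 3) ζ(n+2) = 2 ∑ ζ(a+1) ζ(b+1), over a + b = n with a and b odd.
      euler : sg n ≈ 1# → AD (λ a b → (1# - sg b) * (g a * g b)) n ≈ fromℚ (int (suc (suc (suc n)))) * ζₙ
      euler even = begin
        AD (λ a b → (1# - sg b) * (g a * g b)) n
          ≈⟨ AD-cong n (λ a b _ → solve 3 (λ o s x → (o :- s) :* x := o :* x :+ :- (s :* x)) refl 1# (sg b) (g a * g b)) ⟩
        AD (λ a b → 1# * (g a * g b) + - (sg b * (g a * g b))) n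
          ≈⟨ trans (AD-+ (λ a b → 1# * (g a * g b)) (λ a b → - (sg b * (g a * g b))) n) (+-cong (AD-cong n (λ a b _ → *-identityˡ (g a * g b))) (AD-neg (λ a b → sg b * (g a * g b)) n)) ⟩
        AD (λ a b → g a * g b) n - AD (λ a b → sg b * (g a * g b)) n
          ≈⟨ +-cong stuffle-sum (-‿cong (trans shuffle-sum (trans (*-congʳ (+-congˡ even)) (trans (distribʳ _ _ _) (+-cong (*-identityˡ _) (*-identityˡ _)))))) ⟩
        ADτ + (ADτ + i * ζₙ) - (τ 0 n + τ 0 n)
          -- Twice `ADτ` is eliminated by `sum-formula` and twice `τ 0 n` by `stuffle-0`. The terms
          -- `τ n 0` cancel, and two further ζₙ appear, so that n + 1 becomes n + 3.
          ≈⟨ solve 5 (λ a i ζₙ p q → a :+ (a :+ i :* ζₙ) :- (p :+ p) := ((a :+ q) :+ (a :+ q) :+ i :* ζₙ :+ (ζₙ :+ ζₙ)) :- ((p :+ (q :+ ζₙ)) :+ (p :+ (q :+ ζₙ)))) refl ADτ i ζₙ (τ 0 n) (τ n 0) ⟩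
        ((ADτ + τ n 0) + (ADτ + τ n 0) + i * ζₙ + (ζₙ + ζₙ)) - ((τ 0 n + (τ n 0 + ζₙ)) + (τ 0 n + (τ n 0 + ζₙ)))
          ≈⟨ +-cong (+-congʳ (+-congʳ (+-cong sum-formula sum-formula))) (-‿cong (+-cong stuffle-0 stuffle-0)) ⟩
        (0# + 0# + i * ζₙ + (ζₙ + ζₙ)) - (0# + 0#)
          ≈⟨ solve 3 (λ o iz ζₙ → (o :+ o :+ iz :+ (ζₙ :+ ζₙ)) :- (o :+ o) := ζₙ :+ (ζₙ :+ iz)) refl 0# (i * ζₙ) ζₙ ⟩
        ζₙ + (ζₙ + i * ζₙ)
          ≈⟨ +-cong (sym (*-identityˡ ζₙ)) (+-congʳ (sym (*-identityˡ ζₙ))) ⟩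
        1# * ζₙ + (1# * ζₙ + i * ζₙ)
          ≈⟨ +-congˡ (trans (sym (distribʳ _ _ _)) (*-congʳ (sym (fromℚ-+ 1ℚ (int (suc n)))))) ⟩
        1# * ζₙ + fromℚ (int (suc (suc n))) * ζₙ
          ≈⟨ trans (sym (distribʳ _ _ _)) (*-congʳ (sym (fromℚ-+ 1ℚ (int (suc (suc n)))))) ⟩
        fromℚ (int (suc (suc (suc n)))) * ζₙ ∎
        where i = fromℚ (int (suc n))

    double : ℕ → ℕ
    double zero    = 0
    double (suc m) = suc (suc (double m))

    sg-double : ∀ m → sg (double m) ≈ 1#
    sg-double zero    = refl
    sg-double (suc m) = trans (solve 1 (λ s → :- (:- s) := s) refl _) (sg-double m)

    parity : ∀ b → (∃[ m ] b ≡ double m) ⊎ (∃[ m ] b ≡ suc (double m))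
    parity zero    = inj₁ (0 , ≡.refl)
    parity (suc b) with parity b
    ... | inj₁ (m , e) = inj₂ (m , ≡.cong suc e)
    ... | inj₂ (m , e) = inj₁ (suc m , ≡.cong suc e)

    double-mono : ∀ {m n} → suc (double m) ℕ.≤ double n → m ℕ.< n
    double-mono {zero}  {suc n} _                   = ℕ.s≤s ℕ.z≤n
    double-mono {suc m} {suc n} (ℕ.s≤s (ℕ.s≤s h)) = ℕ.s≤s (double-mono h)

    𝒵-g : ∀ a → 𝒵 (g a)
    𝒵-g a = 𝒵-α ((1+ a) ∷ [])

    -- Strong induction by `euler` with n = 2m: the factor 1 - (-1)^b removes the even b, and for
    -- odd b the factor ζ(b + 1) is an even zeta value of smaller weight.
    even-I : ∀ m → Acc ℕ._<_ m → I (g (suc (double m)))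
    even-I zero    _         = inI 𝒵-1 (trans (ρ-adm (snoc [] ℕ.≤-refl)) (sym (*-identityʳ _)))
    even-I (suc m) (acc rec) = I-unint (suc (suc (suc (suc (double m))))) (I-≈ (euler (suc (double m)) (sg-double (suc m)))
      (AD-closed {I} I-+ (double (suc m)) term))
      where
      term : ∀ a b → a ℕ.+ b ≡ double (suc m) → I ((1# - sg b) * (g a * g b))
      term a b e with parity b
      ... | inj₁ (p , ≡.refl) = I-≈ (sym (trans (*-congʳ (trans (+-congˡ (-‿cong (sg-double p))) (-‿inverseʳ 1#))) (zeroˡ _))) I-0
      ... | inj₂ (p , ≡.refl) = I-*ˡ (𝒵-- 𝒵-1 (𝒵-sg (suc (double p)))) (I-*ˡ (𝒵-g a)
            (even-I p (rec (double-mono (ℕ.≤-trans (ℕ.m≤n+m (suc (double p)) a) (ℕ.≤-reflexive e))))))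

    2⁺ : ℕ⁺
    2⁺ = 2+⁺ 0

    -- Newton's identities in the variables 1/n², whose power sums are the even zeta values.
    ins-I : ∀ j m → I (ins (1+ suc (double m)) 2⁺ j α)
    ins-I zero    m = even-I m (<-wellFounded m)
    ins-I (suc j) m = I-≈ (sym (α-ins (1+ suc (double m)) 2⁺ j))
      (I-- (I-*ʳ (even-I m (<-wellFounded m)) (𝒵-α (replicate (suc j) 2⁺)))
        (I-≈ (≡⇒≈ (≡.cong (λ k → ins (1+ k) 2⁺ j α) (≡.sym (≡.trans (ℕ.+-suc (suc (double m)) 1) (≡.cong suc (≡.trans (ℕ.+-suc (suc (double m)) 0) (≡.cong suc (ℕ.+-identityʳ (suc (double m)))))))))) (ins-I j (suc m))))

  twos-I : ∀ n → I (α (replicate (suc n) 2⁺))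
  twos-I n = I-unint n (I-≈ (ins-same 2⁺ n α) (ins-I n 0))

  private
    shift-2 : ∀ i w → replicate i 2⁺ ++ 2⁺ ∷ w ≡ 2⁺ ∷ replicate i 2⁺ ++ w
    shift-2 zero    w = ≡.refl
    shift-2 (suc i) w = ≡.cong (2⁺ ∷_) (shift-2 i w)

    S-cong : ∀ {f h} n → (∀ w → f w ≈ h w) → Ones.S f n ≈ Ones.S h n
    S-cong n e = AD-cong n (λ i j _ → *-congˡ (⅀-cong (ones i ∗ʳ ones j) e))

    -- Each step by `S-+2` moves one more 2 to the front. The process ends at n = 0 with ζ({2}^i), i
    -- > 0, or at n = 1 with 0.
    S-I : ∀ i n → i ℕ.+ n ℕ.> 0 → I (Ones.S (λ w → α (replicate i 2⁺ ++ w)) n)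
    S-I (suc i) zero _ = I-≈ (sym (trans (Ones.S-0 (λ w → α (replicate (suc i) 2⁺ ++ w))) (≡⇒≈ (≡.cong α (List.++-identityʳ (replicate (suc i) 2⁺)))))) (twos-I i)
    S-I i (suc zero) _ = I-≈ (sym (Ones.S-1 (λ w → α (replicate i 2⁺ ++ w)))) I-0
    S-I i (suc (suc n)) _ = I-≈ (sym (trans (Ones.S-+2 (λ w → α (replicate i 2⁺ ++ w)) n)
        (-‿cong (S-cong n (λ w → ≡⇒≈ (≡.cong α (shift-2 i w)))))))
      (I-neg (S-I (suc i) n (ℕ.s≤s ℕ.z≤n)))

  E⊛twE : ∀ n → I ((E ⊛ tw E) (suc n))
  E⊛twE n = I-≈ (sym (begin
    (E ⊛ tw E) (suc n)                           ≈⟨ AD-⊛ E (tw E) (suc n) ⟩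
    AD (λ i j → E i * (sg j * E j)) (suc n)
      ≈⟨ AD-cong (suc n) (λ i j _ → trans (solve 3 (λ x s y → x :* (s :* y) := s :* (x :* y)) refl (E i) (sg j) (E j)) (*-congˡ (α-∗ (ones i) (ones j)))) ⟩
    Ones.S α (suc n) ∎)) (S-I 0 (suc n) (ℕ.s≤s ℕ.z≤n))

  private
    -- a(u) a(-u) without its constant term, which is 1 for both series used here.
    ε : Series → Series
    ε a zero    = 0#
    ε a (suc n) = (a ⊛ tw a) (suc n)

    inverse : ∀ n → ((A ⊛ tw A) ⊛ (E ⊛ tw E)) n ≈ δ₀ n
    inverse n = begin
      ((A ⊛ tw A) ⊛ (E ⊛ tw E)) n      ≈⟨ ⊛-assoc A (tw A) (E ⊛ tw E) n ⟩
      (A ⊛ (tw A ⊛ (E ⊛ tw E))) n      ≈⟨ ⊛-cong {A} (λ _ → refl) (λ m → trans (sym (⊛-assoc (tw A) E (tw E) m)) (trans (⊛-cong {b = tw E} (⊛-comm (tw A) E) (λ _ → refl) m) (⊛-assoc E (tw A) (tw E) m))) n ⟩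
      (A ⊛ (E ⊛ (tw A ⊛ tw E))) n      ≈⟨ sym (⊛-assoc A E (tw A ⊛ tw E) n) ⟩
      ((A ⊛ E) ⊛ (tw A ⊛ tw E)) n      ≈⟨ ⊛-cong A⊛E (λ m → trans (sym (tw-⊛ A E m)) (trans (*-congˡ (A⊛E m)) (tw-δ₀ m))) n ⟩
      (δ₀ ⊛ δ₀) n                      ≈⟨ ⊛-identityˡ δ₀ n ⟩
      δ₀ n ∎

  -- For X = A(u) A(-u) and E(u) E(-u) = 1 + ε the identity X (1 + ε) = 1 gives X = 1 - X ε, where X
  -- has coefficients in 𝒵 and ε in the ideal.
  A⊛twA : ∀ n → I ((A ⊛ tw A) (suc n))
  A⊛twA n = I-≈ (begin
    - ((A ⊛ tw A) ⊛ ε E) (suc n)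
      ≈⟨ solve 2 (λ x d → :- x := d :- (d :+ x)) refl _ ((A ⊛ tw A) (suc n)) ⟩
    (A ⊛ tw A) (suc n) - ((A ⊛ tw A) (suc n) + ((A ⊛ tw A) ⊛ ε E) (suc n))
      ≈⟨ +-congˡ (-‿cong (trans (+-congʳ (sym (⊛-identityʳ (A ⊛ tw A) (suc n)))) (trans (sym (⊛-+ʳ (A ⊛ tw A) δ₀ (ε E) (suc n)))
           (trans (⊛-cong {A ⊛ tw A} (λ _ → refl) (λ m → sym (split m)) (suc n)) (inverse (suc n)))))) ⟩
    (A ⊛ tw A) (suc n) - 0#
      ≈⟨ trans (+-congˡ (trans (sym (+-identityˡ _)) (-‿inverseʳ 0#))) (+-identityʳ _) ⟩
    (A ⊛ tw A) (suc n) ∎)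
    (I-neg (I-⊛ (suc n) (λ m → 𝒵-⊛ m (λ k _ → 𝒵-A k) (λ k _ → 𝒵-* (𝒵-sg k) (𝒵-A k))) ε-I))
    where
    split : ∀ m → (E ⊛ tw E) m ≈ δ₀ m + ε E m
    split zero    = trans (*-cong E-0 (trans (*-identityˡ _) E-0)) (trans (*-identityˡ _) (sym (+-identityʳ _)))
    split (suc m) = sym (+-identityˡ _)
    ε-I : ∀ m → I (ε E m)
    ε-I zero    = I-0
    ε-I (suc m) = E⊛twE m

-- Linear extensions and the Kaneko–Yamamoto regularization

private
  variable
    X Y : Set

-- The sums over all shuffles of two lists and over all orderings of a list.
Sh : (List X → ℝ) → List X → List X → ℝ
Sh f []      v       = f v
Sh f (a ∷ u) []      = f (a ∷ u)
Sh f (a ∷ u) (b ∷ v) = Sh (λ w → f (a ∷ w)) u (b ∷ v) + Sh (λ w → f (b ∷ w)) (a ∷ u) v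

PS : (List X → ℝ) → List X → ℝ
PS f []      = f []
PS f (a ∷ l) = PS (λ u → Sh f (a ∷ []) u) l

interleave-[] : ∀ (v : List X) → Interleaving [] v v
interleave-[] []      = []
interleave-[] (b ∷ v) = consʳ (interleave-[] v)

interleave-[]ʳ : ∀ (u : List X) → Interleaving u [] u
interleave-[]ʳ []      = []
interleave-[]ʳ (a ∷ u) = consˡ (interleave-[]ʳ u)

Sh-cong-I : ∀ {f g : List X → ℝ} u v → (∀ w → Interleaving u v w → f w ≈ g w) → Sh f u v ≈ Sh g u v
Sh-cong-I []      v       e = e v (interleave-[] v)
Sh-cong-I (a ∷ u) []      e = e (a ∷ u) (interleave-[]ʳ (a ∷ u))
Sh-cong-I (a ∷ u) (b ∷ v) e = +-cong (Sh-cong-I u (b ∷ v) (λ w i → e (a ∷ w) (consˡ i))) (Sh-cong-I (a ∷ u) v (λ w i → e (b ∷ w) (consʳ i)))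

Sh-cong : ∀ {f g : List X → ℝ} u v → (∀ w → f w ≈ g w) → Sh f u v ≈ Sh g u v
Sh-cong u v e = Sh-cong-I u v (λ w _ → e w)

PS-cong↭ : ∀ {f g : List X → ℝ} l → (∀ w → w ↭ l → f w ≈ g w) → PS f l ≈ PS g l
PS-cong↭ []      e = e [] ↭-refl
PS-cong↭ (a ∷ l) e = PS-cong↭ l (λ u u↭l → Sh-cong-I (a ∷ []) u (λ w i → e w (↭-trans (toPermutation i) (prep a u↭l))))

PS-cong : ∀ {f g : List X → ℝ} l → (∀ w → f w ≈ g w) → PS f l ≈ PS g l
PS-cong l e = PS-cong↭ l (λ w _ → e w)

Sh-+ : ∀ (f g : List X → ℝ) u v → Sh (λ w → f w + g w) u v ≈ Sh f u v + Sh g u v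
Sh-+ f g []      v       = refl
Sh-+ f g (a ∷ u) []      = refl
Sh-+ f g (a ∷ u) (b ∷ v) = trans (+-cong (Sh-+ _ _ u (b ∷ v)) (Sh-+ _ _ (a ∷ u) v)) (interchange _ _ _ _)

Sh-* : ∀ x (f : List X → ℝ) u v → Sh (λ w → x * f w) u v ≈ x * Sh f u v
Sh-* x f []      v       = refl
Sh-* x f (a ∷ u) []      = refl
Sh-* x f (a ∷ u) (b ∷ v) = trans (+-cong (Sh-* x _ u (b ∷ v)) (Sh-* x _ (a ∷ u) v)) (sym (distribˡ _ _ _))

Sh-0 : ∀ (u v : List X) → Sh (λ _ → 0#) u v ≈ 0#
Sh-0 []      v       = refl
Sh-0 (a ∷ u) []      = refl
Sh-0 (a ∷ u) (b ∷ v) = trans (+-cong (Sh-0 u (b ∷ v)) (Sh-0 (a ∷ u) v)) (+-identityˡ _)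

PS-+ : ∀ (f g : List X → ℝ) l → PS (λ w → f w + g w) l ≈ PS f l + PS g l
PS-+ f g []      = refl
PS-+ f g (a ∷ l) = trans (PS-cong l (Sh-+ f g (a ∷ []))) (PS-+ _ _ l)

PS-* : ∀ x (f : List X → ℝ) l → PS (λ w → x * f w) l ≈ x * PS f l
PS-* x f []      = refl
PS-* x f (a ∷ l) = trans (PS-cong l (Sh-* x f (a ∷ []))) (PS-* x _ l)

PS-0 : ∀ (l : List X) → PS (λ _ → 0#) l ≈ 0#
PS-0 []      = refl
PS-0 (a ∷ l) = trans (PS-cong l (Sh-0 (a ∷ []))) (PS-0 l)

Sh-[]ʳ : ∀ (f : List X → ℝ) u → Sh f u [] ≈ f u
Sh-[]ʳ f []      = refl
Sh-[]ʳ f (a ∷ u) = refl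

Sh-comm : ∀ (f : List X → ℝ) u v → Sh f u v ≈ Sh f v u
Sh-comm f []      []      = refl
Sh-comm f []      (b ∷ v) = refl
Sh-comm f (a ∷ u) []      = refl
Sh-comm f (a ∷ u) (b ∷ v) = trans (+-cong (Sh-comm _ u (b ∷ v)) (Sh-comm _ (a ∷ u) v)) (+-comm _ _)

Sh-assoc : ∀ (f : List X → ℝ) u v z → Sh (λ w → Sh f w z) u v ≈ Sh (λ w → Sh f u w) v z
Sh-assoc f []      v       z       = refl
Sh-assoc f (a ∷ u) []      z       = refl
Sh-assoc f (a ∷ u) (b ∷ v) []      = trans (Sh-cong (a ∷ u) (b ∷ v) (Sh-[]ʳ f)) refl
Sh-assoc f (a ∷ u) (b ∷ v) (c ∷ z) = begin
  Sh (λ w → Sh (f∘ a) w (c ∷ z) + Sh (f∘ c) (a ∷ w) z) u (b ∷ v) + Sh (λ w → Sh (f∘ b) w (c ∷ z) + Sh (f∘ c) (b ∷ w) z) (a ∷ u) v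
    ≈⟨ +-cong (Sh-+ (λ w → Sh (f∘ a) w (c ∷ z)) (λ w → Sh (f∘ c) (a ∷ w) z) u (b ∷ v)) (Sh-+ (λ w → Sh (f∘ b) w (c ∷ z)) (λ w → Sh (f∘ c) (b ∷ w) z) (a ∷ u) v) ⟩
  (p + q) + (r + s)
    ≈⟨ solve 4 (λ p q r s → (p :+ q) :+ (r :+ s) := (p :+ r) :+ (q :+ s)) refl p q r s ⟩
  (p + r) + Sh (λ w → Sh (f∘ c) w z) (a ∷ u) (b ∷ v)
    ≈⟨ +-cong (+-cong (Sh-assoc (f∘ a) u (b ∷ v) (c ∷ z)) (Sh-assoc (f∘ b) (a ∷ u) v (c ∷ z))) (Sh-assoc (f∘ c) (a ∷ u) (b ∷ v) z) ⟩
  ((p₁ + p₂) + r′) + s′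
    ≈⟨ solve 4 (λ p q r s → ((p :+ q) :+ r) :+ s := (p :+ r) :+ (q :+ s)) refl p₁ p₂ r′ s′ ⟩
  (p₁ + r′) + (p₂ + s′)
    ≈⟨ sym (+-cong (Sh-+ (λ w → Sh (f∘ a) u (b ∷ w)) (λ w → Sh (f∘ b) (a ∷ u) w) v (c ∷ z)) (Sh-+ (λ w → Sh (f∘ a) u (c ∷ w)) (λ w → Sh (f∘ c) (a ∷ u) w) (b ∷ v) z)) ⟩
  Sh (λ w → Sh f (a ∷ u) w) (b ∷ v) (c ∷ z) ∎
  where
  f∘ : _ → _
  f∘ x w = f (x ∷ w)
  p = Sh (λ w → Sh (f∘ a) w (c ∷ z)) u (b ∷ v)
  q = Sh (λ w → Sh (f∘ c) (a ∷ w) z) u (b ∷ v)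
  r = Sh (λ w → Sh (f∘ b) w (c ∷ z)) (a ∷ u) v
  s = Sh (λ w → Sh (f∘ c) (b ∷ w) z) (a ∷ u) v
  p₁ = Sh (λ w → Sh (f∘ a) u (b ∷ w)) v (c ∷ z)
  p₂ = Sh (λ w → Sh (f∘ a) u (c ∷ w)) (b ∷ v) z
  r′ = Sh (λ w → Sh (f∘ b) (a ∷ u) w) v (c ∷ z)
  s′ = Sh (λ w → Sh (f∘ c) (a ∷ u) w) (b ∷ v) z

Sh-PS : ∀ (F : List X → List Y → ℝ) l u v → Sh (λ w → PS (F w) l) u v ≈ PS (λ y → Sh (λ w → F w y) u v) l
Sh-PS F l []      v       = refl
Sh-PS F l (a ∷ u) []      = refl
Sh-PS F l (a ∷ u) (b ∷ v) = trans (+-cong (Sh-PS _ l u (b ∷ v)) (Sh-PS _ l (a ∷ u) v)) (sym (PS-+ _ _ l))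

PS-++ : ∀ (f : List X → ℝ) a b → PS f (a ++ b) ≈ PS (λ u → PS (λ v → Sh f u v) b) a
PS-++ f []      b = refl
PS-++ f (x ∷ a) b = trans (PS-++ (λ u → Sh f (x ∷ []) u) a b) (PS-cong a (λ u →
  trans (PS-cong b (λ v → sym (Sh-assoc f (x ∷ []) u v))) (sym (Sh-PS (λ w v → Sh f w v) b (x ∷ []) u))))

PS-↭ : ∀ (f : List X → ℝ) {l m} → l ↭ m → PS f l ≈ PS f m
PS-↭ f ↭.refl         = refl
PS-↭ f (prep x p)        = PS-↭ (λ u → Sh f (x ∷ []) u) p
PS-↭ f (↭.swap {l} x y p) = trans (PS-cong l swapped) (PS-↭ (λ u → Sh (λ w → Sh f (y ∷ []) w) (x ∷ []) u) p)
  where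
  swapped : ∀ u → Sh (λ w → Sh f (x ∷ []) w) (y ∷ []) u ≈ Sh (λ w → Sh f (y ∷ []) w) (x ∷ []) u
  swapped u = trans (sym (Sh-assoc f (x ∷ []) (y ∷ []) u)) (trans (Sh-comm (λ w → Sh f w u) (x ∷ []) (y ∷ [])) (Sh-assoc f (y ∷ []) (x ∷ []) u))
PS-↭ f (↭.trans p q)  = trans (PS-↭ f p) (PS-↭ f q)

Sh-map : ∀ (g : X → Y) (f : List Y → ℝ) u v → Sh f (map g u) (map g v) ≈ Sh (f ∘ map g) u v
Sh-map g f []      v       = refl
Sh-map g f (a ∷ u) []      = refl
Sh-map g f (a ∷ u) (b ∷ v) = +-cong (Sh-map g _ u (b ∷ v)) (Sh-map g _ (a ∷ u) v)

PS-map : ∀ (g : X → Y) (f : List Y → ℝ) l → PS f (map g l) ≈ PS (f ∘ map g) l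
PS-map g f []      = refl
PS-map g f (a ∷ l) = trans (PS-map g _ l) (PS-cong l (λ u → Sh-map g f (a ∷ []) u))

⅀-shʳ : ∀ (f : Word → ℝ) u v → ⅀ (u shʳ v) f ≈ Sh f u v
⅀-shʳ f []      v       = +-identityʳ _
⅀-shʳ f (a ∷ u) []      = +-identityʳ _
⅀-shʳ f (a ∷ u) (b ∷ v) = trans (⅀-++ (map (a ∷_) (u shʳ (b ∷ v))) _ f)
  (+-cong (trans (⅀-map (a ∷_) (u shʳ (b ∷ v)) f) (⅀-shʳ _ u (b ∷ v))) (trans (⅀-map (b ∷_) ((a ∷ u) shʳ v) f) (⅀-shʳ _ (a ∷ u) v)))

-- The recursion from the last elements instead of the first: `shʷ` shuffles reversed words, and
-- this lets `Sh-reverse` remove the reversal.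
Sh-snoc : ∀ (f : List X → ℝ) u a v b → Sh f (u ∷ʳ a) (v ∷ʳ b) ≈ Sh (λ w → f (w ∷ʳ a)) u (v ∷ʳ b) + Sh (λ w → f (w ∷ʳ b)) (u ∷ʳ a) v
Sh-snoc f []      a []      b = +-comm _ _
Sh-snoc f []      a (y ∷ v) b = trans (+-congˡ (Sh-snoc (λ w → f (y ∷ w)) [] a v b))
  (solve 3 (λ p q r → p :+ (q :+ r) := q :+ (p :+ r)) refl _ _ _)
Sh-snoc f (x ∷ u) a []      b = trans (+-congʳ (trans (Sh-snoc (λ w → f (x ∷ w)) u a [] b) (+-congˡ (Sh-[]ʳ _ (u ∷ʳ a)))))
  (solve 3 (λ p q r → (p :+ q) :+ r := (p :+ r) :+ q) refl _ _ _)
Sh-snoc f (x ∷ u) a (y ∷ v) b = trans (+-cong (Sh-snoc (λ w → f (x ∷ w)) u a (y ∷ v) b) (Sh-snoc (λ w → f (y ∷ w)) (x ∷ u) a v b))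
  (interchange _ _ _ _)

Sh-reverse : ∀ (f : List X → ℝ) u v → Sh (f ∘ reverse) u v ≈ Sh f (reverse u) (reverse v)
Sh-reverse f []      v       = refl
Sh-reverse f (a ∷ u) []      = sym (Sh-[]ʳ f (reverse (a ∷ u)))
Sh-reverse f (a ∷ u) (b ∷ v) = begin
  Sh (λ w → f (reverse (a ∷ w))) u (b ∷ v) + Sh (λ w → f (reverse (b ∷ w))) (a ∷ u) v
    ≈⟨ +-cong (trans (Sh-cong u (b ∷ v) (λ w → ≡⇒≈ (≡.cong f (List.unfold-reverse a w)))) (Sh-reverse (λ w → f (w ∷ʳ a)) u (b ∷ v)))
              (trans (Sh-cong (a ∷ u) v (λ w → ≡⇒≈ (≡.cong f (List.unfold-reverse b w)))) (Sh-reverse (λ w → f (w ∷ʳ b)) (a ∷ u) v)) ⟩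
  Sh (λ w → f (w ∷ʳ a)) (reverse u) (reverse (b ∷ v)) + Sh (λ w → f (w ∷ʳ b)) (reverse (a ∷ u)) (reverse v)
    ≈⟨ +-cong (≡⇒≈ (≡.cong (Sh (λ w → f (w ∷ʳ a)) (reverse u)) (List.unfold-reverse b v)))
              (≡⇒≈ (≡.cong (λ z → Sh (λ w → f (w ∷ʳ b)) z (reverse v)) (List.unfold-reverse a u))) ⟩
  Sh (λ w → f (w ∷ʳ a)) (reverse u) (reverse v ∷ʳ b) + Sh (λ w → f (w ∷ʳ b)) (reverse u ∷ʳ a) (reverse v)
    ≈⟨ sym (Sh-snoc f (reverse u) a (reverse v) b) ⟩
  Sh f (reverse u ∷ʳ a) (reverse v ∷ʳ b)
    ≈⟨ ≡⇒≈ (≡.cong₂ (Sh f) (≡.sym (List.unfold-reverse a u)) (≡.sym (List.unfold-reverse b v))) ⟩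
  Sh f (reverse (a ∷ u)) (reverse (b ∷ v)) ∎

-- Orderings subject to constraints

module Before {V : Set} (_≟_ : DecidableEquality V) where

  -- Whether p is met before q; false if neither occurs.
  bef : V → V → List V → Bool
  bef p q []      = false
  bef p q (x ∷ l) = if does (x ≟ p) then true else (if does (x ≟ q) then false else bef p q l)

  -- Linear extensions are counted as all orderings, weighted with the indicator of their
  -- constraints. Different partial orders on the same elements can then be compared ordering by
  -- ordering.
  sat : List (V × V) → List V → Bool
  sat []            l = true
  sat ((p , q) ∷ Γ) l = bef p q l ∧ sat Γ l

  sat-++ : ∀ Γ D l → sat (Γ ++ D) l ≡ sat Γ l ∧ sat D l
  sat-++ []            D l = ≡.refl
  sat-++ ((p , q) ∷ Γ) D l = ≡.trans (≡.cong (bef p q l ∧_) (sat-++ Γ D l)) (≡.sym (Bool.∧-assoc (bef p q l) _ _))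

  𝟙 : Bool → ℝ
  𝟙 true  = 1#
  𝟙 false = 0#

  𝟙-∧ : ∀ a b → 𝟙 (a ∧ b) ≈ 𝟙 a * 𝟙 b
  𝟙-∧ true  b = sym (*-identityˡ _)
  𝟙-∧ false b = sym (zeroˡ _)

  -- The membership excludes the one case in which both comparisons are false.
  bef-flip : ∀ {p q} l → p ∈ l → p ≢ q → bef q p l ≡ not (bef p q l)
  bef-flip {p} {q} (x ∷ l) p∈ p≢q with x ≟ p | x ≟ q
  ... | yes ≡.refl | yes ≡.refl = ⊥-elim (p≢q ≡.refl)
  ... | yes ≡.refl | no _       = ≡.refl
  ... | no _       | yes _      = ≡.refl
  ... | no x≢p     | no _ with p∈
  ...   | here p≡x = ⊥-elim (x≢p (≡.sym p≡x))
  ...   | there h  = bef-flip l h p≢q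

  bef-skipˡ : ∀ {p q u v w} → Interleaving u v w → p ∉ v → q ∉ v → bef p q w ≡ bef p q u
  bef-skipˡ []        _  _  = ≡.refl
  bef-skipˡ {p} {q} {w = x ∷ _} (consˡ i) p∉ q∉ with does (x ≟ p) | does (x ≟ q)
  ... | true  | _     = ≡.refl
  ... | false | true  = ≡.refl
  ... | false | false = bef-skipˡ i p∉ q∉
  bef-skipˡ {p} {q} {w = x ∷ _} (consʳ i) p∉ q∉ with x ≟ p | x ≟ q
  ... | yes ≡.refl | _          = ⊥-elim (p∉ (here ≡.refl))
  ... | no _       | yes ≡.refl = ⊥-elim (q∉ (here ≡.refl))
  ... | no _       | no _       = bef-skipˡ i (p∉ ∘ there) (q∉ ∘ there)

  Avoids : List V → V × V → Set
  Avoids v (p , q) = p ∉ v × q ∉ v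

  sat-skipˡ : ∀ {Γ u v w} → Interleaving u v w → All (Avoids v) Γ → sat Γ w ≡ sat Γ u
  sat-skipˡ i []                = ≡.refl
  sat-skipˡ i ((p∉ , q∉) ∷ h) = ≡.cong₂ _∧_ (bef-skipˡ i p∉ q∉) (sat-skipˡ i h)

  Sh-satˡ : ∀ {Γ} f u v → All (Avoids v) Γ → Sh (λ w → 𝟙 (sat Γ w) * f w) u v ≈ 𝟙 (sat Γ u) * Sh f u v
  Sh-satˡ {Γ} f u v h = trans (Sh-cong-I u v (λ w i → *-congʳ (≡⇒≈ (≡.cong 𝟙 (sat-skipˡ i h))))) (Sh-* (𝟙 (sat Γ u)) f u v)

  Sh-satʳ : ∀ {Γ} f u v → All (Avoids u) Γ → Sh (λ w → 𝟙 (sat Γ w) * f w) u v ≈ 𝟙 (sat Γ v) * Sh f u v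
  Sh-satʳ {Γ} f u v h = trans (Sh-comm _ u v) (trans (Sh-satˡ f v u h) (*-congˡ (Sh-comm f v u)))

  consC : List V → List (V × V)
  consC []          = []
  consC (x ∷ [])    = []
  consC (x ∷ y ∷ l) = (x , y) ∷ consC (y ∷ l)

  consC-avoids : ∀ {v} l → All (_∉ v) l → All (Avoids v) (consC l)
  consC-avoids []          _             = []
  consC-avoids (x ∷ [])    _             = []
  consC-avoids (x ∷ y ∷ l) (x∉ ∷ y∉ ∷ h) = (x∉ , y∉) ∷ consC-avoids (y ∷ l) (y∉ ∷ h)

  data Distinct : List V → Set where
    []  : Distinct []
    _∷_ : ∀ {x l} → All (x ≢_) l → Distinct l → Distinct (x ∷ l)

  bef-head : ∀ p q l → bef p q (p ∷ l) ≡ true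
  bef-head p q l with p ≟ p
  ... | yes _ = ≡.refl
  ... | no p≢p = ⊥-elim (p≢p ≡.refl)

  bef-wrong : ∀ {p q} l → p ≢ q → bef p q (q ∷ l) ≡ false
  bef-wrong {p} {q} l p≢q with q ≟ p | q ≟ q
  ... | yes q≡p | _ = ⊥-elim (p≢q (≡.sym q≡p))
  ... | no _    | yes _ = ≡.refl
  ... | no _    | no q≢q = ⊥-elim (q≢q ≡.refl)

  -- By induction the tail admits only its own ordering; x is then shuffled into it and has to stand
  -- before its first element.
  PS-consC : ∀ f {l} → Distinct l → PS (λ w → 𝟙 (sat (consC l) w) * f w) l ≈ f l
  PS-consC f []                = *-identityˡ _
  PS-consC f (_ ∷ [])          = *-identityˡ _
  PS-consC f {x ∷ y ∷ l} (x≢@(x≢y ∷ _) ∷ d) = begin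
    PS (λ u → Sh (λ w → 𝟙 (bef x y w ∧ sat Γ w) * f w) (x ∷ []) u) (y ∷ l)
      ≈⟨ PS-cong (y ∷ l) (λ u → Sh-cong (x ∷ []) u (λ w → trans (*-congʳ (trans (𝟙-∧ (bef x y w) (sat Γ w)) (*-comm _ _))) (*-assoc _ _ _))) ⟩
    PS (λ u → Sh (λ w → 𝟙 (sat Γ w) * (𝟙 (bef x y w) * f w)) (x ∷ []) u) (y ∷ l)
      ≈⟨ PS-cong (y ∷ l) (λ u → Sh-satʳ (λ w → 𝟙 (bef x y w) * f w) (x ∷ []) u (consC-avoids (y ∷ l) (All.map (λ { x≢z (here z≡x) → x≢z (≡.sym z≡x) }) x≢))) ⟩
    PS (λ u → 𝟙 (sat Γ u) * Sh (λ w → 𝟙 (bef x y w) * f w) (x ∷ []) u) (y ∷ l)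
      ≈⟨ PS-consC (λ u → Sh (λ w → 𝟙 (bef x y w) * f w) (x ∷ []) u) d ⟩
    𝟙 (bef x y (x ∷ y ∷ l)) * f (x ∷ y ∷ l) + Sh (λ w → 𝟙 (bef x y (y ∷ w)) * f (y ∷ w)) (x ∷ []) l
      ≈⟨ +-cong (trans (*-congʳ (≡⇒≈ (≡.cong 𝟙 (bef-head x y (y ∷ l))))) (*-identityˡ _))
           (trans (Sh-cong (x ∷ []) l (λ w → trans (*-congʳ (≡⇒≈ (≡.cong 𝟙 (bef-wrong w x≢y)))) (zeroˡ _))) (Sh-0 (x ∷ []) l)) ⟩
    f (x ∷ y ∷ l) + 0# ≈⟨ +-identityʳ _ ⟩
    f (x ∷ y ∷ l) ∎
    where Γ = consC (y ∷ l)

insAt : ∀ {A : Set} {n} → Fin (suc n) → A → (Fin n → A) → Fin (suc n) → A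
insAt zero    a g zero    = a
insAt zero    a g (suc x) = g x
insAt {n = suc n} (suc j) a g zero    = g zero
insAt {n = suc n} (suc j) a g (suc x) = insAt j a (g ∘ suc) x

insAt-unique : ∀ {A : Set} {n} (j : Fin (suc n)) {a : A} {g : Fin n → A} {h : Fin (suc n) → A} →
               h j ≡ a → (∀ x → h (punchIn j x) ≡ g x) → ∀ y → h y ≡ insAt j a g y
insAt-unique zero    e f zero    = e
insAt-unique zero    e f (suc x) = f x
insAt-unique {n = suc n} (suc j) e f zero    = f zero
insAt-unique {n = suc n} (suc j) e f (suc y) = insAt-unique j e (f ∘ suc) y

Sh-insert : ∀ {A : Set} {n} (F : List A → ℝ) a (g : Fin n → A) →
            Sh F (a ∷ []) (tabulate g) ≈ ⅀ (allFin (suc n)) (λ j → F (tabulate (insAt j a g)))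
Sh-insert {n = zero}  F a g = sym (+-identityʳ _)
Sh-insert {n = suc n} F a g = +-congˡ (begin
  Sh (λ w → F (g zero ∷ w)) (a ∷ []) (tabulate (g ∘ suc))
    ≈⟨ Sh-insert _ a (g ∘ suc) ⟩
  ⅀ (allFin (suc n)) (λ j → F (tabulate (insAt (suc j) a g)))
    ≈⟨ sym (⅀-map suc (allFin (suc n)) _) ⟩
  ⅀ (map suc (allFin (suc n))) (λ j → F (tabulate (insAt j a g)))
    ≈⟨ ≡⇒≈ (≡.cong (λ l → ⅀ l (λ j → F (tabulate (insAt j a g)))) (List.map-tabulate id suc)) ⟩
  ⅀ (tabulate suc) (λ j → F (tabulate (insAt j a g))) ∎)

-- In the list of values of the inverse, `insert zero j π` has 0 at position j and elsewhere the
-- values for π raised by one. So the recursion of `permutations` is the insertion of 0 by which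
-- `PS` is defined.
insert-from : ∀ {n} (j : Fin (suc n)) (π : Permutation n n) y →
              Inverse.from (insert zero j π) y ≡ insAt j zero (suc ∘ Inverse.from π) y
insert-from j π = insAt-unique j at off
  where
  at : Inverse.from (insert zero j π) j ≡ zero
  at with j Fin.≟ j
  ... | yes _  = ≡.refl
  ... | no j≢j = ⊥-elim (j≢j ≡.refl)
  off : ∀ x → Inverse.from (insert zero j π) (punchIn j x) ≡ suc (Inverse.from π x)
  off x = ≡.trans (≡.cong (Inverse.from (insert zero j π)) (≡.sym
      (≡.trans (Perm.insert-punchIn zero j π (Inverse.from π x)) (≡.cong (punchIn j) (Inverse.strictlyInverseˡ π x)))))
    (Inverse.strictlyInverseʳ (insert zero j π) (suc (Inverse.from π x)))

⅀-permutations : ∀ n (F : List (Fin n) → ℝ) → ⅀ (permutations n) (λ π → F (tabulate (Inverse.from π))) ≈ PS F (allFin n)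
⅀-permutations zero    F = +-identityʳ _
⅀-permutations (suc n) F = begin
  ⅀ (concatMap (λ j → map (insert zero j) (permutations n)) (allFin (suc n))) G
    ≈⟨ trans (⅀-concatMap (λ j → map (insert zero j) (permutations n)) (allFin (suc n)) G) (⅀-cong (allFin (suc n)) (λ j → ⅀-map (insert zero j) (permutations n) G)) ⟩
  ⅀ (allFin (suc n)) (λ j → ⅀ (permutations n) (λ π → G (insert zero j π)))
    ≈⟨ ⅀-swap (allFin (suc n)) (permutations n) (λ j π → G (insert zero j π)) ⟩
  ⅀ (permutations n) (λ π → ⅀ (allFin (suc n)) (λ j → G (insert zero j π)))
    ≈⟨ ⅀-cong (permutations n) (λ π → trans (⅀-cong (allFin (suc n)) (λ j → ≡⇒≈ (≡.cong F (List.tabulate-cong (insert-from j π)))))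
         (trans (sym (Sh-insert F zero (suc ∘ Inverse.from π))) (≡⇒≈ (≡.cong (Sh F (zero ∷ [])) (≡.sym (List.map-tabulate (Inverse.from π) suc)))))) ⟩
  ⅀ (permutations n) (λ π → Sh F (zero ∷ []) (map suc (tabulate (Inverse.from π))))
    ≈⟨ ⅀-permutations n (λ u → Sh F (zero ∷ []) (map suc u)) ⟩
  PS (λ u → Sh F (zero ∷ []) (map suc u)) (allFin n)
    ≈⟨ sym (PS-map suc (λ u → Sh F (zero ∷ []) u) (allFin n)) ⟩
  PS (λ u → Sh F (zero ∷ []) u) (map suc (allFin n))
    ≈⟨ ≡⇒≈ (≡.cong (PS (λ u → Sh F (zero ∷ []) u)) (List.map-tabulate id suc)) ⟩
  PS F (allFin (suc n)) ∎
  where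
  G : Permutation (suc n) (suc n) → ℝ
  G π = F (tabulate (Inverse.from π))

-- p_{i+1,m+1} is encoded as (i , m).
E₂ : Set
E₂ = ℕ × ℕ

_≟E_ : DecidableEquality E₂
_≟E_ = Product.≡-dec ℕ._≟_ ℕ._≟_

open Before _≟E_ public

⅀-filter : ∀ {A : Set} {P : A → Set} (P? : U.Decidable P) l f → ⅀ (filter P? l) f ≈ ⅀ l (λ x → 𝟙 (does (P? x)) * f x)
⅀-filter P? []      f = refl
⅀-filter P? (x ∷ l) f with does (P? x)
... | true  = +-cong (sym (*-identityˡ _)) (⅀-filter P? l f)
... | false = trans (⅀-filter P? l f) (sym (trans (+-congʳ (zeroˡ _)) (+-identityˡ _)))

does-≡ : ∀ {P : Set} (P? : Dec P) b → (P → b ≡ true) → (b ≡ true → P) → does P? ≡ b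
does-≡ (yes p) b     f g = ≡.sym (f p)
does-≡ (no ¬p) true  f g = ⊥-elim (¬p (g ≡.refl))
does-≡ (no ¬p) false f g = ≡.refl

does-true : ∀ {P : Set} (P? : Dec P) → does P? ≡ true → P
does-true (yes p) _ = p

-- It has m + 1 elements, so that m can be the predecessor stored in ℕ⁺.
run : ℕ → ℕ → ℕ → List E₂
run n s zero    = (n , s) ∷ []
run n s (suc m) = (n , s) ∷ run n (suc s) m

chainL : ℕ → ℕ⁺ → List E₂
chainL n k = run n 0 (pred⁺ k)

top : ℕ → ℕ⁺ → E₂
top n k = n , pred⁺ k

full : ℕ → Index → List E₂
full n []      = []
full n (k ∷ q) = chainL n k ++ full (suc n) q

linkC : ℕ → Index → List (E₂ × E₂)
linkC n []      = []
linkC n (k ∷ _) = ((n , 0) , top (suc n) k) ∷ []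

-- The generating relations `_⋖_` of X⋆ in the encoding by pairs; see `zigC-complete` and
-- `zigC-sound`.
zigC : ℕ → Index → List (E₂ × E₂)
zigC n []      = []
zigC n (k ∷ q) = consC (chainL n k) ++ linkC n q ++ zigC (suc n) q

pos : ∀ {r} → ℕ → Fin r → ℕ
pos n zero    = n
pos n (suc i) = pos (suc n) i

pos≥ : ∀ {r} n (i : Fin r) → n ℕ.≤ pos n i
pos≥ n zero    = ℕ.≤-refl
pos≥ n (suc i) = ℕ.≤-trans (ℕ.n≤1+n n) (pos≥ (suc n) i)

pos-injective : ∀ {r} n (i j : Fin r) → pos n i ≡ pos n j → i ≡ j
pos-injective n zero    zero    e = ≡.refl
pos-injective n zero    (suc j) e = ⊥-elim (ℕ.<-irrefl e (pos≥ (suc n) j))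
pos-injective n (suc i) zero    e = ⊥-elim (ℕ.<-irrefl (≡.sym e) (pos≥ (suc n) i))
pos-injective n (suc i) (suc j) e = ≡.cong suc (pos-injective (suc n) i j e)

enc : ∀ k → ℕ → X⋆-Order.Elem k → E₂
enc k n (i , m) = pos n i , toℕ m

enc-injective : ∀ k n (p q : X⋆-Order.Elem k) → enc k n p ≡ enc k n q → p ≡ q
enc-injective k n (i , m) (j , m′) e with pos-injective n i j (≡.cong proj₁ e)
... | ≡.refl = ≡.cong (i ,_) (Fin.toℕ-injective (≡.cong proj₂ e))

run-∈ : ∀ n s m a → a ℕ.< m → ((n , a ℕ.+ s) , (n , suc a ℕ.+ s)) ∈ consC (run n s m)
run-∈ n s (suc zero)    zero    _          = here ≡.refl
run-∈ n s (suc zero)    (suc a) (ℕ.s≤s ())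
run-∈ n s (suc (suc m)) zero    _          = here ≡.refl
run-∈ n s (suc (suc m)) (suc a) (ℕ.s≤s h) = there (≡.subst (λ b → ((n , b) , (n , suc b)) ∈ consC (run n (suc s) (suc m))) (ℕ.+-suc a s) (run-∈ n (suc s) (suc m) a h))

∈-run : ∀ n s m {x} → x ∈ consC (run n s m) → ∃[ a ] a ℕ.< m × x ≡ ((n , a ℕ.+ s) , (n , suc a ℕ.+ s))
∈-run n s (suc zero)    (here e)  = 0 , ℕ.s≤s ℕ.z≤n , e
∈-run n s (suc (suc m)) (here e)  = 0 , ℕ.s≤s ℕ.z≤n , e
∈-run n s (suc (suc m)) (there h) with ∈-run n (suc s) (suc m) h
... | a , a< , e = suc a , ℕ.s≤s a< , ≡.trans e (≡.cong (λ b → (n , b) , (n , suc b)) (ℕ.+-suc a s))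

zigC-complete : ∀ n k {p q} → X⋆-Order._⋖_ k p q → (enc k n p , enc k n q) ∈ zigC n k
zigC-complete n (k ∷ l) (X⋆-Order.chain {zero} {m} {m′} e) = ∈-++⁺ˡ (≡.subst (_∈ consC (chainL n k))
    (≡.cong₂ (λ a b → (n , a) , (n , b)) (ℕ.+-identityʳ (toℕ m)) (≡.trans (ℕ.+-identityʳ (suc (toℕ m))) (≡.sym e)))
    (run-∈ n 0 (pred⁺ k) (toℕ m) (ℕ.≤-pred (≡.subst (ℕ._< suc (pred⁺ k)) e (Fin.toℕ<n m′)))))
zigC-complete n (k ∷ l) (X⋆-Order.chain {suc i} e) = ∈-++⁺ʳ (consC (chainL n k)) (∈-++⁺ʳ (linkC n l) (zigC-complete (suc n) l (X⋆-Order.chain {i = i} e)))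
zigC-complete n (k ∷ k′ ∷ l) (X⋆-Order.link {zero} {suc zero} e) = ∈-++⁺ʳ (consC (chainL n k)) (here (≡.cong (λ t → (n , 0) , (suc n , t)) (Fin.toℕ-fromℕ (pred⁺ k′))))
zigC-complete n (k ∷ l) (X⋆-Order.link {suc i} {suc j} e) = ∈-++⁺ʳ (consC (chainL n k)) (∈-++⁺ʳ (linkC n l) (zigC-complete (suc n) l (X⋆-Order.link {i = i} {j = j} (ℕ.suc-injective e))))

⋖-suc : ∀ {k l p q} → X⋆-Order._⋖_ l p q → X⋆-Order._⋖_ (k ∷ l) (suc (proj₁ p) , proj₂ p) (suc (proj₁ q) , proj₂ q)
⋖-suc (X⋆-Order.chain e) = X⋆-Order.chain e
⋖-suc (X⋆-Order.link e)  = X⋆-Order.link (≡.cong suc e)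

zigC-sound : ∀ n k {x} → x ∈ zigC n k → ∃[ p ] ∃[ q ] X⋆-Order._⋖_ k p q × x ≡ (enc k n p , enc k n q)
zigC-sound n (k ∷ l) h with ∈-++⁻ (consC (chainL n k)) h
... | inj₁ h₁ with ∈-run n 0 (pred⁺ k) h₁
...   | a , a< , ≡.refl = (zero , Fin.fromℕ< (ℕ.m≤n⇒m≤1+n a<)) , (zero , Fin.fromℕ< (ℕ.s≤s a<)) ,
        X⋆-Order.chain (≡.trans (Fin.toℕ-fromℕ< (ℕ.s≤s a<)) (≡.cong suc (≡.sym (Fin.toℕ-fromℕ< (ℕ.m≤n⇒m≤1+n a<))))) ,
        ≡.cong₂ (λ a b → (n , a) , (n , b)) (≡.trans (ℕ.+-identityʳ a) (≡.sym (Fin.toℕ-fromℕ< (ℕ.m≤n⇒m≤1+n a<))))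
          (≡.trans (ℕ.+-identityʳ (suc a)) (≡.sym (Fin.toℕ-fromℕ< (ℕ.s≤s a<))))
zigC-sound n (k ∷ l) h | inj₂ h₂ with ∈-++⁻ (linkC n l) h₂
zigC-sound n (k ∷ k′ ∷ l) h | inj₂ h₂ | inj₁ (here ≡.refl) = (zero , zero) , (suc zero , Fin.fromℕ (pred⁺ k′)) , X⋆-Order.link ≡.refl ,
        ≡.cong (λ t → (n , 0) , (suc n , t)) (≡.sym (Fin.toℕ-fromℕ (pred⁺ k′)))
zigC-sound n (k ∷ l) h | inj₂ h₂ | inj₂ h₃ with zigC-sound (suc n) l h₃
... | p , q , p⋖q , e = (suc (proj₁ p) , proj₂ p) , (suc (proj₁ q) , proj₂ q) , ⋖-suc p⋖q , e

sat-true : ∀ {Γ l} → (∀ {p q} → (p , q) ∈ Γ → bef p q l ≡ true) → sat Γ l ≡ true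
sat-true {[]}          h = ≡.refl
sat-true {(p , q) ∷ Γ} h = ≡.cong₂ _∧_ (h (here ≡.refl)) (sat-true (h ∘ there))

true-sat : ∀ {Γ l p q} → sat Γ l ≡ true → (p , q) ∈ Γ → bef p q l ≡ true
true-sat {(p , q) ∷ Γ} {l} h (here ≡.refl) with bef p q l
... | true = ≡.refl
true-sat {(p , q) ∷ Γ} {l} h (there x) with bef p q l
... | true = true-sat {Γ} h x

bef-tabulate : ∀ {n} (g : Fin n → E₂) → (∀ i j → g i ≡ g j → i ≡ j) → ∀ i j → i ≢ j → bef (g i) (g j) (tabulate g) ≡ does (i Fin.<? j)
bef-tabulate g inj zero    zero    i≢j = ⊥-elim (i≢j ≡.refl)
bef-tabulate g inj zero    (suc j) i≢j = bef-head (g zero) (g (suc j)) (tabulate (g ∘ suc))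
bef-tabulate g inj (suc i) zero    i≢j = bef-wrong (tabulate (g ∘ suc)) (λ e → i≢j (inj _ _ e))
bef-tabulate g inj (suc i) (suc j) i≢j = ≡.trans skip (bef-tabulate (g ∘ suc) (λ i j e → Fin.suc-injective (inj _ _ e)) i j (λ e → i≢j (≡.cong suc e)))
  where
  skip : bef (g (suc i)) (g (suc j)) (g zero ∷ tabulate (g ∘ suc)) ≡ bef (g (suc i)) (g (suc j)) (tabulate (g ∘ suc))
  skip with g zero ≟E g (suc i) | g zero ≟E g (suc j)
  ... | yes e | _     = ⊥-elim (Fin.0≢1+n (inj _ _ e))
  ... | no _  | yes e = ⊥-elim (Fin.0≢1+n (inj _ _ e))
  ... | no _  | no _  = ≡.refl

module _ (k : Index) where
  open X⋆-Order k using (Elem; _⋖_; _≺_; rank-⋖)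

  -- By transitivity of < only the generating relations have to be tested, and for them `bef` in the
  -- list of the inverse of f compares the values of f.
  mono-sat : ∀ (f : Elem ↔ Fin (X⋆-size k)) → does (monotone? (X⋆ k) f) ≡ sat (zigC 0 k) (tabulate (enc k 0 ∘ Inverse.from f))
  mono-sat f = does-≡ (monotone? (X⋆ k) f) _ to from
    where
    l = tabulate (enc k 0 ∘ Inverse.from f)
    g-inj : ∀ i j → enc k 0 (Inverse.from f i) ≡ enc k 0 (Inverse.from f j) → i ≡ j
    g-inj i j e = ≡.trans (≡.sym (Inverse.strictlyInverseˡ f i)) (≡.trans (≡.cong (Inverse.to f) (enc-injective k 0 _ _ e)) (Inverse.strictlyInverseˡ f j))
    distinct : ∀ {p q} → p ⋖ q → Inverse.to f p ≢ Inverse.to f q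
    distinct {p} {q} p⋖q e = ℕ.<-irrefl (≡.cong (X⋆-Order.rank k) (≡.trans (≡.sym (Inverse.strictlyInverseʳ f p)) (≡.trans (≡.cong (Inverse.from f) e) (Inverse.strictlyInverseʳ f q)))) (rank-⋖ p⋖q)
    key : ∀ {p q} → p ⋖ q → bef (enc k 0 p) (enc k 0 q) l ≡ does (Inverse.to f p Fin.<? Inverse.to f q)
    key {p} {q} p⋖q = ≡.trans (≡.cong₂ (λ a b → bef (enc k 0 a) (enc k 0 b) l) (≡.sym (Inverse.strictlyInverseʳ f p)) (≡.sym (Inverse.strictlyInverseʳ f q)))
      (bef-tabulate (enc k 0 ∘ Inverse.from f) g-inj (Inverse.to f p) (Inverse.to f q) (distinct p⋖q))
    <-true : ∀ {m n} (x : Fin m) (y : Fin n) → x Fin.< y → does (x Fin.<? y) ≡ true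
    <-true x y h = does-≡ (x Fin.<? y) true (λ _ → ≡.refl) (λ _ → h)
    true-< : ∀ {m n} (x : Fin m) (y : Fin n) → does (x Fin.<? y) ≡ true → x Fin.< y
    true-< x y e = does-true (x Fin.<? y) e
    to : Monotone (X⋆ k) f → sat (zigC 0 k) l ≡ true
    to mono = sat-true λ h → constraint (zigC-sound 0 k h)
      where
      constraint : ∀ {a b} → ∃[ p ] ∃[ q ] (p ⋖ q) × (a , b) ≡ (enc k 0 p , enc k 0 q) → bef a b l ≡ true
      constraint (p , q , p⋖q , ≡.refl) = ≡.trans (key p⋖q) (<-true _ _ (mono p q [ p⋖q ]))
    from : sat (zigC 0 k) l ≡ true → Monotone (X⋆ k) f
    from h p q [ p⋖q ]   = true-< _ _ (≡.trans (≡.sym (key p⋖q)) (true-sat h (zigC-complete 0 k p⋖q)))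
    from h p q (_∷_ {y = r} p⋖r r≺q) = ℕ.<-trans (from h p r [ p⋖r ]) (from h r q r≺q)

tabulate-splitAt : ∀ {A : Set} m {n} (h : Fin m ⊎ Fin n → A) → tabulate (h ∘ Fin.splitAt m) ≡ tabulate (h ∘ inj₁) ++ tabulate (h ∘ inj₂)
tabulate-splitAt zero    h = ≡.refl
tabulate-splitAt (suc m) h = ≡.cong (h (inj₁ zero) ∷_) (≡.trans (List.tabulate-cong (λ i → lem (Fin.splitAt m i))) (tabulate-splitAt m (h ∘ Sum.map₁ suc)))
  where
  lem : ∀ x → h (Sum.map suc id x) ≡ h (Sum.map₁ suc x)
  lem (inj₁ _) = ≡.refl
  lem (inj₂ _) = ≡.refl

tabulate-run : ∀ n s m → tabulate {n = suc m} (λ i → n , toℕ i ℕ.+ s) ≡ run n s m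
tabulate-run n s zero    = ≡.refl
tabulate-run n s (suc m) = ≡.cong ((n , s) ∷_) (≡.trans (List.tabulate-cong (λ i → ≡.cong (n ,_) (≡.sym (ℕ.+-suc (toℕ i) s)))) (tabulate-run n (suc s) m))

tabulate-enum : ∀ n k → tabulate (enc k n ∘ Inverse.from (X⋆-enum k)) ≡ full n k
tabulate-enum n []      = ≡.refl
tabulate-enum n (k ∷ l) = ≡.trans (List.tabulate-cong point)
  (≡.trans (tabulate-splitAt ⌊ k ⌋ h) (≡.cong₂ _++_ (≡.trans (List.tabulate-cong (λ i → ≡.cong (n ,_) (≡.sym (ℕ.+-identityʳ (toℕ i))))) (tabulate-run n 0 (pred⁺ k))) (tabulate-enum (suc n) l)))
  where
  h : Fin ⌊ k ⌋ ⊎ Fin (X⋆-size l) → E₂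
  h (inj₁ m) = n , toℕ m
  h (inj₂ i) = enc l (suc n) (Inverse.from (X⋆-enum l) i)
  point : ∀ i → enc (k ∷ l) n (Inverse.from (X⋆-enum (k ∷ l)) i) ≡ h (Fin.splitAt ⌊ k ⌋ i)
  point i with Fin.splitAt ⌊ k ⌋ i
  ... | inj₁ m = ≡.refl
  ... | inj₂ i = ≡.refl

label₂ : E₂ → Letter
label₂ (n , zero)  = 𝕪
label₂ (n , suc m) = 𝕩

⅀-linearExtensions : ∀ k (g : Word → ℝ) →
  ⅀ (linearExtensions (X⋆ k)) (λ f → g (tabulate (X⋆-Order.label k ∘ Inverse.from f))) ≈
  PS (λ l → 𝟙 (sat (zigC 0 k) l) * g (map label₂ l)) (full 0 k)
⅀-linearExtensions k g = begin
  ⅀ (linearExtensions (X⋆ k)) (λ f → g (tabulate (X⋆-Order.label k ∘ Inverse.from f)))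
    ≈⟨ trans (⅀-filter (monotone? (X⋆ k)) (map (_↔-∘ X⋆-enum k) (permutations (X⋆-size k))) _) (⅀-map (_↔-∘ X⋆-enum k) (permutations (X⋆-size k)) _) ⟩
  ⅀ (permutations (X⋆-size k)) (λ π → 𝟙 (does (monotone? (X⋆ k) (π ↔-∘ X⋆-enum k))) * g (tabulate (X⋆-Order.label k ∘ Inverse.from (π ↔-∘ X⋆-enum k))))
    ≈⟨ ⅀-cong (permutations (X⋆-size k)) (λ π → trans
         (*-cong (≡⇒≈ (≡.cong 𝟙 (mono-sat k (π ↔-∘ X⋆-enum k)))) (≡⇒≈ (≡.cong g (≡.trans (List.tabulate-cong (λ i → labels (Inverse.from (π ↔-∘ X⋆-enum k) i))) (≡.sym (List.map-tabulate _ label₂))))))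
         (≡⇒≈ (≡.cong F (≡.sym (List.map-tabulate (Inverse.from π) h))))) ⟩
  ⅀ (permutations (X⋆-size k)) (λ π → F (map h (tabulate (Inverse.from π))))
    ≈⟨ ⅀-permutations (X⋆-size k) (F ∘ map h) ⟩
  PS (F ∘ map h) (allFin (X⋆-size k))
    ≈⟨ sym (PS-map h F (allFin (X⋆-size k))) ⟩
  PS F (map h (allFin (X⋆-size k)))
    ≈⟨ ≡⇒≈ (≡.cong (PS F) (≡.trans (List.map-tabulate id h) (tabulate-enum 0 k))) ⟩
  PS F (full 0 k) ∎
  where
  h : Fin (X⋆-size k) → E₂
  h = enc k 0 ∘ Inverse.from (X⋆-enum k)
  F : List E₂ → ℝ
  F l = 𝟙 (sat (zigC 0 k) l) * g (map label₂ l)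
  labels : ∀ p → X⋆-Order.label k p ≡ label₂ (enc k 0 p)
  labels (i , zero)  = ≡.refl
  labels (i , suc m) = ≡.refl

runInit runTail : ℕ → ℕ → ℕ → List E₂
runInit n s zero    = []
runInit n s (suc m) = (n , s) ∷ runInit n (suc s) m
runTail n s zero    = []
runTail n s (suc m) = run n (suc s) m

run-last : ∀ n s m → run n s m ≡ runInit n s m ∷ʳ (n , m ℕ.+ s)
run-last n s zero    = ≡.refl
run-last n s (suc m) = ≡.cong ((n , s) ∷_) (≡.trans (run-last n (suc s) m) (≡.cong (λ t → runInit n (suc s) m ∷ʳ (n , t)) (ℕ.+-suc m s)))

run-head : ∀ n s m → run n s m ≡ (n , s) ∷ runTail n s m
run-head n s zero    = ≡.refl
run-head n s (suc m) = ≡.refl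

-- The chains of q in one sequence, each of them before the preceding one.
blk : ℕ → Index → List E₂
blk n []      = []
blk n (k ∷ q) = blk (suc n) q ++ chainL n k

full-++ : ∀ n p q → full n (p ++ q) ≡ full n p ++ full (length p ℕ.+ n) q
full-++ n []      q = ≡.refl
full-++ n (k ∷ p) q = ≡.trans (≡.cong (chainL n k ++_) (≡.trans (full-++ (suc n) p q) (≡.cong (λ m → full (suc n) p ++ full m q) (ℕ.+-suc (length p) n))))
  (≡.sym (List.++-assoc (chainL n k) (full (suc n) p) _))

full-↭-blk : ∀ n q → full n q ↭ blk n q
full-↭-blk n []      = ↭-refl
full-↭-blk n (k ∷ q) = ↭-trans (++⁺ˡ (chainL n k) (full-↭-blk (suc n) q)) (++-comm (chainL n k) (blk (suc n) q))

map-label-blk : ∀ n q → map label₂ (blk n q) ≡ zs (reverse q)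
map-label-blk n []      = ≡.refl
map-label-blk n (k ∷ q) = ≡.trans (List.map-++ label₂ (blk (suc n) q) (chainL n k)) (≡.trans
  (≡.cong₂ _++_ (map-label-blk (suc n) q) (map-label-chain n k))
  (≡.sym (≡.trans (≡.cong zs (List.unfold-reverse k q)) (≡.trans (List.concatMap-++ z (reverse q) (k ∷ [])) (≡.cong (zs (reverse q) ++_) (List.++-identityʳ (z k)))))))
  where
  xs : ∀ s m → map label₂ (runTail n s m) ≡ replicate m 𝕩
  xs s zero    = ≡.refl
  xs s (suc m) = ≡.trans (≡.cong (map label₂) (run-head n (suc s) m)) (≡.cong (𝕩 ∷_) (xs (suc s) m))
  map-label-chain : ∀ n′ k → map label₂ (chainL n k) ≡ z k
  map-label-chain _ (1+ m) = ≡.trans (≡.cong (map label₂) (run-head n 0 m)) (≡.cong (𝕪 ∷_) (xs 0 m))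

Below Above : ℕ → E₂ → Set
Below n x = proj₁ x ℕ.< n
Above n x = n ℕ.≤ proj₁ x

At : ℕ → E₂ → Set
At n x = proj₁ x ≡ n

run-at : ∀ n s m → All (At n) (run n s m)
run-at n s zero    = ≡.refl ∷ []
run-at n s (suc m) = ≡.refl ∷ run-at n (suc s) m

full-below : ∀ n p → All (Below (length p ℕ.+ n)) (full n p)
full-below n []      = []
full-below n (k ∷ p) = All.++⁺
  (All.map (λ e → ≡.subst (ℕ._< suc (length p ℕ.+ n)) (≡.sym e) (ℕ.s≤s (ℕ.m≤n+m n (length p)))) (run-at n 0 (pred⁺ k)))
  (≡.subst (λ m → All (Below m) (full (suc n) p)) (ℕ.+-suc (length p) n) (full-below (suc n) p))

blk-above : ∀ n q → All (Above n) (blk n q)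
blk-above n []      = []
blk-above n (k ∷ q) = All.++⁺ (All.map (ℕ.≤-trans (ℕ.n≤1+n n)) (blk-above (suc n) q)) (All.map (λ e → ℕ.≤-reflexive (≡.sym e)) (run-at n 0 (pred⁺ k)))

Both : (E₂ → Set) → E₂ × E₂ → Set
Both P (x , y) = P x × P y

consC-both : ∀ {P : E₂ → Set} l → All P l → All (Both P) (consC l)
consC-both []          _             = []
consC-both (x ∷ [])    _             = []
consC-both (x ∷ y ∷ l) (px ∷ py ∷ h) = (px , py) ∷ consC-both (y ∷ l) (py ∷ h)

zigC-below : ∀ n p → All (Both (Below (length p ℕ.+ n))) (zigC n p)
zigC-below n []      = []
zigC-below n (k ∷ p) = All.++⁺
  (consC-both _ (All.map (λ e → ≡.subst (ℕ._< suc (length p ℕ.+ n)) (≡.sym e) (ℕ.s≤s (ℕ.m≤n+m n (length p)))) (run-at n 0 (pred⁺ k))))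
  (All.++⁺ (link p) (≡.subst (λ m → All (Both (Below m)) (zigC (suc n) p)) (ℕ.+-suc (length p) n) (zigC-below (suc n) p)))
  where
  link : ∀ p → All (Both (Below (suc (length p ℕ.+ n)))) (linkC n p)
  link []       = []
  link (k′ ∷ p) = (ℕ.s≤s (ℕ.m≤n⇒m≤1+n (ℕ.m≤n+m n (length p))) , ℕ.s≤s (ℕ.s≤s (ℕ.m≤n+m n (length p)))) ∷ []

above∉ : ∀ {n v x} → All (Above n) v → Below n x → x ∉ v
above∉ h x<n x∈ = ℕ.<⇒≱ x<n (All.lookup h x∈)

below∉ : ∀ {n v x} → All (Below n) v → Above n x → x ∉ v
below∉ h n≤x x∈ = ℕ.<⇒≱ (All.lookup h x∈) n≤x

distinct-++ : ∀ {u v} → Distinct u → Distinct v → All (λ x → All (x ≢_) v) u → Distinct (u ++ v)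
distinct-++ []      dv _        = dv
distinct-++ (x ∷ d) dv (h ∷ hs) = All.++⁺ x h ∷ distinct-++ d dv hs

distinct-run : ∀ n s m → Distinct (run n s m)
distinct-run n s zero    = [] ∷ []
distinct-run n s (suc m) = All.map (λ s<t e → ℕ.<-irrefl (≡.cong proj₂ e) s<t) (aboveCut s m) ∷ distinct-run n (suc s) m
  where
  aboveCut : ∀ s m → All (λ x → s ℕ.< proj₂ x) (run n (suc s) m)
  aboveCut s zero    = ℕ.≤-refl ∷ []
  aboveCut s (suc m) = ℕ.≤-refl ∷ All.map (ℕ.≤-trans (ℕ.n≤1+n (suc s))) (aboveCut (suc s) m)

distinct-blk : ∀ n q → Distinct (blk n q)
distinct-blk n []      = []
distinct-blk n (k ∷ q) = distinct-++ (distinct-blk (suc n) q) (distinct-run n 0 (pred⁺ k))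
  (All.map (λ n<x → All.map (λ y≡n x≡y → ℕ.<-irrefl (≡.sym (≡.trans (≡.cong proj₁ x≡y) y≡n)) n<x) (run-at n 0 (pred⁺ k))) (blk-above (suc n) q))

zigC-snoc : ∀ n q a k l → sat (zigC n (q ∷ʳ a ∷ʳ k)) l ≡
            sat (zigC n (q ∷ʳ a)) l ∧ (bef (length q ℕ.+ n , 0) (top (suc (length q ℕ.+ n)) k) l ∧ sat (consC (chainL (suc (length q ℕ.+ n)) k)) l)
zigC-snoc n [] a k l = ≡.trans (sat-++ (consC (chainL n a)) _ l) (≡.trans
  (≡.cong (λ b → sat (consC (chainL n a)) l ∧ (bef (n , 0) (top (suc n) k) l ∧ b)) (≡.trans (sat-++ (consC (chainL (suc n) k)) [] l) (Bool.∧-identityʳ _)))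
  (≡.cong (_∧ (bef (n , 0) (top (suc n) k) l ∧ sat (consC (chainL (suc n) k)) l)) (≡.sym (≡.trans (sat-++ (consC (chainL n a)) [] l) (Bool.∧-identityʳ _)))))
zigC-snoc n (x ∷ q) a k l = ≡.trans (split (q ∷ʳ a ∷ʳ k)) (≡.trans
  (≡.cong₂ (λ Γ b → sat (consC (chainL n x)) l ∧ (sat Γ l ∧ b)) (same-link q) (≡.trans (zigC-snoc (suc n) q a k l)
    (≡.cong (λ m → sat (zigC (suc n) (q ∷ʳ a)) l ∧ (bef (m , 0) (top (suc m) k) l ∧ sat (consC (chainL (suc m) k)) l)) (ℕ.+-suc (length q) n))))
  (≡.trans (regroup (sat (consC (chainL n x)) l) (sat (linkC n (q ∷ʳ a)) l) (sat (zigC (suc n) (q ∷ʳ a)) l) rest) (≡.cong (_∧ rest) (≡.sym (split (q ∷ʳ a))))))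
  where
  rest = bef (suc (length q ℕ.+ n) , 0) (top (suc (suc (length q ℕ.+ n))) k) l ∧ sat (consC (chainL (suc (suc (length q ℕ.+ n))) k)) l
  regroup : ∀ a b c d → a ∧ (b ∧ (c ∧ d)) ≡ (a ∧ (b ∧ c)) ∧ d
  regroup true  true  c d = ≡.refl
  regroup true  false c d = ≡.refl
  regroup false b     c d = ≡.refl
  split : ∀ q′ → sat (zigC n (x ∷ q′)) l ≡ sat (consC (chainL n x)) l ∧ (sat (linkC n q′) l ∧ sat (zigC (suc n) q′) l)
  split q′ = ≡.trans (sat-++ (consC (chainL n x)) _ l) (≡.cong (sat (consC (chainL n x)) l ∧_) (sat-++ (linkC n q′) (zigC (suc n) q′) l))
  same-link : ∀ q → linkC n (q ∷ʳ a ∷ʳ k) ≡ linkC n (q ∷ʳ a)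
  same-link []      = ≡.refl
  same-link (_ ∷ _) = ≡.refl

consC-snoc : ∀ u x y v l → sat (consC ((u ∷ʳ x) ++ y ∷ v)) l ≡ sat (consC (u ∷ʳ x)) l ∧ (bef x y l ∧ sat (consC (y ∷ v)) l)
consC-snoc []          x y v l = ≡.refl
consC-snoc (a ∷ [])    x y v l = ≡.sym (Bool.∧-assoc (bef a x l) true _)
consC-snoc (a ∷ b ∷ u) x y v l = ≡.trans (≡.cong (bef a b l ∧_) (consC-snoc (b ∷ u) x y v l)) (≡.sym (Bool.∧-assoc (bef a b l) _ _))

blk-cons : ∀ n k k′ q l → sat (consC (blk n (k ∷ k′ ∷ q))) l ≡
           sat (consC (blk (suc n) (k′ ∷ q))) l ∧ (bef (top (suc n) k′) (n , 0) l ∧ sat (consC (chainL n k)) l)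
blk-cons n k k′ q l = ≡.trans (≡.cong₂ (λ a b → sat (consC (a ++ b)) l) blk-last (run-head n 0 (pred⁺ k)))
  (≡.trans (consC-snoc U (suc n , pred⁺ k′ ℕ.+ 0) (n , 0) (runTail n 0 (pred⁺ k)) l)
    (≡.cong₂ (λ a b → sat (consC a) l ∧ b) (≡.sym blk-last)
      (≡.cong₂ (λ t c → bef (suc n , t) (n , 0) l ∧ sat (consC c) l) (ℕ.+-identityʳ (pred⁺ k′)) (≡.sym (run-head n 0 (pred⁺ k))))))
  where
  U = blk (suc (suc n)) q ++ runInit (suc n) 0 (pred⁺ k′)
  blk-last : blk (suc n) (k′ ∷ q) ≡ U ∷ʳ (suc n , pred⁺ k′ ℕ.+ 0)
  blk-last = ≡.trans (≡.cong (blk (suc (suc n)) q ++_) (run-last (suc n) 0 (pred⁺ k′))) (≡.sym (List.++-assoc (blk (suc (suc n)) q) _ _))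

∧-shuffle₁ : ∀ z c l → z ∧ (c ∧ l) ≡ z ∧ (l ∧ c)
∧-shuffle₁ z c l = ≡.cong (z ∧_) (Bool.∧-comm c l)

∧-shuffle₂ : ∀ z c l b r → z ∧ ((b ∧ (r ∧ c)) ∧ l) ≡ (z ∧ (l ∧ c)) ∧ (b ∧ r)
∧-shuffle₂ false c     l     b     r     = ≡.refl
∧-shuffle₂ true  false l     b     r     rewrite Bool.∧-zeroʳ r | Bool.∧-zeroʳ b | Bool.∧-zeroʳ l = ≡.refl
∧-shuffle₂ true  true  false b     r     = Bool.∧-zeroʳ _
∧-shuffle₂ true  true  true  b     r     rewrite Bool.∧-identityʳ r = Bool.∧-identityʳ _

-- For a fixed ordering, the alternating sum over the cuts telescopes.
zig : Index → List E₂ → Bool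
zig p l = sat (zigC 0 (reverse p)) l

-- The relations of the disjoint union of X⋆ for the part before the cut and the single chain for
-- the reversed part after it, whose linear extensions give the terms of a product w⋆ sh z.
cut : Index → Index → List E₂ → Bool
cut p q l = zig p l ∧ sat (consC (blk (length p) q)) l

alt : Index → Index → List E₂ → ℝ
alt p []      l = 𝟙 (cut p [] l)
alt p (k ∷ q) l = sg (length (k ∷ q)) * 𝟙 (cut p (k ∷ q) l) + alt (k ∷ p) q l

private
  -- The case of `cut` in which the link across the cut is violated. The last chain of p has number
  -- `length p` - 1; the predecessor is harmless since this is applied to non-empty p only.
  belowCut : Index → Index → List E₂ → Bool
  belowCut p []      l = zig p l
  belowCut p (k ∷ q) l = zig p l ∧ (sat (consC (blk (length p) (k ∷ q))) l ∧ bef (top (length p) k) (ℕ.pred (length p) , 0) l)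

  zig-cons : ∀ k a p l → zig (k ∷ a ∷ p) l ≡ zig (a ∷ p) l ∧ (bef (length p , 0) (top (suc (length p)) k) l ∧ sat (consC (chainL (suc (length p)) k)) l)
  zig-cons k a p l = ≡.trans (≡.cong (λ r → sat (zigC 0 r) l) (≡.trans (List.unfold-reverse k (a ∷ p)) (≡.cong (_∷ʳ k) (List.unfold-reverse a p))))
    (≡.trans (zigC-snoc 0 (reverse p) a k l) (≡.cong₂ (λ r m → sat (zigC 0 r) l ∧ (bef (m , 0) (top (suc m) k) l ∧ sat (consC (chainL (suc m) k)) l))
      (≡.sym (List.unfold-reverse a p)) (≡.trans (ℕ.+-identityʳ _) (List.length-reverse p))))

  -- If the link across the cut holds, the first chain of the right part can join the zigzag on the
  -- left. In the right part the top of the next chain preceded its bottom, so the link across the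
  -- new cut is violated.
  aboveCut : ∀ a p k q l → zig (a ∷ p) l ∧ (sat (consC (blk (suc (length p)) (k ∷ q))) l ∧ bef (length p , 0) (top (suc (length p)) k) l) ≡ belowCut (k ∷ a ∷ p) q l
  aboveCut a p k []       l = ≡.trans (∧-shuffle₁ (zig (a ∷ p) l) (sat (consC (chainL (suc (length p)) k)) l) (bef (length p , 0) (top (suc (length p)) k) l))
    (≡.sym (zig-cons k a p l))
  aboveCut a p k (k′ ∷ q) l = ≡.trans (≡.cong (λ b → zg ∧ (b ∧ lk)) (blk-cons n k k′ q l))
    (≡.trans (∧-shuffle₂ zg ch lk b r) (≡.cong (_∧ (b ∧ r)) (≡.sym (zig-cons k a p l))))
    where
    n = suc (length p)
    zg = zig (a ∷ p) l
    lk = bef (length p , 0) (top n k) l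
    ch = sat (consC (chainL n k)) l
    b = sat (consC (blk (suc n) (k′ ∷ q))) l
    r = bef (top (suc n) k′) (n , 0) l

  𝟙-split : ∀ z b x y → y ≡ not x → 𝟙 (z ∧ b) ≈ 𝟙 (z ∧ (b ∧ y)) + 𝟙 (z ∧ (b ∧ x))
  𝟙-split false b     x     y     _      = sym (+-identityˡ _)
  𝟙-split true  false x     y     _      = sym (+-identityˡ _)
  𝟙-split true  true  true  .false ≡.refl = sym (+-identityˡ _)
  𝟙-split true  true  false .true  ≡.refl = sym (+-identityʳ _)

  -- Each cut is split according to the order of the two ends of its link, and the half in which the
  -- link holds cancels against the next cut by `aboveCut`. The hypothesis on l makes the two cases
  -- complementary.
  alt-belowCut : ∀ a p q l → (∀ j → j ℕ.< length q ℕ.+ suc (length p) → (j , 0) ∈ l) → alt (a ∷ p) q l ≈ sg (length q) * 𝟙 (belowCut (a ∷ p) q l)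
  alt-belowCut a p []      l marks = trans (≡⇒≈ (≡.cong 𝟙 (Bool.∧-identityʳ _))) (sym (*-identityˡ _))
  alt-belowCut a p (k ∷ q) l marks = begin
    - s * 𝟙 (cut (a ∷ p) (k ∷ q) l) + alt (k ∷ a ∷ p) q l
      ≈⟨ +-cong (*-congˡ (𝟙-split (zig (a ∷ p) l) _ _ _ (bef-flip l (marks (length p) (ℕ.s≤s (ℕ.≤-trans (ℕ.n≤1+n (length p)) (ℕ.m≤n+m (suc (length p)) (length q))))) (λ e → ℕ.m≢1+m+n (length p) (≡.trans (≡.cong proj₁ e) (≡.cong suc (≡.sym (ℕ.+-identityʳ _))))))))
           (alt-belowCut k (a ∷ p) q l (λ j h → marks j (≡.subst (j ℕ.<_) (ℕ.+-suc (length q) (suc (length p))) h))) ⟩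
    - s * (𝟙 (belowCut (a ∷ p) (k ∷ q) l) + 𝟙 (zig (a ∷ p) l ∧ (sat (consC (blk (suc (length p)) (k ∷ q))) l ∧ bef (length p , 0) (top (suc (length p)) k) l))) + s * 𝟙 (belowCut (k ∷ a ∷ p) q l)
      ≈⟨ +-congʳ (*-congˡ (+-congˡ (≡⇒≈ (≡.cong 𝟙 (aboveCut a p k q l))))) ⟩
    - s * (𝟙 (belowCut (a ∷ p) (k ∷ q) l) + 𝟙 (belowCut (k ∷ a ∷ p) q l)) + s * 𝟙 (belowCut (k ∷ a ∷ p) q l)
      ≈⟨ solve 3 (λ s x y → (:- s) :* (x :+ y) :+ s :* y := (:- s) :* x) refl s _ _ ⟩
    - s * 𝟙 (belowCut (a ∷ p) (k ∷ q) l) ∎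
    where s = sg (length q)

  -- Before the first chain there is no link to decide: the single chain already has the top of the
  -- second chain before the bottom of the first.
  firstCut : ∀ k q l → sat (consC (blk 0 (k ∷ q))) l ≡ belowCut (k ∷ []) q l
  firstCut k []       l = ≡.sym (≡.trans (sat-++ (consC (chainL 0 k)) [] l) (Bool.∧-identityʳ _))
  firstCut k (k′ ∷ q) l = ≡.trans (blk-cons 0 k k′ q l) (lem (sat (consC (blk 1 (k′ ∷ q))) l) _ _ _ (≡.trans (sat-++ (consC (chainL 0 k)) [] l) (Bool.∧-identityʳ _)))
    where
    lem : ∀ b r c c′ → c′ ≡ c → b ∧ (r ∧ c) ≡ c′ ∧ (b ∧ r)
    lem b r c .c ≡.refl = ≡.trans (≡.sym (Bool.∧-assoc b r c)) (Bool.∧-comm (b ∧ r) c)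

alt-0 : ∀ k q l → (∀ j → j ℕ.< length (k ∷ q) → (j , 0) ∈ l) → alt [] (k ∷ q) l ≈ 0#
alt-0 k q l marks = begin
  - s * 𝟙 (sat (consC (blk 0 (k ∷ q))) l) + alt (k ∷ []) q l
    ≈⟨ +-cong (*-congˡ (≡⇒≈ (≡.cong 𝟙 (firstCut k q l)))) (alt-belowCut k [] q l (λ j h → marks j (≡.subst (j ℕ.<_) (ℕ.+-comm (length q) 1) h))) ⟩
  - s * 𝟙 (belowCut (k ∷ []) q l) + s * 𝟙 (belowCut (k ∷ []) q l)
    ≈⟨ trans (sym (distribʳ _ _ _)) (trans (*-congʳ (-‿inverseˡ s)) (zeroˡ _)) ⟩
  0# ∎
  where s = sg (length q)

full-marks : ∀ n q j → j ℕ.< length q → (j ℕ.+ n , 0) ∈ full n q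
full-marks n (k ∷ q) zero    _          = ∈-++⁺ˡ (≡.subst ((n , 0) ∈_) (≡.sym (run-head n 0 (pred⁺ k))) (here ≡.refl))
full-marks n (k ∷ q) (suc j) (ℕ.s≤s h) = ∈-++⁺ʳ (chainL n k) (≡.subst (λ m → (m , 0) ∈ full (suc n) q) (ℕ.+-suc j n) (full-marks (suc n) q j h))

module _ (G : List E₂ → ℝ) where

  cutSum : Index → Index → ℝ
  cutSum p q = PS (λ l → 𝟙 (cut p q l) * G l) (full 0 (reverse p ++ q))

  -- The constraints of the two parts concern disjoint sets of elements and factor out of the
  -- shuffles; the right part is a chain and has only one ordering.
  cutSum-≈ : ∀ p q → cutSum p q ≈ PS (λ u → 𝟙 (zig p u) * Sh G u (blk (length p) q)) (full 0 (reverse p))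
  cutSum-≈ p q = begin
    PS (λ l → 𝟙 (cut p q l) * G l) (full 0 (reverse p ++ q))
      ≈⟨ trans (≡⇒≈ (≡.cong (PS (λ l → 𝟙 (cut p q l) * G l)) split)) (PS-↭ (λ l → 𝟙 (cut p q l) * G l) (++⁺ˡ (full 0 (reverse p)) (full-↭-blk n q))) ⟩
    PS (λ l → 𝟙 (cut p q l) * G l) (full 0 (reverse p) ++ blk n q)
      ≈⟨ PS-++ (λ l → 𝟙 (cut p q l) * G l) (full 0 (reverse p)) (blk n q) ⟩
    PS (λ u → PS (λ v → Sh (λ l → 𝟙 (cut p q l) * G l) u v) (blk n q)) (full 0 (reverse p))
      ≈⟨ PS-cong↭ (full 0 (reverse p)) (λ u u↭ → trans (PS-cong↭ (blk n q) (λ v v↭ → inner u v u↭ v↭))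
           (trans (PS-* (𝟙 (zig p u)) (λ v → 𝟙 (sat (consC (blk n q)) v) * Sh G u v) (blk n q)) (*-congˡ (PS-consC (Sh G u) (distinct-blk n q))))) ⟩
    PS (λ u → 𝟙 (zig p u) * Sh G u (blk n q)) (full 0 (reverse p)) ∎
    where
    n = length p
    split : full 0 (reverse p ++ q) ≡ full 0 (reverse p) ++ full n q
    split = ≡.trans (full-++ 0 (reverse p) q) (≡.cong (λ m → full 0 (reverse p) ++ full m q) (≡.trans (ℕ.+-identityʳ _) (List.length-reverse p)))
    m≡n : length (reverse p) ℕ.+ 0 ≡ n
    m≡n = ≡.trans (ℕ.+-identityʳ _) (List.length-reverse p)
    inner : ∀ u v → u ↭ full 0 (reverse p) → v ↭ blk n q →
            Sh (λ l → 𝟙 (cut p q l) * G l) u v ≈ 𝟙 (zig p u) * (𝟙 (sat (consC (blk n q)) v) * Sh G u v)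
    inner u v u↭ v↭ = begin
      Sh (λ l → 𝟙 (zig p l ∧ sat (consC (blk n q)) l) * G l) u v
        ≈⟨ Sh-cong u v (λ l → trans (*-congʳ (𝟙-∧ (zig p l) (sat (consC (blk n q)) l))) (*-assoc _ _ _)) ⟩
      Sh (λ l → 𝟙 (zig p l) * (𝟙 (sat (consC (blk n q)) l) * G l)) u v
        ≈⟨ Sh-satˡ (λ l → 𝟙 (sat (consC (blk n q)) l) * G l) u v (All.map (λ (x , y) → above∉ v-above x , above∉ v-above y) (≡.subst (λ m → All (Both (Below m)) (zigC 0 (reverse p))) m≡n (zigC-below 0 (reverse p)))) ⟩
      𝟙 (zig p u) * Sh (λ l → 𝟙 (sat (consC (blk n q)) l) * G l) u v
        ≈⟨ *-congˡ (Sh-satʳ G u v (consC-avoids (blk n q) (All.map (below∉ u-below) (blk-above n q)))) ⟩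
      𝟙 (zig p u) * (𝟙 (sat (consC (blk n q)) v) * Sh G u v) ∎
      where
      v-above : All (Above n) v
      v-above = All-resp-↭ (↭-sym v↭) (blk-above n q)
      u-below : All (Below n) u
      u-below = All-resp-↭ (↭-sym u↭) (≡.subst (λ m → All (Below m) (full 0 (reverse p))) m≡n (full-below 0 (reverse p)))

  pairCut : Index → Index → ℝ
  pairCut p []      = cutSum p []
  pairCut p (k ∷ q) = sg (length (k ∷ q)) * cutSum p (k ∷ q) + pairCut (k ∷ p) q

  pairCut-alt : ∀ p q → pairCut p q ≈ PS (λ l → alt p q l * G l) (full 0 (reverse p ++ q))
  pairCut-alt p []      = refl
  pairCut-alt p (k ∷ q) = begin
    sg (length (k ∷ q)) * cutSum p (k ∷ q) + pairCut (k ∷ p) q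
      ≈⟨ +-cong (sym (PS-* _ _ (full 0 (reverse p ++ k ∷ q)))) (trans (pairCut-alt (k ∷ p) q) (≡⇒≈ (≡.cong (λ r → PS (λ l → alt (k ∷ p) q l * G l) (full 0 r)) shift-k))) ⟩
    PS (λ l → sg (length (k ∷ q)) * (𝟙 (cut p (k ∷ q) l) * G l)) L + PS (λ l → alt (k ∷ p) q l * G l) L
      ≈⟨ sym (PS-+ (λ l → sg (length (k ∷ q)) * (𝟙 (cut p (k ∷ q) l) * G l)) (λ l → alt (k ∷ p) q l * G l) L) ⟩
    PS (λ l → sg (length (k ∷ q)) * (𝟙 (cut p (k ∷ q) l) * G l) + alt (k ∷ p) q l * G l) L
      ≈⟨ PS-cong L (λ l → trans (+-congʳ (sym (*-assoc _ _ _))) (sym (distribʳ _ _ _))) ⟩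
    PS (λ l → alt p (k ∷ q) l * G l) L ∎
    where
    L = full 0 (reverse p ++ k ∷ q)
    shift-k : reverse (k ∷ p) ++ q ≡ reverse p ++ k ∷ q
    shift-k = ≡.trans (≡.cong (_++ q) (List.unfold-reverse k p)) (List.++-assoc (reverse p) (k ∷ []) q)

  pairCut-0 : ∀ k q → pairCut [] (k ∷ q) ≈ 0#
  pairCut-0 k q = trans (pairCut-alt [] (k ∷ q)) (trans (PS-cong↭ (full 0 (k ∷ q)) (λ l l↭ → trans (*-congʳ (alt-0 k q l (marks l l↭))) (zeroˡ _))) (PS-0 (full 0 (k ∷ q))))
    where
    marks : ∀ l → l ↭ full 0 (k ∷ q) → ∀ j → j ℕ.< length (k ∷ q) → (j , 0) ∈ l
    marks l l↭ j h = ∈-resp-↭ (↭-sym l↭) (≡.subst (λ m → (m , 0) ∈ full 0 (k ∷ q)) (ℕ.+-identityʳ j) (full-marks 0 (k ∷ q) j h))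

module KY {Zsh : 𝔥¹ → ℝ[T]} (regsh : IsRegularization _sh¹_ Zsh) where
  open Regsh regsh

  s : Index → ℝ
  s p = ζ⋆-KY Zsh (reverse p)

  β± : Index → ℝ
  β± q = sg (length q) * β q

  private
    G : List E₂ → ℝ
    G l = ρᵂ (map label₂ l)

    ⅀-shʷ : ∀ a b → ⅀ (a shʷ b) ρᵂ ≈ Sh ρᵂ a b
    ⅀-shʷ a b = begin
      ⅀ (a shʷ b) ρᵂ                               ≈⟨ ⅀-map reverse (reverse a shʳ reverse b) ρᵂ ⟩
      ⅀ (reverse a shʳ reverse b) (ρᵂ ∘ reverse)   ≈⟨ ⅀-shʳ _ (reverse a) (reverse b) ⟩
      Sh (ρᵂ ∘ reverse) (reverse a) (reverse b)    ≈⟨ Sh-reverse ρᵂ (reverse a) (reverse b) ⟩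
      Sh ρᵂ (reverse (reverse a)) (reverse (reverse b)) ≈⟨ ≡⇒≈ (≡.cong₂ (Sh ρᵂ) (List.reverse-involutive a) (List.reverse-involutive b)) ⟩
      Sh ρᵂ a b ∎

    s*β : ∀ p q → s p * β q ≈ cutSum G p q
    s*β p q = begin
      s p * β q
        ≈⟨ *-cong (linear (w⋆ k)) (sym ρ⟨ reverse q ⟩) ⟩
      ρ[ w⋆ k ] * ρ[ ⟨ reverse q ⟩ ]
        ≈⟨ ρ-sh (w⋆ k) ⟨ reverse q ⟩ ⟩
      ⅀ (ι (w⋆ k)) (λ (r , a) → fromℚ (r ℚ.* 1ℚ) * ⅀ (a shʷ zs (reverse q)) ρᵂ + 0#)
        ≈⟨ ≡⇒≈ (≡.cong (λ w → ⅀ w (λ (r , a) → fromℚ (r ℚ.* 1ℚ) * ⅀ (a shʷ zs (reverse q)) ρᵂ + 0#)) (ι-w⋆ k)) ⟩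
      ⅀ (W (X⋆ k)) (λ (r , a) → fromℚ (r ℚ.* 1ℚ) * ⅀ (a shʷ zs (reverse q)) ρᵂ + 0#)
        ≈⟨ ⅀-map _ (linearExtensions (X⋆ k)) _ ⟩
      ⅀ (linearExtensions (X⋆ k)) (λ f → fromℚ (1ℚ ℚ.* 1ℚ) * ⅀ (word f shʷ zs (reverse q)) ρᵂ + 0#)
        ≈⟨ ⅀-cong (linearExtensions (X⋆ k)) (λ f → trans (+-identityʳ _) (trans (*-identityˡ _) (⅀-shʷ (word f) (zs (reverse q))))) ⟩
      ⅀ (linearExtensions (X⋆ k)) (λ f → Sh ρᵂ (word f) (zs (reverse q)))
        ≈⟨ ⅀-linearExtensions k (λ a → Sh ρᵂ a (zs (reverse q))) ⟩
      PS (λ u → 𝟙 (zig p u) * Sh ρᵂ (map label₂ u) (zs (reverse q))) (full 0 k)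
        ≈⟨ PS-cong (full 0 k) (λ u → *-congˡ (trans (≡⇒≈ (≡.cong (Sh ρᵂ (map label₂ u)) (≡.sym (map-label-blk (length p) q)))) (Sh-map label₂ ρᵂ u (blk (length p) q)))) ⟩
      PS (λ u → 𝟙 (zig p u) * Sh G u (blk (length p) q)) (full 0 k)
        ≈⟨ sym (cutSum-≈ G p q) ⟩
      cutSum G p q ∎
      where
      k = reverse p
      word : _ → Word
      word f = tabulate (X⋆-Order.label k ∘ Inverse.from f)

    pair-cut : ∀ p q → pair s β± p q ≈ pairCut G p q
    pair-cut p []      = trans (*-congˡ (*-identityˡ _)) (s*β p [])
    pair-cut p (k ∷ q) = +-cong (trans (solve 3 (λ x y z → x :* (y :* z) := y :* (x :* z)) refl (s p) (sg (length (k ∷ q))) (β (k ∷ q))) (*-congˡ (s*β p (k ∷ q)))) (pair-cut (k ∷ p) q)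

  pair-s-0 : ∀ k q → pair s β± [] (k ∷ q) ≈ 0#
  pair-s-0 k q = trans (pair-cut [] (k ∷ q)) (pairCut-0 G k q)

  pair-s-[] : pair s β± [] [] ≈ 1#
  pair-s-[] = trans (pair-cut [] []) (trans (*-identityˡ _) ρ-[])

-- t-adic symmetric values

-- Multiplication by w anticommutes with D, so that conjugation by w turns a(D) into a(-D).
▷-twist : ∀ (w : Index → ℝ) → (∀ p → w (1⁺ ∷ p) ≈ - w p) → ∀ a f p → w p * (a ▷ f) p ≈ (tw a ▷ (λ q → w q * f q)) p
▷-twist w w1 a f []            = assoc₀
  where
  assoc₀ : w [] * (a 0 * f []) ≈ 1# * a 0 * (w [] * f [])
  assoc₀ = trans (solve 3 (λ w a f → w :* (a :* f) := a :* (w :* f)) refl _ _ _) (*-congʳ (sym (*-identityˡ _)))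
▷-twist w w1 a f (1⁺ ∷ p)      = begin
  w (1⁺ ∷ p) * (a 0 * f (1⁺ ∷ p) + (shift a ▷ f) p)
    ≈⟨ solve 4 (λ w a f s → w :* (a :* f :+ s) := a :* (w :* f) :+ w :* s) refl (w (1⁺ ∷ p)) (a 0) (f (1⁺ ∷ p)) _ ⟩
  a 0 * (w (1⁺ ∷ p) * f (1⁺ ∷ p)) + w (1⁺ ∷ p) * (shift a ▷ f) p
    ≈⟨ +-cong (*-congʳ (sym (*-identityˡ _))) (trans (*-congʳ (w1 p)) (solve 2 (λ w s → (:- w) :* s := :- (w :* s)) refl _ _)) ⟩
  tw a 0 * (w (1⁺ ∷ p) * f (1⁺ ∷ p)) + - (w p * (shift a ▷ f) p)
    ≈⟨ +-congˡ (-‿cong (▷-twist w w1 (shift a) f p)) ⟩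
  tw a 0 * (w (1⁺ ∷ p) * f (1⁺ ∷ p)) + - (tw (shift a) ▷ (λ q → w q * f q)) p
    ≈⟨ +-congˡ (trans (neg1 _) (sym (▷-* (- 1#) (tw (shift a)) (λ q → w q * f q) p))) ⟩
  tw a 0 * (w (1⁺ ∷ p) * f (1⁺ ∷ p)) + ((λ n → - 1# * tw (shift a) n) ▷ (λ q → w q * f q)) p
    ≈⟨ +-congˡ (▷-cong (λ n → trans (sym (neg1 _)) (solve 2 (λ s x → :- (s :* x) := (:- s) :* x) refl _ _)) (λ _ → refl) p) ⟩
  tw a 0 * (w (1⁺ ∷ p) * f (1⁺ ∷ p)) + (shift (tw a) ▷ (λ q → w q * f q)) p ∎
  where
  neg1 : ∀ x → - x ≈ - 1# * x
  neg1 x = trans (-‿cong (sym (*-identityˡ x))) (solve 2 (λ o x → :- (o :* x) := (:- o) :* x) refl _ _)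
▷-twist w w1 a f ((2+⁺ m) ∷ p) = trans (solve 3 (λ w a f → w :* (a :* f) := a :* (w :* f)) refl _ _ _) (*-congʳ (sym (*-identityˡ _)))

-- The convolution is triangular: its last summand is F at the whole index times G [] = 1, and the
-- others contain F at shorter indices only.
pair-cancel : ∀ {F F′ G} → G [] ≈ 1# → (∀ q → pair F G [] q ≈ pair F′ G [] q) → ∀ p → F p ≈ F′ p
pair-cancel {F} {F′} {G} G1 e p = ≡.subst (λ r → F r ≈ F′ r) (List.reverse-involutive p) (below (suc (length (reverse p))) (reverse p) ℕ.≤-refl)
  where
  +-cancelˡ : ∀ {x y y′} → x + y ≈ x + y′ → y ≈ y′
  +-cancelˡ {x} {y} {y′} h = trans (solve 2 (λ x y → y := (:- x) :+ (x :+ y)) refl x y) (trans (+-congˡ h) (solve 2 (λ x y → (:- x) :+ (x :+ y) := y) refl x y′))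
  last : ∀ p q → (∀ r → length r ℕ.< length p ℕ.+ length q → F r ≈ F′ r) → pair F G p q ≈ pair F′ G p q → F (reverse q ++ p) ≈ F′ (reverse q ++ p)
  last p []      h e = trans (sym (trans (*-congˡ G1) (*-identityʳ _))) (trans e (trans (*-congˡ G1) (*-identityʳ _)))
  last p (k ∷ q) h e = ≡.subst (λ r → F r ≈ F′ r) shift-k
    (last (k ∷ p) q (λ r lt → h r (≡.subst (length r ℕ.<_) (≡.sym (ℕ.+-suc (length p) (length q))) lt))
      (+-cancelˡ (trans e (+-congʳ (*-congʳ (sym (h p (ℕ.m<m+n (length p) (ℕ.s≤s ℕ.z≤n)))))))))
    where
    shift-k : reverse q ++ k ∷ p ≡ reverse (k ∷ q) ++ p
    shift-k = ≡.sym (≡.trans (≡.cong (_++ p) (List.unfold-reverse k q)) (List.++-assoc (reverse q) (k ∷ []) p))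
  below : ∀ n q → length q ℕ.< n → F (reverse q) ≈ F′ (reverse q)
  below (suc n) q (ℕ.s≤s lt) = ≡.subst (λ r → F r ≈ F′ r) (List.++-identityʳ (reverse q))
    (last [] q (λ r h → ≡.subst (λ r → F r ≈ F′ r) (List.reverse-involutive r)
      (below n (reverse r) (ℕ.≤-trans (≡.subst (ℕ._< length q) (≡.sym (List.length-reverse r)) h) lt))) (e q))

mergeLast : ℕ⁺ → Index → Index
mergeLast l []          = []
mergeLast l (x ∷ [])    = (x ⊕ l) ∷ []
mergeLast l (x ∷ y ∷ w) = x ∷ mergeLast l (y ∷ w)

mergeLast-snoc : ∀ l w x → mergeLast l (w ∷ʳ x) ≡ w ∷ʳ (x ⊕ l)
mergeLast-snoc l []          x = ≡.refl
mergeLast-snoc l (y ∷ [])    x = ≡.refl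
mergeLast-snoc l (y ∷ z ∷ w) x = ≡.cong (y ∷_) (mergeLast-snoc l (z ∷ w) x)

squaresFrom-snoc : ∀ k ks l f → ⅀ (squaresFrom k (ks ∷ʳ l)) f ≈ ⅀ (squaresFrom k ks) (λ w → f (w ∷ʳ l) + f (mergeLast l w))
squaresFrom-snoc k []       l f = trans (+-congˡ (+-identityʳ _)) (sym (+-identityʳ _))
squaresFrom-snoc k (x ∷ ks) l f = begin
  ⅀ (map (k ∷_) (squaresFrom x (ks ∷ʳ l)) ++ squaresFrom (k ⊕ x) (ks ∷ʳ l)) f
    ≈⟨ trans (⅀-++ (map (k ∷_) (squaresFrom x (ks ∷ʳ l))) _ f) (+-congʳ (⅀-map (k ∷_) (squaresFrom x (ks ∷ʳ l)) f)) ⟩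
  ⅀ (squaresFrom x (ks ∷ʳ l)) (λ w → f (k ∷ w)) + ⅀ (squaresFrom (k ⊕ x) (ks ∷ʳ l)) f
    ≈⟨ +-cong (trans (squaresFrom-snoc x ks l (λ w → f (k ∷ w))) (∷-nonempty x ks (λ h t → refl))) (squaresFrom-snoc (k ⊕ x) ks l f) ⟩
  ⅀ (squaresFrom x ks) (λ w → f (k ∷ w ∷ʳ l) + f (mergeLast l (k ∷ w))) + ⅀ (squaresFrom (k ⊕ x) ks) (λ w → f (w ∷ʳ l) + f (mergeLast l w))
    ≈⟨ sym (trans (⅀-++ (map (k ∷_) (squaresFrom x ks)) _ _) (+-congʳ (⅀-map (k ∷_) (squaresFrom x ks) _))) ⟩
  ⅀ (squaresFrom k (x ∷ ks)) (λ w → f (w ∷ʳ l) + f (mergeLast l w)) ∎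

-- `squares` unfolds at the first entry, so the recursion at the last one, by appending or merging,
-- is what its reversal needs.
squares-reverse : ∀ p f → ⅀ (squares (reverse p)) f ≈ ⅀ (squares p) (f ∘ reverse)
squares-reverse []          f = refl
squares-reverse (a ∷ [])    f = refl
squares-reverse (a ∷ b ∷ p) f = begin
  ⅀ (squares (reverse (a ∷ b ∷ p))) f
    ≈⟨ ≡⇒≈ (≡.cong (λ r → ⅀ (squares r) f) (List.unfold-reverse a (b ∷ p))) ⟩
  ⅀ (squares (reverse (b ∷ p) ∷ʳ a)) f
    ≈⟨ snoc′ (reverse (b ∷ p)) (λ e → nonempty (≡.trans (≡.sym (List.unfold-reverse b p)) e)) ⟩
  ⅀ (squares (reverse (b ∷ p))) (λ w → f (w ∷ʳ a) + f (mergeLast a w))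
    ≈⟨ squares-reverse (b ∷ p) _ ⟩
  ⅀ (squaresFrom b p) (λ w → f (reverse w ∷ʳ a) + f (mergeLast a (reverse w)))
    ≈⟨ ∷-nonempty b p (λ h t → +-cong (≡⇒≈ (≡.cong f (≡.sym (List.unfold-reverse a (h ∷ t))))) (≡⇒≈ (≡.cong f (merge-reverse h t)))) ⟩
  ⅀ (squaresFrom b p) (λ w → f (reverse (a ∷ w)) + f (reverse (mergeHead a w)))
    ≈⟨ ⅀-+ (squaresFrom b p) _ _ ⟩
  ⅀ (squaresFrom b p) (λ w → f (reverse (a ∷ w))) + ⅀ (squaresFrom b p) (λ w → f (reverse (mergeHead a w)))
    ≈⟨ +-cong (sym (⅀-map (a ∷_) (squaresFrom b p) (f ∘ reverse))) (trans (sym (⅀-map (mergeHead a) (squaresFrom b p) (f ∘ reverse))) (≡⇒≈ (≡.cong (λ l → ⅀ l (f ∘ reverse)) (≡.sym (squaresFrom-⊕ a b p))))) ⟩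
  ⅀ (map (a ∷_) (squaresFrom b p)) (f ∘ reverse) + ⅀ (squaresFrom (a ⊕ b) p) (f ∘ reverse)
    ≈⟨ sym (⅀-++ (map (a ∷_) (squaresFrom b p)) _ _) ⟩
  ⅀ (squares (a ∷ b ∷ p)) (f ∘ reverse) ∎
  where
  nonempty : reverse p ∷ʳ b ≢ []
  nonempty e with reverse p
  nonempty () | []
  nonempty () | _ ∷ _
  snoc′ : ∀ r → r ≢ [] → ⅀ (squares (r ∷ʳ a)) f ≈ ⅀ (squares r) (λ w → f (w ∷ʳ a) + f (mergeLast a w))
  snoc′ []      ne = contradiction ≡.refl ne
  snoc′ (k ∷ r) ne = squaresFrom-snoc k r a f
  merge-reverse : ∀ h t → mergeLast a (reverse (h ∷ t)) ≡ reverse (mergeHead a (h ∷ t))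
  merge-reverse h t = ≡.trans (≡.cong (mergeLast a) (List.unfold-reverse h t)) (≡.trans (mergeLast-snoc a (reverse t) h) (≡.sym (List.unfold-reverse (h ⊕ a) t)))

ζ⋆-star : ∀ Z• p → ζ⋆ Z• (reverse p) ≈ star (λ l → regζ Z• (reverse l)) p
ζ⋆-star Z• p = trans (∑≈⅀ (regζ Z•) (squares (reverse p))) (squares-reverse p (regζ Z•))

sgn≈sg : ∀ n → sgn n ≈ sg n
sgn≈sg zero    = refl
sgn≈sg (suc n) = trans (≡⇒≈ (≡.sym (⊖-def (sgn n)))) (-‿cong (sgn≈sg n))

weight : Index → ℝ
weight q = sgn (sum (map ⌊_⌋ q))

-- Here f takes its argument read from the end. The last entry of (k_r + l_r, ..., k_{i+1} +
-- l_{i+1}) is the one next to the cut, so this reading is the suffix in its given order.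
tail : (Index → ℝ) → ℕ → Index → ℝ
tail f n q = ⅀ (weakCompositions (length q) n) (λ l → binom q l * f (zipWith _⊞_ q l))

tail-cong : ∀ {f g} → (∀ p → f p ≈ g p) → ∀ n q → tail f n q ≈ tail g n q
tail-cong e n q = ⅀-cong (weakCompositions (length q) n) (λ l → *-congˡ (e _))

suffix : (Index → ℝ) → ℕ → Index → ℝ
suffix f n q = weight q * tail f n q

reverse-shift : ∀ {A : Set} (k : A) q p → reverse (k ∷ q) ++ p ≡ reverse q ++ k ∷ p
reverse-shift k q p = ≡.trans (≡.cong (_++ p) (List.unfold-reverse k q)) (List.++-assoc (reverse q) (k ∷ []) p)

pair-upTo : ∀ F G p q → ⅀ (upTo (suc (length q))) (λ i → F (reverse (take i q) ++ p) * G (drop i q)) ≈ pair F G p q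
pair-upTo F G p []      = +-identityʳ _
pair-upTo F G p (k ∷ q) = +-congˡ (begin
  ⅀ (applyUpTo suc (suc (length q))) (λ i → F (reverse (take i (k ∷ q)) ++ p) * G (drop i (k ∷ q)))
    ≈⟨ ≡⇒≈ (≡.cong (λ l → ⅀ l (λ i → F (reverse (take i (k ∷ q)) ++ p) * G (drop i (k ∷ q)))) (≡.sym (List.map-upTo suc (suc (length q))))) ⟩
  ⅀ (map suc (upTo (suc (length q)))) (λ i → F (reverse (take i (k ∷ q)) ++ p) * G (drop i (k ∷ q)))
    ≈⟨ ⅀-map suc (upTo (suc (length q))) _ ⟩
  ⅀ (upTo (suc (length q))) (λ i → F (reverse (k ∷ take i q) ++ p) * G (drop i q))
    ≈⟨ ⅀-cong (upTo (suc (length q))) (λ i → *-congʳ (≡⇒≈ (≡.cong F (reverse-shift k (take i q) p)))) ⟩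
  ⅀ (upTo (suc (length q))) (λ i → F (reverse (take i q) ++ k ∷ p) * G (drop i q))
    ≈⟨ pair-upTo F G (k ∷ p) q ⟩
  pair F G (k ∷ p) q ∎)

ζŜ-pair : ∀ f k n → ζŜ f k n ≈ pair (f ∘ reverse) (suffix (f ∘ reverse) n) [] k
ζŜ-pair f k n = trans (∑≈⅀ (ζŜ-term f k n) (upTo (suc (length k))))
  (trans (⅀-cong (upTo (suc (length k))) term) (pair-upTo (f ∘ reverse) (suffix (f ∘ reverse) n) [] k))
  where
  term : ∀ i → ζŜ-term f k n i ≈ f (reverse (reverse (take i k) ++ [])) * suffix (f ∘ reverse) n (drop i k)
  term i = begin
    (weight q *ℝ f (take i k)) *ℝ ∑ (map g (weakCompositions (length q) n))
      ≈⟨ ≡⇒≈ (≡.trans (≡.sym (∙-def _ _)) (≡.cong (_* ∑ (map g (weakCompositions (length q) n))) (≡.sym (∙-def (weight q) (f (take i k)))))) ⟩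
    (weight q * f (take i k)) * ∑ (map g (weakCompositions (length q) n))
      ≈⟨ *-congˡ (trans (∑≈⅀ g (weakCompositions (length q) n)) (⅀-cong (weakCompositions (length q) n) (λ l → ≡⇒≈ (≡.sym (∙-def (binom q l) _))))) ⟩
    (weight q * f (take i k)) * tail (f ∘ reverse) n q
      ≈⟨ solve 3 (λ w f t → (w :* f) :* t := f :* (w :* t)) refl _ _ _ ⟩
    f (take i k) * suffix (f ∘ reverse) n q
      ≈⟨ *-congʳ (≡⇒≈ (≡.cong f (≡.sym (≡.trans (≡.cong reverse (List.++-identityʳ (reverse (take i k)))) (List.reverse-involutive (take i k)))))) ⟩
    f (reverse (reverse (take i k) ++ [])) * suffix (f ∘ reverse) n q ∎
    where
    q = drop i k
    g : List ℕ → ℝ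
    g l = binom q l *ℝ f (reverse (zipWith _⊞_ q l))

binom-0 : ∀ q l → binom (1⁺ ∷ q) (0 ∷ l) ≡ binom q l
binom-0 q l = ≡.cong (λ m → fromℚ (ℤ.+ m ℚ./ 1)) (ℕ.*-identityˡ (product (zipWith (λ kⱼ lⱼ → (pred⁺ kⱼ ℕ.+ lⱼ) C lⱼ) q l)))

-- After raising, the first entry is 1 only if it was 1 and its l is 0, and then its binomial
-- coefficient is 1.
tail-D : ∀ f n q → tail (D f) n q ≈ D (tail f n) q
tail-D f zero    [] = trans (+-identityʳ _) (zeroʳ _)
tail-D f (suc n) [] = refl
tail-D f n (1⁺ ∷ q) = begin
  ⅀ (concatMap (λ l → map (l ∷_) (wc (n ℕ.∸ l))) (upTo (suc n))) F
    ≈⟨ trans (⅀-concatMap (λ l → map (l ∷_) (wc (n ℕ.∸ l))) (upTo (suc n)) F) (+-cong (⅀-map (0 ∷_) (wc n) F) higher) ⟩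
  ⅀ (wc n) (λ l → binom (1⁺ ∷ q) (0 ∷ l) * f (zipWith _⊞_ q l)) + 0#
    ≈⟨ trans (+-identityʳ _) (⅀-cong (wc n) (λ l → *-congʳ (≡⇒≈ (binom-0 q l)))) ⟩
  tail f n q ∎
  where
  wc = weakCompositions (length q)
  F : List ℕ → ℝ
  F l = binom (1⁺ ∷ q) l * D f (zipWith _⊞_ (1⁺ ∷ q) l)
  higher : ⅀ (applyUpTo suc n) (λ l → ⅀ (map (l ∷_) (wc (n ℕ.∸ l))) F) ≈ 0#
  higher = trans (≡⇒≈ (≡.cong (λ l → ⅀ l (λ l → ⅀ (map (l ∷_) (wc (n ℕ.∸ l))) F)) (≡.sym (List.map-upTo suc n))))
    (trans (⅀-map suc (upTo n) _) (⅀-0 (upTo n) (λ l → trans (⅀-map (suc l ∷_) (wc (n ℕ.∸ suc l)) F) (⅀-0 (wc (n ℕ.∸ suc l)) (λ _ → zeroʳ _)))))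
tail-D f n ((2+⁺ m) ∷ q) = trans (⅀-concatMap (λ l → map (l ∷_) (wc (n ℕ.∸ l))) (upTo (suc n)) F)
  (⅀-0 (upTo (suc n)) (λ l → trans (⅀-map (l ∷_) (wc (n ℕ.∸ l)) F) (⅀-0 (wc (n ℕ.∸ l)) (λ _ → zeroʳ _))))
  where
  wc = weakCompositions (length q)
  F : List ℕ → ℝ
  F l = binom ((2+⁺ m) ∷ q) l * D f (zipWith _⊞_ ((2+⁺ m) ∷ q) l)

tail-▷ : ∀ a f n q → tail (a ▷ f) n q ≈ (a ▷ tail f n) q
tail-▷ a f n q = begin
  tail (a ▷ f) n q
    ≈⟨ ⅀-cong L (λ l → trans (*-congˡ (▷-D a f _)) (trans (distribˡ _ _ _) (+-congʳ (solve 3 (λ b a f → b :* (a :* f) := a :* (b :* f)) refl _ _ _)))) ⟩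
  ⅀ L (λ l → a 0 * (binom q l * f (zipWith _⊞_ q l)) + binom q l * D (shift a ▷ f) (zipWith _⊞_ q l))
    ≈⟨ trans (⅀-+ L _ _) (+-cong (⅀-*ˡ L (a 0) _) (trans (tail-D (shift a ▷ f) n q) (below q))) ⟩
  a 0 * tail f n q + D (shift a ▷ tail f n) q
    ≈⟨ sym (▷-D a (tail f n) q) ⟩
  (a ▷ tail f n) q ∎
  where
  L = weakCompositions (length q) n
  below : ∀ q → D (tail (shift a ▷ f) n) q ≈ D (shift a ▷ tail f n) q
  below []            = refl
  below (1⁺ ∷ q)      = tail-▷ (shift a) f n q
  below ((2+⁺ _) ∷ q) = refl

suffix-▷ : ∀ a f n q → suffix (a ▷ f) n q ≈ (tw a ▷ suffix f n) q
suffix-▷ a f n q = trans (*-congˡ (tail-▷ a f n q)) (▷-twist weight (λ p → trans (≡⇒≈ (≡.sym (⊖-def _))) refl) a (tail f n) q)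

module Congruences {Z∗ Zsh : 𝔥¹ → ℝ[T]} (reg∗ : IsRegularization _∗_ Z∗) (regsh : IsRegularization _sh¹_ Zsh) where
  open Reg∗ reg∗ using (α)
  open Reg∗-Limit reg∗
  open Regsh regsh using (β; ρ-[])
  open Comparison reg∗ regsh
  open Membership reg∗
  open EvenZeta reg∗ regsh

  σ : Index → ℝ
  σ = star α

  ζ⋆∗ : ∀ p → ζ⋆ Z∗ (reverse p) ≈ σ p
  ζ⋆∗ p = ζ⋆-star Z∗ p

  ζ⋆sh : ∀ p → ζ⋆ Zsh (reverse p) ≈ (A ▷ σ) p
  ζ⋆sh p = trans (ζ⋆-star Zsh p) (trans (⅀-cong (squares p) β≈A▷α) (star-▷ A α p))

  -- As β± = A(-D) χ± and D is self-adjoint for `pair`, E(-D) σ pairs with β± as σ does with E(-D)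
  -- A(-D) χ± = χ±, hence by the antipode relation. `KY.s` satisfies the same relation with β±.
  ζ⋆KY : ∀ p → ζ⋆-KY Zsh (reverse p) ≈ (tw E ▷ σ) p
  ζ⋆KY = pair-cancel {G = KY.β± regsh} (trans (*-identityˡ _) ρ-[]) agree
    where
    β±≈ : ∀ q → KY.β± regsh q ≈ (tw A ▷ χ±) q
    β±≈ q = trans (*-congˡ (β≈A▷α q)) (▷-twist (λ q → sg (length q)) (λ _ → refl) A α q)
    rhs : ∀ q → pair (tw E ▷ σ) (KY.β± regsh) [] q ≈ pair σ χ± [] q
    rhs q = begin
      pair (tw E ▷ σ) (KY.β± regsh) [] q        ≈⟨ pair-cong (λ _ → refl) β±≈ [] q ⟩
      pair (tw E ▷ σ) (tw A ▷ χ±) [] q          ≈⟨ pair-▷ (tw E) σ (tw A ▷ χ±) q ⟩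
      pair σ (tw E ▷ (tw A ▷ χ±)) [] q          ≈⟨ pair-cong (λ _ → refl) cancel [] q ⟩
      pair σ χ± [] q ∎
      where
      cancel : ∀ r → (tw E ▷ (tw A ▷ χ±)) r ≈ χ± r
      cancel r = trans (▷-▷ (tw E) (tw A) χ± r) (trans (▷-cong (λ n → trans (⊛-comm (tw E) (tw A) n)
        (trans (sym (tw-⊛ A E n)) (trans (*-congˡ (A⊛E n)) (tw-δ₀ n)))) (λ _ → refl) r) (▷-δ₀ χ± r))
    agree : ∀ q → pair (KY.s regsh) (KY.β± regsh) [] q ≈ pair (tw E ▷ σ) (KY.β± regsh) [] q
    agree []      = trans (KY.pair-s-[] regsh) (sym (trans (rhs []) antipode-[]))
    agree (k ∷ q) = trans (KY.pair-s-0 regsh k q) (sym (trans (rhs (k ∷ q)) (antipode k q)))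

  𝒵-σ : ∀ p → 𝒵 (σ p)
  𝒵-σ p = ⅀-closed {𝒵} 𝒵-0 𝒵-+ (All.universal 𝒵-α (squares p))

  𝒵-suffix : ∀ {f} → (∀ p → 𝒵 (f p)) → ∀ n q → 𝒵 (suffix f n q)
  𝒵-suffix h n q = 𝒵-* (𝒵-≈ (sym (sgn≈sg (sum (map ⌊_⌋ q)))) (𝒵-sg (sum (map ⌊_⌋ q))))
    (⅀-closed {𝒵} 𝒵-0 𝒵-+ (All.universal (λ l → 𝒵-ℚ _ (h _)) (weakCompositions (length q) n)))

  𝒵-pair : ∀ {F G} → (∀ p → 𝒵 (F p)) → (∀ p → 𝒵 (G p)) → ∀ p q → 𝒵 (pair F G p q)
  𝒵-pair g h p []      = 𝒵-* (g p) (h [])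
  𝒵-pair g h p (k ∷ q) = 𝒵-+ (𝒵-* (g p) (h (k ∷ q))) (𝒵-pair g h (k ∷ p) q)

  I-pair : ∀ {F G} → (∀ p → 𝒵 (F p)) → (∀ p → I (G p)) → ∀ p q → I (pair F G p q)
  I-pair g h p []      = I-*ˡ (g p) (h [])
  I-pair g h p (k ∷ q) = I-+ (I-*ˡ (g p) (h (k ∷ q))) (I-pair g h (k ∷ p) q)

  ζŜ-𝒵 : ∀ f → (∀ p → 𝒵 (f (reverse p))) → ∀ k n → 𝒵 (ζŜ f k n)
  ζŜ-𝒵 f h k n = 𝒵-≈ (sym (ζŜ-pair f k n)) (𝒵-pair h (𝒵-suffix h n) [] k)

  -- ⟨a ▷ σ , tw a ▷ suffix⟩ = ⟨σ , (a ⊛ tw a) ▷ suffix⟩, and a ⊛ tw a = 1 modulo ζ(2).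
  ζŜ-twist : ∀ a f → a 0 * a 0 ≈ 1# → (∀ m → I ((a ⊛ tw a) (suc m))) → (∀ p → f (reverse p) ≈ (a ▷ σ) p) →
             ∀ k n → I (ζŜ f k n - ζŜ (ζ⋆ Z∗) k n)
  ζŜ-twist a f a0 ideal e k n = I-≈ (sym (begin
    ζŜ f k n - ζŜ (ζ⋆ Z∗) k n
      ≈⟨ +-cong (trans (ζŜ-pair f k n) (pair-cong e (λ q → trans (*-congˡ (tail-cong e n q)) (suffix-▷ a σ n q)) [] k))
                (-‿cong (trans (ζŜ-pair (ζ⋆ Z∗) k n) (pair-cong ζ⋆∗ (λ q → *-congˡ (tail-cong ζ⋆∗ n q)) [] k))) ⟩
    pair (a ▷ σ) (tw a ▷ S) [] k - pair σ S [] k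
      ≈⟨ +-congʳ (trans (pair-▷ a σ (tw a ▷ S) k) (pair-cong (λ _ → refl) (λ q → trans (▷-▷ a (tw a) S q) (split q)) [] k)) ⟩
    pair σ (λ q → S q + (ε ▷ S) q) [] k - pair σ S [] k
      ≈⟨ +-congʳ (pair-+ʳ σ S (ε ▷ S) [] k) ⟩
    pair σ S [] k + pair σ (ε ▷ S) [] k - pair σ S [] k
      ≈⟨ solve 2 (λ x y → x :+ y :- x := y) refl _ _ ⟩
    pair σ (ε ▷ S) [] k ∎))
    (I-pair 𝒵-σ (I-▷ ε-I (𝒵-suffix 𝒵-σ n)) [] k)
    where
    S = suffix σ n
    ε : Series
    ε zero    = 0#
    ε (suc m) = (a ⊛ tw a) (suc m)
    ε-I : ∀ m → I (ε m)
    ε-I zero    = I-0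
    ε-I (suc m) = ideal m
    a⊛twa : ∀ m → (a ⊛ tw a) m ≈ δ₀ m + ε m
    a⊛twa zero    = trans (*-congˡ (*-identityˡ _)) (trans a0 (sym (+-identityʳ _)))
    a⊛twa (suc m) = sym (+-identityˡ _)
    split : ∀ q → ((a ⊛ tw a) ▷ S) q ≈ S q + (ε ▷ S) q
    split q = trans (▷-cong a⊛twa (λ _ → refl) q) (trans (▷-+ δ₀ ε S q) (+-congʳ (▷-δ₀ S q)))

  difference-sh : ∀ k n → I (ζŜ (ζ⋆ Zsh) k n - ζŜ (ζ⋆ Z∗) k n)
  difference-sh = ζŜ-twist A (ζ⋆ Zsh) (trans (*-cong A-0 A-0) (*-identityˡ _)) A⊛twA ζ⋆sh

  difference-KY : ∀ k n → I (ζŜ (ζ⋆-KY Zsh) k n - ζŜ (ζ⋆ Z∗) k n)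
  difference-KY = ζŜ-twist (tw E) (ζ⋆-KY Zsh) (trans (*-cong twE-0 twE-0) (*-identityˡ _))
    -- E(-u) E(u) is unchanged under the substitution of -u for u, so `E⊛twE` applies.
    (λ m → I-≈ (sym (trans (⊛-cong {tw E} (λ _ → refl) (tw-tw E) (suc m)) (⊛-comm (tw E) E (suc m)))) (E⊛twE m)) ζ⋆KY
    where
    twE-0 : tw E 0 ≈ 1#
    twE-0 = trans (*-identityˡ _) E-0

  congruent : ∀ {a b} → 𝒵 a → 𝒵 b → I (a - b) → a ≡[ζ2𝒵] b
  congruent {a} {b} (in𝒵 v g) (in𝒵 w h) (inI {c} (in𝒵 x m) e) = (v , un≋ g) , (w , un≋ h) , c , (x , un≋ m) ,
    un≋ (trans (≡⇒≈ (≡.sym (≡.trans (⊹-def a (⊖ b)) (≡.cong (a +ℝ_) (⊖-def b))))) (trans e (≡⇒≈ (∙-def ζ2 c))))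

theorem2p2 : (Z∗ Zsh : 𝔥¹ → ℝ[T]) →
    IsRegularization _∗_ Z∗ →
    IsRegularization _sh¹_ Zsh →
    (k : Index) →
    (ζŜ (ζ⋆ Z∗) k ≡[ζ2𝒵]⟦t⟧ ζŜ (ζ⋆ Zsh) k) ×
    (ζŜ (ζ⋆ Zsh) k ≡[ζ2𝒵]⟦t⟧ ζŜ (ζ⋆-KY Zsh) k)
theorem2p2 Z∗ Zsh reg∗ regsh k =
  (λ n → congruent (𝒵∗ n) (𝒵sh n)
    (I-≈ (solve 2 (λ x y → :- (x :- y) := y :- x) refl _ _) (I-neg (difference-sh k n)))) ,
  (λ n → congruent (𝒵sh n) (𝒵KY n)
    (I-≈ (solve 3 (λ x y z → (x :- z) :- (y :- z) := x :- y) refl _ _ _) (I-- (difference-sh k n) (difference-KY k n))))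
  where
  open Membership reg∗
  open Regsh regsh
  open Reg∗-Limit reg∗
  open Congruences reg∗ regsh
  𝒵∗ : ∀ n → 𝒵 (ζŜ (ζ⋆ Z∗) k n)
  𝒵∗ = ζŜ-𝒵 (ζ⋆ Z∗) (λ p → 𝒵-≈ (sym (ζ⋆∗ p)) (𝒵-σ p)) k
  𝒵sh : ∀ n → 𝒵 (ζŜ (ζ⋆ Zsh) k n)
  𝒵sh = ζŜ-𝒵 (ζ⋆ Zsh) (λ p → 𝒵-≈ (sym (ζ⋆sh p)) (𝒵-▷ 𝒵-A 𝒵-σ p)) k
  𝒵KY : ∀ n → 𝒵 (ζŜ (ζ⋆-KY Zsh) k n)
  𝒵KY = ζŜ-𝒵 (ζ⋆-KY Zsh) (λ p → 𝒵-≈ (sym (ζ⋆KY p)) (𝒵-▷ (λ m → 𝒵-* (𝒵-sg m) (𝒵-E m)) 𝒵-σ p)) k
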